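{- Let $f(x) \in \mathbb{Z}[x]$ be a monic polynomial. There is a positive integer $N = N(f)$ such that \[ f(p) \mid f(p^{p}) \quad \text{for all primes } p \geq N \] if and only if there are positive integers $d_{1},\dots,d_{m}$ and nonnegative integers $e_{0},e_{1},\dots,e_{m}$ such that \[ f(x)=x^{e_{0}}\Phi_{d_{1}}(x)^{e_{1}}\Phi_{d_{2}}(x)^{e_{2}}\cdots \Phi_{d_{m}}(x)^{e_{m}}, \] where $\Phi_{d}(x)$ denotes the $d$-th cyclotomic polynomial. -}

module Defs where

open import Data.Bool using (Bool; true; false; if_then_else_)
open import Data.Nat as ℕ using (ℕ; zero; suc)
open import Data.Nat.Divisibility using (_∣?_)
open import Data.Integer as ℤ using (ℤ; +_; 0ℤ; 1ℤ; -1ℤ)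
open import Data.List using (List; []; _∷_; _++_; [_]; map; foldr; replicate; length; filter; zip; upTo; tabulate)
open import Data.Fin using (Fin)
open import Data.Product using (Σ; _,_; _×_; proj₁; proj₂)
open import Relation.Nullary.Decidable using (⌊_⌋)
open import Relation.Binary.PropositionalEquality using (_≡_)

-- Polynomials in ℤ[x] as little-endian coefficient lists:
-- (a₀ ∷ a₁ ∷ … ∷ aₙ ∷ []) represents a₀ + a₁ x + … + aₙ xⁿ.
-- Trailing zeros are allowed; equality of polynomials is equality after
-- stripping trailing zeros.

Poly : Set
Poly = List ℤ

strip : Poly → Poly
strip [] = []
strip (a ∷ p) with strip p
... | [] = if ⌊ a ℤ.≟ 0ℤ ⌋ then [] else (a ∷ [])
... | q@(_ ∷ _) = a ∷ q

_≈ₚ_ : Poly → Poly → Set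
p ≈ₚ q = strip p ≡ strip q

infix 4 _≈ₚ_

Monic : Poly → Set
Monic p = Σ (List ℤ) λ cs → strip p ≡ cs ++ [ 1ℤ ]

infixl 6 _⊕_
infixl 7 _⊗_
infixr 8 _^ₚ_

_⊕_ : Poly → Poly → Poly
[] ⊕ q = q
(a ∷ p) ⊕ [] = a ∷ p
(a ∷ p) ⊕ (b ∷ q) = (a ℤ.+ b) ∷ (p ⊕ q)

scale : ℤ → Poly → Poly
scale a = map (a ℤ.*_)

_⊗_ : Poly → Poly → Poly
[] ⊗ q = []
(a ∷ p) ⊗ q = scale a q ⊕ (0ℤ ∷ (p ⊗ q))

negₚ : Poly → Poly
negₚ = scale -1ℤ

oneₚ : Poly
oneₚ = 1ℤ ∷ []

X : Poly
X = 0ℤ ∷ 1ℤ ∷ []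

_^ₚ_ : Poly → ℕ → Poly
p ^ₚ zero = oneₚ
p ^ₚ suc n = p ⊗ (p ^ₚ n)

prodₚ : List Poly → Poly
prodₚ = foldr _⊗_ oneₚ

eval : Poly → ℤ → ℤ
eval [] a = 0ℤ
eval (c ∷ p) a = c ℤ.+ a ℤ.* eval p a

lastCoeff : Poly → ℤ
lastCoeff [] = 0ℤ
lastCoeff (a ∷ []) = a
lastCoeff (_ ∷ p@(_ ∷ _)) = lastCoeff p

-- quot fuel r g : quotient of r by the monic g (r, g in stripped form)
quot : ℕ → Poly → Poly → Poly
quot zero r g = []
quot (suc k) r g =
  if ⌊ length r ℕ.<? length g ⌋ then []
  else (t ⊕ quot k (strip (r ⊕ negₚ (t ⊗ g))) g)
  where
  t : Poly
  t = replicate (length r ℕ.∸ length g) 0ℤ ++ [ lastCoeff r ]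

-- Cyclotomic polynomials, via the defining identity
--   xⁿ - 1 = ∏_{d ∣ n} Φ_d(x)   (n ≥ 1),
-- i.e. Φ_n = (xⁿ - 1) / ∏_{d ∣ n, d < n} Φ_d.

xⁿ-1 : ℕ → Poly
xⁿ-1 n = (X ^ₚ n) ⊕ negₚ oneₚ

newCyc : ℕ → List Poly → Poly
newCyc n prev = quot (suc n) (strip (xⁿ-1 n)) (strip properProd)
  where
  indexed : List (ℕ × Poly)
  indexed = zip (map suc (upTo (length prev))) prev
  properProd : Poly
  properProd = prodₚ (map proj₂ (filter (λ kp → proj₁ kp ∣? n) indexed))

cycs : ℕ → List Poly
cycs zero = []
cycs (suc n) = cycs n ++ [ newCyc (suc n) (cycs n) ]

-- Φ d, the d-th cyclotomic polynomial (d ≥ 1; Φ 0 is a dummy value 1)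
Φ : ℕ → Poly
Φ zero = oneₚ
Φ (suc n) = newCyc (suc n) (cycs n)

∏ₚ : (m : ℕ) → (Fin m → Poly) → Poly
∏ₚ m f = prodₚ (tabulate f)

{-# OPTIONS --safe #-}

-- If p ∤ d then Φ_d(x) divides Φ_d(x^p): it divides x^{dp} - 1, which is the product of the Φ_e(x^p) over e ∣ d, and it is
-- coprime to the factors with e < d. Hence a product of powers of x and of Φ_d's satisfies the condition for large p.
--
-- Conversely, strip from f all factors x and Φ_d. Unless nothing is left, what remains is coprime to every x^W - 1,
-- because Φ_d is irreducible (Landau's argument), so a nonzero integer R lies in the ideal (f, x^W - 1). A prime q ∤ R
-- dividing f(a) makes a an element of (ℤ/q)^× whose order j does not divide W. For p ≡ a mod q and p ≡ u mod j the prime q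
-- divides f(p) and therefore also the value of the original polynomial at p^p ≡ a^u, which happens for few u only. So most
-- classes (a, u) modulo q j contain only finitely many primes. Call a class c of units bounded if Σ Λ(n)/n over n ≡ c is.
-- By Selberg's identity in arithmetic progressions, if c and h c are bounded then so is h. Hence every unit ≡ 1 mod q is
-- bounded, and with a second such prime every unit is, against Mertens' theorem that Σ_{n ≤ x} Λ(n)/n ~ log x.

module Submission where

-- Dirichlet's theorem would directly supply a prime p ≡ a mod q, p ≡ u mod j; the argument gets by
-- with less. Selberg's formula controls only the sum of two contributions to a class, that of prime
-- powers and that of products of two of them, so it leaves a class any density between 0 and twice
-- the expected one, and a single empty class is no contradiction. But if c is bounded, the products
-- x y ≡ c carry twice their expected mass. They can do so only if, whenever a class b carries mass,
-- the class c/b is filled to the maximum. If c/h is bounded as well, h can carry only bounded mass: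
-- this is the quotient property. The main term of Selberg's formula is not computed from the Möbius
-- function. Only differences between unit classes are estimated that way, and the main term comes
-- from Mertens' theorem over all units. No real numbers occur: below a cutoff X = 2^T, 1/n becomes
-- X!/n and log p an integer near κ log₂ p, with κ so large that rounding is harmless. T has to grow
-- with the range considered, so all constants must be uniform in T.

-- Finite sums of integers, indicators, certificates for inequalities

module Sums where

  open import Data.Integer hiding (suc)
  open import Data.Integer.Properties
  open import Data.Integer.Tactic.RingSolver using (solve-∀; solve)
  open import Data.List using ([]; _∷_)
  open import Data.Nat as ℕ using (ℕ; zero; suc; z≤n; s≤s)
  import Data.Nat.Properties as ℕₚ
  open import Data.Product using (_×_; _,_)
  open import Data.Sum using (inj₁; inj₂)
  open import Relation.Binary.PropositionalEquality
  open import Relation.Nullary using (Dec; yes; no; ¬_; contradiction)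

  -- Inequalities are certified: the difference of the two sides is displayed as a combination of
  -- quantities known to be nonnegative, assembled with `_⊹_`, `_⊛_` and `gap`, and the ring solver
  -- checks the identity. Most estimates below have this shape, the identity often being stated
  -- separately under a name ending in `-≡`.
  by≤ : ∀ {a b e} → 0ℤ ≤ e → b - a ≡ e → a ≤ b
  by≤ 0≤e eq = 0≤i-j⇒j≤i (subst (0ℤ ≤_) (sym eq) 0≤e)

  gap : ∀ {a b} → a ≤ b → 0ℤ ≤ b - a
  gap = i≤j⇒0≤j-i

  infixl 6 _⊹_
  _⊹_ : ∀ {a b} → 0ℤ ≤ a → 0ℤ ≤ b → 0ℤ ≤ a + b
  _⊹_ = +-mono-≤

  infixl 7 _⊛_
  _⊛_ : ∀ {a b} → 0ℤ ≤ a → 0ℤ ≤ b → 0ℤ ≤ a * b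
  _⊛_ {+ a} {+ b} _ _ = subst (0ℤ ≤_) (pos-* a b) (+≤+ z≤n)

  0≤+ : ∀ n → 0ℤ ≤ + n
  0≤+ n = +≤+ z≤n

  0≤1 : 0ℤ ≤ 1ℤ
  0≤1 = +≤+ z≤n

  *-monoˡ : ∀ {a b c} → 0ℤ ≤ c → a ≤ b → c * a ≤ c * b
  *-monoˡ {a} {b} {c} 0≤c a≤b = by≤ (0≤c ⊛ gap a≤b) (solve (a ∷ b ∷ c ∷ []))

  *-monoʳ : ∀ {a b c} → 0ℤ ≤ c → a ≤ b → a * c ≤ b * c
  *-monoʳ {a} {b} {c} 0≤c a≤b = by≤ (0≤c ⊛ gap a≤b) (solve (a ∷ b ∷ c ∷ []))

  *-mono : ∀ {a b c d} → 0ℤ ≤ a → 0ℤ ≤ d → a ≤ b → c ≤ d → a * c ≤ b * d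
  *-mono 0≤a 0≤d a≤b c≤d = ≤-trans (*-monoˡ 0≤a c≤d) (*-monoʳ 0≤d a≤b)

  +-congʳ : ∀ a {b c} → b ≡ c → a + b ≡ a + c
  +-congʳ a = cong (λ z → a + z)

  ∑ : ℕ → (ℕ → ℤ) → ℤ
  ∑ zero f = 0ℤ
  ∑ (suc n) f = ∑ n f + f n

  ∑-cong< : ∀ n {f g} → (∀ i → i ℕ.< n → f i ≡ g i) → ∑ n f ≡ ∑ n g
  ∑-cong< zero h = refl
  ∑-cong< (suc n) h = cong₂ _+_ (∑-cong< n λ i i<n → h i (ℕₚ.m<n⇒m<1+n i<n)) (h n ℕₚ.≤-refl)

  ∑-cong : ∀ n {f g} → (∀ i → f i ≡ g i) → ∑ n f ≡ ∑ n g
  ∑-cong n h = ∑-cong< n λ i _ → h i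

  ∑-zero< : ∀ n {f} → (∀ i → i ℕ.< n → f i ≡ 0ℤ) → ∑ n f ≡ 0ℤ
  ∑-zero< zero h = refl
  ∑-zero< (suc n) h = cong₂ _+_ (∑-zero< n λ i i<n → h i (ℕₚ.m<n⇒m<1+n i<n)) (h n ℕₚ.≤-refl)

  ∑-+ : ∀ n f g → ∑ n (λ i → f i + g i) ≡ ∑ n f + ∑ n g
  ∑-+ zero f g = refl
  ∑-+ (suc n) f g = trans (cong (_+ (f n + g n)) (∑-+ n f g)) (lem (∑ n f) (∑ n g) (f n) (g n))
    where
    lem : ∀ a b c d → a + b + (c + d) ≡ a + c + (b + d)
    lem = solve-∀

  ∑-*ˡ : ∀ n c f → ∑ n (λ i → c * f i) ≡ c * ∑ n f
  ∑-*ˡ zero c f = sym (*-zeroʳ c)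
  ∑-*ˡ (suc n) c f = trans (cong (_+ c * f n) (∑-*ˡ n c f)) (sym (*-distribˡ-+ c (∑ n f) (f n)))

  ∑-*ʳ : ∀ n c f → ∑ n (λ i → f i * c) ≡ ∑ n f * c
  ∑-*ʳ n c f = trans (∑-cong n λ i → *-comm (f i) c) (trans (∑-*ˡ n c f) (*-comm c (∑ n f)))

  ∑-- : ∀ n f g → ∑ n (λ i → f i - g i) ≡ ∑ n f - ∑ n g
  ∑-- zero f g = refl
  ∑-- (suc n) f g = trans (cong (_+ (f n - g n)) (∑-- n f g)) (lem (∑ n f) (∑ n g) (f n) (g n))
    where
    lem : ∀ a b c d → a - b + (c - d) ≡ a + c - (b + d)
    lem = solve-∀

  ∑-swap : ∀ m n (f : ℕ → ℕ → ℤ) → ∑ m (λ i → ∑ n (f i)) ≡ ∑ n (λ j → ∑ m λ i → f i j)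
  ∑-swap zero n f = sym (∑-zero< n λ _ _ → refl)
  ∑-swap (suc m) n f = trans (cong (_+ ∑ n (f m)) (∑-swap m n f)) (sym (∑-+ n _ (f m)))

  ∑-mono< : ∀ n {f g} → (∀ i → i ℕ.< n → f i ≤ g i) → ∑ n f ≤ ∑ n g
  ∑-mono< zero h = ≤-refl
  ∑-mono< (suc n) h = +-mono-≤ (∑-mono< n λ i i<n → h i (ℕₚ.m<n⇒m<1+n i<n)) (h n ℕₚ.≤-refl)

  ∑-mono : ∀ n {f g} → (∀ i → f i ≤ g i) → ∑ n f ≤ ∑ n g
  ∑-mono n h = ∑-mono< n λ i _ → h i

  ∑-≥0 : ∀ n {f} → (∀ i → 0ℤ ≤ f i) → 0ℤ ≤ ∑ n f
  ∑-≥0 zero h = ≤-refl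
  ∑-≥0 (suc n) h = ∑-≥0 n h ⊹ h n

  ∑-const : ∀ n c → ∑ n (λ _ → c) ≡ + n * c
  ∑-const zero c = sym (*-zeroˡ c)
  ∑-const (suc n) c = trans (cong (_+ c) (∑-const n c)) (lem (+ n) c)
    where
    lem : ∀ n c → n * c + c ≡ (1ℤ + n) * c
    lem = solve-∀

  ∑-split : ∀ m n f → ∑ (m ℕ.+ n) f ≡ ∑ m f + ∑ n (λ i → f (m ℕ.+ i))
  ∑-split m zero f = trans (cong (λ k → ∑ k f) (ℕₚ.+-identityʳ m)) (sym (+-identityʳ _))
  ∑-split m (suc n) f = trans (cong (λ k → ∑ k f) (ℕₚ.+-suc m n))
    (trans (cong (_+ f (m ℕ.+ n)) (∑-split m n f)) (+-assoc (∑ m f) _ _))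

  ∑-head : ∀ n f → ∑ (suc n) f ≡ f 0 + ∑ n (λ i → f (suc i))
  ∑-head n f = trans (∑-split 1 n f) (cong (_+ ∑ n (λ i → f (suc i))) (+-identityˡ (f 0)))

  ∑-extend : ∀ {m n} f → m ℕ.≤ n → (∀ i → m ℕ.≤ i → f i ≡ 0ℤ) → ∑ n f ≡ ∑ m f
  ∑-extend {m} {n} f m≤n h = trans (cong (λ k → ∑ k f) (sym (ℕₚ.m+[n∸m]≡n m≤n)))
    (trans (∑-split m (n ℕ.∸ m) f)
    (trans (+-congʳ (∑ m f) (∑-zero< (n ℕ.∸ m) λ i _ → h (m ℕ.+ i) (ℕₚ.m≤m+n m i))) (+-identityʳ _)))

  ∑-monoⁿ : ∀ {m n} f → (∀ i → 0ℤ ≤ f i) → m ℕ.≤ n → ∑ m f ≤ ∑ n f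
  ∑-monoⁿ {m} {n} f h m≤n = subst (∑ m f ≤_) (trans (sym (∑-split m (n ℕ.∸ m) f)) (cong (λ k → ∑ k f) (ℕₚ.m+[n∸m]≡n m≤n)))
    (by≤ (∑-≥0 (n ℕ.∸ m) λ i → h (m ℕ.+ i)) (lem (∑ m f) _))
    where
    lem : ∀ a b → a + b - a ≡ b
    lem = solve-∀

  χ : ∀ {a} {P : Set a} → Dec P → ℤ
  χ (yes _) = 1ℤ
  χ (no _) = 0ℤ

  module _ {a} {P : Set a} where

    χ-yes : (d : Dec P) → P → χ d ≡ 1ℤ
    χ-yes (yes _) p = refl
    χ-yes (no ¬p) p = contradiction p ¬p

    χ-no : (d : Dec P) → ¬ P → χ d ≡ 0ℤ
    χ-no (yes p) ¬p = contradiction p ¬p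
    χ-no (no _) ¬p = refl

    χ≥0 : (d : Dec P) → 0ℤ ≤ χ d
    χ≥0 (yes _) = 0≤1
    χ≥0 (no _) = ≤-refl

    χ≤1 : (d : Dec P) → χ d ≤ 1ℤ
    χ≤1 (yes _) = ≤-refl
    χ≤1 (no _) = 0≤1

    χ-*-cong : (d : Dec P) → ∀ {x y} → (P → x ≡ y) → χ d * x ≡ χ d * y
    χ-*-cong (yes p) h = cong (1ℤ *_) (h p)
    χ-*-cong (no _) h = refl

    χ-*-mono : (d : Dec P) → ∀ {x y} → (P → x ≤ y) → χ d * x ≤ χ d * y
    χ-*-mono (yes p) h = *-monoˡ 0≤1 (h p)
    χ-*-mono (no _) h = ≤-refl

    χ-*-≤ : (d : Dec P) → ∀ {x y} → 0ℤ ≤ y → (P → x ≤ y) → χ d * x ≤ y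
    χ-*-≤ (yes p) {x} 0≤y h = subst (_≤ _) (sym (*-identityˡ x)) (h p)
    χ-*-≤ (no _) 0≤y h = 0≤y

  module _ {a b} {P : Set a} {Q : Set b} where

    χ-⇔ : (d : Dec P) (e : Dec Q) → (P → Q) → (Q → P) → χ d ≡ χ e
    χ-⇔ (yes p) e f g = sym (χ-yes e (f p))
    χ-⇔ (no ¬p) e f g = sym (χ-no e λ q → ¬p (g q))

    χ-mono : (d : Dec P) (e : Dec Q) → (P → Q) → χ d ≤ χ e
    χ-mono (yes p) e f = ≤-reflexive (sym (χ-yes e (f p)))
    χ-mono (no ¬p) e f = χ≥0 e

  ∑-≟ : ∀ {j n} (f : ℕ → ℤ) → j ℕ.< n → ∑ n (λ i → χ (i ℕ.≟ j) * f i) ≡ f j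
  ∑-≟ {j} {suc n} f (s≤s j≤n) with ℕₚ.m≤n⇒m<n∨m≡n j≤n
  ... | inj₁ j<n = trans (cong₂ _+_ (∑-≟ {j} {n} f j<n) (cong (λ c → c * f n) (χ-no (n ℕ.≟ j) (ℕₚ.>⇒≢ j<n)))) (lem (f j) (f n))
    where
    lem : ∀ x y → x + 0ℤ * y ≡ x
    lem = solve-∀
  ... | inj₂ refl = trans (cong₂ _+_ (∑-zero< n λ i i<n → trans (cong (λ c → c * f i) (χ-no (i ℕ.≟ n) (ℕₚ.<⇒≢ i<n))) (*-zeroˡ (f i))) (cong (λ c → c * f n) (χ-yes (n ℕ.≟ n) refl)))
    (lem (f n))
    where
    lem : ∀ x → 0ℤ + 1ℤ * x ≡ x
    lem = solve-∀

  ∑-≟-out : ∀ {j} n (f : ℕ → ℤ) → n ℕ.≤ j → ∑ n (λ i → χ (i ℕ.≟ j) * f i) ≡ 0ℤ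
  ∑-≟-out {j} n f n≤j = ∑-zero< n λ i i<n →
    trans (cong (λ c → c * f i) (χ-no (i ℕ.≟ j) (ℕₚ.<⇒≢ (ℕₚ.<-≤-trans i<n n≤j)))) (*-zeroˡ (f i))

  ∑-χ< : ∀ z n → z ℕ.≤ n → ∑ n (λ i → χ (i ℕ.<? z)) ≡ + z
  ∑-χ< z n h = trans (∑-extend {z} {n} (λ i → χ (i ℕ.<? z)) h λ i z≤i → χ-no (i ℕ.<? z) (ℕₚ.≤⇒≯ z≤i))
    (trans (∑-cong< z {λ i → χ (i ℕ.<? z)} {λ _ → 1ℤ} λ i i<z → χ-yes (i ℕ.<? z) i<z) (trans (∑-const z 1ℤ) (*-identityʳ _)))

  infix 4 _≤∣_
  -- The bound |x| ≤ b as two linear inequalities, each of which can enter a certificate directly.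
  _≤∣_ : ℤ → ℤ → Set
  x ≤∣ b = - b ≤ x × x ≤ b

  ≤∣-+ : ∀ {x y b c} → x ≤∣ b → y ≤∣ c → x + y ≤∣ b + c
  ≤∣-+ {x} {y} {b} {c} (p , q) (r , s) = subst (_≤ x + y) (lem b c) (+-mono-≤ p r) , +-mono-≤ q s
    where
    lem : ∀ b c → - b + - c ≡ - (b + c)
    lem = solve-∀

  ≤∣-neg : ∀ {x b} → x ≤∣ b → - x ≤∣ b
  ≤∣-neg {x} {b} (p , q) = by≤ (gap q) (solve (x ∷ b ∷ [])) , by≤ (gap p) (solve (x ∷ b ∷ []))

  ≤∣-mono : ∀ {x b c} → b ≤ c → x ≤∣ b → x ≤∣ c
  ≤∣-mono b≤c (p , q) = ≤-trans (neg-mono-≤ b≤c) p , ≤-trans q b≤c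

  ≤∣-* : ∀ {x b k} → 0ℤ ≤ k → x ≤∣ b → k * x ≤∣ k * b
  ≤∣-* {x} {b} {k} 0≤k (p , q) = by≤ (0≤k ⊛ gap p) (solve (x ∷ b ∷ k ∷ [])) , *-monoˡ 0≤k q

  ≤∣-unit : ∀ {m x b} → m ≤∣ 1ℤ → x ≤∣ b → m * x ≤∣ b
  -- For m = 0 the claim is 0 ≤ b, and the two bounds on x add up to 2 b ≥ 0.
  ≤∣-unit {+ 0} {x} {b} _ (p , q) = by≤ b≥0 (solve (x ∷ b ∷ [])) , b≥0
    where
    b≥0 : 0ℤ ≤ b
    b≥0 = *-cancelˡ-≤-pos 0ℤ b (+ 2) (by≤ (gap p ⊹ gap q) (solve (x ∷ b ∷ [])))
  ≤∣-unit {+ 1} {x} _ h = subst (_≤∣ _) (sym (*-identityˡ x)) h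
  ≤∣-unit { -[1+ 0 ]} {x} _ h = subst (_≤∣ _) (sym (-1*i≡-i x)) (≤∣-neg h)
  ≤∣-unit {+ suc (suc n)} (_ , +≤+ (s≤s ())) h
  ≤∣-unit { -[1+ suc n ]} (-≤- () , _) h

  ∑-≤∣ : ∀ n {f b} → (∀ i → i ℕ.< n → f i ≤∣ b i) → ∑ n f ≤∣ ∑ n b
  ∑-≤∣ zero h = ≤-refl , ≤-refl
  ∑-≤∣ (suc n) h = ≤∣-+ (∑-≤∣ n λ i i<n → h i (ℕₚ.m<n⇒m<1+n i<n)) (h n ℕₚ.≤-refl)

-- Primes, von Mangoldt sums below a cutoff, Möbius inversion, Selberg's identity

module Arith where

  open import Data.Integer hiding (suc; _^_; NonZero)
  open import Data.Integer.Properties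
  open import Data.Integer.Tactic.RingSolver using (solve-∀)
  open import Data.List using ([]; _∷_)
  open import Data.List.Relation.Unary.All using (All; []; _∷_)
  open import Data.Nat as ℕ using (ℕ; zero; suc; z≤n; s≤s; _^_; _!; NonZero)
  import Data.Nat.Properties as ℕₚ
  open import Data.Nat.Coprimality using (Coprime; coprime-divisor)
  open import Data.Nat.Divisibility
  open import Data.Nat.Primality
  open import Data.Nat.Primality.Factorisation using (factorise; module PrimeFactorisation)
  open import Data.Product using (Σ; _×_; _,_; proj₁)
  open import Data.Sum using (inj₁; inj₂)
  open import Relation.Binary.PropositionalEquality
  open import Relation.Nullary using (Dec; yes; no; ¬_; contradiction)
  open Sums

  1<p : ∀ {p} → Prime p → 1 ℕ.< p
  1<p pp = ℕ.nonTrivial⇒n>1 _ ⦃ prime⇒nonTrivial pp ⦄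

  0<p : ∀ {p} → Prime p → 0 ℕ.< p
  0<p pp = ℕₚ.<⇒≤ (1<p pp)

  n<p^n : ∀ {p} n → 1 ℕ.< p → n ℕ.< p ^ n
  n<p^n zero _ = s≤s z≤n
  n<p^n {p} (suc n) 1<p = ℕₚ.<-≤-trans (ℕₚ.+-mono-≤-< (ℕₚ.≤-trans (s≤s z≤n) ih) ih) 
    (ℕₚ.≤-trans (ℕₚ.≤-reflexive (cong (p ^ n ℕ.+_) (sym (ℕₚ.+-identityʳ (p ^ n))))) (ℕₚ.*-monoˡ-≤ (p ^ n) 1<p))
    where ih = n<p^n n 1<p

  0<* : ∀ {m n} → 0 ℕ.< m → 0 ℕ.< n → 0 ℕ.< m ℕ.* n
  0<* = ℕₚ.*-mono-≤

  0<^ : ∀ {p} n → 0 ℕ.< p → 0 ℕ.< p ^ n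
  0<^ zero _ = s≤s z≤n
  0<^ (suc n) 0<p = 0<* 0<p (0<^ n 0<p)

  prime∣prime : ∀ {p q} → Prime p → Prime q → p ∣ q → p ≡ q
  prime∣prime pp pq p∣q with prime⇒irreducible pq p∣q
  ... | inj₁ refl = contradiction pp ¬prime[1]
  ... | inj₂ eq = eq

  prime∣^ : ∀ {p} m n → Prime p → p ∣ m ^ n → p ∣ m
  prime∣^ m zero pp h = contradiction (subst Prime (∣1⇒≡1 h) pp) ¬prime[1]
  prime∣^ m (suc n) pp h with euclidsLemma m (m ^ n) pp h
  ... | inj₁ d = d
  ... | inj₂ d = prime∣^ m n pp d

  prime-divisor : ∀ {n} → 1 ℕ.< n → Σ ℕ λ p → Prime p × p ∣ n
  prime-divisor {n} 1<n = go factors isFactorisation factorsPrime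
    where
    instance
      nz : NonZero n
      nz = ℕ.>-nonZero (ℕₚ.<⇒≤ 1<n)
    open PrimeFactorisation (factorise n)
    open import Data.Nat.ListAction using (product)
    go : ∀ ps → n ≡ product ps → All Prime ps → Σ ℕ λ p → Prime p × p ∣ n
    go [] eq _ = contradiction 1<n (ℕₚ.≤⇒≯ (ℕₚ.≤-reflexive eq))
    go (p ∷ ps) eq (pp ∷ _) = p , pp , divides (product ps) (trans eq (ℕₚ.*-comm p (product ps)))

  no-common-prime⇒coprime : ∀ {m n} → 0 ℕ.< n → (∀ {p} → Prime p → p ∣ m → ¬ p ∣ n) → Coprime m n
  no-common-prime⇒coprime 0<n h {zero} (_ , d∣n) = contradiction (0∣⇒≡0 d∣n) (ℕₚ.>⇒≢ 0<n)
  no-common-prime⇒coprime 0<n h {suc zero} _ = refl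
  no-common-prime⇒coprime 0<n h {suc (suc d)} (d∣m , d∣n) with prime-divisor {suc (suc d)} (s≤s (s≤s z≤n))
  ... | p , pp , p∣d = contradiction (∣-trans p∣d d∣n) (h pp (∣-trans p∣d d∣m))

  coprime-prime-powers : ∀ {p q} n → Prime p → Prime q → ¬ p ≡ q → Coprime (p ^ n) q
  coprime-prime-powers {p} {q} n pp pq p≢q = no-common-prime⇒coprime (0<p pq) λ {r} pr r∣pⁿ r∣q →
    p≢q (trans (sym (prime∣prime pr pp (prime∣^ p n pr r∣pⁿ))) (prime∣prime pr pq r∣q))

  coprime⇒∣-⇔ : ∀ {m q k} → Coprime m q → Dec (m ∣ k) → χ (m ∣? q ℕ.* k) ≡ χ (m ∣? k)
  coprime⇒∣-⇔ {m} {q} {k} c _ = χ-⇔ (m ∣? q ℕ.* k) (m ∣? k) (coprime-divisor c) (∣n⇒∣m*n q)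

  χ-∣-*ˡ : ∀ {q} m k → 0 ℕ.< q → χ (q ℕ.* m ∣? q ℕ.* k) ≡ χ (m ∣? k)
  χ-∣-*ˡ {q} m k 0<q = χ-⇔ (q ℕ.* m ∣? q ℕ.* k) (m ∣? k) (*-cancelˡ-∣ q ⦃ ℕ.>-nonZero 0<q ⦄) (*-monoʳ-∣ q)

  ∣! : ∀ {n} X → 0 ℕ.< n → n ℕ.≤ X → n ∣ X !
  ∣! zero 0<n n≤0 = contradiction n≤0 (ℕₚ.<⇒≱ 0<n)
  ∣! {n} (suc X) 0<n n≤X with ℕₚ.m≤n⇒m<n∨m≡n n≤X
  ... | inj₁ n<X = ∣n⇒∣m*n (suc X) (∣! X 0<n (ℕₚ.≤-pred n<X))
  ... | inj₂ refl = m∣m*n (X !)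

  ∏ : ℕ → (ℕ → ℤ) → ℤ
  ∏ zero f = 1ℤ
  ∏ (suc n) f = ∏ n f * f n

  ∏-cong< : ∀ n {f g} → (∀ i → i ℕ.< n → f i ≡ g i) → ∏ n f ≡ ∏ n g
  ∏-cong< zero h = refl
  ∏-cong< (suc n) h = cong₂ _*_ (∏-cong< n λ i i<n → h i (ℕₚ.m<n⇒m<1+n i<n)) (h n ℕₚ.≤-refl)

  ∏-one : ∀ n {f} → (∀ i → f i ≡ 1ℤ) → ∏ n f ≡ 1ℤ
  ∏-one zero h = refl
  ∏-one (suc n) h = cong₂ _*_ (∏-one n h) (h n)

  ∏-unit : ∀ n {f} → (∀ i → f i ≤∣ 1ℤ) → ∏ n f ≤∣ 1ℤ
  ∏-unit zero h = -≤+ , ≤-refl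
  ∏-unit (suc n) h = ≤∣-unit (∏-unit n h) (h n)

  ∏-factor : ∀ {q n} (f g : ℕ → ℤ) c → q ℕ.< n → (∀ i → ¬ i ≡ q → f i ≡ g i) → f q ≡ c * g q → ∏ n f ≡ c * ∏ n g
  ∏-factor {q} {suc n} f g c (s≤s q≤n) h hq with ℕₚ.m≤n⇒m<n∨m≡n q≤n
  ... | inj₁ q<n = trans (cong₂ _*_ (∏-factor f g c q<n h hq) (h n (ℕₚ.>⇒≢ q<n))) (*-assoc c (∏ n g) (g n))
  ... | inj₂ refl = trans (cong₂ _*_ (∏-cong< n λ i i<n → h i (ℕₚ.<⇒≢ i<n)) hq) (lem (∏ n g) c (g n))
    where
    lem : ∀ a c b → a * (c * b) ≡ c * (a * b)
    lem = solve-∀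

  -- `X` cuts off every sum, over primes and exponents alike, and `lam` is an arbitrary substitute
  -- for the logarithm on primes. The identities of this part are exact; only later is the size of
  -- `lam` compared with a binary logarithm.
  module Arithmetic (X : ℕ) (lam : ℕ → ℤ) where

    PrimePower : ℕ → Set
    PrimePower m = Σ ℕ λ p → Prime p × p ℕ.< X × Σ ℕ λ i → m ≡ p ^ suc i

    1<pp : ∀ {m} → PrimePower m → 1 ℕ.< m
    1<pp (p , pp , _ , i , refl) = ℕₚ.<-≤-trans (1<p pp) (ℕₚ.m≤m*n p (p ^ i) ⦃ ℕ.>-nonZero (0<^ i (0<p pp)) ⦄)

    0<pp : ∀ {m} → PrimePower m → 0 ℕ.< m
    0<pp pm = ℕₚ.<⇒≤ (1<pp pm)

    -- The measure Σ Λ(m) δ_m on prime powers, with lam p in the role of log p, as a functional.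
    Λ : (ℕ → ℤ) → ℤ
    Λ Ψ = ∑ X λ p → ∑ X λ i → χ (prime? p) * (lam p * Ψ (p ^ suc i))

    Λ-cong : ∀ {Ψ Φ : ℕ → ℤ} → (∀ m → PrimePower m → Ψ m ≡ Φ m) → Λ Ψ ≡ Λ Φ
    Λ-cong {Ψ} {Φ} h = ∑-cong< X λ p p<X → ∑-cong X λ i → χ-*-cong (prime? p) λ pp →
      cong (λ z → lam p * z) (h (p ^ suc i) (p , pp , p<X , i , refl))

    Λ-mono : (∀ p → 0ℤ ≤ lam p) → ∀ {Ψ Φ : ℕ → ℤ} → (∀ m → PrimePower m → Ψ m ≤ Φ m) → Λ Ψ ≤ Λ Φ
    Λ-mono lam≥0 {Ψ} {Φ} h = ∑-mono< X λ p p<X → ∑-mono X λ i → χ-*-mono (prime? p) λ pp →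
      *-monoˡ (lam≥0 p) (h (p ^ suc i) (p , pp , p<X , i , refl))

    Λ-∑ : ∀ n (F : ℕ → ℕ → ℤ) → Λ (λ m → ∑ n (F m)) ≡ ∑ n λ j → Λ λ m → F m j
    Λ-∑ n F = trans (∑-cong X λ p → trans (∑-cong X λ i → pull p i) (∑-swap X n (λ i j → T p i j)))
      (∑-swap X n λ p j → ∑ X λ i → T p i j)
      where
      T : ℕ → ℕ → ℕ → ℤ
      T p i j = χ (prime? p) * (lam p * F (p ^ suc i) j)
      pull : ∀ p i → χ (prime? p) * (lam p * ∑ n (F (p ^ suc i))) ≡ ∑ n (T p i)
      pull p i = sym (trans (∑-*ˡ n (χ (prime? p)) λ j → lam p * F (p ^ suc i) j) (cong (λ z → χ (prime? p) * z) (∑-*ˡ n (lam p) (F (p ^ suc i)))))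

    Λ-+ : ∀ (Ψ Φ : ℕ → ℤ) → Λ (λ m → Ψ m + Φ m) ≡ Λ Ψ + Λ Φ
    Λ-+ Ψ Φ = trans (∑-cong X λ p → trans (∑-cong X λ i → lem (χ (prime? p)) (lam p) (Ψ (p ^ suc i)) (Φ (p ^ suc i)))
       (∑-+ X (λ i → χ (prime? p) * (lam p * Ψ (p ^ suc i))) (λ i → χ (prime? p) * (lam p * Φ (p ^ suc i)))))
       (∑-+ X (λ p → ∑ X λ i → χ (prime? p) * (lam p * Ψ (p ^ suc i))) (λ p → ∑ X λ i → χ (prime? p) * (lam p * Φ (p ^ suc i))))
      where
      lem : ∀ a b x y → a * (b * (x + y)) ≡ a * (b * x) + a * (b * y)
      lem = solve-∀

    Λ-*ˡ : ∀ c (Ψ : ℕ → ℤ) → Λ (λ m → c * Ψ m) ≡ c * Λ Ψ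
    Λ-*ˡ c Ψ = trans (∑-cong X λ p → trans (∑-cong X λ i → lem (χ (prime? p)) (lam p) c (Ψ (p ^ suc i)))
       (∑-*ˡ X c (λ i → χ (prime? p) * (lam p * Ψ (p ^ suc i)))))
       (∑-*ˡ X c (λ p → ∑ X λ i → χ (prime? p) * (lam p * Ψ (p ^ suc i))))
      where
      lem : ∀ a b c x → a * (b * (c * x)) ≡ c * (a * (b * x))
      lem = solve-∀

    Λ-- : ∀ (Ψ Φ : ℕ → ℤ) → Λ (λ m → Ψ m - Φ m) ≡ Λ Ψ - Λ Φ
    Λ-- Ψ Φ = trans (Λ-cong {λ m → Ψ m - Φ m} {λ m → Ψ m + -1ℤ * Φ m} λ m _ → sym (lem (Ψ m) (Φ m)))
      (trans (Λ-+ Ψ (λ m → -1ℤ * Φ m)) (trans (+-congʳ (Λ Ψ) (Λ-*ˡ -1ℤ Φ)) (lem (Λ Ψ) (Λ Φ))))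
      where
      lem : ∀ x y → x + -1ℤ * y ≡ x - y
      lem = solve-∀

    Λ-≥0 : (∀ p → 0ℤ ≤ lam p) → ∀ {Ψ : ℕ → ℤ} → (∀ m → PrimePower m → 0ℤ ≤ Ψ m) → 0ℤ ≤ Λ Ψ
    Λ-≥0 lam≥0 {Ψ} h = ∑-cong-≥0
      where
      ∑-cong-≥0 : 0ℤ ≤ Λ Ψ
      ∑-cong-≥0 = ≤-trans (≤-reflexive (sym (trans (Λ-cong {λ _ → 0ℤ} {λ _ → 0ℤ * 0ℤ} λ _ _ → refl) (Λ-*ˡ 0ℤ λ _ → 0ℤ)))) (Λ-mono lam≥0 {λ _ → 0ℤ} {Ψ} h)

    -- The logarithm belonging to `lam`: for 0 < n < `X` it is the sum of `lam p` over the prime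
    -- factors of n with multiplicity. It is thus exactly additive, where a rounded logarithm of n
    -- would be so only up to an error.
    ℓ : ℕ → ℤ
    ℓ n = Λ λ m → χ (m ∣? n)

    -- Vanishing from `X` on makes a sum over k < `X` of ψ (m k) a sum over all k; vanishing at 0
    -- removes the common multiple 0 of all m.
    Supported : (ℕ → ℤ) → Set
    Supported ψ = ψ 0 ≡ 0ℤ × (∀ n → X ℕ.≤ n → ψ n ≡ 0ℤ)

    supported-* : ∀ {ψ m} → 0 ℕ.< m → Supported ψ → Supported λ n → ψ (m ℕ.* n)
    supported-* {ψ} {m} 0<m (h₀ , h) = trans (cong ψ (ℕₚ.*-zeroʳ m)) h₀ ,
      λ n X≤n → h (m ℕ.* n) (ℕₚ.≤-trans X≤n (ℕₚ.m≤n*m n m ⦃ ℕ.>-nonZero 0<m ⦄))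

    ∑-multiples : ∀ {ψ m} → 0 ℕ.< m → Supported ψ → ∑ X (λ k → ψ (m ℕ.* k)) ≡ ∑ X λ n → χ (m ∣? n) * ψ n
    ∑-multiples {ψ} {m} 0<m (h₀ , h) = trans (∑-cong X spread)
      (trans (∑-swap X X λ k n → χ (n ℕ.≟ m ℕ.* k) * ψ n)
      (∑-cong< X λ n n<X → trans (∑-*ʳ X (ψ n) λ k → χ (n ℕ.≟ m ℕ.* k)) (cong (λ z → z * ψ n) (count n n<X))))
      where
      instance
        m≢0 : NonZero m
        m≢0 = ℕ.>-nonZero 0<m
      spread : ∀ k → ψ (m ℕ.* k) ≡ ∑ X λ n → χ (n ℕ.≟ m ℕ.* k) * ψ n
      spread k with m ℕ.* k ℕ.<? X
      ... | yes lt = sym (∑-≟ ψ lt)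
      ... | no ¬lt = trans (h _ (ℕₚ.≮⇒≥ ¬lt)) (sym (∑-≟-out X ψ (ℕₚ.≮⇒≥ ¬lt)))
      count : ∀ n → n ℕ.< X → ∑ X (λ k → χ (n ℕ.≟ m ℕ.* k)) ≡ χ (m ∣? n)
      count n n<X with m ∣? n
      ... | no ¬d = ∑-zero< X λ k _ → χ-no (n ℕ.≟ m ℕ.* k) λ eq → ¬d (divides k (trans eq (ℕₚ.*-comm m k)))
      ... | yes (divides q eq) = trans (∑-cong X λ k → trans (χ-⇔ (n ℕ.≟ m ℕ.* k) (k ℕ.≟ q)
               (λ e → ℕₚ.*-cancelˡ-≡ k q m (trans (sym e) (trans eq (ℕₚ.*-comm q m))))
               (λ { refl → trans eq (ℕₚ.*-comm q m) })) (sym (*-identityʳ (χ (k ℕ.≟ q)))))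
               (∑-≟ (λ _ → 1ℤ) (ℕₚ.≤-<-trans (ℕₚ.≤-trans (ℕₚ.m≤m*n q m) (ℕₚ.≤-reflexive (sym eq))) n<X))

    -- log = Λ * 1
    Λ-multiples : ∀ {ψ} → Supported ψ → Λ (λ m → ∑ X λ k → ψ (m ℕ.* k)) ≡ ∑ X λ n → ψ n * ℓ n
    Λ-multiples {ψ} s = trans (Λ-cong λ m pm → trans (∑-multiples {ψ} (0<pp pm) s) (∑-cong X λ n → *-comm (χ (m ∣? n)) (ψ n)))
      (trans (Λ-∑ X λ m n → ψ n * χ (m ∣? n)) (∑-cong X λ n → Λ-*ˡ (ψ n) λ m → χ (m ∣? n)))

    v : ℕ → ℕ → ℤ
    v p n = ∑ X λ i → χ (p ^ suc i ∣? n)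

    ℓ-v : ∀ n → ℓ n ≡ ∑ X λ p → χ (prime? p) * (lam p * v p n)
    ℓ-v n = ∑-cong X λ p → trans (∑-*ˡ X (χ (prime? p)) λ i → lam p * χ (p ^ suc i ∣? n))
      (cong (λ z → χ (prime? p) * z) (∑-*ˡ X (lam p) λ i → χ (p ^ suc i ∣? n)))

    v-other : ∀ {p q} k → Prime p → Prime q → ¬ p ≡ q → v p (q ℕ.* k) ≡ v p k
    v-other {p} k pp pq p≢q = ∑-cong X λ i → coprime⇒∣-⇔ (coprime-prime-powers (suc i) pp pq p≢q) (p ^ suc i ∣? k)

    -- Cancelling q shifts the exponents by one: a new first term 1 appears, and the last term drops
    -- out because q^X exceeds k.
    v-self : ∀ {q k} → Prime q → 0 ℕ.< k → k ℕ.< X → v q (q ℕ.* k) ≡ 1ℤ + v q k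
    v-self {q} {k} pq 0<k k<X = trans (∑-cong X λ i → χ-∣-*ˡ (q ^ i) k (0<p pq)) (shift X k<X)
      where
      shift : ∀ n → k ℕ.< n → ∑ n (λ i → χ (q ^ i ∣? k)) ≡ 1ℤ + ∑ n λ i → χ (q ^ suc i ∣? k)
      shift (suc n) (s≤s k≤n) = trans (∑-head n λ i → χ (q ^ i ∣? k)) (cong₂ _+_ (χ-yes (1 ∣? k) (1∣ k))
        (trans (sym (+-identityʳ _)) (+-congʳ (∑ n λ i → χ (q ^ suc i ∣? k)) (sym (χ-no (q ^ suc n ∣? k) (>⇒∤ ⦃ ℕ.>-nonZero 0<k ⦄ big))))))
        where
        big : k ℕ.< q ^ suc n
        big = ℕₚ.≤-<-trans k≤n (ℕₚ.<-trans (ℕₚ.n<1+n n) (n<p^n (suc n) (1<p pq)))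

    -- Only the valuation at q changes, by one, so a single term of the sum over p is altered. The
    -- product must stay below `X`, the range of the exponents.
    ℓ-prime* : ∀ {q k} → Prime q → 0 ℕ.< k → q ℕ.* k ℕ.< X → ℓ (q ℕ.* k) ≡ lam q + ℓ k
    ℓ-prime* {q} {k} pq 0<k qk<X = begin
      ℓ (q ℕ.* k)
        ≡⟨ ℓ-v (q ℕ.* k) ⟩
      ∑ X (λ p → χ (prime? p) * (lam p * v p (q ℕ.* k)))
        ≡⟨ ∑-cong X pointwise ⟩
      ∑ X (λ p → χ (p ℕ.≟ q) * (χ (prime? p) * lam p) + χ (prime? p) * (lam p * v p k))
        ≡⟨ ∑-+ X (λ p → χ (p ℕ.≟ q) * (χ (prime? p) * lam p)) (λ p → χ (prime? p) * (lam p * v p k)) ⟩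
      ∑ X (λ p → χ (p ℕ.≟ q) * (χ (prime? p) * lam p)) + ∑ X (λ p → χ (prime? p) * (lam p * v p k))
        ≡⟨ cong₂ _+_ (trans (∑-≟ (λ p → χ (prime? p) * lam p) q<X) (trans (cong (λ z → z * lam q) (χ-yes (prime? q) pq)) (*-identityˡ (lam q)))) (sym (ℓ-v k)) ⟩
      lam q + ℓ k ∎
      where
      open ≡-Reasoning
      q<X : q ℕ.< X
      q<X = ℕₚ.≤-<-trans (ℕₚ.m≤m*n q k ⦃ ℕ.>-nonZero 0<k ⦄) qk<X
      k<X : k ℕ.< X
      k<X = ℕₚ.≤-<-trans (ℕₚ.m≤n*m k q ⦃ ℕ.>-nonZero (0<p pq) ⦄) qk<X
      e₁ : ∀ a b c → a * (b * c) ≡ 0ℤ * (a * b) + a * (b * c)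
      e₁ = solve-∀
      e₂ : ∀ b c → 1ℤ * (b * (1ℤ + c)) ≡ 1ℤ * (1ℤ * b) + 1ℤ * (b * c)
      e₂ = solve-∀
      e₃ : ∀ b c d → 0ℤ * (b * c) ≡ d * (0ℤ * b) + 0ℤ * (b * c)
      e₃ b c d = sym (trans (cong (λ z → d * z + 0ℤ * (b * c)) (*-zeroˡ b)) (trans (cong (λ z → z + 0ℤ * (b * c)) (*-zeroʳ d)) (+-identityˡ _)))
      pointwise : ∀ p → χ (prime? p) * (lam p * v p (q ℕ.* k)) ≡ χ (p ℕ.≟ q) * (χ (prime? p) * lam p) + χ (prime? p) * (lam p * v p k)
      pointwise p with prime? p | p ℕ.≟ q
      ... | yes pp | no p≢q = trans (cong (λ z → 1ℤ * (lam p * z)) (v-other k pp pq p≢q)) (e₁ 1ℤ (lam p) (v p k))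
      ... | yes pp | yes refl = trans (cong (λ z → 1ℤ * (lam p * z)) (v-self {p} {k} pp 0<k k<X)) (e₂ (lam p) (v p k))
      ... | no _ | d = trans (*-zeroˡ (lam p * v p (q ℕ.* k))) (trans (sym (*-zeroˡ (lam p * v p k))) (e₃ (lam p) (v p k) (χ d)))

    ℓ-1 : ℓ 1 ≡ 0ℤ
    ℓ-1 = trans (Λ-cong {λ m → χ (m ∣? 1)} {λ m → 0ℤ * 0ℤ} λ m pm → χ-no (m ∣? 1) λ d → ℕₚ.>⇒≢ (1<pp pm) (∣1⇒≡1 d)) (Λ-*ˡ 0ℤ λ _ → 0ℤ)

    ℓ-prime^* : ∀ {q k} j → Prime q → 0 ℕ.< k → q ^ j ℕ.* k ℕ.< X → ℓ (q ^ j ℕ.* k) ≡ + j * lam q + ℓ k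
    ℓ-prime^* {q} {k} zero pq 0<k lt = trans (cong ℓ (ℕₚ.*-identityˡ k)) (lem (lam q) (ℓ k))
      where
      lem : ∀ a b → b ≡ 0ℤ * a + b
      lem = solve-∀
    ℓ-prime^* {q} {k} (suc j) pq 0<k lt = trans (cong ℓ (ℕₚ.*-assoc q (q ^ j) k))
      (trans (ℓ-prime* pq (0<* (0<^ j (0<p pq)) 0<k) lt′)
      (trans (+-congʳ (lam q) (ℓ-prime^* j pq 0<k (ℕₚ.≤-<-trans (ℕₚ.m≤n*m (q ^ j ℕ.* k) q ⦃ ℕ.>-nonZero (0<p pq) ⦄) lt′)))
      (lem (+ j) (lam q) (ℓ k))))
      where
      lt′ : q ℕ.* (q ^ j ℕ.* k) ℕ.< X
      lt′ = subst (ℕ._< X) (ℕₚ.*-assoc q (q ^ j) k) lt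
      lem : ∀ j a b → a + (j * a + b) ≡ (1ℤ + j) * a + b
      lem = solve-∀

    ℓ-prime^ : ∀ {q} j → Prime q → q ^ j ℕ.< X → ℓ (q ^ j) ≡ + j * lam q
    ℓ-prime^ {q} j pq lt = trans (cong ℓ (sym (ℕₚ.*-identityʳ (q ^ j))))
      (trans (ℓ-prime^* {q} {1} j pq (s≤s z≤n) (subst (ℕ._< X) (sym (ℕₚ.*-identityʳ (q ^ j))) lt))
      (trans (+-congʳ (+ j * lam q) ℓ-1) (+-identityʳ _)))

    ℓ-pp* : ∀ {m k} → PrimePower m → 0 ℕ.< k → m ℕ.* k ℕ.< X → ℓ (m ℕ.* k) ≡ ℓ m + ℓ k
    ℓ-pp* {m} {k} (q , pq , _ , i , refl) 0<k lt = trans (ℓ-prime^* {q} {k} (suc i) pq 0<k lt)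
      (cong (λ z → z + ℓ k) (sym (ℓ-prime^ (suc i) pq (ℕₚ.≤-<-trans (ℕₚ.m≤m*n (q ^ suc i) k ⦃ ℕ.>-nonZero 0<k ⦄) lt))))

    -- Selberg's Λ₂ = Λ log + Λ * Λ
    Λ₂ : (ℕ → ℤ) → ℤ
    Λ₂ Ψ = Λ (λ m → ℓ m * Ψ m) + Λ λ a → Λ λ b → Ψ (a ℕ.* b)

    Λ₂-cong : ∀ {Ψ Φ : ℕ → ℤ} → (∀ m → 0 ℕ.< m → Ψ m ≡ Φ m) → Λ₂ Ψ ≡ Λ₂ Φ
    Λ₂-cong h = cong₂ _+_ (Λ-cong λ m pm → cong (λ z → ℓ m * z) (h m (0<pp pm)))
      (Λ-cong λ a pa → Λ-cong λ b pb → h (a ℕ.* b) (0<* (0<pp pa) (0<pp pb)))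

    Λ₂-∑ : ∀ n (F : ℕ → ℕ → ℤ) → Λ₂ (λ m → ∑ n (F m)) ≡ ∑ n λ j → Λ₂ λ m → F m j
    Λ₂-∑ n F = trans (cong₂ _+_
        (trans (Λ-cong λ m _ → sym (∑-*ˡ n (ℓ m) (F m))) (Λ-∑ n λ m j → ℓ m * F m j))
        (trans (Λ-cong λ a _ → Λ-∑ n λ b j → F (a ℕ.* b) j) (Λ-∑ n λ a j → Λ λ b → F (a ℕ.* b) j)))
      (sym (∑-+ n (λ j → Λ λ m → ℓ m * F m j) (λ j → Λ λ a → Λ λ b → F (a ℕ.* b) j)))

    Λ₂-+ : ∀ (Ψ Φ : ℕ → ℤ) → Λ₂ (λ m → Ψ m + Φ m) ≡ Λ₂ Ψ + Λ₂ Φ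
    Λ₂-+ Ψ Φ = trans (cong₂ _+_
        (trans (Λ-cong λ m _ → *-distribˡ-+ (ℓ m) (Ψ m) (Φ m)) (Λ-+ (λ m → ℓ m * Ψ m) λ m → ℓ m * Φ m))
        (trans (Λ-cong λ a _ → Λ-+ (λ b → Ψ (a ℕ.* b)) λ b → Φ (a ℕ.* b)) (Λ-+ (λ a → Λ λ b → Ψ (a ℕ.* b)) λ a → Λ λ b → Φ (a ℕ.* b))))
      (lem (Λ λ m → ℓ m * Ψ m) (Λ λ m → ℓ m * Φ m) (Λ λ a → Λ λ b → Ψ (a ℕ.* b)) (Λ λ a → Λ λ b → Φ (a ℕ.* b)))
      where
      lem : ∀ a b c d → (a + b) + (c + d) ≡ (a + c) + (b + d)
      lem = solve-∀

    Λ₂-*ˡ : ∀ c (Ψ : ℕ → ℤ) → Λ₂ (λ m → c * Ψ m) ≡ c * Λ₂ Ψ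
    Λ₂-*ˡ c Ψ = trans (cong₂ _+_
        (trans (Λ-cong λ m _ → lem (ℓ m) c (Ψ m)) (Λ-*ˡ c λ m → ℓ m * Ψ m))
        (trans (Λ-cong λ a _ → Λ-*ˡ c λ b → Ψ (a ℕ.* b)) (Λ-*ˡ c λ a → Λ λ b → Ψ (a ℕ.* b))))
      (sym (*-distribˡ-+ c (Λ λ m → ℓ m * Ψ m) (Λ λ a → Λ λ b → Ψ (a ℕ.* b))))
      where
      lem : ∀ a c x → a * (c * x) ≡ c * (a * x)
      lem = solve-∀

    -- log² = Λ₂ * 1
    Λ₂-multiples : ∀ {ψ} → Supported ψ → Λ₂ (λ m → ∑ X λ k → ψ (m ℕ.* k)) ≡ ∑ X λ n → ψ n * (ℓ n * ℓ n)
    Λ₂-multiples {ψ} s@(s₀ , s₁) = sym (begin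
      ∑ X (λ n → ψ n * (ℓ n * ℓ n))
        ≡⟨ ∑-cong X (λ n → sym (*-assoc (ψ n) (ℓ n) (ℓ n))) ⟩
      ∑ X (λ n → ψℓ n * ℓ n)
        ≡⟨ Λ-multiples {ψℓ} ψℓ-supported ⟨
      Λ (λ m → ∑ X λ k → ψℓ (m ℕ.* k))
        ≡⟨ Λ-cong (λ m pm → trans (∑-cong X (additive m pm)) (∑-+ X (λ k → ℓ m * ψ (m ℕ.* k)) λ k → ψ (m ℕ.* k) * ℓ k)) ⟩
      Λ (λ m → ∑ X (λ k → ℓ m * ψ (m ℕ.* k)) + ∑ X (λ k → ψ (m ℕ.* k) * ℓ k))
        ≡⟨ Λ-cong (λ m pm → cong₂ _+_ (∑-*ˡ X (ℓ m) λ k → ψ (m ℕ.* k)) (trans (sym (Λ-multiples {λ k → ψ (m ℕ.* k)} (supported-* {ψ} (0<pp pm) s)))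
              (Λ-cong λ b _ → ∑-cong X λ k → cong ψ (sym (ℕₚ.*-assoc m b k))))) ⟩
      Λ (λ m → ℓ m * ∑ X (λ k → ψ (m ℕ.* k)) + Λ λ b → ∑ X λ k → ψ (m ℕ.* b ℕ.* k))
        ≡⟨ Λ-+ (λ m → ℓ m * ∑ X λ k → ψ (m ℕ.* k)) (λ m → Λ λ b → ∑ X λ k → ψ (m ℕ.* b ℕ.* k)) ⟩
      Λ₂ (λ m → ∑ X λ k → ψ (m ℕ.* k)) ∎)
      where
      open ≡-Reasoning
      ψℓ : ℕ → ℤ
      ψℓ n = ψ n * ℓ n
      ψℓ-supported : Supported ψℓ
      ψℓ-supported = trans (cong (λ z → z * ℓ 0) s₀) (*-zeroˡ (ℓ 0)) , λ n X≤n → trans (cong (λ z → z * ℓ n) (s₁ n X≤n)) (*-zeroˡ (ℓ n))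
      lem : ∀ x a b → x * (a + b) ≡ a * x + x * b
      lem = solve-∀
      vanish : ∀ {x} a b c → x ≡ 0ℤ → x * a ≡ b * x + x * c
      vanish a b c refl = trans (*-zeroˡ a) (sym (cong₂ _+_ (*-zeroʳ b) (*-zeroˡ c)))
      additive : ∀ m → PrimePower m → ∀ k → ψℓ (m ℕ.* k) ≡ ℓ m * ψ (m ℕ.* k) + ψ (m ℕ.* k) * ℓ k
      additive m pm zero = vanish (ℓ (m ℕ.* 0)) (ℓ m) (ℓ 0) (trans (cong ψ (ℕₚ.*-zeroʳ m)) s₀)
      additive m pm (suc k) with m ℕ.* suc k ℕ.<? X
      ... | yes lt = trans (cong (λ z → ψ (m ℕ.* suc k) * z) (ℓ-pp* pm (s≤s z≤n) lt)) (lem (ψ (m ℕ.* suc k)) (ℓ m) (ℓ (suc k)))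
      ... | no ¬lt = vanish (ℓ (m ℕ.* suc k)) (ℓ m) (ℓ (suc k)) (s₁ _ (ℕₚ.≮⇒≥ ¬lt))

    -- For a prime p the factor is 1, -1 or 0 according as p divides n not at all, exactly once, or
    -- at least twice. For 0 < n < `X` the product over all p < `X` is therefore the Möbius
    -- function, in a form where multiplication by a prime touches one factor only.
    fac : ℕ → ℕ → ℤ
    fac p n = 1ℤ - χ (prime? p) * (+ 2 * χ (p ∣? n) - χ (p ℕ.* p ∣? n))

    μ : ℕ → ℤ
    μ n = ∏ X λ p → fac p n

    μ-unit : ∀ n → μ n ≤∣ 1ℤ
    μ-unit n = ∏-unit X λ p → unit p
      where
      unit : ∀ p → fac p n ≤∣ 1ℤ
      unit p with prime? p | p ∣? n | p ℕ.* p ∣? n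
      ... | no _ | a | b = subst (_≤∣ 1ℤ) (sym (trans (cong (λ z → 1ℤ - z) (*-zeroˡ (+ 2 * χ a - χ b))) refl)) (-≤+ , ≤-refl)
      ... | yes _ | yes _ | yes _ = -≤+ , 0≤1
      ... | yes _ | yes _ | no _ = ≤-refl , -≤+
      ... | yes _ | no _ | no _ = -≤+ , ≤-refl
      ... | yes _ | no p∤n | yes p²∣n = contradiction (∣-trans (m∣m*n p) p²∣n) p∤n

    fac-other : ∀ {q} p d → Prime q → ¬ p ≡ q → fac p (q ℕ.* d) ≡ fac p d
    fac-other {q} p d pq p≢q = cong (λ z → 1ℤ - z) (χ-*-cong (prime? p) λ pp → cong₂ (λ x y → + 2 * x - y)
      (coprime⇒∣-⇔ (subst (λ z → Coprime z q) (ℕₚ.*-identityʳ p) (coprime-prime-powers 1 pp pq p≢q)) (p ∣? d))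
      (coprime⇒∣-⇔ (subst (λ z → Coprime (p ℕ.* z) q) (ℕₚ.*-identityʳ p) (coprime-prime-powers 2 pp pq p≢q)) (p ℕ.* p ∣? d)))

    μ-prime* : ∀ {q} d → Prime q → q ℕ.< X → μ (q ℕ.* d) ≡ (χ (q ∣? d) - 1ℤ) * μ d
    μ-prime* {q} d pq q<X = ∏-factor (λ p → fac p (q ℕ.* d)) (λ p → fac p d) (χ (q ∣? d) - 1ℤ) q<X (λ p p≢q → fac-other p d pq p≢q)
      (trans (cong₂ (λ x y → 1ℤ - χ (prime? q) * (+ 2 * x - y)) (χ-yes (q ∣? q ℕ.* d) (m∣m*n d)) (χ-∣-*ˡ q d (0<p pq))) self)
      where
      self : 1ℤ - χ (prime? q) * (+ 2 * 1ℤ - χ (q ∣? d)) ≡ (χ (q ∣? d) - 1ℤ) * fac q d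
      self with prime? q | q ∣? d | q ℕ.* q ∣? d
      ... | no ¬pq | _ | _ = contradiction pq ¬pq
      ... | yes _ | yes _ | yes _ = refl
      ... | yes _ | yes _ | no _ = refl
      ... | yes _ | no _ | no _ = refl
      ... | yes _ | no q∤d | yes q²∣d = contradiction (∣-trans (m∣m*n q) q²∣d) q∤d

    μ-1 : μ 1 ≡ 1ℤ
    μ-1 = ∏-one X one
      where
      one : ∀ p → fac p 1 ≡ 1ℤ
      one p = trans (cong (λ z → 1ℤ - z) (trans (χ-*-cong (prime? p) {_} {0ℤ} λ pp → cong₂ (λ x y → + 2 * x - y)
        (χ-no (p ∣? 1) (λ h → ¬1 pp (∣1⇒≡1 h))) (χ-no (p ℕ.* p ∣? 1) λ h → ¬1 pp (∣1⇒≡1 (∣-trans (m∣m*n p) h))))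
        (*-zeroʳ (χ (prime? p))))) refl
        where
        ¬1 : Prime p → ¬ p ≡ 1
        ¬1 pp = ℕₚ.>⇒≢ (1<p pp)

    -- For a prime q dividing e, the divisors d prime to q are paired with q d, where μ has the
    -- opposite sign; divisors with q² ∣ d contribute nothing.
    ∑-μ : ∀ {e} → 0 ℕ.< e → e ℕ.< X → ∑ X (λ d → χ (d ∣? e) * μ d) ≡ χ (e ℕ.≟ 1)
    ∑-μ {suc zero} _ 1<X = trans (∑-cong X λ d → cong (λ z → z * μ d) (χ-⇔ (d ∣? 1) (d ℕ.≟ 1) ∣1⇒≡1 λ { refl → ∣-refl }))
      (trans (∑-≟ μ 1<X) μ-1)
    ∑-μ {e@(suc (suc e₀))} 0<e e<X with prime-divisor {e} (s≤s (s≤s z≤n))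
    ... | q , pq , divides e′ e≡e′q = begin
      ∑ X ψ
        ≡⟨ ∑-cong X (λ d → lem (χ (q ∣? d)) (ψ d)) ⟩
      ∑ X (λ d → χ (q ∣? d) * ψ d + (1ℤ - χ (q ∣? d)) * ψ d)
        ≡⟨ ∑-+ X (λ d → χ (q ∣? d) * ψ d) (λ d → (1ℤ - χ (q ∣? d)) * ψ d) ⟩
      ∑ X (λ d → χ (q ∣? d) * ψ d) + B
        ≡⟨ cong (λ z → z + B) (sym (∑-multiples {ψ} (0<p pq) ψ-supported)) ⟩
      ∑ X (λ k → ψ (q ℕ.* k)) + B
        ≡⟨ cong (λ z → z + B) (trans (∑-cong X flip) (∑-*ˡ X -1ℤ λ k → (1ℤ - χ (q ∣? k)) * ψ k)) ⟩
      -1ℤ * B + B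
        ≡⟨ lem′ B ⟩
      0ℤ ∎
      where
      open ≡-Reasoning
      ψ : ℕ → ℤ
      ψ d = χ (d ∣? e) * μ d
      B : ℤ
      B = ∑ X λ d → (1ℤ - χ (q ∣? d)) * ψ d
      e≡ : e ≡ q ℕ.* e′
      e≡ = trans e≡e′q (ℕₚ.*-comm e′ q)
      q<X : q ℕ.< X
      q<X = ℕₚ.≤-<-trans (∣⇒≤ (divides e′ e≡e′q)) e<X
      ψ-supported : Supported ψ
      ψ-supported = trans (cong (λ z → z * μ 0) (χ-no (0 ∣? e) λ h → contradiction (0∣⇒≡0 h) λ ())) (*-zeroˡ (μ 0)) ,
        λ n X≤n → trans (cong (λ z → z * μ n) (χ-no (n ∣? e) (>⇒∤ (ℕₚ.<-≤-trans e<X X≤n)))) (*-zeroˡ (μ n))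
      lem : ∀ c x → x ≡ c * x + (1ℤ - c) * x
      lem = solve-∀
      lem′ : ∀ b → -1ℤ * b + b ≡ 0ℤ
      lem′ = solve-∀
      lem₁ : ∀ x m → x * ((0ℤ - 1ℤ) * m) ≡ -1ℤ * ((1ℤ - 0ℤ) * (x * m))
      lem₁ = solve-∀
      lem₂ : ∀ x y m → x * ((1ℤ - 1ℤ) * m) ≡ -1ℤ * ((1ℤ - 1ℤ) * (y * m))
      lem₂ x y m = trans (cong (λ z → x * z) (*-zeroˡ m)) (trans (*-zeroʳ x) (sym (cong (λ z → -1ℤ * z) (*-zeroˡ (y * m)))))
      flip : ∀ k → ψ (q ℕ.* k) ≡ -1ℤ * ((1ℤ - χ (q ∣? k)) * ψ k)
      flip k = trans (cong₂ _*_ (trans (cong (λ z → χ (q ℕ.* k ∣? z)) e≡) (χ-∣-*ˡ k e′ (0<p pq))) (μ-prime* k pq q<X)) (cases (q ∣? k))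
        where
        cases : (dec : Dec (q ∣ k)) → χ (k ∣? e′) * ((χ dec - 1ℤ) * μ k) ≡ -1ℤ * ((1ℤ - χ dec) * ψ k)
        cases (yes _) = lem₂ (χ (k ∣? e′)) (χ (k ∣? e)) (μ k)
        cases (no q∤k) = trans (cong (λ z → z * ((0ℤ - 1ℤ) * μ k)) (sym (trans (cong (λ z → χ (k ∣? z)) e≡)
          (coprime⇒∣-⇔ (no-common-prime⇒coprime (0<p pq) λ pr r∣k r∣q → q∤k (subst (_∣ k) (prime∣prime pr pq r∣q) r∣k)) (k ∣? e′)))))
          (lem₁ (χ (k ∣? e)) (μ k))

    -- Selberg's Λ₂ = μ * log². It follows from log² = Λ₂ * 1, applied to ψ n = Σ μ(d) g(d n), whose
    -- sum over the multiples of m is g m again by Möbius inversion.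
    Λ₂-möbius : ∀ {g} → Supported g → 1 ℕ.< X → Λ₂ g ≡ ∑ X λ d → μ d * ∑ X λ n → g (d ℕ.* n) * (ℓ n * ℓ n)
    Λ₂-möbius {g} s@(s₀ , s₁) 1<X = begin
      Λ₂ g
        ≡⟨ Λ₂-cong (λ m 0<m → sym (invert m 0<m)) ⟩
      Λ₂ (λ m → ∑ X λ k → ψ (m ℕ.* k))
        ≡⟨ Λ₂-multiples {ψ} ψ-supported ⟩
      ∑ X (λ n → ψ n * (ℓ n * ℓ n))
        ≡⟨ ∑-cong X (λ n → sym (trans (∑-cong X λ d → sym (*-assoc (μ d) (g (d ℕ.* n)) (ℓ n * ℓ n))) (∑-*ʳ X (ℓ n * ℓ n) λ d → μ d * g (d ℕ.* n)))) ⟩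
      ∑ X (λ n → ∑ X λ d → μ d * (g (d ℕ.* n) * (ℓ n * ℓ n)))
        ≡⟨ ∑-swap X X (λ n d → μ d * (g (d ℕ.* n) * (ℓ n * ℓ n))) ⟩
      ∑ X (λ d → ∑ X λ n → μ d * (g (d ℕ.* n) * (ℓ n * ℓ n)))
        ≡⟨ ∑-cong X (λ d → ∑-*ˡ X (μ d) λ n → g (d ℕ.* n) * (ℓ n * ℓ n)) ⟩
      ∑ X (λ d → μ d * ∑ X λ n → g (d ℕ.* n) * (ℓ n * ℓ n)) ∎
      where
      open ≡-Reasoning
      ψ : ℕ → ℤ
      ψ n = ∑ X λ d → μ d * g (d ℕ.* n)
      g-zero : ∀ {n} → n ≡ 0 → g n ≡ 0ℤ
      g-zero refl = s₀
      ψ-supported : Supported ψ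
      ψ-supported = ∑-zero< X (λ d _ → trans (cong (λ z → μ d * z) (g-zero (ℕₚ.*-zeroʳ d))) (*-zeroʳ (μ d))) ,
        λ n X≤n → ∑-zero< X λ d _ → trans (cong (λ z → μ d * z) (out d n X≤n)) (*-zeroʳ (μ d))
        where
        out : ∀ d n → X ℕ.≤ n → g (d ℕ.* n) ≡ 0ℤ
        out zero n _ = s₀
        out (suc d) n X≤n = s₁ _ (ℕₚ.≤-trans X≤n (ℕₚ.m≤n*m n (suc d)))
      invert : ∀ m → 0 ℕ.< m → ∑ X (λ k → ψ (m ℕ.* k)) ≡ g m
      invert m 0<m = begin
        ∑ X (λ k → ∑ X λ d → μ d * g (d ℕ.* (m ℕ.* k)))
          ≡⟨ ∑-swap X X (λ k d → μ d * g (d ℕ.* (m ℕ.* k))) ⟩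
        ∑ X (λ d → ∑ X λ k → μ d * g (d ℕ.* (m ℕ.* k)))
          ≡⟨ ∑-cong X (λ d → trans (∑-*ˡ X (μ d) λ k → g (d ℕ.* (m ℕ.* k))) (cong (λ z → μ d * z) (inner d))) ⟩
        ∑ X (λ d → μ d * ∑ X λ e → χ (d ∣? e) * G e)
          ≡⟨ ∑-cong X (λ d → sym (∑-*ˡ X (μ d) λ e → χ (d ∣? e) * G e)) ⟩
        ∑ X (λ d → ∑ X λ e → μ d * (χ (d ∣? e) * G e))
          ≡⟨ ∑-swap X X (λ d e → μ d * (χ (d ∣? e) * G e)) ⟩
        ∑ X (λ e → ∑ X λ d → μ d * (χ (d ∣? e) * G e))
          ≡⟨ ∑-cong< X (λ e e<X → trans (∑-cong X λ d → rearrange (μ d) (χ (d ∣? e)) (G e)) (trans (∑-*ʳ X (G e) λ d → χ (d ∣? e) * μ d) (collapse e e<X))) ⟩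
        ∑ X (λ e → χ (e ℕ.≟ 1) * G e)
          ≡⟨ ∑-≟ G 1<X ⟩
        g (m ℕ.* 1)
          ≡⟨ cong g (ℕₚ.*-identityʳ m) ⟩
        g m ∎
        where
        G : ℕ → ℤ
        G e = g (m ℕ.* e)
        G-supported : Supported G
        G-supported = supported-* {g} 0<m s
        rearrange : ∀ a b c → a * (b * c) ≡ b * a * c
        rearrange = solve-∀
        swap* : ∀ d k → d ℕ.* (m ℕ.* k) ≡ m ℕ.* (d ℕ.* k)
        swap* d k = trans (sym (ℕₚ.*-assoc d m k)) (trans (cong (ℕ._* k) (ℕₚ.*-comm d m)) (ℕₚ.*-assoc m d k))
        inner : ∀ d → ∑ X (λ k → g (d ℕ.* (m ℕ.* k))) ≡ ∑ X λ e → χ (d ∣? e) * G e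
        inner (suc d) = trans (∑-cong X λ k → cong g (swap* (suc d) k)) (∑-multiples {G} (s≤s z≤n) G-supported)
        inner zero = trans (∑-zero< X λ _ _ → s₀) (sym (∑-zero< X λ e _ → trans (χ-*-cong (0 ∣? e) {G e} {0ℤ} λ h → trans (cong G (0∣⇒≡0 h)) (proj₁ G-supported)) (*-zeroʳ (χ (0 ∣? e)))))
        collapse : ∀ e → e ℕ.< X → ∑ X (λ d → χ (d ∣? e) * μ d) * G e ≡ χ (e ℕ.≟ 1) * G e
        collapse zero _ = trans (cong (λ z → ∑ X (λ d → χ (d ∣? 0) * μ d) * z) (proj₁ G-supported)) (trans (*-zeroʳ (∑ X (λ d → χ (d ∣? 0) * μ d))) (sym (*-zeroˡ (G 0))))
        collapse (suc e) lt = cong (λ z → z * G (suc e)) (∑-μ (s≤s z≤n) lt)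

-- The quotient step, as an inequality between dyadic block masses

module Closure where

  open import Data.Integer hiding (suc; _^_; NonZero)
  open import Data.Integer.Properties
  open import Data.Integer.Tactic.RingSolver using (solve-∀)
  open import Data.Nat as ℕ using (ℕ; zero; suc; z≤n; s≤s)
  import Data.Nat.Properties as ℕₚ
  open import Relation.Binary.PropositionalEquality
  open import Relation.Binary.Definitions using (tri<; tri≈; tri>)
  open import Relation.Nullary using (yes; no; contradiction)
  open Sums

  ∑-squares : ∀ n → + 6 * ∑ n (λ k → + k * + k) ≡ + 2 * (+ n * + n * + n) - + 3 * (+ n * + n) + + n
  ∑-squares zero = refl
  ∑-squares (suc n) = trans (*-distribˡ-+ (+ 6) (∑ n λ k → + k * + k) (+ n * + n))
    (trans (cong (λ z → z + + 6 * (+ n * + n)) (∑-squares n)) (lem (+ n)))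
    where
    lem : ∀ n → + 2 * (n * n * n) - + 3 * (n * n) + n + + 6 * (n * n) ≡
      + 2 * ((1ℤ + n) * (1ℤ + n) * (1ℤ + n)) - + 3 * ((1ℤ + n) * (1ℤ + n)) + (1ℤ + n)
    lem = solve-∀

  ∑-suc : ∀ n → + 2 * ∑ n (λ k → + suc k) ≡ + n * + suc n
  ∑-suc zero = refl
  ∑-suc (suc n) = trans (*-distribˡ-+ (+ 2) (∑ n λ k → + suc k) (+ suc n))
    (trans (cong (λ z → z + + 2 * + suc n) (∑-suc n)) (lem (+ n)))
    where
    lem : ∀ n → n * (1ℤ + n) + + 2 * (1ℤ + n) ≡ (1ℤ + n) * (1ℤ + (1ℤ + n))
    lem = solve-∀

  <∸⇒+< : ∀ {i j n} → i ℕ.< n ℕ.∸ j → i ℕ.+ j ℕ.< n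
  <∸⇒+< {i} {j} {n} h with j ℕ.≤? n
  ... | yes j≤n = ℕₚ.m≤o∸n⇒m+n≤o (suc i) j≤n h
  ... | no j≰n = contradiction (subst (i ℕ.<_) (ℕₚ.m≤n⇒m∸n≡0 (ℕₚ.<⇒≤ (ℕₚ.≰⇒> j≰n))) h) λ ()

  ∑-χ+< : ∀ j n (f : ℕ → ℤ) → ∑ n (λ i → χ (i ℕ.+ j ℕ.<? n) * f i) ≡ ∑ (n ℕ.∸ j) f
  ∑-χ+< j n f = trans (∑-extend {n ℕ.∸ j} {n} (λ i → χ (i ℕ.+ j ℕ.<? n) * f i) (ℕₚ.m∸n≤m n j)
      λ i n∸j≤i → trans (cong (λ z → z * f i) (χ-no (i ℕ.+ j ℕ.<? n) (ℕₚ.≤⇒≯ (subst (n ℕ.≤_) (ℕₚ.+-comm j i) (ℕₚ.≤-trans (ℕₚ.m≤n+m∸n n j) (ℕₚ.+-monoʳ-≤ j n∸j≤i)))))) (*-zeroˡ (f i)))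
    (∑-cong< (n ℕ.∸ j) λ i i<n∸j → trans (cong (λ z → z * f i) (χ-yes (i ℕ.+ j ℕ.<? n) (<∸⇒+< i<n∸j))) (*-identityˡ (f i)))

  -- Σ over i + j < k, for k at most the common range n of i and j
  Tri : ℕ → ℕ → (ℕ → ℕ → ℤ) → ℤ
  Tri n k F = ∑ n λ j → ∑ n λ i → χ (i ℕ.+ j ℕ.<? k) * F i j

  Tri-cong : ∀ n k {F G : ℕ → ℕ → ℤ} → (∀ i j → F i j ≡ G i j) → Tri n k F ≡ Tri n k G
  Tri-cong n k h = ∑-cong n λ j → ∑-cong n λ i → cong (λ z → χ (i ℕ.+ j ℕ.<? k) * z) (h i j)

  Tri-flip : ∀ n k F → Tri n k F ≡ Tri n k λ i j → F j i
  Tri-flip n k F = trans (∑-swap n n λ j i → χ (i ℕ.+ j ℕ.<? k) * F i j)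
    (∑-cong n λ i → ∑-cong n λ j → cong (λ z → z * F i j) (χ-⇔ (i ℕ.+ j ℕ.<? k) (j ℕ.+ i ℕ.<? k)
       (subst (ℕ._< k) (ℕₚ.+-comm i j)) (subst (ℕ._< k) (ℕₚ.+-comm j i))))

  Tri-+ : ∀ n k (F G : ℕ → ℕ → ℤ) → Tri n k (λ i j → F i j + G i j) ≡ Tri n k F + Tri n k G
  Tri-+ n k F G = trans (∑-cong n λ j → trans (∑-cong n λ i → *-distribˡ-+ (χ (i ℕ.+ j ℕ.<? k)) (F i j) (G i j))
    (∑-+ n (λ i → χ (i ℕ.+ j ℕ.<? k) * F i j) λ i → χ (i ℕ.+ j ℕ.<? k) * G i j))
    (∑-+ n (λ j → ∑ n λ i → χ (i ℕ.+ j ℕ.<? k) * F i j) λ j → ∑ n λ i → χ (i ℕ.+ j ℕ.<? k) * G i j)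

  -- Summation by parts along the antidiagonals: for d < n, exactly n - 1 - d of the k < n exceed d.
  Tri-weighted : ∀ n F → Tri n n (λ i j → + (i ℕ.+ j) * F i j) ≡ (+ n - 1ℤ) * Tri n n F - ∑ n λ k → Tri n k F
  Tri-weighted n F = sym (trans (cong₂ _-_ (sym (trans (∑-cong n λ j → ∑-*ˡ n (+ n - 1ℤ) λ i → χ (i ℕ.+ j ℕ.<? n) * F i j) (∑-*ˡ n (+ n - 1ℤ) λ j → ∑ n λ i → χ (i ℕ.+ j ℕ.<? n) * F i j)))
       (trans (∑-swap n n λ k j → ∑ n λ i → χ (i ℕ.+ j ℕ.<? k) * F i j) (∑-cong n λ j → trans (∑-swap n n λ k i → χ (i ℕ.+ j ℕ.<? k) * F i j) (∑-cong n λ i → ∑-*ʳ n (F i j) λ k → χ (i ℕ.+ j ℕ.<? k)))))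
    (trans (sym (∑-- n (λ j → ∑ n λ i → (+ n - 1ℤ) * (χ (i ℕ.+ j ℕ.<? n) * F i j)) λ j → ∑ n λ i → ∑ n (λ k → χ (i ℕ.+ j ℕ.<? k)) * F i j))
    (∑-cong n λ j → trans (sym (∑-- n (λ i → (+ n - 1ℤ) * (χ (i ℕ.+ j ℕ.<? n) * F i j)) λ i → ∑ n (λ k → χ (i ℕ.+ j ℕ.<? k)) * F i j))
      (∑-cong n λ i → pointwise (i ℕ.+ j) (F i j)))))
    where
    count : ∀ d n → ∑ n (λ k → χ (d ℕ.<? k)) ≡ χ (d ℕ.<? n) * (+ n - 1ℤ - + d)
    count d zero = sym (trans (cong (λ z → z * (+ 0 - 1ℤ - + d)) (χ-no (d ℕ.<? 0) λ ())) (*-zeroˡ (+ 0 - 1ℤ - + d)))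
    count d (suc n) with ℕₚ.<-cmp d n
    ... | tri< d<n _ _ = trans (cong₂ _+_ (trans (count d n) (cong (λ z → z * (+ n - 1ℤ - + d)) (χ-yes (d ℕ.<? n) d<n))) (χ-yes (d ℕ.<? n) d<n))
         (trans (lem (+ n) (+ d)) (cong (λ z → z * (+ suc n - 1ℤ - + d)) (sym (χ-yes (d ℕ.<? suc n) (ℕₚ.m<n⇒m<1+n d<n)))))
      where
      lem : ∀ n d → 1ℤ * (n - 1ℤ - d) + 1ℤ ≡ 1ℤ * ((1ℤ + n) - 1ℤ - d)
      lem = solve-∀
    ... | tri≈ ¬d<n refl _ = trans (cong₂ _+_ (trans (count d n) (cong (λ z → z * (+ n - 1ℤ - + d)) (χ-no (d ℕ.<? n) ¬d<n))) (χ-no (d ℕ.<? n) ¬d<n))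
         (trans (lem (+ n)) (cong (λ z → z * (+ suc n - 1ℤ - + d)) (sym (χ-yes (d ℕ.<? suc n) (ℕₚ.n<1+n d)))))
      where
      lem : ∀ n → 0ℤ * (n - 1ℤ - n) + 0ℤ ≡ 1ℤ * ((1ℤ + n) - 1ℤ - n)
      lem n = trans (cong (λ z → z + 0ℤ) (*-zeroˡ (n - 1ℤ - n))) (lem′ n)
        where
        lem′ : ∀ n → 0ℤ + 0ℤ ≡ 1ℤ * ((1ℤ + n) - 1ℤ - n)
        lem′ = solve-∀
    ... | tri> ¬d<n _ n<d = trans (cong₂ _+_ (trans (count d n) (cong (λ z → z * (+ n - 1ℤ - + d)) (χ-no (d ℕ.<? n) ¬d<n))) (χ-no (d ℕ.<? n) ¬d<n))
         (trans (lem (+ n - 1ℤ - + d) (+ suc n - 1ℤ - + d)) (cong (λ z → z * (+ suc n - 1ℤ - + d)) (sym (χ-no (d ℕ.<? suc n) (ℕₚ.≤⇒≯ n<d)))))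
      where
      lem : ∀ x y → 0ℤ * x + 0ℤ ≡ 0ℤ * y
      lem x y = trans (cong (λ z → z + 0ℤ) (*-zeroˡ x)) (sym (*-zeroˡ y))
    pointwise : ∀ d x → (+ n - 1ℤ) * (χ (d ℕ.<? n) * x) - ∑ n (λ k → χ (d ℕ.<? k)) * x ≡ χ (d ℕ.<? n) * (+ d * x)
    pointwise d x = trans (cong (λ z → (+ n - 1ℤ) * (χ (d ℕ.<? n) * x) - z * x) (count d n)) (lem (+ n) (χ (d ℕ.<? n)) (+ d) x)
      where
      lem : ∀ n c d x → (n - 1ℤ) * (c * x) - c * (n - 1ℤ - d) * x ≡ c * (d * x)
      lem = solve-∀

  module _ (t : ℕ → ℤ) (u C : ℤ) (0≤u : 0ℤ ≤ u) where

    -- Abel summation done twice: from n to n + 1 the quadratic moment grows by twice the linear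
    -- moment plus a partial sum, and the linear one by that partial sum. The part of the bound free
    -- of `C` is the exact value when t is constantly `u`.
    ∑-squares-bound : ∀ n → (∀ k → k ℕ.≤ n → ∑ k t ≤ (+ k + C) * u) →
      + 6 * ∑ n (λ j → t j * (+ (n ℕ.∸ j) * + (n ℕ.∸ j))) ≤ (+ 2 * (+ n * + n * + n) + + 3 * (+ n * + n) + + n + + 6 * (C * (+ n * + n))) * u
    ∑-squares-bound n H = proj₁ (bounds n H)
      where
      open import Data.Product using (_×_; _,_; proj₁)
      P R : ℕ → ℤ
      P n = ∑ n λ j → t j * (+ (n ℕ.∸ j) * + (n ℕ.∸ j))
      R n = ∑ n λ j → t j * + (n ℕ.∸ j)
      down : ∀ n j → j ℕ.≤ n → + (suc n ℕ.∸ j) ≡ 1ℤ + + (n ℕ.∸ j)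
      down n j j≤n = cong +_ (ℕₚ.+-∸-assoc 1 j≤n)
      last : ∀ n → + (n ℕ.∸ n) ≡ 0ℤ
      last n = cong +_ (ℕₚ.n∸n≡0 n)
      R-step : ∀ n → R (suc n) ≡ R n + ∑ (suc n) t
      R-step n = trans (∑-cong< (suc n) λ j j<1+n → trans (cong (λ z → t j * z) (down n j (ℕₚ.≤-pred j<1+n))) (lem (t j) (+ (n ℕ.∸ j))))
        (trans (∑-+ (suc n) (λ j → t j * + (n ℕ.∸ j)) t) (cong (λ z → z + ∑ (suc n) t) (trans (+-congʳ (R n) (trans (cong (λ z → t n * z) (last n)) (*-zeroʳ (t n)))) (+-identityʳ (R n)))))
        where
        lem : ∀ a x → a * (1ℤ + x) ≡ a * x + a
        lem = solve-∀
      P-step : ∀ n → P (suc n) ≡ P n + + 2 * R n + ∑ (suc n) t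
      P-step n = trans (∑-cong< (suc n) λ j j<1+n → trans (cong (λ z → t j * (z * z)) (down n j (ℕₚ.≤-pred j<1+n))) (lem (t j) (+ (n ℕ.∸ j))))
        (trans (∑-+ (suc n) (λ j → t j * (+ (n ℕ.∸ j) * + (n ℕ.∸ j)) + + 2 * (t j * + (n ℕ.∸ j))) t)
        (cong (λ z → z + ∑ (suc n) t) (trans (∑-+ (suc n) (λ j → t j * (+ (n ℕ.∸ j) * + (n ℕ.∸ j))) λ j → + 2 * (t j * + (n ℕ.∸ j)))
        (cong₂ _+_ (trans (+-congʳ (P n) (trans (cong (λ z → t n * (z * z)) (last n)) (*-zeroʳ (t n)))) (+-identityʳ (P n)))
           (trans (∑-*ˡ (suc n) (+ 2) λ j → t j * + (n ℕ.∸ j)) (cong (λ z → + 2 * z) (trans (+-congʳ (R n) (trans (cong (λ z → t n * z) (last n)) (*-zeroʳ (t n)))) (+-identityʳ (R n)))))))))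
        where
        lem : ∀ a x → a * ((1ℤ + x) * (1ℤ + x)) ≡ a * (x * x) + + 2 * (a * x) + a
        lem = solve-∀
      RB PB : ℤ → ℤ
      RB n = (n * n + n + + 2 * (C * n)) * u
      PB n = (+ 2 * (n * n * n) + + 3 * (n * n) + n + + 6 * (C * (n * n))) * u
      Goal : ℕ → Set
      Goal n = + 6 * P n ≤ PB (+ n) × + 2 * R n ≤ RB (+ n)
      step-≡ : ∀ n P R T C u → (+ 2 * ((1ℤ + n) * (1ℤ + n) * (1ℤ + n)) + + 3 * ((1ℤ + n) * (1ℤ + n)) + (1ℤ + n) + + 6 * (C * ((1ℤ + n) * (1ℤ + n)))) * u - (+ 6 * (P + + 2 * R + T)) ≡
        ((+ 2 * (n * n * n) + + 3 * (n * n) + n + + 6 * (C * (n * n))) * u - (+ 6 * P)) + + 6 * ((n * n + n + + 2 * (C * n)) * u - (+ 2 * R)) + + 6 * (((1ℤ + n) + C) * u - T)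
      step-≡ = solve-∀
      step : ∀ n P R T C u → + 6 * P ≤ (+ 2 * (n * n * n) + + 3 * (n * n) + n + + 6 * (C * (n * n))) * u → + 2 * R ≤ (n * n + n + + 2 * (C * n)) * u → T ≤ ((1ℤ + n) + C) * u →
        + 6 * (P + + 2 * R + T) ≤ (+ 2 * ((1ℤ + n) * (1ℤ + n) * (1ℤ + n)) + + 3 * ((1ℤ + n) * (1ℤ + n)) + (1ℤ + n) + + 6 * (C * ((1ℤ + n) * (1ℤ + n)))) * u
      step n P R T C u p r t = by≤ (gap p ⊹ 0≤+ 6 ⊛ gap r ⊹ 0≤+ 6 ⊛ gap t) (step-≡ n P R T C u)
      step′-≡ : ∀ n R T C u → ((1ℤ + n) * (1ℤ + n) + (1ℤ + n) + + 2 * (C * (1ℤ + n))) * u - (+ 2 * (R + T)) ≡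
        ((n * n + n + + 2 * (C * n)) * u - (+ 2 * R)) + + 2 * (((1ℤ + n) + C) * u - T)
      step′-≡ = solve-∀
      step′ : ∀ n R T C u → + 2 * R ≤ (n * n + n + + 2 * (C * n)) * u → T ≤ ((1ℤ + n) + C) * u →
        + 2 * (R + T) ≤ ((1ℤ + n) * (1ℤ + n) + (1ℤ + n) + + 2 * (C * (1ℤ + n))) * u
      step′ n R T C u r t = by≤ (gap r ⊹ 0≤+ 2 ⊛ gap t) (step′-≡ n R T C u)
      bounds : ∀ n → (∀ k → k ℕ.≤ n → ∑ k t ≤ (+ k + C) * u) → Goal n
      bounds zero H = ≤-reflexive (sym (lem C u)) , ≤-reflexive (sym (lem′ C u))
        where
        lem : ∀ C u → (+ 2 * (0ℤ * 0ℤ * 0ℤ) + + 3 * (0ℤ * 0ℤ) + 0ℤ + + 6 * (C * (0ℤ * 0ℤ))) * u ≡ 0ℤ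
        lem = solve-∀
        lem′ : ∀ C u → (0ℤ * 0ℤ + 0ℤ + + 2 * (C * 0ℤ)) * u ≡ 0ℤ
        lem′ = solve-∀
      bounds (suc n) H with bounds n (λ k k≤n → H k (ℕₚ.m≤n⇒m≤1+n k≤n))
      ... | p , r = ≤-trans (≤-reflexive (cong (λ z → + 6 * z) (P-step n))) (step (+ n) (P n) (R n) (∑ (suc n) t) C u p r (H (suc n) ℕₚ.≤-refl)) ,
        ≤-trans (≤-reflexive (cong (λ z → + 2 * z) (R-step n))) (step′ (+ n) (R n) (∑ (suc n) t) C u r (H (suc n) ℕₚ.≤-refl))

  -- Here s b j is the mass of the class b in the dyadic block j, e a b says whether a b ≡ c, and the bound on V at h
  -- comes from the sparse class c′ with c = h c′. If h carried mass, the pairs (c′, h) would leave a deficit in Z.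
  module Step (M n : ℕ) (s e : ℕ → ℕ → ℤ) (u C φ : ℤ) (h : ℕ) (h<M : h ℕ.< M)
    (0<u : 0ℤ < u) (0≤C : 0ℤ ≤ C) (0≤φ : 0ℤ ≤ φ) (s≥0 : ∀ b j → 0ℤ ≤ s b j) (e-sym : ∀ a b → e a b ≡ e b a) where

    σ : ℕ → ℕ → ℤ
    σ b i = ∑ M λ a → e a b * s a i

    V : ℕ → ℕ → ℤ
    V b k = ∑ k λ i → + i * σ b i

    -- With e a b the indicator of a b ≡ c, `σ b i` is the mass of the class c / b in block i, and
    -- this is the mass of the pairs with product in class c and members in blocks i and j.
    A : ℕ → ℕ → ℤ
    A i j = ∑ M λ b → σ b i * s b j

    private
      0≤u : 0ℤ ≤ u
      0≤u = <⇒≤ 0<u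

      t : ℕ → ℤ
      t j = ∑ M λ b → s b j

      -- The deficit: what the class h would contribute to the upper bound if `V h` had the size
      -- allowed for the other classes.
      H : ℤ
      H = ∑ n λ j → s h j * (+ (n ℕ.∸ j) * + (n ℕ.∸ j))

      A-sym : ∀ i j → A i j ≡ A j i
      A-sym i j = trans (∑-cong M λ b → sym (∑-*ʳ M (s b j) λ a → e a b * s a i))
        (trans (∑-swap M M λ b a → e a b * s a i * s b j)
        (∑-cong M λ a → trans (∑-cong M λ b → trans (cong (λ z → z * s a i * s b j) (e-sym a b)) (lem (e b a) (s a i) (s b j)))
          (∑-*ʳ M (s a i) λ b → e b a * s b j)))
        where
        lem : ∀ x y z → x * y * z ≡ x * z * y
        lem = solve-∀

      W W₁ : ℤ
      W = Tri n n λ i j → + (i ℕ.+ j) * A i j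
      W₁ = Tri n n λ i j → + i * A i j

      -- The weight i + j splits into two equal halves because `A` is symmetric. In one half, the
      -- sum over i < n - j then becomes a `V` in `W₁≡`.
      W≡2W₁ : W ≡ W₁ + W₁
      W≡2W₁ = trans (Tri-cong n n λ i j → trans (cong (λ z → z * A i j) (pos-+ i j)) (*-distribʳ-+ (A i j) (+ i) (+ j)))
        (trans (Tri-+ n n (λ i j → + i * A i j) λ i j → + j * A i j)
        (+-congʳ W₁ (trans (Tri-flip n n λ i j → + j * A i j) (Tri-cong n n λ i j → cong (λ z → + i * z) (A-sym j i)))))

      W₁≡ : W₁ ≡ ∑ n λ j → ∑ M λ b → s b j * V b (n ℕ.∸ j)
      W₁≡ = ∑-cong n λ j → trans (∑-χ+< j n λ i → + i * A i j)
        (trans (∑-cong (n ℕ.∸ j) λ i → trans (sym (∑-*ˡ M (+ i) λ b → σ b i * s b j)) (∑-cong M λ b → lem (+ i) (σ b i) (s b j)))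
        (trans (∑-swap (n ℕ.∸ j) M λ i b → s b j * (+ i * σ b i)) (∑-cong M λ b → ∑-*ˡ (n ℕ.∸ j) (s b j) λ i → + i * σ b i)))
        where
        lem : ∀ x y z → x * (y * z) ≡ z * (x * y)
        lem = solve-∀

    -- `Z-lower` and `Z-upper` put the pair mass at k² u² / φ. This is twice what equidistribution
    -- would give: the sparse class c leaves the whole main term of Selberg's formula to products of
    -- two prime powers. `V-bound` is the most that the same formula allows to a class.
    module _ 
      (mertens : ∀ k → k ℕ.≤ n → ∑ k t ≤ (+ k + C) * u)
      (V-bound : ∀ b k → b ℕ.< M → k ℕ.≤ n → φ * V b k ≤ ((1ℤ - χ (b ℕ.≟ h)) * (+ k * + k) + C * + suc k) * u)
      (Z-lower : (+ n * + n - C * + suc n) * (u * u) ≤ φ * Tri n n A)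
      (Z-upper : ∀ k → k ℕ.< n → φ * Tri n k A ≤ (+ k * + k + C * + suc k) * (u * u))
      where

      private
        W₁-upper : φ * W₁ ≤ (∑ n (λ j → t j * (+ (n ℕ.∸ j) * + (n ℕ.∸ j))) - H + C * + suc n * ∑ n t) * u
        W₁-upper = ≤-trans (≤-reflexive (trans (cong (λ z → φ * z) W₁≡) (trans (sym (∑-*ˡ n φ λ j → ∑ M λ b → s b j * V b (n ℕ.∸ j)))
            (∑-cong n λ j → trans (sym (∑-*ˡ M φ λ b → s b j * V b (n ℕ.∸ j))) (∑-cong M λ b → lem φ (s b j) (V b (n ℕ.∸ j)))))))
          (≤-trans (∑-mono n λ j → ≤-trans (∑-mono< M λ b b<M → *-monoˡ (s≥0 b j) (V-bound′ b j b<M)) (≤-reflexive (inner j)))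
          (≤-reflexive outer))
          where
          q : ℕ → ℤ
          q j = + (n ℕ.∸ j) * + (n ℕ.∸ j)
          lem : ∀ x y z → x * (y * z) ≡ y * (x * z)
          lem = solve-∀
          V-bound′ : ∀ b j → b ℕ.< M → φ * V b (n ℕ.∸ j) ≤ ((1ℤ - χ (b ℕ.≟ h)) * q j + C * + suc n) * u
          V-bound′ b j b<M = ≤-trans (V-bound b (n ℕ.∸ j) b<M (ℕₚ.m∸n≤m n j))
            (*-monoʳ 0≤u (+-monoʳ-≤ ((1ℤ - χ (b ℕ.≟ h)) * q j) (*-monoˡ 0≤C (+≤+ (s≤s (ℕₚ.m∸n≤m n j))))))
          inner : ∀ j → ∑ M (λ b → s b j * (((1ℤ - χ (b ℕ.≟ h)) * q j + C * + suc n) * u)) ≡ (t j * q j - s h j * q j + C * + suc n * t j) * u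
          inner j = trans (∑-cong M λ b → lem₁ (s b j) (χ (b ℕ.≟ h)) (q j) (C * + suc n) u)
            (trans (∑-- M (λ b → s b j * ((q j + C * + suc n) * u)) λ b → χ (b ℕ.≟ h) * (s b j * (q j * u)))
            (trans (cong₂ _-_ (∑-*ʳ M ((q j + C * + suc n) * u) λ b → s b j) (∑-≟ (λ b → s b j * (q j * u)) h<M)) (lem₂ (t j) (s h j) (q j) (C * + suc n) u)))
            where
            lem₁ : ∀ s x q c u → s * (((1ℤ - x) * q + c) * u) ≡ s * ((q + c) * u) - x * (s * (q * u))
            lem₁ = solve-∀
            lem₂ : ∀ t s q c u → t * ((q + c) * u) - s * (q * u) ≡ (t * q - s * q + c * t) * u
            lem₂ = solve-∀
          outer : ∑ n (λ j → (t j * q j - s h j * q j + C * + suc n * t j) * u) ≡ (∑ n (λ j → t j * q j) - H + C * + suc n * ∑ n t) * u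
          outer = trans (∑-*ʳ n u λ j → t j * q j - s h j * q j + C * + suc n * t j) (cong (λ z → z * u)
            (trans (∑-+ n (λ j → t j * q j - s h j * q j) λ j → C * + suc n * t j) (cong₂ _+_ (∑-- n (λ j → t j * q j) λ j → s h j * q j) (∑-*ˡ n (C * + suc n) t))))

        Z-sum : + 6 * ∑ n (λ k → φ * Tri n k A) ≤ (+ 2 * (+ n * + n * + n) - + 3 * (+ n * + n) + + n + + 3 * (C * (+ n * + suc n))) * (u * u)
        Z-sum = ≤-trans (*-monoˡ (0≤+ 6) (∑-mono< n Z-upper)) (≤-reflexive
          (trans (cong (λ z → + 6 * z) (trans (∑-*ʳ n (u * u) λ k → + k * + k + C * + suc k) (cong (λ z → z * (u * u)) (trans (∑-+ n (λ k → + k * + k) λ k → C * + suc k) (+-congʳ (∑ n λ k → + k * + k) (∑-*ˡ n C λ k → + suc k))))))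
          (trans (lem (∑ n λ k → + k * + k) C (∑ n λ k → + suc k) (u * u)) (cong (λ z → z * (u * u)) (cong₂ (λ x y → x + + 3 * (C * y)) (∑-squares n) (∑-suc n))))))
          where
          lem : ∀ a C b w → + 6 * ((a + C * b) * w) ≡ (+ 6 * a + + 3 * (C * (+ 2 * b))) * w
          lem = solve-∀

        -- The main term is (6 - 2) n³ u²: the lower bound for the full triangle, times n - 1, minus
        -- the upper bounds for the smaller triangles.
        W-lower : 1 ℕ.≤ n → (+ 6 * ((+ n - 1ℤ) * (+ n * + n - C * + suc n)) - (+ 2 * (+ n * + n * + n) - + 3 * (+ n * + n) + + n + + 3 * (C * (+ n * + suc n)))) * (u * u) ≤ + 6 * (φ * W)
        W-lower 1≤n = ≤-trans (final (+ n) C (u * u) (φ * Tri n n A) (∑ n λ k → φ * Tri n k A) (gap (+≤+ 1≤n)) Z-lower Z-sum)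
          (≤-reflexive (sym (cong (λ z → + 6 * z) (trans (cong (λ z → φ * z) (Tri-weighted n A)) (trans (lem φ (+ n - 1ℤ) (Tri n n A) (∑ n λ k → Tri n k A)) (cong (λ z → (+ n - 1ℤ) * (φ * Tri n n A) - z) (sym (∑-*ˡ n φ λ k → Tri n k A))))))))
          where
          lem : ∀ f a b c → f * (a * b - c) ≡ a * (f * b) - f * c
          lem = solve-∀
          final-≡ : ∀ n C w Z S → + 6 * ((n - 1ℤ) * Z - S) - ((+ 6 * ((n - 1ℤ) * (n * n - C * (1ℤ + n))) - (+ 2 * (n * n * n) - + 3 * (n * n) + n + + 3 * (C * (n * (1ℤ + n))))) * w) ≡
            + 6 * ((n - 1ℤ) * (Z - ((n * n - C * (1ℤ + n)) * w))) + ((+ 2 * (n * n * n) - + 3 * (n * n) + n + + 3 * (C * (n * (1ℤ + n)))) * w - (+ 6 * S))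
          final-≡ = solve-∀
          final : ∀ n C w Z S → 0ℤ ≤ n - 1ℤ → (n * n - C * (1ℤ + n)) * w ≤ Z → + 6 * S ≤ (+ 2 * (n * n * n) - + 3 * (n * n) + n + + 3 * (C * (n * (1ℤ + n)))) * w →
            (+ 6 * ((n - 1ℤ) * (n * n - C * (1ℤ + n))) - (+ 2 * (n * n * n) - + 3 * (n * n) + n + + 3 * (C * (n * (1ℤ + n))))) * w ≤ + 6 * ((n - 1ℤ) * Z - S)
          final n C w Z S 0≤n-1 p q = by≤ (0≤+ 6 ⊛ (0≤n-1 ⊛ gap p) ⊹ gap q) (final-≡ n C w Z S)

        -- Upper and lower bound for 12 φ `W₁` share the main term 4 n³ u², so the cubic terms
        -- cancel and the deficit 12 u `H` is left against quadratic terms. These are collected in 1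
        -- + 4 C + 2 C².
        H-bound : 1 ℕ.≤ n → H ≤ (1ℤ + + 4 * C + + 2 * (C * C)) * (+ n * + n) * u
        H-bound 1≤n = *-cancelˡ-≤-pos H _ (+ 12 * u) ⦃ positive (pos12 0<u) ⦄
          (combine (+ n) C u H (φ * W₁) (∑ n λ j → t j * (+ (n ℕ.∸ j) * + (n ℕ.∸ j))) (∑ n t) (gap (+≤+ 1≤n)) 0≤C 0≤u
            (≤-trans (W-lower 1≤n) (≤-reflexive (trans (cong (λ z → + 6 * (φ * z)) W≡2W₁) (dbl φ W₁)))) W₁-upper (∑-squares-bound t u C 0≤u n mertens) (mertens n ℕₚ.≤-refl))
          where
          dbl : ∀ f w → + 6 * (f * (w + w)) ≡ + 12 * (f * w)
          dbl = solve-∀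
          pos12 : 0ℤ < u → 0ℤ < + 12 * u
          pos12 0<u = subst (_< + 12 * u) (*-zeroʳ (+ 12)) (*-monoˡ-<-pos (+ 12) 0<u)
          combine-≡ : ∀ n C u H W P T → + 12 * u * ((1ℤ + + 4 * C + + 2 * (C * C)) * (n * n) * u) - + 12 * u * H ≡
            (+ 12 * W - ((+ 6 * ((n - 1ℤ) * (n * n - C * (1ℤ + n))) - (+ 2 * (n * n * n) - + 3 * (n * n) + n + + 3 * (C * (n * (1ℤ + n))))) * (u * u))) + + 12 * ((P - H + C * (1ℤ + n) * T) * u - W) + + 2 * (u * ((+ 2 * (n * n * n) + + 3 * (n * n) + n + + 6 * (C * (n * n))) * u - (+ 6 * P))) + + 12 * (C * ((n - 1ℤ) + + 2) * (u * ((n + C) * u - T))) + (u * u) * (+ 3 * ((n - 1ℤ) + 1ℤ) * (n - 1ℤ) + + 15 * C * ((n - 1ℤ) + 1ℤ) * (n - 1ℤ) + + 6 * C + + 12 * C * C * (((n - 1ℤ) + 1ℤ) * (n - 1ℤ) + (n - 1ℤ) * ((n - 1ℤ) + + 2)))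
          combine-≡ = solve-∀
          combine : ∀ n C u H W P T → 0ℤ ≤ n - 1ℤ → 0ℤ ≤ C → 0ℤ ≤ u →
            (+ 6 * ((n - 1ℤ) * (n * n - C * (1ℤ + n))) - (+ 2 * (n * n * n) - + 3 * (n * n) + n + + 3 * (C * (n * (1ℤ + n))))) * (u * u) ≤ + 12 * W →
            W ≤ (P - H + C * (1ℤ + n) * T) * u →
            + 6 * P ≤ (+ 2 * (n * n * n) + + 3 * (n * n) + n + + 6 * (C * (n * n))) * u →
            T ≤ (n + C) * u →
            + 12 * u * H ≤ + 12 * u * ((1ℤ + + 4 * C + + 2 * (C * C)) * (n * n) * u)
          combine n C u H W P T n1 c0 u0 a b p t = by≤
            (gap a ⊹ 0≤+ 12 ⊛ gap b ⊹ 0≤+ 2 ⊛ (u0 ⊛ gap p) ⊹ 0≤+ 12 ⊛ (c0 ⊛ (n1 ⊹ 0≤+ 2) ⊛ (u0 ⊛ gap t))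
               ⊹ (u0 ⊛ u0) ⊛ (0≤+ 3 ⊛ (n1 ⊹ 0≤1) ⊛ n1 ⊹ 0≤+ 15 ⊛ c0 ⊛ (n1 ⊹ 0≤1) ⊛ n1 ⊹ 0≤+ 6 ⊛ c0 ⊹ 0≤+ 12 ⊛ c0 ⊛ c0 ⊛ ((n1 ⊹ 0≤1) ⊛ n1 ⊹ n1 ⊛ (n1 ⊹ 0≤+ 2))))
            (combine-≡ n C u H W P T)

      -- For n = 2 m every j < m has weight (n - j)² ≥ m², so division by m² turns the quadratic
      -- bound into a constant one. The factor 4 is (2 m)² / m².
      conclusion : ∀ m → n ≡ m ℕ.+ m → ∑ m (s h) ≤ + 4 * (1ℤ + + 4 * C + + 2 * (C * C)) * u
      conclusion zero _ = (0≤+ 4 ⊛ (0≤1 ⊹ 0≤+ 4 ⊛ 0≤C ⊹ 0≤+ 2 ⊛ (0≤C ⊛ 0≤C))) ⊛ 0≤u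
      conclusion m@(suc m′) refl = *-cancelˡ-≤-pos (∑ m (s h)) _ (+ m * + m)
        (≤-trans (≤-trans (≤-reflexive (sym (trans (∑-*ʳ m (+ m * + m) (s h)) (*-comm (∑ m (s h)) (+ m * + m)))))
          (≤-trans (∑-mono< m λ j j<m → *-monoˡ (s≥0 h j) (sq j j<m)) (∑-monoⁿ {m} {n} (λ j → s h j * (+ (n ℕ.∸ j) * + (n ℕ.∸ j))) (λ j → s≥0 h j ⊛ (0≤+ (n ℕ.∸ j) ⊛ 0≤+ (n ℕ.∸ j))) (ℕₚ.m≤m+n m m))))
        (≤-trans (H-bound (s≤s z≤n)) (≤-reflexive (trans (cong (λ z → (1ℤ + + 4 * C + + 2 * (C * C)) * (z * z) * u) (pos-+ m m)) (lem (+ m) (1ℤ + + 4 * C + + 2 * (C * C)) u)))))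
        where
        lem : ∀ m k u → k * ((m + m) * (m + m)) * u ≡ m * m * (+ 4 * k * u)
        lem = solve-∀
        m≤n∸j : ∀ j → j ℕ.< m → m ℕ.≤ n ℕ.∸ j
        m≤n∸j j j<m = ℕₚ.≤-trans (ℕₚ.≤-reflexive (sym (ℕₚ.m+n∸n≡m m m))) (ℕₚ.∸-monoʳ-≤ (m ℕ.+ m) (ℕₚ.<⇒≤ j<m))
        sq : ∀ j → j ℕ.< m → + m * + m ≤ + (n ℕ.∸ j) * + (n ℕ.∸ j)
        sq j j<m = *-mono (0≤+ m) (0≤+ _) (+≤+ (m≤n∸j j j<m)) (+≤+ (m≤n∸j j j<m))

-- Integer binary logarithms and their near-additivity

module Logs where

  open import Data.Nat
  open import Data.Nat.Properties
  open import Data.Product using (_×_; _,_; proj₁; proj₂)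
  open import Relation.Binary.PropositionalEquality
  open import Relation.Nullary using (yes; no; contradiction)

  -- ⌊log₂ n⌋ for n ≥ 1, and L 0 = 0
  L : ℕ → ℕ
  L zero = 0
  L (suc n) with 2 ^ suc (L n) ≤? suc n
  ... | yes _ = suc (L n)
  ... | no _ = L n

  2^<2^suc : ∀ k → 2 ^ k < 2 ^ suc k
  2^<2^suc k = ^-monoʳ-< 2 (s≤s (s≤s z≤n)) {k} ≤-refl

  L-spec : ∀ n → 0 < n → 2 ^ L n ≤ n × n < 2 ^ suc (L n)
  L-spec (suc zero) _ = s≤s z≤n , s≤s (s≤s z≤n)
  L-spec (suc (suc n)) _ with 2 ^ suc (L (suc n)) ≤? suc (suc n) | L-spec (suc n) (s≤s z≤n)
  ... | yes h | _ , lt = h , ≤-<-trans lt (2^<2^suc (suc (L (suc n))))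
  ... | no ¬h | le , _ = m≤n⇒m≤1+n le , ≰⇒> ¬h

  2^-mono : ∀ {i j} → i ≤ j → 2 ^ i ≤ 2 ^ j
  2^-mono = ^-monoʳ-≤ 2

  0<2^ : ∀ k → 0 < 2 ^ k
  0<2^ k = m^n>0 2 k

  n<2^n : ∀ n → n < 2 ^ n
  n<2^n zero = s≤s z≤n
  n<2^n (suc n) = ≤-trans (+-mono-≤ (0<2^ n) (n<2^n n)) (≤-reflexive (cong (2 ^ n +_) (sym (+-identityʳ (2 ^ n)))))

  2^suc : ∀ k → 2 ^ suc k ≡ 2 ^ k + 2 ^ k
  2^suc k = cong (2 ^ k +_) (+-identityʳ (2 ^ k))

  L-≥ : ∀ {i n} → 2 ^ i ≤ n → i ≤ L n
  L-≥ {i} {n} h with i ≤? L n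
  ... | yes i≤L = i≤L
  ... | no i≰L = contradiction (≤-trans (2^-mono (≰⇒> i≰L)) h) (<⇒≱ (proj₂ (L-spec n (≤-trans (0<2^ i) h))))

  L-< : ∀ {i n} → 0 < n → n < 2 ^ i → L n < i
  L-< {i} {n} 0<n h with L n <? i
  ... | yes lt = lt
  ... | no ¬lt = contradiction (≤-trans (2^-mono (≮⇒≥ ¬lt)) (proj₁ (L-spec n 0<n))) (<⇒≱ h)

  L-mono : ∀ {m n} → 0 < m → m ≤ n → L m ≤ L n
  L-mono {m} 0<m m≤n = L-≥ (≤-trans (proj₁ (L-spec m 0<m)) m≤n)

  L-block : ∀ {k i} → i < 2 ^ k → L (2 ^ k + i) ≡ k
  L-block {k} {i} i<2^k = ≤-antisym
    (≤-pred (L-< (≤-trans (0<2^ k) (m≤m+n _ i)) (subst (2 ^ k + i <_) (sym (2^suc k)) (+-monoʳ-< (2 ^ k) i<2^k))))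
    (L-≥ (m≤m+n (2 ^ k) i))

  L-*-≥ : ∀ {m n} → 0 < m → 0 < n → L m + L n ≤ L (m * n)
  L-*-≥ {m} {n} 0<m 0<n = L-≥ (≤-trans (≤-reflexive (^-distribˡ-+-* 2 (L m) (L n))) (*-mono-≤ (proj₁ (L-spec m 0<m)) (proj₁ (L-spec n 0<n))))

  L-*-≤ : ∀ {m n} → 0 < m → 0 < n → L (m * n) ≤ suc (L m + L n)
  L-*-≤ {m} {n} 0<m 0<n = ≤-pred (L-< (*-mono-≤ 0<m 0<n) (<-≤-trans (*-mono-< (proj₂ (L-spec m 0<m)) (proj₂ (L-spec n 0<n)))
    (≤-reflexive (trans (sym (^-distribˡ-+-* 2 (suc (L m)) (suc (L n)))) (cong (λ z → 2 ^ suc z) (+-suc (L m) (L n)))))))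

  ^-distrib-* : ∀ o m n → (m * n) ^ o ≡ m ^ o * n ^ o
  ^-distrib-* zero m n = refl
  ^-distrib-* (suc o) m n = trans (cong (m * n *_) (^-distrib-* o m n)) ([m*n]*[o*p]≡[m*o]*[n*p] m n (m ^ o) (n ^ o))

  module _ (κ : ℕ) where

    -- κ log₂ n up to an error less than 1
    lg : ℕ → ℕ
    lg n = L (n ^ κ)

    0<^κ : ∀ {n} → 0 < n → 0 < n ^ κ
    0<^κ {n} 0<n = m^n>0 n ⦃ >-nonZero 0<n ⦄ κ

    lg-mono : ∀ {m n} → 0 < m → m ≤ n → lg m ≤ lg n
    lg-mono 0<m m≤n = L-mono (0<^κ 0<m) (^-monoˡ-≤ κ m≤n)

    lg-≥ : ∀ {n} → 0 < n → κ * L n ≤ lg n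
    lg-≥ {n} 0<n = L-≥ (≤-trans (≤-reflexive (trans (cong (2 ^_) (*-comm κ (L n))) (sym (^-*-assoc 2 (L n) κ)))) (^-monoˡ-≤ κ (proj₁ (L-spec n 0<n))))

    lg-≤ : ∀ {n i} → 0 < n → n ≤ 2 ^ i → lg n ≤ κ * i
    lg-≤ {n} {i} 0<n h = ≤-pred (L-< (0<^κ 0<n) (≤-<-trans (^-monoˡ-≤ κ h)
      (≤-<-trans (≤-reflexive (trans (^-*-assoc 2 i κ) (cong (2 ^_) (*-comm i κ)))) (2^<2^suc (κ * i)))))

    lg-*-≥ : ∀ {m n} → 0 < m → 0 < n → lg m + lg n ≤ lg (m * n)
    lg-*-≥ {m} {n} 0<m 0<n = ≤-trans (L-*-≥ (0<^κ 0<m) (0<^κ 0<n)) (≤-reflexive (cong L (sym (^-distrib-* κ m n))))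

    lg-*-≤ : ∀ {m n} → 0 < m → 0 < n → lg (m * n) ≤ suc (lg m + lg n)
    lg-*-≤ {m} {n} 0<m 0<n = ≤-trans (≤-reflexive (cong L (^-distrib-* κ m n))) (L-*-≤ (0<^κ 0<m) (0<^κ 0<n))

    lg-1 : lg 1 ≡ 0
    lg-1 = trans (cong L (^-zeroˡ κ)) refl

  lg-0 : ∀ κ → lg κ 0 ≡ 0
  lg-0 zero = refl
  lg-0 (suc κ) = refl

-- Chebyshev's bound and Mertens' theorem in scaled integers

module Mertens where

  open import Data.Integer hiding (suc; _^_; _/_; _%_; NonZero)
  open import Data.Integer.Properties
  open import Data.Integer.Tactic.RingSolver using (solve-∀; solve)
  open import Data.List using ([]; _∷_)
  open import Data.Nat as ℕ using (ℕ; zero; suc; z≤n; s≤s; _^_; NonZero)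
  import Data.Nat.Properties as ℕₚ
  open import Data.Nat.Divisibility using (divides; _∣?_)
  open import Data.Nat.DivMod using (_/_; m≡m%n+[m/n]*n; m/n*n≤m; m%n<n)
  open import Data.Nat.Induction using (<-rec)
  open import Data.Nat.Primality
  open import Data.Product using (Σ; _×_; _,_; proj₁; proj₂)
  open import Relation.Binary.PropositionalEquality
  open import Relation.Nullary using (yes; no; contradiction)
  open Sums
  open Arith
  open Logs

  -- For x > 0 this is the indicator of 0 < n < x, written as a difference so that the two
  -- conditions can be counted separately.
  ρ : ℕ → ℕ → ℤ
  ρ x n = χ (n ℕ.<? x) - χ (n ℕ.≟ 0)

  ρ-0 : ∀ {x} → 0 ℕ.< x → ρ x 0 ≡ 0ℤ
  ρ-0 {x} 0<x = cong₂ _-_ (χ-yes (0 ℕ.<? x) 0<x) (χ-yes (0 ℕ.≟ 0) refl)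

  ρ-pos : ∀ x {n} → 0 ℕ.< n → ρ x n ≡ χ (n ℕ.<? x)
  ρ-pos x {n} 0<n = trans (cong (λ z → χ (n ℕ.<? x) - z) (χ-no (n ℕ.≟ 0) (ℕₚ.>⇒≢ 0<n))) (+-identityʳ _)

  ρ-out : ∀ {x n} → 0 ℕ.< x → x ℕ.≤ n → ρ x n ≡ 0ℤ
  ρ-out {x} {n} 0<x x≤n = trans (ρ-pos x (ℕₚ.<-≤-trans 0<x x≤n)) (χ-no (n ℕ.<? x) (ℕₚ.≤⇒≯ x≤n))

  pos-2^suc : ∀ k → + (2 ^ suc k) ≡ + 2 * + (2 ^ k)
  pos-2^suc k = pos-* 2 (2 ^ k)

  ∑-L : ∀ k → (+ k - + 2) * + (2 ^ k) ≤ ∑ (2 ^ k) λ n → + L n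
  ∑-L zero = -≤+
  ∑-L (suc k) = ≤-trans (≤-reflexive (trans (cong (λ z → (+ suc k - + 2) * z) (pos-2^suc k)) (lem (+ k) (+ (2 ^ k)))))
    (≤-trans (+-monoˡ-≤ (+ (2 ^ k) * + k) (∑-L k)) (≤-reflexive (sym (trans (cong (λ z → ∑ z (λ n → + L n)) (2^suc k))
      (trans (∑-split (2 ^ k) (2 ^ k) λ n → + L n) (+-congʳ (∑ (2 ^ k) λ n → + L n) (trans (∑-cong< (2 ^ k) λ i i<2^k → cong +_ (L-block {k} i<2^k)) (∑-const (2 ^ k) (+ k)))))))))
    where
    lem : ∀ k x → ((1ℤ + k) - + 2) * (+ 2 * x) ≡ (k - + 2) * x + x * k
    lem = solve-∀

  -- 1/n is represented by w n = Y/n, with Y a common multiple, and log₂ p by an integer close to κ log₂ p.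
  record Scaling : Set where
    field
      T X κ : ℕ
      Y : ℤ
      w : ℕ → ℤ
      X≡2^T : X ≡ 2 ^ T
      -- Large enough to absorb all rounding: the total error 4 κ T² X made in replacing squared
      -- logarithms stays below κ². The 8 is the additive constant of the upper bound in Mertens'
      -- theorem.
      κ-big : 4 ℕ.* ((T ℕ.+ 8) ℕ.* (T ℕ.+ 8)) ℕ.* X ℕ.≤ κ
      1≤T : 1 ℕ.≤ T
      0<Y : 0ℤ < Y
      w≥0 : ∀ n → 0ℤ ≤ w n
      w-spec : ∀ n → 0 ℕ.< n → n ℕ.< X → + n * w n ≡ Y
      -- A convention that keeps w weakly decreasing from 0 on, as partial summation requires.
      w-0 : w 0 ≡ w 1

  module Level (𝒮 : Scaling) where

    open Scaling 𝒮

    lam : ℕ → ℤ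
    lam p = + lg κ p

    open Arithmetic X lam public

    lam≥0 : ∀ p → 0ℤ ≤ lam p
    lam≥0 p = 0≤+ (lg κ p)

    0≤Y : 0ℤ ≤ Y
    0≤Y = <⇒≤ 0<Y

    -- The scaled log 2: κ is the scale of the logarithms and Y that of the weights 1/n. Estimates
    -- are stated in multiples of `u` or, for Λ₂, of u².
    u : ℤ
    u = + κ * Y

    0<X : 0 ℕ.< X
    0<X = subst (0 ℕ.<_) (sym X≡2^T) (0<2^ T)

    T²X≤κ : ∀ a b → a ℕ.≤ T ℕ.+ 8 → b ℕ.≤ T ℕ.+ 8 → 4 ℕ.* (a ℕ.* b) ℕ.* X ℕ.≤ κ
    T²X≤κ a b ha hb = ℕₚ.≤-trans (ℕₚ.*-monoˡ-≤ X (ℕₚ.*-monoʳ-≤ 4 (ℕₚ.*-mono-≤ ha hb))) κ-big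

    T²≤κ : ∀ a b → a ℕ.≤ T ℕ.+ 8 → b ℕ.≤ T ℕ.+ 8 → a ℕ.* b ℕ.≤ κ
    T²≤κ a b ha hb = ℕₚ.≤-trans (ℕₚ.≤-trans (ℕₚ.m≤n*m (a ℕ.* b) 4) (ℕₚ.m≤m*n (4 ℕ.* (a ℕ.* b)) X ⦃ ℕ.>-nonZero 0<X ⦄)) (T²X≤κ a b ha hb)

    T≤κ : ∀ k → k ℕ.≤ T ℕ.+ 8 → k ℕ.≤ κ
    T≤κ k h = subst (ℕ._≤ κ) (ℕₚ.*-identityʳ k) (T²≤κ k 1 h (ℕₚ.≤-trans (s≤s z≤n) (ℕₚ.m≤n+m 8 T)))

    0<κ : 0 ℕ.< κ
    0<κ = T≤κ 1 (ℕₚ.≤-trans (s≤s z≤n) (ℕₚ.m≤n+m 8 T))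

    0<u : 0ℤ < u
    0<u = subst (_< u) (*-zeroʳ (+ κ)) (*-monoˡ-<-pos (+ κ) ⦃ positive (+<+ 0<κ) ⦄ 0<Y)

    0≤u : 0ℤ ≤ u
    0≤u = <⇒≤ 0<u

    2^k≤X : ∀ {k} → k ℕ.≤ T → 2 ^ k ℕ.≤ X
    2^k≤X h = subst (_ ℕ.≤_) (sym X≡2^T) (2^-mono h)

    -- Splitting off a prime factor loses at most 1 through rounding, and n has at most `L n` prime
    -- factors. The upper bound holds because the rounded logarithm is superadditive.
    ℓ-bounds : ∀ n → 0 ℕ.< n → n ℕ.< X → + lg κ n - + L n ≤ ℓ n × ℓ n ≤ + lg κ n
    ℓ-bounds = <-rec _ go
      where
      Goal : ℕ → Set
      Goal n = 0 ℕ.< n → n ℕ.< X → + lg κ n - + L n ≤ ℓ n × ℓ n ≤ + lg κ n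
      go : ∀ n → (∀ {m} → m ℕ.< n → Goal m) → Goal n
      go (suc zero) _ _ _ = subst (λ z → + lg κ 1 - + 0 ≤ z × z ≤ + lg κ 1) (sym ℓ-1) (subst (λ z → + z - + 0 ≤ 0ℤ × 0ℤ ≤ + z) (sym (lg-1 κ)) (≤-refl , ≤-refl))
      go n@(suc (suc _)) rec 0<n n<X with prime-divisor {n} (s≤s (s≤s z≤n))
      ... | q , pq , divides k n≡kq = subst (λ z → + lg κ n - + L n ≤ z × z ≤ + lg κ n) (sym ℓ≡)
          (lower (+ lg κ n) (+ L n) (lam q) (+ lg κ k) (+ L k) (ℓ k) (proj₁ ih) (+≤+ lgn≤) (+≤+ Lk<) , ≤-trans (+-monoʳ-≤ (lam q) (proj₂ ih)) (+≤+ lgn≥))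
        where
        n≡ : n ≡ q ℕ.* k
        n≡ = trans n≡kq (ℕₚ.*-comm k q)
        0<k : 0 ℕ.< k
        0<k = ℕₚ.n≢0⇒n>0 λ { refl → contradiction n≡kq λ () }
        k<n : k ℕ.< n
        k<n = subst (k ℕ.<_) (sym n≡kq) (ℕₚ.m<m*n k q ⦃ ℕ.>-nonZero 0<k ⦄ (1<p pq))
        ih : + lg κ k - + L k ≤ ℓ k × ℓ k ≤ + lg κ k
        ih = rec k<n 0<k (ℕₚ.<-trans k<n n<X)
        ℓ≡ : ℓ n ≡ lam q + ℓ k
        ℓ≡ = trans (cong ℓ n≡) (ℓ-prime* pq 0<k (subst (ℕ._< X) n≡ n<X))
        lgn≤ : lg κ n ℕ.≤ suc (lg κ q ℕ.+ lg κ k)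
        lgn≤ = subst (λ z → lg κ z ℕ.≤ suc (lg κ q ℕ.+ lg κ k)) (sym n≡) (lg-*-≤ κ (0<p pq) 0<k)
        lgn≥ : lg κ q ℕ.+ lg κ k ℕ.≤ lg κ n
        lgn≥ = subst (λ z → lg κ q ℕ.+ lg κ k ℕ.≤ lg κ z) (sym n≡) (lg-*-≥ κ (0<p pq) 0<k)
        Lk< : suc (L k) ℕ.≤ L n
        Lk< = ℕₚ.≤-trans (ℕₚ.+-monoˡ-≤ (L k) (L-≥ {1} (1<p pq))) (subst (λ z → L q ℕ.+ L k ℕ.≤ L z) (sym n≡) (L-*-≥ (0<p pq) 0<k))
        lower-≡ : ∀ n Ln q k Lk ℓk → q + ℓk - (n - Ln) ≡
          (ℓk - (k - Lk)) + (1ℤ + (q + k) - n) + (Ln - (1ℤ + Lk))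
        lower-≡ = solve-∀
        lower : ∀ n Ln q k Lk ℓk → k - Lk ≤ ℓk → n ≤ 1ℤ + (q + k) → 1ℤ + Lk ≤ Ln → n - Ln ≤ q + ℓk
        lower n Ln q k Lk ℓk a b c = by≤ (gap a ⊹ gap b ⊹ gap c) (lower-≡ n Ln q k Lk ℓk)

    ℓ≥0 : ∀ n → 0ℤ ≤ ℓ n
    ℓ≥0 n = Λ-≥0 lam≥0 λ m _ → χ≥0 (m ∣? n)

    module _ (k : ℕ) (k≤T : k ℕ.≤ T) where

      private
        x : ℕ
        x = 2 ^ k

        0<x : 0 ℕ.< x
        0<x = 0<2^ k

        x≤X : x ℕ.≤ X
        x≤X = 2^k≤X k≤T

      N : ℕ → ℤ
      N m = ∑ X λ j → ρ x (m ℕ.* j)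

      Aₖ : ℤ
      Aₖ = ∑ X λ n → ρ x n * ℓ n

      -- Legendre's formula for the logarithm of (x - 1)!.
      Λ-N : Λ N ≡ Aₖ
      Λ-N = Λ-multiples {ρ x} (ρ-0 0<x , λ n X≤n → ρ-out 0<x (ℕₚ.≤-trans x≤X X≤n))

      N-div : ∀ {m} → 0 ℕ.< m → Σ ℕ λ q → N m ≡ + q × m ℕ.* q ℕ.< x × x ℕ.≤ m ℕ.* suc q
      N-div {m} 0<m = q , N≡q , mq<x , x≤m*sq
        where
        instance
          m≢0 : NonZero m
          m≢0 = ℕ.>-nonZero 0<m
        q : ℕ
        q = (x ℕ.∸ 1) / m
        x≡ : x ≡ suc (x ℕ.∸ 1)
        x≡ = sym (ℕₚ.m+[n∸m]≡n 0<x)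
        mq<x : m ℕ.* q ℕ.< x
        mq<x = ℕₚ.≤-trans (s≤s (ℕₚ.≤-trans (ℕₚ.≤-reflexive (ℕₚ.*-comm m q)) (m/n*n≤m (x ℕ.∸ 1) m))) (ℕₚ.≤-reflexive (sym x≡))
        x≤m*sq : x ℕ.≤ m ℕ.* suc q
        x≤m*sq = ℕₚ.≤-trans (ℕₚ.≤-reflexive x≡) (ℕₚ.≤-trans (ℕₚ.≤-trans (ℕₚ.≤-reflexive (cong suc (m≡m%n+[m/n]*n (x ℕ.∸ 1) m))) (ℕₚ.+-monoˡ-≤ (q ℕ.* m) (m%n<n (x ℕ.∸ 1) m)))
          (ℕₚ.≤-reflexive (ℕₚ.*-comm (suc q) m)))
        sq≤X : suc q ℕ.≤ X
        sq≤X = ℕₚ.≤-trans (ℕₚ.≤-<-trans (ℕₚ.m≤n*m q m) mq<x) x≤X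
        N≡q : N m ≡ + q
        N≡q = trans (∑-- X (λ j → χ (m ℕ.* j ℕ.<? x)) λ j → χ (m ℕ.* j ℕ.≟ 0))
          (trans (cong₂ _-_ (trans (∑-cong X λ j → χ-⇔ (m ℕ.* j ℕ.<? x) (j ℕ.<? suc q)
              (λ lt → ℕₚ.*-cancelˡ-< m j (suc q) (ℕₚ.<-≤-trans lt x≤m*sq)) (λ lt → ℕₚ.≤-<-trans (ℕₚ.*-monoʳ-≤ m (ℕₚ.≤-pred lt)) mq<x))
              (∑-χ< (suc q) X sq≤X))
            (trans (∑-cong X λ j → trans (χ-⇔ (m ℕ.* j ℕ.≟ 0) (j ℕ.≟ 0) (λ eq → ℕₚ.m*n≡0⇒m≡0 j m (trans (ℕₚ.*-comm j m) eq)) (λ { refl → ℕₚ.*-zeroʳ m })) (sym (*-identityʳ (χ (j ℕ.≟ 0)))))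
              (∑-≟ (λ _ → 1ℤ) 0<X)))
          (lem (+ q)))
          where
          lem : ∀ q → (1ℤ + q) - 1ℤ ≡ q
          lem = solve-∀

      S : ℤ
      S = Λ λ m → χ (m ℕ.<? x) * w m

      Ψ : ℤ
      Ψ = Λ λ m → χ (m ℕ.<? x)

      private
        NY≤ : ∀ m → 0 ℕ.< m → Y * N m ≤ + x * (χ (m ℕ.<? x) * w m)
        NY≤ m 0<m with N-div 0<m | m ℕ.<? x
        ... | q , eq , mq<x , _ | yes m<x = ≤-trans (≤-reflexive (trans (cong₂ _*_ (sym (w-spec m 0<m (ℕₚ.<-≤-trans m<x x≤X))) eq) (trans (lem (+ m) (w m) (+ q)) (cong (λ z → z * w m) (sym (pos-* m q))))))
            (≤-trans (*-monoʳ (w≥0 m) (+≤+ (ℕₚ.<⇒≤ mq<x))) (≤-reflexive (cong (λ z → + x * z) (sym (*-identityˡ (w m))))))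
          where
          lem : ∀ m w q → m * w * q ≡ m * q * w
          lem = solve-∀
        ... | zero , eq , _ , _ | no _ = ≤-trans (≤-reflexive (trans (cong (λ z → Y * z) eq) (*-zeroʳ Y))) (0≤+ x ⊛ ≤-reflexive (sym (*-zeroˡ (w m))))
        ... | suc q , eq , mq<x , _ | no m≮x = contradiction (ℕₚ.≤-<-trans (ℕₚ.m≤m*n m (suc q)) mq<x) m≮x

        ≤NY : ∀ m → 0 ℕ.< m → + x * (χ (m ℕ.<? x) * w m) ≤ Y * (N m + χ (m ℕ.<? x))
        ≤NY m 0<m with N-div 0<m | m ℕ.<? x
        ... | q , eq , _ , x≤msq | yes m<x = ≤-trans (≤-reflexive (cong (λ z → + x * z) (*-identityˡ (w m)))) (≤-trans (*-monoʳ (w≥0 m) (+≤+ x≤msq))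
            (≤-reflexive (trans (cong (λ z → z * w m) (pos-* m (suc q))) (trans (lem (+ m) (+ q) (w m)) (cong₂ (λ y n → y * (n + 1ℤ)) (w-spec m 0<m (ℕₚ.<-≤-trans m<x x≤X)) (sym eq))))))
          where
          lem : ∀ m q w → m * (1ℤ + q) * w ≡ m * w * (q + 1ℤ)
          lem = solve-∀
        ... | q , eq , _ , _ | no _ = ≤-trans (≤-reflexive (trans (cong (λ z → + x * z) (*-zeroˡ (w m))) (*-zeroʳ (+ x)))) (0≤Y ⊛ (subst (0ℤ ≤_) (sym eq) (0≤+ q) ⊹ ≤-refl))

      YA≤xS : Y * Aₖ ≤ + x * S
      YA≤xS = ≤-trans (≤-reflexive (trans (cong (λ z → Y * z) (sym Λ-N)) (sym (Λ-*ˡ Y N)))) (≤-trans (Λ-mono lam≥0 λ m pm → NY≤ m (0<pp pm)) (≤-reflexive (Λ-*ˡ (+ x) λ m → χ (m ℕ.<? x) * w m)))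

      -- Replacing x / m by the number of positive multiples of m below x loses at most 1 for each m
      -- < x, in total at most Chebyshev's function `Ψ`.
      xS≤YA : + x * S ≤ Y * (Aₖ + Ψ)
      xS≤YA = ≤-trans (≤-reflexive (sym (Λ-*ˡ (+ x) λ m → χ (m ℕ.<? x) * w m))) (≤-trans (Λ-mono lam≥0 λ m pm → ≤NY m (0<pp pm))
        (≤-reflexive (trans (Λ-*ˡ Y λ m → N m + χ (m ℕ.<? x)) (cong (λ z → Y * z) (trans (Λ-+ N λ m → χ (m ℕ.<? x)) (cong (λ z → z + Ψ) Λ-N))))))

      A-upper : Aₖ ≤ + κ * + k * + x
      A-upper = ≤-trans (∑-mono< X term) (≤-reflexive (trans (∑-*ʳ X (+ κ * + k) λ n → χ (n ℕ.<? x)) (trans (cong (λ z → z * (+ κ * + k)) (∑-χ< x X x≤X)) (*-comm (+ x) (+ κ * + k)))))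
        where
        term : ∀ n → n ℕ.< X → ρ x n * ℓ n ≤ χ (n ℕ.<? x) * (+ κ * + k)
        term zero _ = ≤-trans (≤-reflexive (trans (cong (λ z → z * ℓ 0) (ρ-0 0<x)) (*-zeroˡ (ℓ 0)))) (χ≥0 (0 ℕ.<? x) ⊛ (0≤+ κ ⊛ 0≤+ k))
        term n@(suc _) n<X = ≤-trans (≤-reflexive (cong (λ z → z * ℓ n) (ρ-pos x (s≤s z≤n)))) (χ-*-mono (n ℕ.<? x) λ n<x →
          ≤-trans (proj₂ (ℓ-bounds n (s≤s z≤n) n<X)) (≤-trans (+≤+ (lg-≤ κ (s≤s z≤n) (ℕₚ.<⇒≤ n<x))) (≤-reflexive (pos-* κ k))))

      A-lower : + κ * (+ k - + 3) * + x ≤ Aₖ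
      A-lower = ≤-trans (final (+ κ) (+ k) (+ x) (∑ x λ n → + L n) (0≤+ x) (0≤+ κ) (+≤+ (T≤κ k (ℕₚ.≤-trans k≤T (ℕₚ.m≤m+n T 8)))) (∑-L k))
        (≤-trans (≤-reflexive (sym (trans (∑-- x (λ n → + κ * + L n) λ _ → + k) (cong₂ _-_ (∑-*ˡ x (+ κ) λ n → + L n) (∑-const x (+ k))))))
        (≤-trans (∑-mono< x term) (≤-reflexive (sym (∑-extend {x} {X} (λ n → ρ x n * ℓ n) x≤X λ n x≤n → trans (cong (λ z → z * ℓ n) (ρ-out 0<x x≤n)) (*-zeroˡ (ℓ n)))))))
        where
        final : ∀ κ k x s → 0ℤ ≤ x → 0ℤ ≤ κ → k ≤ κ → (k - + 2) * x ≤ s → κ * (k - + 3) * x ≤ κ * s - x * k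
        final κ k x s 0≤x 0≤κ k≤κ h = by≤ (0≤κ ⊛ gap h ⊹ 0≤x ⊛ gap k≤κ) (solve (κ ∷ k ∷ x ∷ s ∷ []))
        lem : ∀ κ → κ * 0ℤ - 0ℤ ≡ 0ℤ
        lem = solve-∀
        bound-≡ : ∀ a l lg ℓ k → 1ℤ * ℓ - (a * l - k) ≡
          (lg - (a * l)) + (k - l) + (ℓ - (lg - l))
        bound-≡ = solve-∀
        bound : ∀ a l lg ℓ k → a * l ≤ lg → l ≤ k → lg - l ≤ ℓ → a * l - k ≤ 1ℤ * ℓ
        bound a l lg ℓ k p q r = by≤ (gap p ⊹ gap q ⊹ gap r) (bound-≡ a l lg ℓ k)
        term : ∀ n → n ℕ.< x → + κ * + L n - + k ≤ ρ x n * ℓ n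
        term zero _ = ≤-trans (≤-trans (+-monoʳ-≤ (+ κ * + 0) (neg-mono-≤ (0≤+ k))) (≤-reflexive (lem (+ κ)))) (≤-reflexive (sym (trans (cong (λ z → z * ℓ 0) (ρ-0 0<x)) (*-zeroˡ (ℓ 0)))))
        term n@(suc _) n<x = ≤-trans (bound (+ κ) (+ L n) (+ lg κ n) (ℓ n) (+ k) (subst (_≤ + lg κ n) (pos-* κ (L n)) (+≤+ (lg-≥ κ (s≤s z≤n)))) (+≤+ (ℕₚ.<⇒≤ (L-< (s≤s z≤n) n<x)))
            (proj₁ (ℓ-bounds n (s≤s z≤n) (ℕₚ.<-≤-trans n<x x≤X))))
          (≤-reflexive (cong (λ z → z * ℓ n) (sym (trans (ρ-pos x (s≤s z≤n)) (χ-yes (n ℕ.<? x) n<x)))))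

    -- Chebyshev's argument: with N counting multiples below 2 x and below x respectively, N(2x) - 2
    -- N(x) is nonnegative for every m and at least 1 for x ≤ m < 2 x. In the bounds for `Aₖ` the
    -- terms in k cancel, and each doubling costs 8 κ x.
    Ψ-upper : ∀ k (k≤T : k ℕ.≤ T) → Ψ k k≤T ≤ + 8 * + κ * + (2 ^ k)
    Ψ-upper zero k≤T = ≤-trans (≤-reflexive (trans (Λ-cong {λ m → χ (m ℕ.<? 1)} {λ m → 0ℤ * 0ℤ} λ m pm → χ-no (m ℕ.<? 1) (ℕₚ.≤⇒≯ (0<pp pm))) (Λ-*ˡ 0ℤ λ _ → 0ℤ)))
      ((0≤+ 8 ⊛ 0≤+ κ) ⊛ 0≤+ 1)
    Ψ-upper (suc k) 1+k≤T = ≤-trans (Λ-mono lam≥0 λ m pm → pointwise m (0<pp pm))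
      (≤-trans (≤-reflexive (trans (Λ-+ (λ m → χ (m ℕ.<? 2 ^ k)) λ m → N (suc k) 1+k≤T m - + 2 * N k k≤T m)
         (+-congʳ (Ψ k k≤T) (trans (Λ-- (N (suc k) 1+k≤T) λ m → + 2 * N k k≤T m) (cong₂ _-_ (Λ-N (suc k) 1+k≤T) (trans (Λ-*ˡ (+ 2) (N k k≤T)) (cong (λ z → + 2 * z) (Λ-N k k≤T))))))))
      (final (+ κ) (+ k) (+ (2 ^ k)) (+ (2 ^ suc k)) (Ψ k k≤T) (Aₖ (suc k) 1+k≤T) (Aₖ k k≤T) (pos-2^suc k) (Ψ-upper k k≤T) (A-upper (suc k) 1+k≤T) (A-lower k k≤T)))
      where
      k≤T : k ℕ.≤ T
      k≤T = ℕₚ.<⇒≤ 1+k≤T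
      final-≡ : ∀ κ k x p a b → + 8 * κ * (+ 2 * x) - (p + (a - + 2 * b)) ≡
        (+ 8 * κ * x - p) + (κ * (1ℤ + k) * (+ 2 * x) - a) + + 2 * (b - (κ * (k - + 3) * x))
      final-≡ = solve-∀
      final : ∀ κ k x x′ p a b → x′ ≡ + 2 * x → p ≤ + 8 * κ * x → a ≤ κ * (1ℤ + k) * x′ → κ * (k - + 3) * x ≤ b → p + (a - + 2 * b) ≤ + 8 * κ * x′
      final κ k x x′ p a b refl h₁ h₂ h₃ = by≤ (gap h₁ ⊹ gap h₂ ⊹ 0≤+ 2 ⊛ gap h₃) (final-≡ κ k x p a b)
      double : ∀ {m q q′} → 0 ℕ.< m → m ℕ.* q ℕ.< 2 ^ k → 2 ^ suc k ℕ.≤ m ℕ.* suc q′ → 2 ℕ.* q ℕ.≤ q′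
      double {m} {q} {q′} 0<m h h′ = ℕₚ.≤-pred (ℕₚ.*-cancelˡ-< m (2 ℕ.* q) (suc q′) (ℕₚ.<-≤-trans (ℕₚ.≤-trans (ℕₚ.≤-trans (s≤s (ℕₚ.≤-reflexive (trans (sym (ℕₚ.*-assoc m 2 q)) (trans (cong (ℕ._* q) (ℕₚ.*-comm m 2)) (ℕₚ.*-assoc 2 m q)))))
        (ℕₚ.*-monoʳ-< 2 h)) ℕₚ.≤-refl) h′))
      nonneg : ∀ {q q′} → 2 ℕ.* q ℕ.≤ q′ → 0ℤ ≤ + q′ - + 2 * + q
      nonneg {q} {q′} h = gap (subst (_≤ + q′) (pos-* 2 q) (+≤+ h))
      pointwise : ∀ m → 0 ℕ.< m → χ (m ℕ.<? 2 ^ suc k) ≤ χ (m ℕ.<? 2 ^ k) + (N (suc k) 1+k≤T m - + 2 * N k k≤T m)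
      pointwise m 0<m with N-div k k≤T 0<m | N-div (suc k) 1+k≤T 0<m
      ... | q , eq , mq<x , _ | q′ , eq′ , _ , h′ = subst (χ (m ℕ.<? 2 ^ suc k) ≤_) (cong₂ (λ a b → χ (m ℕ.<? 2 ^ k) + (a - + 2 * b)) (sym eq′) (sym eq)) (cases q q′ mq<x h′)
        where
        lem : ∀ a → a ≡ 0ℤ + (a - + 2 * 0ℤ)
        lem = solve-∀
        cases : ∀ q q′ → m ℕ.* q ℕ.< 2 ^ k → 2 ^ suc k ℕ.≤ m ℕ.* suc q′ → χ (m ℕ.<? 2 ^ suc k) ≤ χ (m ℕ.<? 2 ^ k) + (+ q′ - + 2 * + q)
        cases q q′ mq<x h′ with m ℕ.<? 2 ^ k | m ℕ.<? 2 ^ suc k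
        cases q q′ mq<x h′ | yes _ | d = ≤-trans (χ≤1 d) (+-monoʳ-≤ 1ℤ (nonneg {q} {q′} (double {m} {q} {q′} 0<m mq<x h′)))
        cases q q′ mq<x h′ | no _ | no _ = ≤-trans (nonneg {q} {q′} (double {m} {q} {q′} 0<m mq<x h′)) (≤-reflexive (sym (+-identityˡ (+ q′ - + 2 * + q))))
        cases (suc q₁) q′ mq<x h′ | no m≮x | yes m<x′ = contradiction (ℕₚ.≤-<-trans (ℕₚ.m≤m*n m (suc q₁)) mq<x) m≮x
        cases zero (suc q₁) mq<x h′ | no m≮x | yes m<x′ = subst (1ℤ ≤_) (lem (+ suc q₁)) (+≤+ (s≤s z≤n))
        cases zero zero mq<x h′ | no m≮x | yes m<x′ = contradiction (subst (2 ^ suc k ℕ.≤_) (ℕₚ.*-identityʳ m) h′) (ℕₚ.<⇒≱ m<x′)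

    module _ (k : ℕ) (k≤T : k ℕ.≤ T) where

      private
        pos-x : Positive (+ (2 ^ k))
        pos-x = positive (+<+ (0<2^ k))

      S-lower : (+ k - + 3) * u ≤ S k k≤T
      S-lower = *-cancelˡ-≤-pos _ _ (+ (2 ^ k)) ⦃ pos-x ⦄ (≤-trans (≤-trans (≤-reflexive (lem (+ (2 ^ k)) (+ k) (+ κ) Y)) (*-monoˡ 0≤Y (A-lower k k≤T))) (YA≤xS k k≤T))
        where
        lem : ∀ x k κ Y → x * ((k - + 3) * (κ * Y)) ≡ Y * (κ * (k - + 3) * x)
        lem = solve-∀

      S-upper : S k k≤T ≤ (+ k + + 8) * u
      S-upper = *-cancelˡ-≤-pos _ _ (+ (2 ^ k)) ⦃ pos-x ⦄ (≤-trans (xS≤YA k k≤T) (≤-trans (*-monoˡ 0≤Y (+-mono-≤ (A-upper k k≤T) (Ψ-upper k k≤T))) (≤-reflexive (lem (+ (2 ^ k)) (+ k) (+ κ) Y))))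
        where
        lem : ∀ x k κ Y → Y * (κ * k * x + + 8 * κ * x) ≡ x * ((k + + 8) * (κ * Y))
        lem = solve-∀

-- Residue classes, inverses, lifting of units

module Modular where

  open import Data.Nat
  open import Data.Nat.Coprimality using (Coprime; coprime-Bézout) renaming (sym to coprime-sym)
  open import Data.Nat.Divisibility
  open import Data.Nat.DivMod
  open import Data.Nat.GCD using (module Bézout)
  open import Data.Nat.Primality
  open import Data.Nat.Properties
  open import Data.Nat.Tactic.RingSolver using (solve-∀)
  open import Data.Product using (Σ; _×_; _,_)
  open import Data.Sum using (inj₁; inj₂)
  open import Relation.Binary.PropositionalEquality
  open import Relation.Nullary using (Dec; yes; no; ¬_; contradiction)
  open import Relation.Nullary.Decidable using (_×-dec_; ¬?)
  open Arith using (prime∣prime; no-common-prime⇒coprime)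

  coprime-∣ʳ : ∀ {a m n} → m ∣ n → Coprime a n → Coprime a m
  coprime-∣ʳ m∣n c (d∣a , d∣m) = c (d∣a , ∣-trans d∣m m∣n)

  coprime-* : ∀ {a b n} → Coprime a n → Coprime b n → 0 < n → Coprime (a * b) n
  coprime-* {a} {b} ca cb 0<n = no-common-prime⇒coprime 0<n λ pp p∣ab p∣n → case pp p∣ab p∣n
    where
    case : ∀ {p} → Prime p → p ∣ a * b → ¬ p ∣ _
    case pp p∣ab p∣n with euclidsLemma a b pp p∣ab
    ... | inj₁ p∣a = ¬prime[1] (subst Prime (ca (p∣a , p∣n)) pp)
    ... | inj₂ p∣b = ¬prime[1] (subst Prime (cb (p∣b , p∣n)) pp)

  coprime-*ˡ : ∀ {a b n} → Coprime (a * b) n → Coprime a n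
  coprime-*ˡ {a} {b} c (d∣a , d∣n) = c (∣m⇒∣m*n b d∣a , d∣n)

  module _ (M : ℕ) .⦃ _ : NonZero M ⦄ where

    infix 4 _≈_
    _≈_ : ℕ → ℕ → Set
    a ≈ b = a % M ≡ b % M

    ≈-* : ∀ {a a′ b b′} → a ≈ a′ → b ≈ b′ → a * b ≈ a′ * b′
    ≈-* {a} {a′} {b} {b′} p q = trans (%-distribˡ-* a b M) (trans (cong₂ (λ x y → (x * y) % M) p q) (sym (%-distribˡ-* a′ b′ M)))

    ≈-+ : ∀ {a a′ b b′} → a ≈ a′ → b ≈ b′ → a + b ≈ a′ + b′
    ≈-+ {a} {a′} {b} {b′} p q = trans (%-distribˡ-+ a b M) (trans (cong₂ (λ x y → (x + y) % M) p q) (sym (%-distribˡ-+ a′ b′ M)))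

    ≈-∣ : ∀ {d a b} → d ∣ M → a ≈ b → d ∣ a → d ∣ b
    ≈-∣ {d} {a} {b} d∣M p d∣a = subst (d ∣_) (sym (m≡m%n+[m/n]*n b M))
      (∣m∣n⇒∣m+n (subst (d ∣_) p (%-presˡ-∣ d∣a d∣M)) (∣n⇒∣m*n (b / M) d∣M))

    ≈-coprime : ∀ {a b} → a ≈ b → Coprime a M → Coprime b M
    ≈-coprime p c (d∣b , d∣M) = c (≈-∣ d∣M (sym p) d∣b , d∣M)

    ≈-reduce : ∀ {m a b} .⦃ _ : NonZero m ⦄ → m ∣ M → a ≈ b → a % m ≡ b % m
    ≈-reduce {m} {a} {b} m∣M p = trans (sym (m∣n⇒o%n%m≡o%m m M a m∣M)) (trans (cong (_% m) p) (m∣n⇒o%n%m≡o%m m M b m∣M))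

    inverse : ∀ {a} → Coprime a M → Σ ℕ λ b → a * b ≈ 1
    inverse {a} c with coprime-Bézout c
    ... | Bézout.+- x y eq = x , trans (cong (_% M) (trans (*-comm a x) (sym eq))) ([m+kn]%n≡m%n 1 y M)
    -- Here a x ≡ -1, and M - 1 supplies the missing sign.
    ... | Bézout.-+ x y eq = x * (M ∸ 1) , trans (sym ([m+kn]%n≡m%n (a * (x * (M ∸ 1))) y M))
        (trans (cong (_% M) (trans (cong (a * (x * (M ∸ 1)) +_) (sym eq)) (trans (lem a x (M ∸ 1)) (cong (λ z → 1 + a * x * z) (m+[n∸m]≡n {1} (>-nonZero⁻¹ M))))))
        ([m+kn]%n≡m%n 1 (a * x) M))
      where
      lem : ∀ a x m → a * (x * m) + (1 + x * a) ≡ 1 + a * x * (1 + m)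
      lem = solve-∀

    ≈-cancel : ∀ {d x y} → Coprime d M → d * x ≈ d * y → x ≈ y
    ≈-cancel {d} {x} {y} c p with inverse c
    ... | b , db≈1 = trans (back x) (trans (≈-* {b} {b} refl p) (sym (back y)))
      where
      back : ∀ x → x ≈ b * (d * x)
      back x = trans (cong (_% M) (sym (*-identityˡ x))) (trans (≈-* {1} {d * b} {x} {x} (sym db≈1) refl) (cong (_% M) (lem d b x)))
        where
        lem : ∀ d b x → d * b * x ≡ b * (d * x)
        lem = solve-∀

    quotient-class : ∀ {d} c → Coprime d M → Σ ℕ λ a → d * a ≈ c
    quotient-class {d} c cop with inverse cop
    ... | b , db≈1 = b * c , trans (cong (_% M) (sym (*-assoc d b c))) (trans (≈-* {d * b} {1} {c} {c} db≈1 refl) (cong (_% M) (*-identityˡ c)))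

  crt : ∀ {m n} .⦃ _ : NonZero m ⦄ .⦃ _ : NonZero n ⦄ → Coprime m n → ∀ a b → Σ ℕ λ x → x % m ≡ a % m × x % n ≡ b % n
  crt {m} {n} c a b with inverse n {m} c | inverse m {n} (coprime-sym c)
  ... | m′ , mm′ | n′ , nn′ = n * n′ * a + m * m′ * b ,
      trans (≈-+ m {n * n′ * a} {a} {m * m′ * b} {0} (one m (n * n′) a nn′) (zero′ m m′ b)) (cong (_% m) (+-identityʳ a)) ,
      ≈-+ n {n * n′ * a} {0} {m * m′ * b} {b} (zero′ n n′ a) (one n (m * m′) b mm′)
    where
    one : ∀ m .⦃ _ : NonZero m ⦄ e a → e % m ≡ 1 % m → (e * a) % m ≡ a % m
    one m e a h = trans (≈-* m {e} {1} {a} {a} h refl) (cong (_% m) (*-identityˡ a))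
    zero′ : ∀ m .⦃ _ : NonZero m ⦄ e a → (m * e * a) % m ≡ 0 % m
    zero′ m e a = trans (cong (_% m) (trans (*-assoc m e a) (*-comm m (e * a)))) ([m+kn]%n≡m%n 0 (e * a) m)

  -- r + n k is coprime to W as soon as k is the product of the primes that divide W but not r.
  coprime-lift : ∀ {r} n .⦃ _ : NonZero n ⦄ W → 0 < W → Coprime r n → Σ ℕ λ c → c % n ≡ r % n × Coprime c W
  coprime-lift {r} n W 0<W c = r + K (suc W) * n , [m+kn]%n≡m%n r (K (suc W)) n ,
      no-common-prime⇒coprime 0<W λ {p} pp p∣c p∣W → check pp p∣W p∣c (p ∣? r)
    where
    good? : ∀ p → Dec (Prime p × (p ∣ W × ¬ p ∣ r))
    good? p = prime? p ×-dec (p ∣? W ×-dec ¬? (p ∣? r))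
    pick : ∀ {p} → Dec (Prime p × (p ∣ W × ¬ p ∣ r)) → ℕ
    pick {p} (yes _) = p
    pick (no _) = 1
    K : ℕ → ℕ
    K zero = 1
    K (suc N) = K N * pick (good? N)
    ∣K : ∀ {p} N → p < N → Prime p → p ∣ W → ¬ p ∣ r → p ∣ K N
    ∣K {p} (suc N) (s≤s p≤N) pp p∣W p∤r with m≤n⇒m<n∨m≡n p≤N
    ... | inj₁ p<N = ∣m⇒∣m*n (pick (good? N)) (∣K N p<N pp p∣W p∤r)
    ... | inj₂ refl with good? p
    ...   | yes _ = ∣n⇒∣m*n (K p) ∣-refl
    ...   | no ¬g = contradiction (pp , p∣W , p∤r) ¬g
    K∣ : ∀ {p} N → Prime p → p ∣ K N → ¬ p ∣ r
    K∣ zero pp p∣1 = contradiction (subst Prime (∣1⇒≡1 p∣1) pp) ¬prime[1]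
    K∣ {p} (suc N) pp p∣ with euclidsLemma (K N) (pick (good? N)) pp p∣
    ... | inj₁ d = K∣ N pp d
    ... | inj₂ d with good? N
    ...   | yes (pN , _ , N∤r) = subst (λ z → ¬ z ∣ r) (sym (prime∣prime pp pN d)) N∤r
    ...   | no _ = contradiction (subst Prime (∣1⇒≡1 d) pp) ¬prime[1]
    check : ∀ {p} → Prime p → p ∣ W → p ∣ r + K (suc W) * n → Dec (p ∣ r) → _
    check {p} pp p∣W p∣c (no p∤r) = p∤r (∣m+n∣m⇒∣n (subst (p ∣_) (+-comm r (K (suc W) * n)) p∣c)
      (∣m⇒∣m*n n (∣K (suc W) (s≤s (∣⇒≤ ⦃ >-nonZero 0<W ⦄ p∣W)) pp p∣W p∤r)))
    check {p} pp p∣W p∣c (yes p∣r) with euclidsLemma (K (suc W)) n pp (∣m+n∣m⇒∣n p∣c p∣r)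
    ... | inj₁ p∣K = K∣ (suc W) pp p∣K p∣r
    ... | inj₂ p∣n = ¬prime[1] (subst Prime (c (p∣r , p∣n)) pp)

-- Discrepancy between residue classes

module Equi where

  open import Data.Integer hiding (suc; _^_; _/_; _%_; NonZero)
  open import Data.Integer.Properties
  open import Data.Integer.Tactic.RingSolver using (solve-∀; solve)
  open import Data.List using ([]; _∷_)
  open import Data.Nat as ℕ using (ℕ; zero; suc; z≤n; _^_; NonZero)
  import Data.Nat.Properties as ℕₚ
  open import Data.Nat.DivMod using (_%_; _/_; m<n⇒m%n≡m; m%n<n; [m+kn]%n≡m%n; m≡m%n+[m/n]*n)
  open import Data.Product using (_×_; _,_)
  open import Relation.Binary.PropositionalEquality
  open import Relation.Nullary using (yes; no)
  open Sums
  open Arith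
  open Logs
  open Mertens
  open Modular

  ≤∣-0 : ∀ {b} → 0ℤ ≤ b → 0ℤ ≤∣ b
  ≤∣-0 h = neg-mono-≤ h , h

  ≤∣-abs : ∀ {x a b} → 0ℤ ≤ a → a ≤ b → x ≡ a → x ≤∣ b
  ≤∣-abs {a = a} {b} 0≤a a≤b refl = ≤-trans (neg-mono-≤ (≤-trans 0≤a a≤b)) 0≤a , a≤b

  -- The discrete form of Σ log²(x/d) = O(x), with its linear companion: on the upper half of the
  -- range k - `L d` is 1, on the next quarter 2, and so on.
  ∑-k-L : ∀ k → ∑ (2 ^ k) (λ d → + k - + L d) ≤ + 2 * + (2 ^ k) × ∑ (2 ^ k) (λ d → (+ k - + L d) * (+ k - + L d)) ≤ + 6 * + (2 ^ k)
  ∑-k-L zero = +≤+ z≤n , +≤+ z≤n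
  ∑-k-L (suc k) with ∑-k-L k
  ... | m₁ , m₂ = ≤-trans (≤-reflexive split₁) (final₁ (∑ x a) (+ x) (+ (2 ^ suc k)) (pos-2^suc k) m₁) ,
      ≤-trans (≤-reflexive split₂) (final₂ (∑ x a) (∑ x λ d → a d * a d) (+ x) (+ (2 ^ suc k)) (pos-2^suc k) m₁ m₂)
    where
    x : ℕ
    x = 2 ^ k
    a : ℕ → ℤ
    a d = + k - + L d
    final₁ : ∀ s x x′ → x′ ≡ + 2 * x → s ≤ + 2 * x → s + x + x ≤ + 2 * x′
    final₁ s x x′ refl h = by≤ (gap h) (solve (s ∷ x ∷ []))
    final₂ : ∀ s t x x′ → x′ ≡ + 2 * x → s ≤ + 2 * x → t ≤ + 6 * x → t + + 2 * s + x + x ≤ + 6 * x′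
    final₂ s t x x′ refl h h′ = by≤ (gap h ⊹ gap h ⊹ gap h′) (solve (s ∷ t ∷ x ∷ []))
    block : ∀ i → i ℕ.< x → + suc k - + L (x ℕ.+ i) ≡ 1ℤ
    block i i<x = trans (cong (λ z → + suc k - + z) (L-block {k} i<x)) (lem (+ k))
      where
      lem : ∀ k → (1ℤ + k) - k ≡ 1ℤ
      lem = solve-∀
    split₁ : ∑ (2 ^ suc k) (λ d → + suc k - + L d) ≡ ∑ x a + + x + + x
    split₁ = trans (cong (λ z → ∑ z λ d → + suc k - + L d) (2^suc k)) (trans (∑-split x x λ d → + suc k - + L d)
      (cong₂ _+_ (trans (∑-cong x λ d → lem (+ k) (+ L d)) (trans (∑-+ x a λ _ → 1ℤ) (+-congʳ (∑ x a) (one x))))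
        (trans (∑-cong< x block) (one x))))
      where
      one : ∀ x → ∑ x (λ _ → 1ℤ) ≡ + x
      one x = trans (∑-const x 1ℤ) (*-identityʳ (+ x))
      lem : ∀ k l → (1ℤ + k) - l ≡ (k - l) + 1ℤ
      lem = solve-∀
    split₂ : ∑ (2 ^ suc k) (λ d → (+ suc k - + L d) * (+ suc k - + L d)) ≡ ∑ x (λ d → a d * a d) + + 2 * ∑ x a + + x + + x
    split₂ = trans (cong (λ z → ∑ z λ d → (+ suc k - + L d) * (+ suc k - + L d)) (2^suc k)) (trans (∑-split x x λ d → (+ suc k - + L d) * (+ suc k - + L d))
      (cong₂ _+_ (trans (∑-cong x λ d → lem (+ k) (+ L d)) (trans (∑-+ x (λ d → a d * a d + + 2 * a d) λ _ → 1ℤ)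
          (cong₂ _+_ (trans (∑-+ x (λ d → a d * a d) λ d → + 2 * a d) (+-congʳ (∑ x λ d → a d * a d) (∑-*ˡ x (+ 2) a))) (one x))))
        (trans (∑-cong< x λ i i<x → cong (λ z → z * z) (block i i<x)) (one x))))
      where
      one : ∀ x → ∑ x (λ _ → 1ℤ) ≡ + x
      one x = trans (∑-const x 1ℤ) (*-identityʳ (+ x))
      lem : ∀ k l → ((1ℤ + k) - l) * ((1ℤ + k) - l) ≡ (k - l) * (k - l) + + 2 * (k - l) + 1ℤ
      lem = solve-∀

  module Residues (M : ℕ) ⦃ _ : NonZero M ⦄ where

    cl : ℕ → ℕ → ℤ
    cl c n = χ (n % M ℕ.≟ c % M)

    cl-cong : ∀ {c} m n → m % M ≡ n % M → cl c m ≡ cl c n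
    cl-cong {c} m n eq = cong (λ z → χ (z ℕ.≟ c % M)) eq

    D : ℕ → ℕ → ℕ → ℤ
    D a a′ n = ∑ n λ k → cl a k - cl a′ k

    cl-diff : ∀ a a′ k → cl a k - cl a′ k ≤∣ 1ℤ
    cl-diff a a′ k with k % M ℕ.≟ a % M | k % M ℕ.≟ a′ % M
    ... | yes _ | yes _ = -≤+ , 0≤1
    ... | yes _ | no _ = -≤+ , ≤-refl
    ... | no _ | yes _ = ≤-refl , -≤+
    ... | no _ | no _ = -≤+ , 0≤1

    period : ∀ a → ∑ M (cl a) ≡ 1ℤ
    period a = trans (∑-cong< M λ i i<M → trans (cong (λ z → χ (z ℕ.≟ a % M)) (m<n⇒m%n≡m i<M)) (sym (*-identityʳ (χ (i ℕ.≟ a % M)))))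
      (∑-≟ (λ _ → 1ℤ) (m%n<n a M))

    -- A full period meets each class once, so only the last incomplete period counts.
    D-bound : ∀ a a′ n → D a a′ n ≤∣ + M
    D-bound a a′ n = subst (λ z → D a a′ z ≤∣ + M) (sym (trans (m≡m%n+[m/n]*n n M) (ℕₚ.+-comm (n % M) (n / M ℕ.* M))))
      (go (n / M))
      where
      r : ℕ
      r = n % M
      small : D a a′ r ≤∣ + M
      small = ≤∣-mono (≤-trans (≤-reflexive (trans (∑-const r 1ℤ) (*-identityʳ (+ r)))) (+≤+ (ℕₚ.<⇒≤ (m%n<n n M))))
        (∑-≤∣ r λ k _ → cl-diff a a′ k)
      go : ∀ q → D a a′ (q ℕ.* M ℕ.+ r) ≤∣ + M
      go zero = small
      go (suc q) = subst (_≤∣ + M) (sym (trans (cong (D a a′) (ℕₚ.+-assoc M (q ℕ.* M) r))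
        (trans (∑-split M (q ℕ.* M ℕ.+ r) λ k → cl a k - cl a′ k)
        (trans (cong₂ _+_ (trans (∑-- M (cl a) (cl a′)) (cong₂ _-_ (period a) (period a′)))
          (∑-cong (q ℕ.* M ℕ.+ r) λ k → cong₂ _-_ (shift a k) (shift a′ k))) (+-identityˡ _))))) (go q)
        where
        shift : ∀ a k → cl a (M ℕ.+ k) ≡ cl a k
        shift a k = cl-cong {a} (M ℕ.+ k) k (trans (cong (_% M) (trans (ℕₚ.+-comm M k) (cong (k ℕ.+_) (sym (ℕₚ.*-identityˡ M))))) ([m+kn]%n≡m%n k 1 M))

    abel : ∀ a a′ (f : ℕ → ℤ) z → ∑ z (λ n → (cl a n - cl a′ n) * f n) ≡ D a a′ z * f z - ∑ z λ n → D a a′ (suc n) * (f (suc n) - f n)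
    abel a a′ f zero = sym (trans (+-identityʳ (0ℤ * f 0)) (*-zeroˡ (f 0)))
    abel a a′ f (suc z) = trans (cong (λ y → y + (cl a z - cl a′ z) * f z) (abel a a′ f z)) (lem (D a a′ z) (cl a z - cl a′ z) (f z) (f (suc z)) (∑ z λ n → D a a′ (suc n) * (f (suc n) - f n)))
      where
      lem : ∀ d e f f′ s → d * f - s + e * f ≡ (d + e) * f′ - (s + (d + e) * (f′ - f))
      lem = solve-∀

    -- Partial summation: the discrepancy never exceeds M, and the increments of f add up to f z.
    -- The boundary term contributes as much again, whence the 2.
    monotone-diff : ∀ a a′ (f : ℕ → ℤ) z → f 0 ≡ 0ℤ → (∀ n → f n ≤ f (suc n)) → (∀ n → 0ℤ ≤ f n) → ∑ z (λ n → (cl a n - cl a′ n) * f n) ≤∣ + 2 * + M * f z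
    monotone-diff a a′ f z f0 mono f≥0 = subst (_≤∣ + 2 * + M * f z) (sym (abel a a′ f z))
      (subst (D a a′ z * f z - R ≤∣_) (trans (cong (λ y → f z * + M + y) (trans (∑-*ʳ z (+ M) λ n → f (suc n) - f n) (cong (λ y → y * + M) (telescope z)))) (lem (f z) (+ M)))
        (≤∣-+ (subst (_≤∣ f z * + M) (*-comm (f z) (D a a′ z)) (≤∣-* (f≥0 z) (D-bound a a′ z)))
          (≤∣-neg (∑-≤∣ z λ n _ → subst (_≤∣ (f (suc n) - f n) * + M) (*-comm (f (suc n) - f n) (D a a′ (suc n))) (≤∣-* (gap (mono n)) (D-bound a a′ (suc n)))))))
      where
      R : ℤ
      R = ∑ z λ n → D a a′ (suc n) * (f (suc n) - f n)
      lem : ∀ f m → f * m + f * m ≡ + 2 * m * f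
      lem = solve-∀
      telescope : ∀ z → ∑ z (λ n → f (suc n) - f n) ≡ f z
      telescope zero = sym f0
      telescope (suc z) = trans (cong (λ y → y + (f (suc z) - f z)) (telescope z)) (lem′ (f z) (f (suc z)))
        where
        lem′ : ∀ a b → a + (b - a) ≡ b
        lem′ = solve-∀

-- Geometric decay and Abel summation of block masses

module Density where

  open import Data.Integer hiding (suc; _^_; _/_; _%_; NonZero)
  open import Data.Integer.Properties
  open import Data.Integer.Tactic.RingSolver using (solve-∀; solve)
  open import Data.List using ([]; _∷_)
  open import Data.Nat as ℕ using (ℕ; zero; suc; _^_)
  import Data.Nat.Properties as ℕₚ
  open import Data.Product using (_,_; proj₁; proj₂)
  open import Relation.Binary.PropositionalEquality hiding (J)
  open import Relation.Nullary using (yes; no)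
  open Sums
  open Arith
  open Closure
  open Logs
  open Mertens

  ∑-χ<-≤ : ∀ z n → ∑ n (λ i → χ (i ℕ.<? z)) ≤ + z
  ∑-χ<-≤ z n with z ℕ.≤? n
  ... | yes z≤n′ = ≤-reflexive (∑-χ< z n z≤n′)
  ... | no z≰n = ≤-trans (∑-mono n λ i → χ≤1 (i ℕ.<? z)) (≤-trans (≤-reflexive (trans (∑-const n 1ℤ) (*-identityʳ (+ n)))) (+≤+ (ℕₚ.<⇒≤ (ℕₚ.≰⇒> z≰n))))

  ∑-halving : ∀ n (f : ℕ → ℤ) Y → 0ℤ ≤ Y → (∀ i → + (2 ^ suc i) * f i ≤ Y) → ∑ n f ≤ Y
  ∑-halving n f Y 0≤Y h = *-cancelˡ-≤-pos (∑ n f) Y (+ (2 ^ n)) ⦃ positive (+<+ (0<2^ n)) ⦄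
    (≤-trans (go n) (by≤ 0≤Y (lem (+ (2 ^ n)) Y)))
    where
    lem : ∀ x y → x * y - (x - 1ℤ) * y ≡ y
    lem = solve-∀
    step : ∀ x x′ s f Y → x′ ≡ + 2 * x → x * s ≤ (x - 1ℤ) * Y → x′ * f ≤ Y → x′ * (s + f) ≤ (x′ - 1ℤ) * Y
    step x x′ s f Y refl p q = by≤ (0≤+ 2 ⊛ gap p ⊹ gap q) (solve (x ∷ s ∷ f ∷ Y ∷ []))
    go : ∀ n → + (2 ^ n) * ∑ n f ≤ (+ (2 ^ n) - 1ℤ) * Y
    go zero = ≤-reflexive (sym (*-zeroˡ Y))
    go (suc n) = step (+ (2 ^ n)) (+ (2 ^ suc n)) (∑ n f) (f n) Y (pos-2^suc n) (go n) (h n)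

  -- Σ_{j < T} (j + 1) / 2^j = 4 - (2 T + 4) / 2^T
  ∑-weighted-halving : ∀ T (b : ℕ → ℤ) Y → 0ℤ ≤ Y → (∀ j → + (2 ^ j) * b j ≤ Y) → ∑ T (λ j → + suc j * b j) ≤ + 4 * Y
  ∑-weighted-halving T b Y 0≤Y h = *-cancelˡ-≤-pos _ (+ 4 * Y) (+ (2 ^ T)) ⦃ positive (+<+ (0<2^ T)) ⦄
    (≤-trans (go T) (by≤ ((0≤+ 2 ⊛ 0≤+ T ⊹ 0≤+ 4) ⊛ 0≤Y) (lem (+ (2 ^ T)) (+ T) Y)))
    where
    lem : ∀ x t y → x * (+ 4 * y) - (+ 4 * x - (+ 2 * t + + 4)) * y ≡ (+ 2 * t + + 4) * y
    lem = solve-∀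
    step-≡ : ∀ t x s f Y → (+ 4 * (+ 2 * x) - (+ 2 * (1ℤ + t) + + 4)) * Y - ((+ 2 * x) * (s + (1ℤ + t) * f)) ≡
      + 2 * ((+ 4 * x - (+ 2 * t + + 4)) * Y - (x * s)) + (+ 2 * (1ℤ + t)) * (Y - (x * f))
    step-≡ = solve-∀
    step : ∀ t x x′ s f Y → 0ℤ ≤ 1ℤ + t → x′ ≡ + 2 * x → x * s ≤ (+ 4 * x - (+ 2 * t + + 4)) * Y → x * f ≤ Y → x′ * (s + (1ℤ + t) * f) ≤ (+ 4 * x′ - (+ 2 * (1ℤ + t) + + 4)) * Y
    step t x x′ s f Y 0≤1+t refl p q = by≤ (0≤+ 2 ⊛ gap p ⊹ (0≤+ 2 ⊛ 0≤1+t) ⊛ gap q) (step-≡ t x s f Y)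
    go : ∀ T → + (2 ^ T) * ∑ T (λ j → + suc j * b j) ≤ (+ 4 * + (2 ^ T) - (+ 2 * + T + + 4)) * Y
    go zero = ≤-reflexive (sym (*-zeroˡ Y))
    go (suc T) = step (+ T) (+ (2 ^ T)) (+ (2 ^ suc T)) (∑ T λ j → + suc j * b j) (b T) Y (0≤+ (suc T)) (pos-2^suc T) (go T) (h T)

  -- Abel summation for partial sums t₀ + … + t_{k-1} that are within C u of k u
  module PartialSums (t : ℕ → ℤ) (t≥0 : ∀ j → 0ℤ ≤ t j) (u C : ℤ) (0≤u : 0ℤ ≤ u) (0≤C : 0ℤ ≤ C) (n : ℕ)
    (near : ∀ k → k ℕ.≤ n → ∑ k t - + k * u ≤∣ C * u) where

    private
      upper : ∀ k → k ℕ.≤ n → ∑ k t ≤ (+ k + C) * u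
      upper k k≤n = by≤ (gap (proj₂ (near k k≤n))) (lem (∑ k t) (+ k) C u)
        where
        lem : ∀ s k C u → (k + C) * u - s ≡ C * u - (s - k * u)
        lem = solve-∀
      lower : ∀ k → k ℕ.≤ n → (+ k - C) * u ≤ ∑ k t
      lower k k≤n = by≤ (gap (proj₁ (near k k≤n))) (lem (∑ k t) (+ k) C u)
        where
        lem : ∀ s k C u → s - (k - C) * u ≡ s - k * u - - (C * u)
        lem = solve-∀
      B : ℕ → ℤ
      B k = ∑ k λ j → ∑ (suc j) t
      J : ℕ → ℤ
      J k = ∑ k λ i → + i * t i
      B-near : ∀ k → k ℕ.≤ n → + 2 * B k - + k * (+ k + 1ℤ) * u ≤∣ + 2 * (C * + k) * u
      B-near zero _ = subst₂ _≤∣_ (sym (lem₁ u)) (sym (lem₂ C u)) (≤-refl , ≤-refl)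
        where
        lem₁ : ∀ u → + 2 * 0ℤ - 0ℤ * (0ℤ + 1ℤ) * u ≡ 0ℤ
        lem₁ = solve-∀
        lem₂ : ∀ C u → + 2 * (C * 0ℤ) * u ≡ 0ℤ
        lem₂ = solve-∀
      B-near (suc k) k<n = subst₂ _≤∣_ (lem₁ (B k) (∑ (suc k) t) (+ k) u) (lem₂ C (+ k) u) (≤∣-+ (B-near k (ℕₚ.<⇒≤ k<n)) (≤∣-* (0≤+ 2) (near (suc k) k<n)))
        where
        lem₁ : ∀ b s k u → + 2 * b - k * (k + 1ℤ) * u + + 2 * (s - (1ℤ + k) * u) ≡ + 2 * (b + s) - (1ℤ + k) * ((1ℤ + k) + 1ℤ) * u
        lem₁ = solve-∀
        lem₂ : ∀ C k u → + 2 * (C * k) * u + + 2 * (C * u) ≡ + 2 * (C * (1ℤ + k)) * u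
        lem₂ = solve-∀
      J≡ : ∀ k → J k ≡ + k * ∑ k t - B k
      J≡ zero = refl
      J≡ (suc k) = trans (cong (λ z → z + + k * t k) (J≡ k)) (lem (+ k) (∑ k t) (t k) (B k))
        where
        lem : ∀ k s t b → k * s - b + k * t ≡ (1ℤ + k) * (s + t) - (b + (s + t))
        lem = solve-∀
      B≡ : ∀ k → B k ≡ ∑ k λ j → t j * + (k ℕ.∸ j)
      B≡ zero = refl
      B≡ (suc k) = sym (trans (∑-cong< (suc k) λ j j<1+k → trans (cong (λ z → t j * + z) (ℕₚ.+-∸-assoc 1 (ℕₚ.≤-pred j<1+k))) (lem (t j) (+ (k ℕ.∸ j))))
        (trans (∑-+ (suc k) (λ j → t j * + (k ℕ.∸ j)) t) (cong (λ z → z + ∑ (suc k) t) (trans (cong₂ _+_ (sym (B≡ k)) (trans (cong (λ z → t k * + z) (ℕₚ.n∸n≡0 k)) (*-zeroʳ (t k)))) (+-identityʳ (B k))))))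
        where
        lem : ∀ a x → a * (1ℤ + x) ≡ a * x + a
        lem = solve-∀

    J-upper : ∀ k → k ℕ.≤ n → + 2 * J k ≤ (+ k * + k + + 4 * (C * + k)) * u
    J-upper k k≤n = ≤-trans (≤-reflexive (cong (λ z → + 2 * z) (J≡ k))) (final (+ k) (∑ k t) (B k) C u (0≤+ k) 0≤u (upper k k≤n) (proj₁ (B-near k k≤n)))
      where
      final-≡ : ∀ k s b C u → (k * k + + 4 * (C * k)) * u - (+ 2 * (k * s - b)) ≡
        + 2 * k * ((k + C) * u - s) + (+ 2 * b - k * (k + 1ℤ) * u - (- (+ 2 * (C * k) * u))) + k * u
      final-≡ = solve-∀
      final : ∀ k s b C u → 0ℤ ≤ k → 0ℤ ≤ u → s ≤ (k + C) * u → - (+ 2 * (C * k) * u) ≤ + 2 * b - k * (k + 1ℤ) * u → + 2 * (k * s - b) ≤ (k * k + + 4 * (C * k)) * u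
      final k s b C u 0≤k 0≤u p q = by≤ (0≤+ 2 ⊛ 0≤k ⊛ gap p ⊹ gap q ⊹ 0≤k ⊛ 0≤u) (final-≡ k s b C u)

    J-lower : ∀ k → k ℕ.≤ n → (+ k * + k - + k - + 4 * (C * + k)) * u ≤ + 2 * J k
    J-lower k k≤n = ≤-trans (final (+ k) (∑ k t) (B k) C u (0≤+ k) (lower k k≤n) (proj₂ (B-near k k≤n))) (≤-reflexive (cong (λ z → + 2 * z) (sym (J≡ k))))
      where
      final-≡ : ∀ k s b C u → + 2 * (k * s - b) - ((k * k - k - + 4 * (C * k)) * u) ≡
        + 2 * k * (s - ((k - C) * u)) + (+ 2 * (C * k) * u - (+ 2 * b - k * (k + 1ℤ) * u))
      final-≡ = solve-∀
      final : ∀ k s b C u → 0ℤ ≤ k → (k - C) * u ≤ s → + 2 * b - k * (k + 1ℤ) * u ≤ + 2 * (C * k) * u → (k * k - k - + 4 * (C * k)) * u ≤ + 2 * (k * s - b)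
      final k s b C u 0≤k p q = by≤ (0≤+ 2 ⊛ 0≤k ⊛ gap p ⊹ gap q) (final-≡ k s b C u)

    Tri≡ : ∀ m k → k ℕ.≤ m → Tri m k (λ i j → t i * t j) ≡ ∑ k λ j → t j * ∑ (k ℕ.∸ j) t
    Tri≡ m k k≤m = trans (∑-cong m row) (trans (∑-extend {k} {m} (λ j → t j * ∑ (k ℕ.∸ j) t) k≤m
        λ j k≤j → trans (cong (λ z → t j * ∑ z t) (ℕₚ.m≤n⇒m∸n≡0 k≤j)) (*-zeroʳ (t j))) refl)
      where
      row : ∀ j → ∑ m (λ i → χ (i ℕ.+ j ℕ.<? k) * (t i * t j)) ≡ t j * ∑ (k ℕ.∸ j) t
      row j = trans (∑-extend {k} {m} (λ i → χ (i ℕ.+ j ℕ.<? k) * (t i * t j)) k≤m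
          λ i k≤i → trans (cong (λ z → z * (t i * t j)) (χ-no (i ℕ.+ j ℕ.<? k) (ℕₚ.≤⇒≯ (ℕₚ.≤-trans k≤i (ℕₚ.m≤m+n i j))))) (*-zeroˡ (t i * t j)))
        (trans (∑-χ+< j k λ i → t i * t j) (trans (∑-*ʳ (k ℕ.∸ j) (t j) t) (*-comm (∑ (k ℕ.∸ j) t) (t j))))

    -- The inner sum over i < k - j is at most (k - j + C) u; what remains is a first moment,
    -- controlled by `B-near`.
    Tri-upper : ∀ m k → k ℕ.≤ m → k ℕ.≤ n → + 2 * Tri m k (λ i j → t i * t j) ≤ (+ k * + k + + k + + 4 * (C * + k) + + 2 * (C * C)) * (u * u)
    Tri-upper m k k≤m k≤n = ≤-trans (*-monoˡ (0≤+ 2) (≤-trans (≤-reflexive (Tri≡ m k k≤m)) (≤-trans (∑-mono k λ j → *-monoˡ (t≥0 j) (upper (k ℕ.∸ j) (ℕₚ.≤-trans (ℕₚ.m∸n≤m k j) k≤n)))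
      (≤-reflexive (trans (∑-cong k λ j → lem (t j) (+ (k ℕ.∸ j)) C u) (trans (∑-*ʳ k u λ j → t j * + (k ℕ.∸ j) + C * t j) (cong (λ z → z * u) (trans (∑-+ k (λ j → t j * + (k ℕ.∸ j)) λ j → C * t j) (cong₂ _+_ (sym (B≡ k)) (∑-*ˡ k C t)))))))))) 
      (final (+ k) (∑ k t) (B k) C u 0≤C 0≤u (upper k k≤n) (proj₂ (B-near k k≤n)))
      where
      lem : ∀ t d C u → t * ((d + C) * u) ≡ (t * d + C * t) * u
      lem = solve-∀
      final-≡ : ∀ k s b C u → (k * k + k + + 4 * (C * k) + + 2 * (C * C)) * (u * u) - (+ 2 * ((b + C * s) * u)) ≡
        (+ 2 * C * ((k + C) * u - s) + (+ 2 * (C * k) * u - (+ 2 * b - k * (k + 1ℤ) * u))) * u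
      final-≡ = solve-∀
      final : ∀ k s b C u → 0ℤ ≤ C → 0ℤ ≤ u → s ≤ (k + C) * u → + 2 * b - k * (k + 1ℤ) * u ≤ + 2 * (C * k) * u → + 2 * ((b + C * s) * u) ≤ (k * k + k + + 4 * (C * k) + + 2 * (C * C)) * (u * u)
      final k s b C u 0≤C 0≤u p q = by≤ ((0≤+ 2 ⊛ 0≤C ⊛ gap p ⊹ gap q) ⊛ 0≤u) (final-≡ k s b C u)

    Tri-lower : ∀ m k → k ℕ.≤ m → k ℕ.≤ n → (+ k * + k + + k - + 4 * (C * + k) - + 2 * (C * C)) * (u * u) ≤ + 2 * Tri m k (λ i j → t i * t j)
    Tri-lower m k k≤m k≤n = ≤-trans (final (+ k) (∑ k t) (B k) C u 0≤C 0≤u (upper k k≤n) (proj₁ (B-near k k≤n)))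
      (*-monoˡ (0≤+ 2) (≤-trans (≤-reflexive (sym (trans (∑-cong k λ j → lem (t j) (+ (k ℕ.∸ j)) C u) (trans (∑-*ʳ k u λ j → t j * + (k ℕ.∸ j) - C * t j) (cong (λ z → z * u) (trans (∑-- k (λ j → t j * + (k ℕ.∸ j)) λ j → C * t j) (cong₂ _-_ (sym (B≡ k)) (∑-*ˡ k C t))))))))
        (≤-trans (∑-mono k λ j → *-monoˡ (t≥0 j) (lower (k ℕ.∸ j) (ℕₚ.≤-trans (ℕₚ.m∸n≤m k j) k≤n))) (≤-reflexive (sym (Tri≡ m k k≤m))))))
      where
      lem : ∀ t d C u → t * ((d - C) * u) ≡ (t * d - C * t) * u
      lem = solve-∀
      final-≡ : ∀ k s b C u → + 2 * ((b - C * s) * u) - ((k * k + k - + 4 * (C * k) - + 2 * (C * C)) * (u * u)) ≡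
        (+ 2 * C * ((k + C) * u - s) + (+ 2 * b - k * (k + 1ℤ) * u - (- (+ 2 * (C * k) * u)))) * u
      final-≡ = solve-∀
      final : ∀ k s b C u → 0ℤ ≤ C → 0ℤ ≤ u → s ≤ (k + C) * u → - (+ 2 * (C * k) * u) ≤ + 2 * b - k * (k + 1ℤ) * u → (k * k + k - + 4 * (C * k) - + 2 * (C * C)) * (u * u) ≤ + 2 * ((b - C * s) * u)
      final k s b C u 0≤C 0≤u p q = by≤ ((0≤+ 2 ⊛ 0≤C ⊛ gap p ⊹ gap q) ⊛ 0≤u) (final-≡ k s b C u)

-- Selberg's formula in residue classes and its consequences

module Selberg where

  open import Data.Integer hiding (suc; _^_; _/_; _%_; NonZero)
  open import Data.Integer.Properties
  open import Data.Integer.Tactic.RingSolver using (solve-∀; solve)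
  open import Data.List using ([]; _∷_)
  open import Data.Nat as ℕ using (ℕ; zero; suc; z≤n; s≤s; _^_; NonZero)
  import Data.Nat.Properties as ℕₚ
  open import Data.Nat.Coprimality using (Coprime; coprime?)
  open import Data.Nat.Divisibility using (m%n≡0⇒n∣m; n∣m⇒m%n≡0; _∣0; ∣-refl; _∣_; _∣?_; ∣⇒≤)
  open import Data.Nat.DivMod using (_%_; _/_; m<n⇒m%n≡m; m%n<n; m≡m%n+[m/n]*n; m/n*n≤m; m%n%n≡m%n)
  open import Data.Product using (_×_; _,_; proj₁; proj₂)
  open import Relation.Binary.PropositionalEquality hiding (J)
  open import Relation.Nullary using (yes; no; Dec; contradiction)
  open Sums
  open Arith
  open Logs
  open Mertens
  open Modular
  open Closure
  open Equi
  open import Data.Nat.Primality using (Prime; prime?)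
  open Density

  -- Passes from an asymptotic formula for the weighted sum of the q a to one for a single x that is
  -- close to those q a that carry weight. It turns the formula over all units into one for each
  -- unit class.
  average-near : ∀ n (e q : ℕ → ℤ) x y z {r δ b} → 0ℤ ≤ y → (∀ a → a ℕ.< n → e a * (x - q a) ≤∣ δ) → ∑ n (λ a → e a * q a) ≡ r →
    y * r - z ≤∣ b → ∑ n e * (y * x) - z ≤∣ y * (+ n * δ) + b
  average-near n e q x y z {δ = δ} {b} 0≤y near refl h = subst₂ _≤∣_ (trans (cong (λ s → y * s + (y * r - z)) sum≡) (lem (∑ n e) y x r z))
      (cong (λ s → y * s + b) (∑-const n δ)) (≤∣-+ (≤∣-* 0≤y (∑-≤∣ n {λ a → e a * (x - q a)} {λ _ → δ} near)) h)
    where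
    r : ℤ
    r = ∑ n λ a → e a * q a
    lem₀ : ∀ e x q → e * (x - q) ≡ e * x - e * q
    lem₀ = solve-∀
    sum≡ : ∑ n (λ a → e a * (x - q a)) ≡ ∑ n e * x - r
    sum≡ = trans (∑-cong n λ a → lem₀ (e a) x (q a)) (trans (∑-- n (λ a → e a * x) λ a → e a * q a) (cong (_- r) (∑-*ʳ n x e)))
    lem : ∀ f y x r z → y * (f * x - r) + (y * r - z) ≡ f * (y * x) - z
    lem = solve-∀

  χ-*-≤∣ : ∀ {a} {P : Set a} (d : Dec P) {x b} → 0ℤ ≤ b → (P → x ≤∣ b) → χ d * x ≤∣ b
  χ-*-≤∣ (yes p) {x} {b} _ h = subst (_≤∣ b) (sym (*-identityˡ x)) (h p)
  χ-*-≤∣ (no _) {x} {b} 0≤b _ = subst (_≤∣ b) (sym (*-zeroˡ x)) (≤∣-0 0≤b)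

  module Sieve (M : ℕ) ⦃ _ : NonZero M ⦄ (1<M : 1 ℕ.< M) (𝒮 : Scaling) where

    open Scaling 𝒮
    open Level 𝒮 public
    open Residues M public

    -- Λ₂ is equidistributed over unit classes

    module Equidistribution where

      cl-0 : ∀ {c} → Coprime c M → cl c 0 ≡ 0ℤ
      cl-0 {c} cop = χ-no (0 % M ℕ.≟ c % M) λ eq → ℕₚ.>⇒≢ 1<M (cop (m%n≡0⇒n∣m c M (trans (sym eq) (n∣m⇒m%n≡0 0 M (M ∣0))) , ∣-refl))

      -- A monotone stand-in for ℓ², which need not be monotone, so that `monotone-diff` applies.
      F : ℕ → ℤ
      F n = + lg κ n * + lg κ n

      lg-mono′ : ∀ n → lg κ n ℕ.≤ lg κ (suc n)
      lg-mono′ zero = subst (ℕ._≤ lg κ 1) (sym (lg-0 κ)) z≤n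
      lg-mono′ (suc n) = lg-mono κ (s≤s z≤n) (ℕₚ.n≤1+n (suc n))

      err : ℤ
      err = + 2 * (+ T * (+ κ * + T))

      ℓ²-lg² : ∀ n → 0 ℕ.< n → n ℕ.< X → F n - ℓ n * ℓ n ≤∣ err
      ℓ²-lg² n 0<n n<X = ≤∣-abs (≤-trans ((gap (proj₂ b)) ⊛ (ℓ≥0 n ⊹ 0≤+ _)) (≤-reflexive (sym (lem (+ lg κ n) (ℓ n))))) (≤-trans (≤-reflexive (lem (+ lg κ n) (ℓ n)))
          (final (+ lg κ n) (ℓ n) (+ L n) (+ T) (+ κ * + T) (proj₁ b) (proj₂ b) (0≤+ _) (+≤+ (ℕₚ.<⇒≤ (L-< 0<n n<2^T))) lg≤ (0≤+ T))) refl
        where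
        b : + lg κ n - + L n ≤ ℓ n × ℓ n ≤ + lg κ n
        b = ℓ-bounds n 0<n n<X
        n<2^T : n ℕ.< 2 ^ T
        n<2^T = subst (n ℕ.<_) X≡2^T n<X
        lg≤ : + lg κ n ≤ + κ * + T
        lg≤ = ≤-trans (+≤+ (lg-≤ κ 0<n (ℕₚ.<⇒≤ n<2^T))) (≤-reflexive (pos-* κ T))
        lem : ∀ a b → a * a - b * b ≡ (a - b) * (b + a)
        lem = solve-∀
        final : ∀ a b l t k → a - l ≤ b → b ≤ a → 0ℤ ≤ a → l ≤ t → a ≤ k → 0ℤ ≤ t → (a - b) * (b + a) ≤ + 2 * (t * k)
        final a b l t k h₁ h₂ 0≤a h₃ h₄ 0≤t = ≤-trans (*-monoˡ (gap h₂) (by≤ (gap h₂) (s₁ a b)))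
          (≤-trans (*-monoʳ {a - b} {t} {a + a} (0≤a ⊹ 0≤a) (by≤ (gap h₁ ⊹ gap h₃) (s₂ a b l t))) (by≤ (0≤+ 2 ⊛ (0≤t ⊛ gap h₄)) (s₃ a t k)))
          where
          s₁ : ∀ a b → (a + a) - (b + a) ≡ a - b
          s₁ = solve-∀
          s₂ : ∀ a b l t → t - (a - b) ≡ (b - (a - l)) + (t - l)
          s₂ = solve-∀
          s₃ : ∀ a t k → + 2 * (t * k) - t * (a + a) ≡ + 2 * (t * (k - a))
          s₃ = solve-∀

      module _ {c c′ : ℕ} (cop : Coprime c M) (cop′ : Coprime c′ M) (y : ℕ) (1≤y : 1 ℕ.≤ y) (y≤X : y ℕ.≤ X) where

        private
          G : ℕ → ℤ
          G n = χ (n ℕ.<? y) * (cl c n - cl c′ n)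

          G-0 : G 0 ≡ 0ℤ
          G-0 = trans (cong₂ (λ a b → χ (0 ℕ.<? y) * (a - b)) (cl-0 cop) (cl-0 cop′)) (*-zeroʳ (χ (0 ℕ.<? y)))

          G-out : ∀ {n} → y ℕ.≤ n → G n ≡ 0ℤ
          G-out {n} y≤n = trans (cong (λ z → z * (cl c n - cl c′ n)) (χ-no (n ℕ.<? y) (ℕₚ.≤⇒≯ y≤n))) (*-zeroˡ (cl c n - cl c′ n))

          I : ℕ → ℤ
          I d = ∑ X λ n → G (d ℕ.* n) * (ℓ n * ℓ n)

          k : ℕ
          k = suc (L y)

          y<2^k : y ℕ.< 2 ^ k
          y<2^k = proj₂ (L-spec y 1≤y)

          b : ℕ → ℤ
          b d = + 2 * + M * (+ κ * (+ k - + L d) * (+ κ * (+ k - + L d))) + err * + X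

          0≤k-L : ∀ {d} → 0 ℕ.< d → d ℕ.< y → 0ℤ ≤ + k - + L d
          0≤k-L 0<d d<y = gap (+≤+ (ℕₚ.<⇒≤ (L-< 0<d (ℕₚ.<-trans d<y y<2^k))))

          0≤err : 0ℤ ≤ err
          0≤err = 0≤+ 2 ⊛ (0≤+ T ⊛ (0≤+ κ ⊛ 0≤+ T))

          b≥0 : ∀ d → 0ℤ ≤ b d
          b≥0 d = (0≤+ 2 ⊛ 0≤+ M) ⊛ square (+ κ * (+ k - + L d)) ⊹ 0≤err ⊛ 0≤+ X
            where
            square : ∀ a → 0ℤ ≤ a * a
            square (+ n) = 0≤+ n ⊛ 0≤+ n
            square -[1+ n ] = +≤+ z≤n

          -- If d shares a factor with M, no multiple of d lies in a unit class and the sum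
          -- vanishes. Otherwise division by d carries c and c′ to two other classes, and their
          -- difference over n of size up to y / d is bounded by a multiple of log²(y/d), plus
          -- rounding.
          I-bound : ∀ d → d ℕ.< y → I d ≤∣ b d
          I-bound zero _ = subst (_≤∣ b 0) (sym (∑-zero< X λ n _ → trans (cong (λ z → z * (ℓ n * ℓ n)) G-0) (*-zeroˡ (ℓ n * ℓ n)))) (≤∣-0 (b≥0 0))
          I-bound d@(suc _) d<y with coprime? d M
          ... | no ¬cop = subst (_≤∣ b d) (sym (∑-zero< X λ n _ → trans (cong (λ z → z * (ℓ n * ℓ n)) (off n)) (*-zeroˡ (ℓ n * ℓ n)))) (≤∣-0 (b≥0 d))
            where
            off-class : ∀ {c} n → Coprime c M → cl c (d ℕ.* n) ≡ 0ℤ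
            off-class {c} n cp = χ-no ((d ℕ.* n) % M ℕ.≟ c % M) λ eq → ¬cop (coprime-*ˡ {d} {n} (≈-coprime M {c} {d ℕ.* n} (sym eq) cp))
            off : ∀ n → G (d ℕ.* n) ≡ 0ℤ
            off n = trans (cong₂ (λ a b → χ (d ℕ.* n ℕ.<? y) * (a - b)) (off-class n cop) (off-class n cop′)) (*-zeroʳ (χ (d ℕ.* n ℕ.<? y)))
          ... | yes dM = subst (_≤∣ b d) (sym I≡) (≤∣-+ main error)
            where
            a a′ z : ℕ
            a = proj₁ (quotient-class M {d} c dM)
            a′ = proj₁ (quotient-class M {d} c′ dM)
            -- The number of n ≥ 0 with d n < y.
            z = suc ((y ℕ.∸ 1) / d)
            y≡ : y ≡ suc (y ℕ.∸ 1)
            y≡ = sym (ℕₚ.m+[n∸m]≡n 1≤y)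
            dz : d ℕ.* ((y ℕ.∸ 1) / d) ℕ.< y
            dz = ℕₚ.≤-trans (s≤s (ℕₚ.≤-trans (ℕₚ.≤-reflexive (ℕₚ.*-comm d ((y ℕ.∸ 1) / d))) (m/n*n≤m (y ℕ.∸ 1) d))) (ℕₚ.≤-reflexive (sym y≡))
            y≤dz : y ℕ.≤ d ℕ.* z
            y≤dz = ℕₚ.≤-trans (ℕₚ.≤-reflexive y≡) (ℕₚ.≤-trans (ℕₚ.≤-trans (ℕₚ.≤-reflexive (cong suc (m≡m%n+[m/n]*n (y ℕ.∸ 1) d))) (ℕₚ.+-monoˡ-≤ ((y ℕ.∸ 1) / d ℕ.* d) (m%n<n (y ℕ.∸ 1) d)))
              (ℕₚ.≤-reflexive (ℕₚ.*-comm z d)))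
            z≤X : z ℕ.≤ X
            z≤X = ℕₚ.≤-trans (ℕₚ.≤-<-trans (ℕₚ.m≤n*m ((y ℕ.∸ 1) / d) d) dz) y≤X
            cut : ∀ n → χ (d ℕ.* n ℕ.<? y) ≡ χ (n ℕ.<? z)
            cut n = χ-⇔ (d ℕ.* n ℕ.<? y) (n ℕ.<? z) (λ lt → ℕₚ.*-cancelˡ-< d n z (ℕₚ.<-≤-trans lt y≤dz)) (λ lt → ℕₚ.≤-<-trans (ℕₚ.*-monoʳ-≤ d (ℕₚ.≤-pred lt)) dz)
            swap-class : ∀ {c} n → cl c (d ℕ.* n) ≡ cl (proj₁ (quotient-class M {d} c dM)) n
            swap-class {c} n = χ-⇔ ((d ℕ.* n) % M ℕ.≟ c % M) (n % M ℕ.≟ q % M)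
                (λ eq → ≈-cancel M {d} {n} {q} dM (trans eq (sym dq≡c))) (λ eq → trans (≈-* M {d} {d} {n} {q} refl eq) dq≡c)
              where
              q : ℕ
              q = proj₁ (quotient-class M {d} c dM)
              dq≡c : (d ℕ.* q) % M ≡ c % M
              dq≡c = proj₂ (quotient-class M {d} c dM)
            e : ℕ → ℤ
            e n = cl a n - cl a′ n
            term : ∀ n → G (d ℕ.* n) * (ℓ n * ℓ n) ≡ χ (n ℕ.<? z) * (e n * (ℓ n * ℓ n))
            term n = trans (cong₂ (λ p q → p * q * (ℓ n * ℓ n)) (cut n) (cong₂ _-_ (swap-class n) (swap-class n))) (*-assoc (χ (n ℕ.<? z)) (e n) (ℓ n * ℓ n))
            I≡ : I d ≡ ∑ z (λ n → e n * F n) + ∑ z λ n → - (e n * (F n - ℓ n * ℓ n))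
            I≡ = trans (∑-cong X term) (trans (∑-extend {z} {X} (λ n → χ (n ℕ.<? z) * (e n * (ℓ n * ℓ n))) z≤X
                λ n z≤n → trans (cong (λ p → p * (e n * (ℓ n * ℓ n))) (χ-no (n ℕ.<? z) (ℕₚ.≤⇒≯ z≤n))) (*-zeroˡ (e n * (ℓ n * ℓ n))))
              (trans (∑-cong< z λ n n<z → trans (cong (λ p → p * (e n * (ℓ n * ℓ n))) (χ-yes (n ℕ.<? z) n<z)) (lem (e n) (F n) (ℓ n * ℓ n))) (∑-+ z (λ n → e n * F n) λ n → - (e n * (F n - ℓ n * ℓ n)))))
              where
              lem : ∀ e f l → 1ℤ * (e * l) ≡ e * f + - (e * (f - l))
              lem = solve-∀
            z≤2^ : z ℕ.≤ 2 ^ (k ℕ.∸ L d)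
            z≤2^ = ℕₚ.*-cancelʳ-< (2 ^ L d) ((y ℕ.∸ 1) / d) (2 ^ (k ℕ.∸ L d)) (ℕₚ.<-≤-trans (ℕₚ.≤-<-trans (ℕₚ.≤-trans (ℕₚ.*-monoʳ-≤ ((y ℕ.∸ 1) / d) (proj₁ (L-spec d (s≤s z≤n)))) (ℕₚ.≤-reflexive (ℕₚ.*-comm ((y ℕ.∸ 1) / d) d))) (ℕₚ.<-trans dz y<2^k))
              (ℕₚ.≤-reflexive (trans (cong (2 ^_) (sym (ℕₚ.m∸n+n≡m Ld≤k))) (ℕₚ.^-distribˡ-+-* 2 (k ℕ.∸ L d) (L d)))))
              where
              Ld≤k : L d ℕ.≤ k
              Ld≤k = ℕₚ.<⇒≤ (L-< (s≤s z≤n) (ℕₚ.<-trans d<y y<2^k))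
            lgz : + lg κ z ≤ + κ * (+ k - + L d)
            lgz = ≤-trans (+≤+ (lg-≤ κ (s≤s z≤n) z≤2^)) (≤-reflexive (trans (pos-* κ (k ℕ.∸ L d)) (cong (λ p → + κ * p) (trans (sym (⊖-≥ Ld≤k)) (sym (m-n≡m⊖n k (L d)))))))
              where
              Ld≤k : L d ℕ.≤ k
              Ld≤k = ℕₚ.<⇒≤ (L-< (s≤s z≤n) (ℕₚ.<-trans d<y y<2^k))
            main : ∑ z (λ n → e n * F n) ≤∣ + 2 * + M * (+ κ * (+ k - + L d) * (+ κ * (+ k - + L d)))
            main = ≤∣-mono (*-monoˡ (0≤+ 2 ⊛ 0≤+ M) (*-mono (0≤+ _) (0≤+ κ ⊛ 0≤k-L (s≤s z≤n) d<y) lgz lgz))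
              (monotone-diff a a′ F z (cong (λ p → + p * + p) (lg-0 κ)) (λ n → *-mono (0≤+ (lg κ n)) (0≤+ (lg κ (suc n))) (+≤+ (lg-mono′ n)) (+≤+ (lg-mono′ n))) λ n → 0≤+ (lg κ n) ⊛ 0≤+ (lg κ n))
            e-0 : e 0 ≡ 0ℤ
            e-0 = cong₂ _-_ (trans (sym (swap-class {c} 0)) (trans (cong (cl c) (ℕₚ.*-zeroʳ d)) (cl-0 cop))) (trans (sym (swap-class {c′} 0)) (trans (cong (cl c′) (ℕₚ.*-zeroʳ d)) (cl-0 cop′)))
            error-term : ∀ n → n ℕ.< z → - (e n * (F n - ℓ n * ℓ n)) ≤∣ err
            error-term zero _ = subst (_≤∣ err) (sym (cong -_ (trans (cong (λ p → p * (F 0 - ℓ 0 * ℓ 0)) e-0) (*-zeroˡ (F 0 - ℓ 0 * ℓ 0))))) (≤∣-0 0≤err)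
            error-term n@(suc _) n<z = ≤∣-neg (≤∣-unit (cl-diff a a′ n) (ℓ²-lg² n (s≤s z≤n) (ℕₚ.<-≤-trans n<z z≤X)))
            error : ∑ z (λ n → - (e n * (F n - ℓ n * ℓ n))) ≤∣ err * + X
            error = ≤∣-mono (≤-trans (≤-reflexive (trans (∑-const z err) (*-comm (+ z) err))) (*-monoˡ 0≤err (+≤+ z≤X))) (∑-≤∣ z error-term)

        -- Comparing two classes makes the main terms of Σ μ(d) log²(y/d) cancel before any
        -- evaluation. The trivial bound for μ then leaves Σ log²(y/d) = O(y). The constant is 24 =
        -- 2 · 6 · 2, from `monotone-diff`, from `∑-k-L` and from 2^k ≤ 2 y, and the 1 covers
        -- rounding.
        Λ₂-diff : Λ₂ (λ n → χ (n ℕ.<? y) * cl c n) - Λ₂ (λ n → χ (n ℕ.<? y) * cl c′ n) ≤∣ (+ 24 * + M + 1ℤ) * (+ κ * + κ) * + y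
        Λ₂-diff = subst (_≤∣ (+ 24 * + M + 1ℤ) * (+ κ * + κ) * + y) (sym Λ₂-diff≡) (≤∣-mono total (∑-≤∣ y λ d d<y → ≤∣-unit (μ-unit d) (I-bound d d<y)))
          where
          1<X : 1 ℕ.< X
          1<X = subst (1 ℕ.<_) (sym X≡2^T) (ℕₚ.≤-trans (s≤s 1≤T) (n<2^n T))
          lem₀ : ∀ x a b → x * a + -1ℤ * (x * b) ≡ x * (a - b)
          lem₀ = solve-∀
          lem₁ : ∀ a b → a - b ≡ a + -1ℤ * b
          lem₁ = solve-∀
          Λ₂-diff≡ : Λ₂ (λ n → χ (n ℕ.<? y) * cl c n) - Λ₂ (λ n → χ (n ℕ.<? y) * cl c′ n) ≡ ∑ y λ d → μ d * I d
          Λ₂-diff≡ = trans (trans (lem₁ (Λ₂ λ n → χ (n ℕ.<? y) * cl c n) (Λ₂ λ n → χ (n ℕ.<? y) * cl c′ n))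
              (trans (+-congʳ (Λ₂ λ n → χ (n ℕ.<? y) * cl c n) (sym (Λ₂-*ˡ -1ℤ λ n → χ (n ℕ.<? y) * cl c′ n)))
              (trans (sym (Λ₂-+ (λ n → χ (n ℕ.<? y) * cl c n) λ n → -1ℤ * (χ (n ℕ.<? y) * cl c′ n))) (Λ₂-cong λ n _ → lem₀ (χ (n ℕ.<? y)) (cl c n) (cl c′ n)))))
            (trans (Λ₂-möbius {G} (G-0 , λ n X≤n → G-out (ℕₚ.≤-trans y≤X X≤n)) 1<X)
            (∑-extend {y} {X} (λ d → μ d * I d) y≤X λ d y≤d → trans (cong (λ p → μ d * p) (∑-zero< X λ n _ → trans (cong (λ p → p * (ℓ n * ℓ n)) (out d n y≤d)) (*-zeroˡ (ℓ n * ℓ n)))) (*-zeroʳ (μ d))))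
            where
            out : ∀ d n → y ℕ.≤ d → G (d ℕ.* n) ≡ 0ℤ
            out d zero _ = trans (cong G (ℕₚ.*-zeroʳ d)) G-0
            out d (suc n) y≤d = G-out (ℕₚ.≤-trans y≤d (ℕₚ.m≤m*n d (suc n)))
          2^k≤2y : + (2 ^ k) ≤ + 2 * + y
          2^k≤2y = ≤-trans (≤-reflexive (pos-2^suc (L y))) (*-monoˡ (0≤+ 2) (+≤+ (proj₁ (L-spec y 1≤y))))
          err-small : + 2 * err * + X ≤ + κ * + κ
          err-small = ≤-trans (≤-reflexive (lem (+ T) (+ κ) (+ X))) (≤-trans (*-monoˡ (0≤+ κ) (≤-reflexive cast))
            (*-monoˡ (0≤+ κ) (+≤+ (T²X≤κ T T (ℕₚ.m≤m+n T 8) (ℕₚ.m≤m+n T 8)))))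
            where
            lem : ∀ t k x → + 2 * (+ 2 * (t * (k * t))) * x ≡ k * (+ 4 * (t * t) * x)
            lem = solve-∀
            cast : + 4 * (+ T * + T) * + X ≡ + (4 ℕ.* (T ℕ.* T) ℕ.* X)
            cast = sym (trans (pos-* (4 ℕ.* (T ℕ.* T)) X) (cong (λ p → p * + X) (trans (pos-* 4 (T ℕ.* T)) (cong (λ p → + 4 * p) (pos-* T T)))))
          total : ∑ y b ≤ (+ 24 * + M + 1ℤ) * (+ κ * + κ) * + y
          total = ≤-trans (∑-monoⁿ {y} {2 ^ k} b b≥0 (ℕₚ.<⇒≤ y<2^k) ) (≤-trans (≤-reflexive sum≡)
              (final (+ M) (+ κ * + κ) (+ (2 ^ k)) (+ y) (∑ (2 ^ k) λ d → (+ k - + L d) * (+ k - + L d)) (err * + X) (0≤+ M) (0≤+ κ ⊛ 0≤+ κ) 2^k≤2y (proj₂ (∑-k-L k)) (0≤err ⊛ 0≤+ X) (0≤+ y)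
                (≤-trans (≤-reflexive (sym (*-assoc (+ 2) err (+ X)))) err-small)))
            where
            lem : ∀ M κ a → + 2 * M * (κ * a * (κ * a)) ≡ + 2 * M * (κ * κ) * (a * a)
            lem = solve-∀
            sum≡ : ∑ (2 ^ k) b ≡ + 2 * + M * (+ κ * + κ) * ∑ (2 ^ k) (λ d → (+ k - + L d) * (+ k - + L d)) + + (2 ^ k) * (err * + X)
            sum≡ = trans (∑-+ (2 ^ k) (λ d → + 2 * + M * (+ κ * (+ k - + L d) * (+ κ * (+ k - + L d)))) λ _ → err * + X)
              (cong₂ _+_ (trans (∑-cong (2 ^ k) λ d → lem (+ M) (+ κ) (+ k - + L d)) (∑-*ˡ (2 ^ k) (+ 2 * + M * (+ κ * + κ)) λ d → (+ k - + L d) * (+ k - + L d))) (∑-const (2 ^ k) (err * + X)))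
            final-≡ : ∀ M κ² x y s e → (+ 24 * M + 1ℤ) * κ² * y - (+ 2 * M * κ² * s + x * e) ≡
              (+ 2 * M * κ²) * (+ 6 * x - s) + (+ 12 * M * κ²) * (+ 2 * y - x) + e * (+ 2 * y - x) + y * (κ² - (+ 2 * e))
            final-≡ = solve-∀
            final : ∀ M κ² x y s e → 0ℤ ≤ M → 0ℤ ≤ κ² → x ≤ + 2 * y → s ≤ + 6 * x → 0ℤ ≤ e → 0ℤ ≤ y → + 2 * e ≤ κ² →
              + 2 * M * κ² * s + x * e ≤ (+ 24 * M + 1ℤ) * κ² * y
            final M κ² x y s e 0≤M 0≤κ h₁ h₂ 0≤e 0≤y h₃ = by≤ ((0≤+ 2 ⊛ 0≤M ⊛ 0≤κ) ⊛ gap h₂ ⊹ (0≤+ 12 ⊛ 0≤M ⊛ 0≤κ) ⊛ gap h₁ ⊹ 0≤e ⊛ gap h₁ ⊹ 0≤y ⊛ gap h₃) (final-≡ M κ² x y s e)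

    open Equidistribution public

    -- Partial summation to the weights 1/n; dyadic blocks

    module Analysis where

      1<X : 1 ℕ.< X
      1<X = subst (1 ℕ.<_) (sym X≡2^T) (ℕₚ.≤-trans (s≤s 1≤T) (n<2^n T))

      w-1 : w 1 ≡ Y
      w-1 = trans (sym (*-identityˡ (w 1))) (w-spec 1 (s≤s z≤n) 1<X)

      w≤Y : ∀ n → 0 ℕ.< n → n ℕ.< X → w n ≤ Y
      w≤Y n 0<n n<X = ≤-trans (≤-trans (≤-reflexive (sym (*-identityˡ (w n)))) (*-monoʳ (w≥0 n) (+≤+ 0<n))) (≤-reflexive (w-spec n 0<n n<X))

      w-anti : ∀ y → suc y ℕ.< X → w (suc y) ≤ w y
      w-anti zero _ = ≤-reflexive (sym w-0)
      w-anti y@(suc _) lt = *-cancelˡ-≤-pos (w (suc y)) (w y) (+ suc y) (≤-trans (≤-reflexive (trans (w-spec (suc y) (s≤s z≤n) lt) (sym (w-spec y (s≤s z≤n) (ℕₚ.<⇒≤ lt)))))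
        (*-monoʳ (w≥0 y) (+≤+ (ℕₚ.n≤1+n y))))

      w-* : ∀ a b → 0 ℕ.< a → 0 ℕ.< b → a ℕ.* b ℕ.< X → w a * w b ≡ Y * w (a ℕ.* b)
      w-* a b 0<a 0<b lt = *-cancelˡ-≡ (+ (a ℕ.* b)) _ _ ⦃ ℕ.>-nonZero (0<* 0<a 0<b) ⦄ (trans (cong (λ z → z * (w a * w b)) (pos-* a b))
        (trans (lem (+ a) (+ b) (w a) (w b)) (trans (cong₂ _*_ (w-spec a 0<a (ℕₚ.≤-<-trans (ℕₚ.m≤m*n a b ⦃ ℕ.>-nonZero 0<b ⦄) lt)) (w-spec b 0<b (ℕₚ.≤-<-trans (ℕₚ.m≤n*m b a ⦃ ℕ.>-nonZero 0<a ⦄) lt)))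
        (trans (cong (λ z → Y * z) (sym (w-spec (a ℕ.* b) (0<* 0<a 0<b) lt))) (lem′ Y (+ (a ℕ.* b)) (w (a ℕ.* b)))))))
        where
        lem : ∀ a b x y → a * b * (x * y) ≡ a * x * (b * y)
        lem = solve-∀
        lem′ : ∀ y a x → y * (a * x) ≡ a * (y * x)
        lem′ = solve-∀

      ∑-w : ∀ k → k ℕ.≤ T → ∑ (2 ^ k) w ≤ + suc k * Y
      ∑-w zero _ = ≤-reflexive (trans (+-identityˡ (w 0)) (trans w-0 (trans w-1 (sym (*-identityˡ Y)))))
      ∑-w (suc k) k<T = ≤-trans (≤-reflexive (trans (cong (λ z → ∑ z w) (2^suc k)) (∑-split (2 ^ k) (2 ^ k) w)))
        (≤-trans (+-mono-≤ (∑-w k (ℕₚ.<⇒≤ k<T)) block) (≤-reflexive (lem (+ suc k) Y)))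
        where
        lem : ∀ k Y → k * Y + Y ≡ (1ℤ + k) * Y
        lem = solve-∀
        block : ∑ (2 ^ k) (λ i → w (2 ^ k ℕ.+ i)) ≤ Y
        block = *-cancelˡ-≤-pos _ Y (+ (2 ^ k)) ⦃ positive (+<+ (0<2^ k)) ⦄ (≤-trans (≤-reflexive (sym (∑-*ˡ (2 ^ k) (+ (2 ^ k)) λ i → w (2 ^ k ℕ.+ i))))
          (≤-trans (∑-mono< (2 ^ k) λ i i<2^k → ≤-trans (*-monoʳ (w≥0 (2 ^ k ℕ.+ i)) (+≤+ (ℕₚ.m≤m+n (2 ^ k) i)))
            (≤-reflexive (w-spec (2 ^ k ℕ.+ i) (ℕₚ.≤-trans (0<2^ k) (ℕₚ.m≤m+n _ i)) (ℕₚ.<-≤-trans (subst (2 ^ k ℕ.+ i ℕ.<_) (sym (2^suc k)) (ℕₚ.+-monoʳ-< (2 ^ k) i<2^k)) (2^k≤X k<T)))))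
          (≤-reflexive (∑-const (2 ^ k) Y))))

      -- Σ Λ₂(n) g(n) / n over n < 2^k.
      Q : (ℕ → ℤ) → ℕ → ℤ
      Q g k = Λ₂ λ n → χ (n ℕ.<? 2 ^ k) * (g n * w n)

      E₀ : ℤ
      E₀ = + 24 * + M + 1ℤ

      0≤E₀ : 0ℤ ≤ E₀
      0≤E₀ = 0≤+ 24 ⊛ 0≤+ M ⊹ 0≤1

      private
        E : ℕ → ℕ → ℤ
        E c y = Λ₂ λ n → χ (n ℕ.<? y) * cl c n

        abel-w : ∀ z n → 0 ℕ.< n → χ (n ℕ.<? suc z) * w n ≡ w z * χ (n ℕ.<? suc z) + ∑ z λ y → (w y - w (suc y)) * χ (n ℕ.<? suc y)
        abel-w zero n 0<n = trans (cong (λ x → x * w n) c) (trans (*-zeroˡ (w n)) (sym (trans (+-identityʳ _) (trans (cong (λ x → w 0 * x) c) (*-zeroʳ (w 0))))))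
          where
          c : χ (n ℕ.<? 1) ≡ 0ℤ
          c = χ-no (n ℕ.<? 1) (ℕₚ.≤⇒≯ 0<n)
        abel-w (suc z) n 0<n = trans (step (n ℕ.<? suc z) (n ℕ.<? suc (suc z))) (trans (cong (λ x → x + w (suc z) * (χ (n ℕ.<? suc (suc z)) - χ (n ℕ.<? suc z))) (abel-w z n 0<n))
          (lem (w z) (w (suc z)) (χ (n ℕ.<? suc z)) (χ (n ℕ.<? suc (suc z))) (∑ z λ y → (w y - w (suc y)) * χ (n ℕ.<? suc y))))
          where
          lem : ∀ w w′ a b s → w * a + s + w′ * (b - a) ≡ w′ * b + (s + (w - w′) * a)
          lem = solve-∀
          e₁ : ∀ x y → 1ℤ * x ≡ 1ℤ * x + y * (1ℤ - 1ℤ)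
          e₁ = solve-∀
          e₂ : ∀ x → 1ℤ * x ≡ 0ℤ * x + x * (1ℤ - 0ℤ)
          e₂ = solve-∀
          e₃ : ∀ x y → 0ℤ * x ≡ 0ℤ * x + y * (0ℤ - 0ℤ)
          e₃ x y = sym (trans (+-congʳ (0ℤ * x) (*-zeroʳ y)) (+-identityʳ _))
          step : (d : Dec (n ℕ.< suc z)) (d′ : Dec (n ℕ.< suc (suc z))) → χ d′ * w n ≡ χ d * w n + w (suc z) * (χ d′ - χ d)
          step (yes _) (yes _) = e₁ (w n) (w (suc z))
          step (no _) (no _) = e₃ (w n) (w (suc z))
          step (yes p) (no ¬q) = contradiction (ℕₚ.m<n⇒m<1+n p) ¬q
          step (no ¬p) (yes q) = trans (e₂ (w n)) (cong (λ m → 0ℤ * w n + w m * (1ℤ - 0ℤ)) (ℕₚ.≤-antisym (ℕₚ.≤-pred q) (ℕₚ.≮⇒≥ ¬p)))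

        Q-abel : ∀ c z → Λ₂ (λ n → χ (n ℕ.<? suc z) * (cl c n * w n)) ≡ w z * E c (suc z) + ∑ z λ y → (w y - w (suc y)) * E c (suc y)
        Q-abel c z = trans (Λ₂-cong λ n 0<n → trans (lem (χ (n ℕ.<? suc z)) (cl c n) (w n)) (trans (cong (λ x → x * cl c n) (abel-w z n 0<n))
            (trans (lem′ (w z) (χ (n ℕ.<? suc z)) (∑ z λ y → (w y - w (suc y)) * χ (n ℕ.<? suc y)) (cl c n)) (+-congʳ (w z * (χ (n ℕ.<? suc z) * cl c n)) (trans (sym (∑-*ʳ z (cl c n) λ y → (w y - w (suc y)) * χ (n ℕ.<? suc y))) (∑-cong z λ y → *-assoc (w y - w (suc y)) (χ (n ℕ.<? suc y)) (cl c n)))))))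
          (trans (Λ₂-+ (λ n → w z * (χ (n ℕ.<? suc z) * cl c n)) λ n → ∑ z λ y → (w y - w (suc y)) * (χ (n ℕ.<? suc y) * cl c n))
          (cong₂ _+_ (Λ₂-*ˡ (w z) λ n → χ (n ℕ.<? suc z) * cl c n) (trans (Λ₂-∑ z λ n y → (w y - w (suc y)) * (χ (n ℕ.<? suc y) * cl c n)) (∑-cong z λ y → Λ₂-*ˡ (w y - w (suc y)) λ n → χ (n ℕ.<? suc y) * cl c n))))
          where
          lem : ∀ a b c → a * (b * c) ≡ a * c * b
          lem = solve-∀
          lem′ : ∀ w a s c → (w * a + s) * c ≡ w * (a * c) + s * c
          lem′ = solve-∀

      -- Partial summation over the decreasing weights: an error linear in y for each cut becomes
      -- the error times Σ w over n < 2^k, a harmonic sum of size k + 1.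
      Q-diff : ∀ {c c′} → Coprime c M → Coprime c′ M → ∀ k → k ℕ.≤ T → Q (cl c) k - Q (cl c′) k ≤∣ E₀ * (+ κ * + κ) * (+ suc k * Y)
      Q-diff {c} {c′} cop cop′ k k≤T = subst (λ x → Λ₂ (λ n → χ (n ℕ.<? x) * (cl c n * w n)) - Λ₂ (λ n → χ (n ℕ.<? x) * (cl c′ n * w n)) ≤∣ E₀ * (+ κ * + κ) * (+ suc k * Y)) (sym x≡)
        (subst (_≤∣ E₀ * (+ κ * + κ) * (+ suc k * Y)) (sym (trans (cong₂ _-_ (Q-abel c z) (Q-abel c′ z)) diff≡))
          (≤∣-mono (≤-trans (≤-reflexive total≡) (*-monoˡ (0≤E₀ ⊛ (0≤+ κ ⊛ 0≤+ κ)) (subst (λ x → ∑ x w ≤ + suc k * Y) x≡ (∑-w k k≤T))))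
            (≤∣-+ (≤∣-* (w≥0 z) (Λ₂-diff cop cop′ (suc z) (s≤s z≤n) z<X)) (∑-≤∣ z λ y y<z → ≤∣-* (gap (w-anti y (ℕₚ.<-≤-trans (s≤s y<z) z<X))) (Λ₂-diff cop cop′ (suc y) (s≤s z≤n) (ℕₚ.≤-trans (ℕₚ.m≤n⇒m≤1+n y<z) z<X))))))
        where
        z : ℕ
        z = 2 ^ k ℕ.∸ 1
        x≡ : 2 ^ k ≡ suc z
        x≡ = sym (ℕₚ.m+[n∸m]≡n (0<2^ k))
        z<X : suc z ℕ.≤ X
        z<X = subst (ℕ._≤ X) x≡ (2^k≤X k≤T)
        A : ℤ
        A = E₀ * (+ κ * + κ)
        diff≡ : w z * E c (suc z) + ∑ z (λ y → (w y - w (suc y)) * E c (suc y)) - (w z * E c′ (suc z) + ∑ z λ y → (w y - w (suc y)) * E c′ (suc y))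
          ≡ w z * (E c (suc z) - E c′ (suc z)) + ∑ z λ y → (w y - w (suc y)) * (E c (suc y) - E c′ (suc y))
        diff≡ = trans (lem (w z) (E c (suc z)) (E c′ (suc z)) (∑ z λ y → (w y - w (suc y)) * E c (suc y)) (∑ z λ y → (w y - w (suc y)) * E c′ (suc y)))
          (+-congʳ (w z * (E c (suc z) - E c′ (suc z))) (trans (sym (∑-- z (λ y → (w y - w (suc y)) * E c (suc y)) λ y → (w y - w (suc y)) * E c′ (suc y))) (∑-cong z λ y → lem′ (w y - w (suc y)) (E c (suc y)) (E c′ (suc y)))))
          where
          lem : ∀ w a b s t → w * a + s - (w * b + t) ≡ w * (a - b) + (s - t)
          lem = solve-∀
          lem′ : ∀ x a b → x * a - x * b ≡ x * (a - b)
          lem′ = solve-∀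
        total≡ : w z * (A * + suc z) + ∑ z (λ y → (w y - w (suc y)) * (A * + suc y)) ≡ A * ∑ (suc z) w
        total≡ = go z
          where
          go : ∀ z → w z * (A * + suc z) + ∑ z (λ y → (w y - w (suc y)) * (A * + suc y)) ≡ A * ∑ (suc z) w
          go zero = lem (w 0) A
            where
            lem : ∀ w A → w * (A * 1ℤ) + 0ℤ ≡ A * (0ℤ + w)
            lem = solve-∀
          go (suc z) = trans (lem (w z) (w (suc z)) A (+ suc z) (∑ z λ y → (w y - w (suc y)) * (A * + suc y))) (trans (cong (λ x → x + A * w (suc z)) (go z)) (sym (*-distribˡ-+ A (∑ (suc z) w) (w (suc z)))))
            where
            lem : ∀ w w′ A n s → w′ * (A * (1ℤ + n)) + (s + (w - w′) * (A * n)) ≡ w * (A * n) + s + A * w′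
            lem = solve-∀

      e : ℕ → ℤ
      e n = χ (coprime? n M)

      bl : ℕ → ℕ → ℤ
      bl i n = χ (i ℕ.≟ L n)

      -- Σ Λ(n) g(n) / n over the dyadic block 2^i ≤ n < 2^(i+1), and over n < 2^k.
      B P : (ℕ → ℤ) → ℕ → ℤ
      B g i = Λ λ n → bl i n * (g n * w n)
      P g k = Λ λ n → χ (n ℕ.<? 2 ^ k) * (g n * w n)

      B≥0 : ∀ {g} → (∀ n → 0ℤ ≤ g n) → ∀ i → 0ℤ ≤ B g i
      B≥0 g≥0 i = Λ-≥0 lam≥0 λ n _ → χ≥0 (i ℕ.≟ L n) ⊛ (g≥0 n ⊛ w≥0 n)

      χ-L< : ∀ k {n} → 0 ℕ.< n → χ (L n ℕ.<? k) ≡ χ (n ℕ.<? 2 ^ k)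
      χ-L< k {n} 0<n = χ-⇔ (L n ℕ.<? k) (n ℕ.<? 2 ^ k) (λ lt → ℕₚ.<-≤-trans (proj₂ (L-spec n 0<n)) (2^-mono lt)) (L-< 0<n)

      ∑-≟-χ : ∀ k j (f : ℕ → ℤ) → ∑ k (λ i → χ (i ℕ.≟ j) * f i) ≡ χ (j ℕ.<? k) * f j
      ∑-≟-χ k j f with j ℕ.<? k
      ... | yes lt = trans (∑-≟ f lt) (sym (*-identityˡ (f j)))
      ... | no ¬lt = trans (∑-≟-out k f (ℕₚ.≮⇒≥ ¬lt)) (sym (*-zeroˡ (f j)))

      ∑-B : ∀ (c : ℕ → ℤ) g k → ∑ k (λ i → c i * B g i) ≡ Λ λ n → c (L n) * (χ (n ℕ.<? 2 ^ k) * (g n * w n))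
      ∑-B c g k = trans (∑-cong k λ i → sym (Λ-*ˡ (c i) λ n → bl i n * (g n * w n))) (trans (sym (Λ-∑ k λ n i → c i * (bl i n * (g n * w n))))
        (Λ-cong λ n pn → trans (∑-cong k λ i → lem (c i) (bl i n) (g n * w n)) (trans (∑-≟-χ k (L n) λ i → c i * (g n * w n))
          (trans (cong (λ z → z * (c (L n) * (g n * w n))) (χ-L< k (0<pp pn))) (lem (χ (n ℕ.<? 2 ^ k)) (c (L n)) (g n * w n))))))
        where
        lem : ∀ a b c → a * (b * c) ≡ b * (a * c)
        lem = solve-∀

      ∑-B₁ : ∀ g k → ∑ k (B g) ≡ P g k
      ∑-B₁ g k = trans (∑-cong k λ i → sym (*-identityˡ (B g i))) (trans (∑-B (λ _ → 1ℤ) g k) (Λ-cong λ n _ → *-identityˡ (χ (n ℕ.<? 2 ^ k) * (g n * w n))))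

      P-mono : ∀ {g} → (∀ n → 0ℤ ≤ g n) → ∀ {j k} → j ℕ.≤ k → P g j ≤ P g k
      P-mono {g} g≥0 {j} {k} j≤k = subst₂ _≤_ (∑-B₁ g j) (∑-B₁ g k) (∑-monoⁿ (B g) (B≥0 g≥0) j≤k)

      -- The part of Λ₂ coming from Λ log, and the one coming from Λ * Λ.
      P-log-upper : ∀ {g} → (∀ n → 0ℤ ≤ g n) → ∀ k → k ℕ.≤ T → Λ (λ n → ℓ n * (χ (n ℕ.<? 2 ^ k) * (g n * w n))) ≤ + κ * ∑ k λ i → + suc i * B g i
      P-log-upper {g} g≥0 k k≤T = ≤-trans (Λ-mono lam≥0 term) (≤-reflexive (trans (Λ-*ˡ (+ κ) λ n → + suc (L n) * (χ (n ℕ.<? 2 ^ k) * (g n * w n))) (cong (λ z → + κ * z) (sym (∑-B (λ i → + suc i) g k)))))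
        where
        lem : ∀ a b c d → a * b * (c * d) ≡ c * (a * b * d)
        lem = solve-∀
        term : ∀ n → PrimePower n → ℓ n * (χ (n ℕ.<? 2 ^ k) * (g n * w n)) ≤ + κ * (+ suc (L n) * (χ (n ℕ.<? 2 ^ k) * (g n * w n)))
        term n pn = ≤-trans (≤-reflexive (swap (ℓ n) (χ (n ℕ.<? 2 ^ k)) (g n * w n))) (≤-trans (χ-*-mono (n ℕ.<? 2 ^ k) λ lt → *-monoʳ (g≥0 n ⊛ w≥0 n)
            (≤-trans (proj₂ (ℓ-bounds n (0<pp pn) (ℕₚ.<-≤-trans lt (2^k≤X k≤T)))) (≤-trans (+≤+ (lg-≤ κ (0<pp pn) (ℕₚ.<⇒≤ (proj₂ (L-spec n (0<pp pn)))))) (≤-reflexive (pos-* κ (suc (L n)))))))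
          (≤-reflexive (swap′ (+ κ) (+ suc (L n)) (χ (n ℕ.<? 2 ^ k)) (g n * w n))))
          where
          swap : ∀ a b c → a * (b * c) ≡ b * (a * c)
          swap = solve-∀
          swap′ : ∀ k l b c → b * (k * l * c) ≡ k * (l * (b * c))
          swap′ = solve-∀

      P-log-lower : ∀ {g} → (∀ n → 0ℤ ≤ g n) → ∀ k → k ℕ.≤ T → (+ κ - 1ℤ) * ∑ k (λ i → + i * B g i) ≤ Λ (λ n → ℓ n * (χ (n ℕ.<? 2 ^ k) * (g n * w n)))
      P-log-lower {g} g≥0 k k≤T = ≤-trans (≤-reflexive (trans (cong (λ z → (+ κ - 1ℤ) * z) (∑-B (λ i → + i) g k)) (sym (Λ-*ˡ (+ κ - 1ℤ) λ n → + L n * (χ (n ℕ.<? 2 ^ k) * (g n * w n)))))) (Λ-mono lam≥0 term)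
        where
        term : ∀ n → PrimePower n → (+ κ - 1ℤ) * (+ L n * (χ (n ℕ.<? 2 ^ k) * (g n * w n))) ≤ ℓ n * (χ (n ℕ.<? 2 ^ k) * (g n * w n))
        term n pn = ≤-trans (≤-reflexive (swap′ (+ κ) (+ L n) (χ (n ℕ.<? 2 ^ k)) (g n * w n))) (≤-trans (χ-*-mono (n ℕ.<? 2 ^ k) λ lt → *-monoʳ (g≥0 n ⊛ w≥0 n)
            (≤-trans (+-monoˡ-≤ (- + L n) (≤-trans (≤-reflexive (sym (pos-* κ (L n)))) (+≤+ (lg-≥ κ (0<pp pn))))) (proj₁ (ℓ-bounds n (0<pp pn) (ℕₚ.<-≤-trans lt (2^k≤X k≤T))))))
          (≤-reflexive (swap (ℓ n) (χ (n ℕ.<? 2 ^ k)) (g n * w n))))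
          where
          swap : ∀ a b c → b * (a * c) ≡ a * (b * c)
          swap = solve-∀
          swap′ : ∀ k l b c → (k - 1ℤ) * (l * (b * c)) ≡ b * ((k * l + - l) * c)
          swap′ = solve-∀

      Λ-product : ∀ (f g : ℕ → ℤ) → Λ (λ a → Λ λ b → f a * g b) ≡ Λ f * Λ g
      Λ-product f g = trans (Λ-cong λ a _ → trans (Λ-*ˡ (f a) g) (*-comm (f a) (Λ g))) (trans (Λ-*ˡ (Λ g) f) (*-comm (Λ g) (Λ f)))

      -- The region a b < 2^k contains the triangle `L a` + `L b` < k - 1 and lies in the triangle
      -- `L a` + `L b` < k. As w a w b = Y w (a b), sums over products are thereby squeezed between
      -- sums over pairs of blocks.
      module Pairs (G : ℕ → ℕ → ℤ) (G≥0 : ∀ a b → 0ℤ ≤ G a b) where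

        Blk : ℕ → ℕ → ℤ
        Blk i j = Λ λ a → Λ λ b → bl i a * bl j b * (G a b * (w a * w b))

        ΛΛ : ℕ → ℤ
        ΛΛ k = Λ λ a → Λ λ b → χ (a ℕ.* b ℕ.<? 2 ^ k) * (G a b * w (a ℕ.* b))

        private
          Tri-Blk : ∀ n k → k ℕ.≤ n → Tri n k Blk ≡ Λ λ a → Λ λ b → χ (L a ℕ.+ L b ℕ.<? k) * (G a b * (w a * w b))
          Tri-Blk n k k≤n = trans (∑-cong n λ j → trans (∑-cong n λ i → sym (trans (Λ-cong λ a _ → Λ-*ˡ (χ (i ℕ.+ j ℕ.<? k)) λ b → bl i a * bl j b * (G a b * (w a * w b))) (Λ-*ˡ (χ (i ℕ.+ j ℕ.<? k)) λ a → Λ λ b → bl i a * bl j b * (G a b * (w a * w b)))))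
              (trans (sym (Λ-∑ n λ a i → Λ λ b → χ (i ℕ.+ j ℕ.<? k) * (bl i a * bl j b * (G a b * (w a * w b))))) (Λ-cong λ a _ → sym (Λ-∑ n λ b i → χ (i ℕ.+ j ℕ.<? k) * (bl i a * bl j b * (G a b * (w a * w b)))))))
            (trans (sym (Λ-∑ n λ a j → Λ λ b → ∑ n λ i → χ (i ℕ.+ j ℕ.<? k) * (bl i a * bl j b * (G a b * (w a * w b)))))
            (Λ-cong λ a _ → trans (sym (Λ-∑ n λ b j → ∑ n λ i → χ (i ℕ.+ j ℕ.<? k) * (bl i a * bl j b * (G a b * (w a * w b))))) (Λ-cong λ b _ → point (L a) (L b) (G a b * (w a * w b)))))
            where
            lem : ∀ x a b g → x * (a * b * g) ≡ a * (b * (x * g))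
            lem = solve-∀
            point : ∀ p q g → ∑ n (λ j → ∑ n λ i → χ (i ℕ.+ j ℕ.<? k) * (χ (i ℕ.≟ p) * χ (j ℕ.≟ q) * g)) ≡ χ (p ℕ.+ q ℕ.<? k) * g
            point p q g = trans (∑-cong n λ j → trans (∑-cong n λ i → lem (χ (i ℕ.+ j ℕ.<? k)) (χ (i ℕ.≟ p)) (χ (j ℕ.≟ q)) g)
                (trans (∑-≟-χ n p λ i → χ (j ℕ.≟ q) * (χ (i ℕ.+ j ℕ.<? k) * g)) (lem′ (χ (p ℕ.<? n)) (χ (j ℕ.≟ q)) (χ (p ℕ.+ j ℕ.<? k) * g))))
              (trans (∑-≟-χ n q λ j → χ (p ℕ.<? n) * (χ (p ℕ.+ j ℕ.<? k) * g)) final)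
              where
              lem′ : ∀ a b c → a * (b * c) ≡ b * (a * c)
              lem′ = solve-∀
              final : χ (q ℕ.<? n) * (χ (p ℕ.<? n) * (χ (p ℕ.+ q ℕ.<? k) * g)) ≡ χ (p ℕ.+ q ℕ.<? k) * g
              final with p ℕ.+ q ℕ.<? k
              ... | no _ = trans (cong (λ z → χ (q ℕ.<? n) * z) (trans (cong (λ z → χ (p ℕ.<? n) * z) (*-zeroˡ g)) (*-zeroʳ (χ (p ℕ.<? n))))) (trans (*-zeroʳ (χ (q ℕ.<? n))) (sym (*-zeroˡ g)))
              ... | yes lt = trans (cong₂ (λ a b → a * (b * (1ℤ * g))) (χ-yes (q ℕ.<? n) (ℕₚ.<-≤-trans (ℕₚ.≤-<-trans (ℕₚ.m≤n+m q p) lt) k≤n)) (χ-yes (p ℕ.<? n) (ℕₚ.<-≤-trans (ℕₚ.≤-<-trans (ℕₚ.m≤m+n p q) lt) k≤n)))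
                    (trans (*-identityˡ _) (*-identityˡ _))

          YΛΛ : ∀ k → k ℕ.≤ T → Y * ΛΛ k ≡ Λ λ a → Λ λ b → χ (a ℕ.* b ℕ.<? 2 ^ k) * (G a b * (w a * w b))
          YΛΛ k k≤T = trans (sym (Λ-*ˡ Y λ a → Λ λ b → χ (a ℕ.* b ℕ.<? 2 ^ k) * (G a b * w (a ℕ.* b))))
            (Λ-cong λ a pa → trans (sym (Λ-*ˡ Y λ b → χ (a ℕ.* b ℕ.<? 2 ^ k) * (G a b * w (a ℕ.* b)))) (Λ-cong λ b pb → trans (lem Y (χ (a ℕ.* b ℕ.<? 2 ^ k)) (G a b) (w (a ℕ.* b)))
              (χ-*-cong (a ℕ.* b ℕ.<? 2 ^ k) λ lt → cong (λ z → G a b * z) (sym (w-* a b (0<pp pa) (0<pp pb) (ℕₚ.<-≤-trans lt (2^k≤X k≤T)))))))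
            where
            lem : ∀ y x g w → y * (x * (g * w)) ≡ x * (g * (y * w))
            lem = solve-∀

          GW≥0 : ∀ a b → 0ℤ ≤ G a b * (w a * w b)
          GW≥0 a b = G≥0 a b ⊛ (w≥0 a ⊛ w≥0 b)

        Pair-upper : ∀ n k → k ℕ.≤ n → k ℕ.≤ T → Y * ΛΛ k ≤ Tri n k Blk
        Pair-upper n k k≤n k≤T = subst₂ _≤_ (sym (YΛΛ k k≤T)) (sym (Tri-Blk n k k≤n)) (Λ-mono lam≥0 λ a pa → Λ-mono lam≥0 λ b pb → *-monoʳ (GW≥0 a b)
          (χ-mono (a ℕ.* b ℕ.<? 2 ^ k) (L a ℕ.+ L b ℕ.<? k) λ lt → ℕₚ.≤-<-trans (L-*-≥ (0<pp pa) (0<pp pb)) (L-< (0<* (0<pp pa) (0<pp pb)) lt)))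

        Pair-lower : ∀ n k → k ℕ.≤ n → k ℕ.< T → Tri n k Blk ≤ Y * ΛΛ (suc k)
        Pair-lower n k k≤n k<T = subst₂ _≤_ (sym (Tri-Blk n k k≤n)) (sym (YΛΛ (suc k) k<T)) (Λ-mono lam≥0 λ a pa → Λ-mono lam≥0 λ b pb → *-monoʳ (GW≥0 a b)
          (χ-mono (L a ℕ.+ L b ℕ.<? k) (a ℕ.* b ℕ.<? 2 ^ suc k) λ lt → ℕₚ.<-≤-trans (proj₂ (L-spec (a ℕ.* b) (0<* (0<pp pa) (0<pp pb))))
            (2^-mono (s≤s (ℕₚ.≤-trans (L-*-≤ (0<pp pa) (0<pp pb)) lt)))))

        ΛΛ≥0 : ∀ k → 0ℤ ≤ ΛΛ k
        ΛΛ≥0 k = Λ-≥0 lam≥0 λ a _ → Λ-≥0 lam≥0 λ b _ → χ≥0 (a ℕ.* b ℕ.<? 2 ^ k) ⊛ (G≥0 a b ⊛ w≥0 (a ℕ.* b))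

    open Analysis public

    -- Mertens' and Selberg's formulas over all units and over one unit class

    module UnitClasses where

      φ : ℤ
      φ = ∑ M e

      e≥0 : ∀ n → 0ℤ ≤ e n
      e≥0 n = χ≥0 (coprime? n M)

      cl≥0 : ∀ c n → 0ℤ ≤ cl c n
      cl≥0 c n = χ≥0 (n % M ℕ.≟ c % M)

      φ≥0 : 0ℤ ≤ φ
      φ≥0 = ∑-≥0 M e≥0

      φ≤M : φ ≤ + M
      φ≤M = ≤-trans (∑-mono M λ a → χ≤1 (coprime? a M)) (≤-reflexive (trans (∑-const M 1ℤ) (*-identityʳ (+ M))))

      e-cong : ∀ {a b} → a % M ≡ b % M → e a ≡ e b
      e-cong {a} {b} eq = χ-⇔ (coprime? a M) (coprime? b M) (≈-coprime M {a} {b} eq) (≈-coprime M {b} {a} (sym eq))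

      e-* : ∀ a b → e (a ℕ.* b) ≡ e a * e b
      e-* a b = go (coprime? a M) (coprime? b M) (coprime? (a ℕ.* b) M)
        where
        0<M : 0 ℕ.< M
        0<M = ℕₚ.<⇒≤ 1<M
        go : (p : Dec (Coprime a M)) (q : Dec (Coprime b M)) (r : Dec (Coprime (a ℕ.* b) M)) → χ r ≡ χ p * χ q
        go (yes p) (yes q) r = χ-yes r (coprime-* p q 0<M)
        go (no ¬p) q r = trans (χ-no r λ h → ¬p (coprime-*ˡ {a} {b} h)) (sym (*-zeroˡ (χ q)))
        go (yes _) (no ¬q) r = χ-no r λ h → ¬q (coprime-*ˡ {b} {a} (subst (λ z → Coprime z M) (ℕₚ.*-comm a b) h))

      ∑-cl : ∀ x (f : ℕ → ℤ) → ∑ M (λ a → cl a x * f a) ≡ f (x % M)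
      ∑-cl x f = trans (∑-cong< M λ a a<M → cong (λ z → z * f a) (χ-⇔ (x % M ℕ.≟ a % M) (a ℕ.≟ x % M) (λ eq → trans (sym (m<n⇒m%n≡m a<M)) (sym eq)) λ eq → sym (trans (m<n⇒m%n≡m a<M) eq)))
        (∑-≟ f (m%n<n x M))

      ∑-e-cl : ∀ x → ∑ M (λ a → e a * cl a x) ≡ e x
      ∑-e-cl x = trans (∑-cong M λ a → *-comm (e a) (cl a x)) (trans (∑-cl x e) (e-cong {x % M} {x} (m%n%n≡m%n x M)))

      B-units : ∀ i → ∑ M (λ a → e a * B (cl a) i) ≡ B e i
      B-units i = trans (∑-cong M λ a → sym (Λ-*ˡ (e a) λ n → bl i n * (cl a n * w n))) (trans (sym (Λ-∑ M λ n a → e a * (bl i n * (cl a n * w n))))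
        (Λ-cong λ n _ → trans (∑-cong M λ a → lem (e a) (bl i n) (cl a n) (w n)) (trans (∑-*ʳ M (bl i n * w n) λ a → e a * cl a n) (trans (cong (λ z → z * (bl i n * w n)) (∑-e-cl n)) (lem′ (e n) (bl i n) (w n))))))
        where
        lem : ∀ e b c w → e * (b * (c * w)) ≡ e * c * (b * w)
        lem = solve-∀
        lem′ : ∀ e b w → e * (b * w) ≡ b * (e * w)
        lem′ = solve-∀

      Q-units : ∀ k → ∑ M (λ a → e a * Q (cl a) k) ≡ Q e k
      Q-units k = trans (∑-cong M λ a → sym (Λ₂-*ˡ (e a) λ n → χ (n ℕ.<? 2 ^ k) * (cl a n * w n))) (trans (sym (Λ₂-∑ M λ n a → e a * (χ (n ℕ.<? 2 ^ k) * (cl a n * w n))))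
        (Λ₂-cong λ n _ → trans (∑-cong M λ a → lem (e a) (χ (n ℕ.<? 2 ^ k)) (cl a n) (w n)) (trans (∑-*ʳ M (χ (n ℕ.<? 2 ^ k) * w n) λ a → e a * cl a n) (trans (cong (λ z → z * (χ (n ℕ.<? 2 ^ k) * w n)) (∑-e-cl n)) (lem′ (e n) (χ (n ℕ.<? 2 ^ k)) (w n))))))
        where
        lem : ∀ e b c w → e * (b * (c * w)) ≡ e * c * (b * w)
        lem = solve-∀
        lem′ : ∀ e b w → e * (b * w) ≡ b * (e * w)
        lem′ = solve-∀

      P≤S : ∀ {g} → (∀ n → g n ≤ 1ℤ) → ∀ k (k≤T : k ℕ.≤ T) → P g k ≤ S k k≤T
      P≤S {g} g≤1 k k≤T = Λ-mono lam≥0 λ n _ → *-monoˡ (χ≥0 (n ℕ.<? 2 ^ k)) (≤-trans (*-monoʳ (w≥0 n) (g≤1 n)) (≤-reflexive (*-identityˡ (w n))))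

      P-upper : ∀ {g} → (∀ n → g n ≤ 1ℤ) → ∀ k → k ℕ.≤ T → P g k ≤ (+ k + + 8) * u
      P-upper g≤1 k k≤T = ≤-trans (P≤S g≤1 k k≤T) (S-upper k k≤T)

      lam≤ : ∀ {p n} → Prime p → p ℕ.≤ n → lam p ≤ + κ * + n
      lam≤ {p} {n} pp p≤n = ≤-trans (+≤+ (lg-≤ κ (0<p pp) (ℕₚ.≤-trans p≤n (ℕₚ.<⇒≤ (n<2^n n))))) (≤-reflexive (pos-* κ n))

      private
        χw≤ : ∀ {x} → x ℕ.≤ X → ∀ {j m} → j ℕ.≤ m → 0 ℕ.< m → + j * (χ (m ℕ.<? x) * w m) ≤ Y
        χw≤ {x} x≤X {j} {m} j≤m 0<m = ≤-trans (≤-reflexive (lem (+ j) (χ (m ℕ.<? x)) (w m))) (χ-*-≤ (m ℕ.<? x) 0≤Y λ lt →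
          ≤-trans (*-monoʳ (w≥0 m) (+≤+ j≤m)) (≤-reflexive (w-spec m 0<m (ℕₚ.<-≤-trans lt x≤X))))
          where
          lem : ∀ a b c → a * (b * c) ≡ b * (a * c)
          lem = solve-∀

      C₀ : ℤ
      C₀ = + M * (1ℤ + + M)

      -- A prime dividing M is among the M + 1 numbers up to M, has `lam p` at most κ M, and the
      -- weights of all its powers sum to at most Y.
      ramified : ∀ k → k ℕ.≤ T → Λ (λ n → χ (n ℕ.<? 2 ^ k) * ((1ℤ - e n) * w n)) ≤ C₀ * u
      ramified k k≤T = ≤-trans (∑-mono< X row) (≤-trans (≤-reflexive (∑-*ʳ X (+ κ * + M * Y) λ p → χ (p ℕ.<? suc M)))
          (≤-trans (*-monoʳ ((0≤+ κ ⊛ 0≤+ M) ⊛ 0≤Y) (∑-χ<-≤ (suc M) X)) (≤-reflexive (lem (+ M) (+ κ) Y))))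
        where
        lem : ∀ M κ Y → (1ℤ + M) * (κ * M * Y) ≡ M * (1ℤ + M) * (κ * Y)
        lem = solve-∀
        row : ∀ p → p ℕ.< X → ∑ X (λ i → χ (prime? p) * (lam p * (χ (p ^ suc i ℕ.<? 2 ^ k) * ((1ℤ - e (p ^ suc i)) * w (p ^ suc i))))) ≤ χ (p ℕ.<? suc M) * (+ κ * + M * Y)
        row p _ = cases (prime? p) (p ∣? M)
          where
          vanish : ∀ a b w {e} → e ≡ 1ℤ → 1ℤ * (a * (b * ((1ℤ - e) * w))) ≡ 0ℤ
          vanish a b w refl = trans (cong (λ z → 1ℤ * (a * (b * z))) (*-zeroˡ w)) (trans (cong (λ z → 1ℤ * (a * z)) (*-zeroʳ b)) (cong (λ z → 1ℤ * z) (*-zeroʳ a)))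
          shrink : ∀ e w → 0ℤ ≤ e → 0ℤ ≤ w → (1ℤ - e) * w ≤ w
          shrink e w 0≤e 0≤w = by≤ (0≤e ⊛ 0≤w) (solve (e ∷ w ∷ []))
          cases : (d : Dec (Prime p)) → Dec (p ∣ M) → ∑ X (λ i → χ d * (lam p * (χ (p ^ suc i ℕ.<? 2 ^ k) * ((1ℤ - e (p ^ suc i)) * w (p ^ suc i))))) ≤ χ (p ℕ.<? suc M) * (+ κ * + M * Y)
          cases (no _) _ = ≤-trans (≤-reflexive (∑-zero< X λ i _ → *-zeroˡ (lam p * (χ (p ^ suc i ℕ.<? 2 ^ k) * ((1ℤ - e (p ^ suc i)) * w (p ^ suc i)))))) (χ≥0 (p ℕ.<? suc M) ⊛ ((0≤+ κ ⊛ 0≤+ M) ⊛ 0≤Y))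
          cases (yes pp) (no p∤M) = ≤-trans (≤-reflexive (∑-zero< X λ i _ → vanish (lam p) (χ (p ^ suc i ℕ.<? 2 ^ k)) (w (p ^ suc i)) (χ-yes (coprime? (p ^ suc i) M)
                  (no-common-prime⇒coprime (ℕₚ.<⇒≤ 1<M) λ {r} pr r∣pⁱ r∣M → p∤M (subst (_∣ M) (prime∣prime pr pp (prime∣^ p (suc i) pr r∣pⁱ)) r∣M)))))
                (χ≥0 (p ℕ.<? suc M) ⊛ ((0≤+ κ ⊛ 0≤+ M) ⊛ 0≤Y))
          cases (yes pp) (yes p∣M) = ≤-trans (∑-mono X λ i → ≤-trans (≤-reflexive (*-identityˡ _)) (*-monoˡ (lam≥0 p) (*-monoˡ (χ≥0 (p ^ suc i ℕ.<? 2 ^ k)) (shrink (e (p ^ suc i)) (w (p ^ suc i)) (e≥0 (p ^ suc i)) (w≥0 (p ^ suc i))))))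
            (≤-trans (≤-reflexive (∑-*ˡ X (lam p) λ i → χ (p ^ suc i ℕ.<? 2 ^ k) * w (p ^ suc i))) (≤-trans (*-mono (lam≥0 p) 0≤Y (lam≤ pp (∣⇒≤ p∣M))
              (∑-halving X (λ i → χ (p ^ suc i ℕ.<? 2 ^ k) * w (p ^ suc i)) Y 0≤Y λ i → χw≤ (2^k≤X k≤T) (ℕₚ.^-monoˡ-≤ (suc i) (1<p pp)) (0<^ (suc i) (0<p pp))))
            (≤-reflexive (sym (trans (cong (λ z → z * (+ κ * + M * Y)) (χ-yes (p ℕ.<? suc M) (s≤s (∣⇒≤ p∣M)))) (*-identityˡ (+ κ * + M * Y)))))))

      C₁ : ℤ
      C₁ = + 8 + C₀

      0≤C₀ : 0ℤ ≤ C₀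
      0≤C₀ = 0≤+ M ⊛ (0≤1 ⊹ 0≤+ M)

      0≤C₁ : 0ℤ ≤ C₁
      0≤C₁ = 0≤+ 8 ⊹ 0≤C₀

      -- Mertens' theorem minus the bounded share of the primes dividing M; the 8 in `C₁` covers the
      -- constants of both `S-lower` and `S-upper`.
      mertens-units : ∀ k → k ℕ.≤ T → ∑ k (B e) - + k * u ≤∣ C₁ * u
      mertens-units k k≤T = subst (λ z → z - + k * u ≤∣ C₁ * u) (sym (∑-B₁ e k))
          (lower (+ k) u C₀ (P e k) (S k k≤T) _ 0≤u split (S-lower k k≤T) (ramified k k≤T) , upper (+ k) u C₀ (P e k) (0≤C₀ ⊛ 0≤u) (P-upper (λ n → χ≤1 (coprime? n M)) k k≤T))
        where
        lem : ∀ x e w → x * w ≡ x * (e * w) + x * ((1ℤ - e) * w)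
        lem = solve-∀
        split : S k k≤T ≡ P e k + Λ (λ n → χ (n ℕ.<? 2 ^ k) * ((1ℤ - e n) * w n))
        split = trans (Λ-cong λ n _ → lem (χ (n ℕ.<? 2 ^ k)) (e n) (w n)) (Λ-+ (λ n → χ (n ℕ.<? 2 ^ k) * (e n * w n)) λ n → χ (n ℕ.<? 2 ^ k) * ((1ℤ - e n) * w n))
        lower-≡ : ∀ k u c p r → p - k * u - (- ((+ 8 + c) * u)) ≡
          ((p + r) - ((k - + 3) * u)) + (c * u - r) + + 5 * u
        lower-≡ = solve-∀
        lower : ∀ k u c p s r → 0ℤ ≤ u → s ≡ p + r → (k - + 3) * u ≤ s → r ≤ c * u → - ((+ 8 + c) * u) ≤ p - k * u
        lower k u c p s r 0≤u refl h₁ h₂ = by≤ (gap h₁ ⊹ gap h₂ ⊹ 0≤+ 5 ⊛ 0≤u) (lower-≡ k u c p r)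
        upper : ∀ k u c p → 0ℤ ≤ c * u → p ≤ (k + + 8) * u → p - k * u ≤ (+ 8 + c) * u
        upper k u c p 0≤cu h = by≤ (gap h ⊹ 0≤cu) (solve (k ∷ u ∷ c ∷ p ∷ []))

      open PartialSums (B e) (B≥0 e≥0) u C₁ 0≤u 0≤C₁ T mertens-units

      module EE = Pairs (λ a b → e a * e b) (λ a b → e≥0 a ⊛ e≥0 b)

      U : (ℕ → ℤ) → ℕ → ℤ
      U g k = ∑ k λ i → + i * B g i

      U≤kP : ∀ {g} → (∀ n → 0ℤ ≤ g n) → ∀ k → U g k ≤ + k * P g k
      U≤kP {g} g≥0 k = ≤-trans (∑-mono< k λ i i<k → *-monoʳ (B≥0 g≥0 i) (+≤+ (ℕₚ.<⇒≤ i<k))) (≤-reflexive (trans (∑-*ˡ k (+ k) (B g)) (cong (λ z → + k * z) (∑-B₁ g k))))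

      -- The purpose of a large κ: the -1 in `P-log-lower`, due to rounding, costs Y `U`, which is
      -- hereby at most u².
      U≤κu : ∀ {g} → (∀ n → 0ℤ ≤ g n) → (∀ n → g n ≤ 1ℤ) → ∀ k → k ℕ.≤ T → U g k ≤ + κ * u
      U≤κu {g} g≥0 g≤1 k k≤T = ≤-trans (U≤kP g≥0 k) (≤-trans (*-monoˡ (0≤+ k) (P-upper g≤1 k k≤T)) (≤-trans (≤-reflexive (sym (*-assoc (+ k) (+ k + + 8) u)))
        (*-monoʳ 0≤u (≤-trans (≤-reflexive (sym (pos-* k (k ℕ.+ 8)))) (+≤+ (T²≤κ k (k ℕ.+ 8) (ℕₚ.≤-trans k≤T (ℕₚ.m≤m+n T 8)) (ℕₚ.+-monoˡ-≤ 8 k≤T)))))))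

      private
        EE-Tri : ∀ n k → Tri n k EE.Blk ≡ Tri n k λ i j → B e i * B e j
        EE-Tri n k = Tri-cong n k λ i j → trans (Λ-cong λ a _ → Λ-cong λ b _ → lem (bl i a) (bl j b) (e a) (e b) (w a) (w b)) (Λ-product (λ a → bl i a * (e a * w a)) λ b → bl j b * (e b * w b))
          where
          lem : ∀ p q e f w v → p * q * (e * f * (w * v)) ≡ p * (e * w) * (q * (f * v))
          lem = solve-∀

        Q-e : ∀ k → Q e k ≡ Λ (λ n → ℓ n * (χ (n ℕ.<? 2 ^ k) * (e n * w n))) + EE.ΛΛ k
        Q-e k = +-congʳ (Λ λ n → ℓ n * (χ (n ℕ.<? 2 ^ k) * (e n * w n))) (Λ-cong λ a _ → Λ-cong λ b _ → cong (λ z → χ (a ℕ.* b ℕ.<? 2 ^ k) * (z * w (a ℕ.* b))) (e-* a b))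

      C₂ : ℤ
      C₂ = C₁ * C₁ + + 5 * C₁ + + 2

      0≤C₂ : 0ℤ ≤ C₂
      0≤C₂ = 0≤C₁ ⊛ 0≤C₁ ⊹ 0≤+ 5 ⊛ 0≤C₁ ⊹ 0≤+ 2

      -- Over all units Selberg's formula follows from Mertens' theorem by Abel summation: the Λ log
      -- part and the pair part contribute k² u² / 2 each.
      selberg : ∀ k → k ℕ.≤ T → Y * Q e k - + k * + k * (u * u) ≤∣ C₂ * + suc k * (u * u)
      selberg k k≤T = lower k k≤T , upper
        where
        upper : Y * Q e k - + k * + k * (u * u) ≤ C₂ * + suc k * (u * u)
        upper = *-cancelˡ-≤-pos _ _ (+ 2) (final (+ k) C₁ u (+ κ) Y (Q e k) (∑ k λ i → + suc i * B e i) (U e k) (∑ k (B e)) (Λ λ n → ℓ n * (χ (n ℕ.<? 2 ^ k) * (e n * w n))) (EE.ΛΛ k) (Tri k k λ i j → B e i * B e j) refl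
            0≤C₁ 0≤u (0≤+ k) 0≤Y (Q-e k) (trans (∑-cong k λ i → lem (+ i) (B e i)) (∑-+ k (λ i → + i * B e i) (B e))) (P-log-upper e≥0 k k≤T) (≤-trans (EE.Pair-upper k k ℕₚ.≤-refl k≤T) (≤-reflexive (EE-Tri k k)))
            (J-upper k k≤T) (proj₂ (mertens-units k k≤T)) (Tri-upper k k ℕₚ.≤-refl k≤T))
          where
          lem : ∀ i b → (1ℤ + i) * b ≡ i * b + b
          lem = solve-∀
          final-≡ : ∀ k C κ Y j s a b t → + 2 * ((C * C + + 5 * C + + 2) * (1ℤ + k) * ((κ * Y) * (κ * Y))) - (+ 2 * (Y * (a + b) - k * k * ((κ * Y) * (κ * Y)))) ≡
            + 2 * Y * (κ * (j + s) - a) + + 2 * (t - (Y * b)) + (κ * Y) * ((k * k + + 4 * (C * k)) * (κ * Y) - (+ 2 * j)) + + 2 * (κ * Y) * (C * (κ * Y) - (s - k * (κ * Y))) + ((k * k + k + + 4 * (C * k) + + 2 * (C * C)) * ((κ * Y) * (κ * Y)) - (+ 2 * t)) + ((κ * Y) * (κ * Y)) * (k * (+ 2 * (C * C) + + 2 * C + 1ℤ) + + 8 * C + + 4)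
          final-≡ = solve-∀
          final : ∀ k C u κ Y q s₁ j s a b t → u ≡ κ * Y → 0ℤ ≤ C → 0ℤ ≤ u → 0ℤ ≤ k → 0ℤ ≤ Y → q ≡ a + b → s₁ ≡ j + s → a ≤ κ * s₁ → Y * b ≤ t → + 2 * j ≤ (k * k + + 4 * (C * k)) * u →
            s - k * u ≤ C * u → + 2 * t ≤ (k * k + k + + 4 * (C * k) + + 2 * (C * C)) * (u * u) → + 2 * (Y * q - k * k * (u * u)) ≤ + 2 * ((C * C + + 5 * C + + 2) * (1ℤ + k) * (u * u))
          final k C u κ Y q s₁ j s a b t refl c0 u0 k0 y0 refl refl h₁ h₂ h₃ h₄ h₅ = by≤
            (0≤+ 2 ⊛ y0 ⊛ gap h₁ ⊹ 0≤+ 2 ⊛ gap h₂ ⊹ u0 ⊛ gap h₃ ⊹ 0≤+ 2 ⊛ u0 ⊛ gap h₄ ⊹ gap h₅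
              ⊹ (u0 ⊛ u0) ⊛ (k0 ⊛ (0≤+ 2 ⊛ (c0 ⊛ c0) ⊹ 0≤+ 2 ⊛ c0 ⊹ 0≤1) ⊹ 0≤+ 8 ⊛ c0 ⊹ 0≤+ 4))
            (final-≡ k C κ Y j s a b t)
        lower : ∀ k → k ℕ.≤ T → - (C₂ * + suc k * (u * u)) ≤ Y * Q e k - + k * + k * (u * u)
        lower zero _ = ≤-trans (neg-mono-≤ ((0≤C₂ ⊛ 0≤1) ⊛ (0≤u ⊛ 0≤u))) (≤-trans (0≤Y ⊛ subst (0ℤ ≤_) (sym (Q-e 0)) (Λ-≥0 lam≥0 (λ n _ → ℓ≥0 n ⊛ (χ≥0 (n ℕ.<? 1) ⊛ (e≥0 n ⊛ w≥0 n))) ⊹ EE.ΛΛ≥0 0)) (≤-reflexive (lem (Y * Q e 0) u)))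
          where
          lem : ∀ x u → x ≡ x - 0ℤ * 0ℤ * (u * u)
          lem = solve-∀
        -- Products below 2^(k+1) are compared with the triangle of size k, one less; k + 1 is
        -- therefore treated with k, and 0 apart.
        lower (suc k) k<T = *-cancelˡ-≤-pos _ _ (+ 2) (final (+ k) C₁ u (+ κ) Y (Q e (suc k)) (U e (suc k)) (Λ λ n → ℓ n * (χ (n ℕ.<? 2 ^ suc k) * (e n * w n))) (EE.ΛΛ (suc k)) (Tri k k λ i j → B e i * B e j) refl
            0≤C₁ 0≤u (0≤+ k) 0≤Y (Q-e (suc k)) (P-log-lower e≥0 (suc k) k<T) (≤-trans (≤-reflexive (sym (EE-Tri k k))) (EE.Pair-lower k k ℕₚ.≤-refl k<T))
            (J-lower (suc k) k<T) (U≤κu e≥0 (λ n → χ≤1 (coprime? n M)) (suc k) k<T) (Tri-lower k k ℕₚ.≤-refl (ℕₚ.<⇒≤ k<T)))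
          where
          final-≡ : ∀ k C κ Y j a b t → + 2 * (Y * (a + b) - (1ℤ + k) * (1ℤ + k) * ((κ * Y) * (κ * Y))) - (+ 2 * - ((C * C + + 5 * C + + 2) * (1ℤ + (1ℤ + k)) * ((κ * Y) * (κ * Y)))) ≡
            + 2 * Y * (a - ((κ - 1ℤ) * j)) + + 2 * (Y * b - t) + (κ * Y) * (+ 2 * j - (((1ℤ + k) * (1ℤ + k) - (1ℤ + k) - + 4 * (C * (1ℤ + k))) * (κ * Y))) + + 2 * Y * (κ * (κ * Y) - j) + (+ 2 * t - ((k * k + k - + 4 * (C * k) - + 2 * (C * C)) * ((κ * Y) * (κ * Y)))) + ((κ * Y) * (κ * Y)) * (k * (+ 2 * (C * C) + + 2 * C + + 2) + + 2 * (C * C) + + 16 * C + + 4)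
          final-≡ = solve-∀
          final : ∀ k C u κ Y q j a b t → u ≡ κ * Y → 0ℤ ≤ C → 0ℤ ≤ u → 0ℤ ≤ k → 0ℤ ≤ Y → q ≡ a + b → (κ - 1ℤ) * j ≤ a → t ≤ Y * b →
            ((1ℤ + k) * (1ℤ + k) - (1ℤ + k) - + 4 * (C * (1ℤ + k))) * u ≤ + 2 * j → j ≤ κ * u →
            (k * k + k - + 4 * (C * k) - + 2 * (C * C)) * (u * u) ≤ + 2 * t →
            + 2 * - ((C * C + + 5 * C + + 2) * (1ℤ + (1ℤ + k)) * (u * u)) ≤ + 2 * (Y * q - (1ℤ + k) * (1ℤ + k) * (u * u))
          final k C u κ Y q j a b t refl c0 u0 k0 y0 refl h₁ h₂ h₃ h₄ h₅ = by≤
            (0≤+ 2 ⊛ y0 ⊛ gap h₁ ⊹ 0≤+ 2 ⊛ gap h₂ ⊹ u0 ⊛ gap h₃ ⊹ 0≤+ 2 ⊛ y0 ⊛ gap h₄ ⊹ gap h₅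
              ⊹ (u0 ⊛ u0) ⊛ (k0 ⊛ (0≤+ 2 ⊛ (c0 ⊛ c0) ⊹ 0≤+ 2 ⊛ c0 ⊹ 0≤+ 2) ⊹ 0≤+ 2 ⊛ (c0 ⊛ c0) ⊹ 0≤+ 16 ⊛ c0 ⊹ 0≤+ 4))
            (final-≡ k C κ Y j a b t)

      C₃ : ℤ
      C₃ = C₂ + + M * E₀

      0≤C₃ : 0ℤ ≤ C₃
      0≤C₃ = 0≤C₂ ⊹ 0≤+ M ⊛ 0≤E₀

      -- By `Q-diff` all unit classes have nearly the same sum, so φ times one of them is the sum
      -- over the units, up to an error linear in k.
      selberg-class : ∀ {c} → Coprime c M → ∀ k → k ℕ.≤ T → φ * (Y * Q (cl c) k) - + k * + k * (u * u) ≤∣ C₃ * + suc k * (u * u)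
      selberg-class {c} cop k k≤T = subst (φ * (Y * Q (cl c) k) - + k * + k * (u * u) ≤∣_) (lem (+ M) E₀ (+ κ) (+ suc k) Y C₂)
          (average-near M e (λ a → Q (cl a) k) (Q (cl c) k) Y (+ k * + k * (u * u)) 0≤Y term (Q-units k) (selberg k k≤T))
        where
        δ : ℤ
        δ = E₀ * (+ κ * + κ) * (+ suc k * Y)
        0≤δ : 0ℤ ≤ δ
        0≤δ = (0≤E₀ ⊛ (0≤+ κ ⊛ 0≤+ κ)) ⊛ (0≤+ (suc k) ⊛ 0≤Y)
        term : ∀ a → a ℕ.< M → e a * (Q (cl c) k - Q (cl a) k) ≤∣ δ
        term a _ = χ-*-≤∣ (coprime? a M) 0≤δ λ cop′ → Q-diff cop cop′ k k≤T
        lem : ∀ m e κ k y c → y * (m * (e * (κ * κ) * (k * y))) + c * k * (κ * y * (κ * y)) ≡ (c + m * e) * k * (κ * y * (κ * y))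
        lem = solve-∀

    open UnitClasses public

    -- The quotient step for residue classes

    module SparseClasses where

      cl≤1 : ∀ c n → cl c n ≤ 1ℤ
      cl≤1 c n = χ≤1 (n % M ℕ.≟ c % M)

      -- One constant for all hypotheses of `Step`: `C₁` serves `mertens`, `C₃` + M serves `φU`, M K
      -- the sparse classes, and 2 `C₃` + 2 covers the shift from k to k + 1 in `Z-upper`.
      C₄ : ℤ → ℤ
      C₄ K = C₁ + + 2 * C₃ + + 2 + + M + + M * K

      bound : ℤ → ℤ
      bound K = + 4 * (1ℤ + + 4 * C₄ K + + 2 * (C₄ K * C₄ K))

      module _ {c c′ h : ℕ} (cop : Coprime c M) (coph : Coprime h M) (h<M : h ℕ.< M) (hc′≡c : (h ℕ.* c′) % M ≡ c % M)
        (K : ℤ) (0≤K : 0ℤ ≤ K) (m : ℕ) (2m≤T : m ℕ.+ m ℕ.≤ T) (sparse : P (cl c) (m ℕ.+ m) ≤ K * u) (sparse′ : P (cl c′) (m ℕ.+ m) ≤ K * u) where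

        private
          n : ℕ
          n = m ℕ.+ m

          s e′ : ℕ → ℕ → ℤ
          s a i = e a * B (cl a) i
          e′ a b = χ ((a ℕ.* b) % M ℕ.≟ c % M)

          C : ℤ
          C = C₄ K

          0≤MK : 0ℤ ≤ + M * K
          0≤MK = 0≤+ M ⊛ 0≤K

          0≤C : 0ℤ ≤ C
          0≤C = 0≤C₁ ⊹ 0≤+ 2 ⊛ 0≤C₃ ⊹ 0≤+ 2 ⊹ 0≤+ M ⊹ 0≤MK

          s≥0 : ∀ a i → 0ℤ ≤ s a i
          s≥0 a i = e≥0 a ⊛ B≥0 (cl≥0 a) i

          e′-sym : ∀ a b → e′ a b ≡ e′ b a
          e′-sym a b = cong (λ z → χ (z % M ℕ.≟ c % M)) (ℕₚ.*-comm a b)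

        open Step M n s e′ u C φ h h<M 0<u 0≤C φ≥0 s≥0 e′-sym

        private
          σ-unit : ∀ b (cb : Coprime b M) i → σ b i ≡ s (proj₁ (quotient-class M {b} c cb) % M) i
          σ-unit b cb i = trans (∑-cong< M λ a a<M → cong (λ z → z * s a i) (χ-⇔ ((a ℕ.* b) % M ℕ.≟ c % M) (a ℕ.≟ q % M)
                (λ eq → trans (sym (m<n⇒m%n≡m a<M)) (≈-cancel M {b} {a} {q} cb (trans (cong (_% M) (ℕₚ.*-comm b a)) (trans eq (sym bq≡c)))))
                (λ eq → trans (cong (_% M) (ℕₚ.*-comm a b)) (trans (≈-* M {b} {b} {a} {q} refl (trans (m<n⇒m%n≡m a<M) eq)) bq≡c))))
              (∑-≟ (λ a → s a i) (m%n<n q M))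
            where
            q : ℕ
            q = proj₁ (quotient-class M {b} c cb)
            bq≡c : (b ℕ.* q) % M ≡ c % M
            bq≡c = proj₂ (quotient-class M {b} c cb)

          q-coprime : ∀ b (cb : Coprime b M) → Coprime (proj₁ (quotient-class M {b} c cb) % M) M
          q-coprime b cb = ≈-coprime M {q} {q % M} (sym (m%n%n≡m%n q M)) (coprime-*ˡ {q} {b} (subst (λ z → Coprime z M) (ℕₚ.*-comm b q) (≈-coprime M {c} {b ℕ.* q} (sym (proj₂ (quotient-class M {b} c cb))) cop)))
            where
            q : ℕ
            q = proj₁ (quotient-class M {b} c cb)

          V-unit : ∀ b (cb : Coprime b M) k → V b k ≡ U (cl (proj₁ (quotient-class M {b} c cb) % M)) k
          V-unit b cb k = ∑-cong k λ i → cong (λ z → + i * z) (trans (σ-unit b cb i) (trans (cong (λ z → z * B (cl q) i) (χ-yes (coprime? q M) (q-coprime b cb))) (*-identityˡ (B (cl q) i))))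
            where
            q : ℕ
            q = proj₁ (quotient-class M {b} c cb) % M

          cl-% : ∀ a → ∀ n → cl (a % M) n ≡ cl a n
          cl-% a n = cong (λ z → χ (n % M ℕ.≟ z)) (m%n%n≡m%n a M)

          -- Selberg's formula for the class a with its nonnegative pair part discarded. This allows
          -- twice the expected size.
          φU : ∀ {a} → Coprime a M → ∀ k → k ℕ.≤ T → φ * U (cl a) k ≤ (+ k * + k + (C₃ + + M) * + suc k) * u
          φU {a} ca k k≤T = *-cancelˡ-≤-pos _ _ u ⦃ positive 0<u ⦄ (final (+ k) (+ κ) Y u φ (+ M) (U (cl a) k) (Λ λ n → ℓ n * (χ (n ℕ.<? 2 ^ k) * (cl a n * w n))) (Λ λ x → Λ λ y → χ (x ℕ.* y ℕ.<? 2 ^ k) * (cl a (x ℕ.* y) * w (x ℕ.* y))) C₃ refl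
              φ≥0 0≤Y 0≤u (0≤+ k) (0≤+ M) φ≤M (P-log-lower (cl≥0 a) k k≤T) (Λ-≥0 lam≥0 λ x _ → Λ-≥0 lam≥0 λ y _ → χ≥0 (x ℕ.* y ℕ.<? 2 ^ k) ⊛ (cl≥0 a (x ℕ.* y) ⊛ w≥0 (x ℕ.* y)))
              (U≤κu (cl≥0 a) (cl≤1 a) k k≤T) (proj₂ (selberg-class ca k k≤T)))
            where
            final-≡ : ∀ k κ Y f M U a b C → (κ * Y) * ((k * k + (C + M) * (1ℤ + k)) * (κ * Y)) - (κ * Y) * (f * U) ≡
              f * Y * (a - ((κ - 1ℤ) * U)) + f * Y * b + f * Y * (κ * (κ * Y) - U) + (C * (1ℤ + k) * ((κ * Y) * (κ * Y)) - (f * (Y * (a + b)) - k * k * ((κ * Y) * (κ * Y)))) + ((κ * Y) * (κ * Y)) * ((M - f) + M * k)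
            final-≡ = solve-∀
            final : ∀ k κ Y u f M U a b C → u ≡ κ * Y → 0ℤ ≤ f → 0ℤ ≤ Y → 0ℤ ≤ u → 0ℤ ≤ k → 0ℤ ≤ M → f ≤ M → (κ - 1ℤ) * U ≤ a → 0ℤ ≤ b → U ≤ κ * u →
              f * (Y * (a + b)) - k * k * (u * u) ≤ C * (1ℤ + k) * (u * u) → u * (f * U) ≤ u * ((k * k + (C + M) * (1ℤ + k)) * u)
            final k κ Y u f M U a b C refl f0 y0 u0 k0 m0 h₁ h₂ h₃ h₄ h₅ = by≤
              (f0 ⊛ y0 ⊛ gap h₂ ⊹ f0 ⊛ y0 ⊛ h₃ ⊹ f0 ⊛ y0 ⊛ gap h₄ ⊹ gap h₅ ⊹ (u0 ⊛ u0) ⊛ (gap h₁ ⊹ m0 ⊛ k0))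
              (final-≡ k κ Y f M U a b C)

          -- The class paired with h is c′, since h c′ ≡ c. Its mass is bounded, so its first moment
          -- grows only linearly in k.
          V-sparse : ∀ k → k ℕ.≤ n → φ * V h k ≤ + M * K * + suc k * u
          V-sparse k k≤n = ≤-trans (*-monoˡ φ≥0 (≤-trans (≤-reflexive (V-unit h coph k)) (≤-trans (U≤kP (cl≥0 (q % M)) k) (*-monoˡ (0≤+ k) (≤-trans (P-mono (cl≥0 (q % M)) k≤n)
                (≤-trans (≤-reflexive (Λ-cong λ x _ → cong (λ z → χ (x ℕ.<? 2 ^ n) * (z * w x)) (trans (cl-% q x) (cong (λ z → χ (x % M ℕ.≟ z)) q≡c′)))) sparse′))))))
              (final φ (+ M) K (+ k) u φ≤M 0≤K (0≤+ k) 0≤u (0≤+ M))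
            where
            q : ℕ
            q = proj₁ (quotient-class M {h} c coph)
            q≡c′ : q % M ≡ c′ % M
            q≡c′ = ≈-cancel M {h} {q} {c′} coph (trans (proj₂ (quotient-class M {h} c coph)) (sym hc′≡c))
            final-≡ : ∀ f M K k u → M * K * (1ℤ + k) * u - f * (k * (K * u)) ≡
              k * K * u * (M - f) + M * K * u
            final-≡ = solve-∀
            final : ∀ f M K k u → f ≤ M → 0ℤ ≤ K → 0ℤ ≤ k → 0ℤ ≤ u → 0ℤ ≤ M → f * (k * (K * u)) ≤ M * K * (1ℤ + k) * u
            final f M K k u h K0 k0 u0 m0 = by≤ (k0 ⊛ K0 ⊛ u0 ⊛ gap h ⊹ m0 ⊛ K0 ⊛ u0) (final-≡ f M K k u)

          V-bound : ∀ b k → b ℕ.< M → k ℕ.≤ n → φ * V b k ≤ ((1ℤ - χ (b ℕ.≟ h)) * (+ k * + k) + C * + suc k) * u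
          V-bound b k b<M k≤n = cases (b ℕ.≟ h) (coprime? b M)
            where
            on-h-≡ : ∀ k a b M x u → ((1ℤ - 1ℤ) * (k * k) + (a + + 2 * b + + 2 + M + x) * (1ℤ + k)) * u - (x * (1ℤ + k) * u) ≡
              (a + + 2 * b + + 2 + M) * (1ℤ + k) * u
            on-h-≡ = solve-∀
            on-h : ∀ k a b M x u → 0ℤ ≤ 1ℤ + k → 0ℤ ≤ u → 0ℤ ≤ a + + 2 * b + + 2 + M → x * (1ℤ + k) * u ≤ ((1ℤ - 1ℤ) * (k * k) + (a + + 2 * b + + 2 + M + x) * (1ℤ + k)) * u
            on-h k a b M x u k0 u0 c0 = by≤ (c0 ⊛ k0 ⊛ u0) (on-h-≡ k a b M x u)
            off-h-≡ : ∀ k a b M x u → ((1ℤ - 0ℤ) * (k * k) + (a + + 2 * b + + 2 + M + x) * (1ℤ + k)) * u - ((k * k + (b + M) * (1ℤ + k)) * u) ≡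
              (a + b + + 2 + x) * (1ℤ + k) * u
            off-h-≡ = solve-∀
            off-h : ∀ k a b M x u → 0ℤ ≤ 1ℤ + k → 0ℤ ≤ u → 0ℤ ≤ a + b + + 2 + x → (k * k + (b + M) * (1ℤ + k)) * u ≤ ((1ℤ - 0ℤ) * (k * k) + (a + + 2 * b + + 2 + M + x) * (1ℤ + k)) * u
            off-h k a b M x u k0 u0 c0 = by≤ (c0 ⊛ k0 ⊛ u0) (off-h-≡ k a b M x u)
            cases : (d : Dec (b ≡ h)) → Dec (Coprime b M) → φ * V b k ≤ ((1ℤ - χ d) * (+ k * + k) + C * + suc k) * u
            cases (yes refl) _ = ≤-trans (V-sparse k k≤n) (on-h (+ k) C₁ C₃ (+ M) (+ M * K) u (0≤+ (suc k)) 0≤u (0≤C₁ ⊹ 0≤+ 2 ⊛ 0≤C₃ ⊹ 0≤+ 2 ⊹ 0≤+ M))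
            cases (no _) (yes cb) = ≤-trans (≤-reflexive (cong (λ z → φ * z) (V-unit b cb k))) (≤-trans (φU (q-coprime b cb) k (ℕₚ.≤-trans k≤n 2m≤T))
              (off-h (+ k) C₁ C₃ (+ M) (+ M * K) u (0≤+ (suc k)) 0≤u (0≤C₁ ⊹ 0≤C₃ ⊹ 0≤+ 2 ⊹ 0≤MK)))
            cases (no _) (no ¬cb) = ≤-trans (≤-reflexive (trans (cong (λ z → φ * z) (∑-zero< k λ i _ → trans (cong (λ z → + i * z) (∑-zero< M λ a _ → trans (cong (λ z → z * s a i) (χ-no ((a ℕ.* b) % M ℕ.≟ c % M)
                λ eq → ¬cb (coprime-*ˡ {b} {a} (subst (λ z → Coprime z M) (ℕₚ.*-comm a b) (≈-coprime M {c} {a ℕ.* b} (sym eq) cop))))) (*-zeroˡ (s a i)))) (*-zeroʳ (+ i)))) (*-zeroʳ φ)))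
              (((0≤1 ⊹ ≤-refl) ⊛ (0≤+ k ⊛ 0≤+ k) ⊹ 0≤C ⊛ 0≤+ (suc k)) ⊛ 0≤u)

          module CC = Pairs (λ x y → cl c (x ℕ.* y)) (λ x y → cl≥0 c (x ℕ.* y))

          -- The pairs (x, y) with x y ≡ c, sorted by the classes a and b of x and y; both are units
          -- because c is one.
          A≡Blk : ∀ i j → A i j ≡ CC.Blk i j
          A≡Blk i j = trans (∑-cong M λ b → trans (sym (∑-*ʳ M (s b j) λ a → e′ a b * s a i)) (∑-cong M λ a → product a b))
            (trans (∑-cong M λ b → trans (sym (Λ-∑ M λ x a → Λ λ y → t a b x y)) (Λ-cong λ x _ → sym (Λ-∑ M λ y a → t a b x y)))
            (trans (sym (Λ-∑ M λ x b → Λ λ y → ∑ M λ a → t a b x y)) (Λ-cong λ x _ → trans (sym (Λ-∑ M λ y b → ∑ M λ a → t a b x y)) (Λ-cong λ y _ → pick x y))))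
            where
            t : ℕ → ℕ → ℕ → ℕ → ℤ
            t a b x y = cl b y * (cl a x * (e′ a b * (e a * e b) * (bl i x * bl j y * (w x * w y))))
            product : ∀ a b → e′ a b * s a i * s b j ≡ Λ λ x → Λ λ y → t a b x y
            product a b = trans (lem (e′ a b) (e a) (B (cl a) i) (e b) (B (cl b) j)) (trans (cong (λ z → e′ a b * (e a * e b) * z) (sym (Λ-product (λ x → bl i x * (cl a x * w x)) λ y → bl j y * (cl b y * w y))))
              (trans (sym (Λ-*ˡ (e′ a b * (e a * e b)) λ x → Λ λ y → bl i x * (cl a x * w x) * (bl j y * (cl b y * w y)))) (Λ-cong λ x _ → trans (sym (Λ-*ˡ (e′ a b * (e a * e b)) λ y → bl i x * (cl a x * w x) * (bl j y * (cl b y * w y))))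
                (Λ-cong λ y _ → lem′ (e′ a b * (e a * e b)) (bl i x) (cl a x) (w x) (bl j y) (cl b y) (w y)))))
              where
              lem : ∀ p e x f y → p * (e * x) * (f * y) ≡ p * (e * f) * (x * y)
              lem = solve-∀
              lem′ : ∀ p b c w b′ c′ w′ → p * (b * (c * w) * (b′ * (c′ * w′))) ≡ c′ * (c * (p * (b * b′ * (w * w′))))
              lem′ = solve-∀
            pick : ∀ x y → ∑ M (λ b → ∑ M λ a → t a b x y) ≡ bl i x * bl j y * (cl c (x ℕ.* y) * (w x * w y))
            pick x y = trans (∑-cong M λ b → trans (∑-*ˡ M (cl b y) λ a → cl a x * (e′ a b * (e a * e b) * r)) (cong (λ z → cl b y * z) (∑-cl x λ a → e′ a b * (e a * e b) * r)))
              (trans (∑-cl y λ b → e′ (x % M) b * (e (x % M) * e b) * r) (trans (cong (λ z → z * r) (classes x y)) (lem (cl c (x ℕ.* y)) (bl i x * bl j y) (w x * w y))))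
              where
              r : ℤ
              r = bl i x * bl j y * (w x * w y)
              lem : ∀ a b c → a * (b * c) ≡ b * (a * c)
              lem = solve-∀
              classes : ∀ x y → e′ (x % M) (y % M) * (e (x % M) * e (y % M)) ≡ cl c (x ℕ.* y)
              classes x y = trans (cong₂ _*_ (cl-cong {c} (x % M ℕ.* (y % M)) (x ℕ.* y) (≈-* M {x % M} {x} {y % M} {y} (m%n%n≡m%n x M) (m%n%n≡m%n y M)))
                  (trans (cong₂ _*_ (e-cong {x % M} {x} (m%n%n≡m%n x M)) (e-cong {y % M} {y} (m%n%n≡m%n y M))) (sym (e-* x y))))
                (unit ((x ℕ.* y) % M ℕ.≟ c % M))
                where
                unit : (d : Dec ((x ℕ.* y) % M ≡ c % M)) → χ d * e (x ℕ.* y) ≡ χ d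
                unit (yes eq) = trans (*-identityˡ (e (x ℕ.* y))) (χ-yes (coprime? (x ℕ.* y) M) (≈-coprime M {c} {x ℕ.* y} (sym eq) cop))
                unit (no _) = *-zeroˡ (e (x ℕ.* y))

          -- As c is sparse, the Λ log part of Selberg's formula for c is only linear in n, and the
          -- pairs must supply the whole main term.
          Z-lower : (+ n * + n - C * + suc n) * (u * u) ≤ φ * Tri n n A
          Z-lower = ≤-trans (final (+ n) (+ κ) Y φ (+ M) K C₁ C₃ (Λ λ x → ℓ x * (χ (x ℕ.<? 2 ^ n) * (cl c x * w x))) (CC.ΛΛ n) (Tri n n CC.Blk) φ≥0 0≤Y 0≤u (0≤+ n) 0≤K (0≤+ M) 0≤C₁ 0≤C₃ φ≤M log-small (CC.Pair-upper n n ℕₚ.≤-refl 2m≤T) (proj₁ (selberg-class cop n 2m≤T)))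
              (≤-reflexive (cong (λ z → φ * z) (sym (Tri-cong n n A≡Blk))))
            where
            log-small : Λ (λ x → ℓ x * (χ (x ℕ.<? 2 ^ n) * (cl c x * w x))) ≤ + κ * (+ n * (K * u))
            log-small = ≤-trans (P-log-upper (cl≥0 c) n 2m≤T) (*-monoˡ (0≤+ κ) (≤-trans (∑-mono< n λ i i<n → *-monoʳ (B≥0 (cl≥0 c) i) (+≤+ i<n))
              (≤-trans (≤-reflexive (trans (∑-*ˡ n (+ n) (B (cl c))) (cong (λ z → + n * z) (∑-B₁ (cl c) n)))) (*-monoˡ (0≤+ n) sparse))))
            final-≡ : ∀ n κ Y f M K c₁ c₃ a b t → f * t - ((n * n - (c₁ + + 2 * c₃ + + 2 + M + M * K) * (1ℤ + n)) * (κ * Y * (κ * Y))) ≡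
              (f * (Y * (a + b)) - n * n * (κ * Y * (κ * Y)) - (- (c₃ * (1ℤ + n) * (κ * Y * (κ * Y))))) + f * Y * (κ * (n * (K * (κ * Y))) - a) + f * (t - (Y * b)) + ((κ * Y) * (κ * Y)) * (n * K * (M - f) + (c₁ + c₃ + + 2 + M) * (1ℤ + n) + M * K)
            final-≡ = solve-∀
            final : ∀ n κ Y f M K c₁ c₃ a b t → 0ℤ ≤ f → 0ℤ ≤ Y → 0ℤ ≤ κ * Y → 0ℤ ≤ n → 0ℤ ≤ K → 0ℤ ≤ M → 0ℤ ≤ c₁ → 0ℤ ≤ c₃ → f ≤ M → a ≤ κ * (n * (K * (κ * Y))) → Y * b ≤ t →
              - (c₃ * (1ℤ + n) * (κ * Y * (κ * Y))) ≤ f * (Y * (a + b)) - n * n * (κ * Y * (κ * Y)) →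
              (n * n - (c₁ + + 2 * c₃ + + 2 + M + M * K) * (1ℤ + n)) * (κ * Y * (κ * Y)) ≤ f * t
            final n κ Y f M K c₁ c₃ a b t f0 y0 u0 n0 K0 m0 c10 c30 h₁ h₂ h₃ h₄ = by≤
              (gap h₄ ⊹ f0 ⊛ y0 ⊛ gap h₂ ⊹ f0 ⊛ gap h₃ ⊹ (u0 ⊛ u0) ⊛ (n0 ⊛ K0 ⊛ gap h₁ ⊹ (c10 ⊹ c30 ⊹ 0≤+ 2 ⊹ m0) ⊛ (0≤1 ⊹ n0) ⊹ m0 ⊛ K0))
              (final-≡ n κ Y f M K c₁ c₃ a b t)

          Z-upper : ∀ k → k ℕ.< n → φ * Tri n k A ≤ (+ k * + k + C * + suc k) * (u * u)
          Z-upper k k<n = ≤-trans (≤-reflexive (cong (λ z → φ * z) (Tri-cong n k A≡Blk))) (final (+ k) (u * u) Y φ (+ M) K C₁ C₃ (Λ λ x → ℓ x * (χ (x ℕ.<? 2 ^ suc k) * (cl c x * w x))) (CC.ΛΛ (suc k)) (Tri n k CC.Blk) φ≥0 0≤Y (0≤u ⊛ 0≤u) (0≤+ k) 0≤C₁ 0≤C₃ (0≤+ M) 0≤MK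
              (Λ-≥0 lam≥0 λ x _ → ℓ≥0 x ⊛ (χ≥0 (x ℕ.<? 2 ^ suc k) ⊛ (cl≥0 c x ⊛ w≥0 x))) (CC.Pair-lower n k (ℕₚ.<⇒≤ k<n) (ℕₚ.<-≤-trans k<n 2m≤T)) (proj₂ (selberg-class cop (suc k) (ℕₚ.≤-trans k<n 2m≤T))))
            where
            final-≡ : ∀ k v Y f M K c₁ c₃ a b t → (k * k + (c₁ + + 2 * c₃ + + 2 + M + M * K) * (1ℤ + k)) * v - f * t ≡
              (c₃ * (1ℤ + (1ℤ + k)) * v - (f * (Y * (a + b)) - (1ℤ + k) * (1ℤ + k) * v)) + f * (Y * b - t) + f * Y * a + v * ((c₁ + M + (M * K)) * (1ℤ + k) + c₃ * k + 1ℤ)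
            final-≡ = solve-∀
            final : ∀ k v Y f M K c₁ c₃ a b t → 0ℤ ≤ f → 0ℤ ≤ Y → 0ℤ ≤ v → 0ℤ ≤ k → 0ℤ ≤ c₁ → 0ℤ ≤ c₃ → 0ℤ ≤ M → 0ℤ ≤ M * K → 0ℤ ≤ a → t ≤ Y * b →
              f * (Y * (a + b)) - (1ℤ + k) * (1ℤ + k) * v ≤ c₃ * (1ℤ + (1ℤ + k)) * v → f * t ≤ (k * k + (c₁ + + 2 * c₃ + + 2 + M + M * K) * (1ℤ + k)) * v
            final k v Y f M K c₁ c₃ a b t f0 y0 v0 k0 c10 c30 m0 mk0 h₁ h₂ h₃ = by≤
              (gap h₃ ⊹ f0 ⊛ gap h₂ ⊹ f0 ⊛ y0 ⊛ h₁ ⊹ v0 ⊛ ((c10 ⊹ m0 ⊹ mk0) ⊛ (0≤1 ⊹ k0) ⊹ c30 ⊛ k0 ⊹ 0≤1))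
              (final-≡ k v Y f M K c₁ c₃ a b t)

          mertens : ∀ k → k ℕ.≤ n → ∑ k (λ j → ∑ M λ b → s b j) ≤ (+ k + C) * u
          mertens k k≤n = ≤-trans (≤-reflexive (∑-cong k B-units)) (final (+ k) C₁ C₃ (+ M) (+ M * K) u (∑ k (B e)) 0≤u (0≤+ 2 ⊛ 0≤C₃ ⊹ 0≤+ 2 ⊹ 0≤+ M ⊹ 0≤MK) (proj₂ (mertens-units k (ℕₚ.≤-trans k≤n 2m≤T))))
            where
            final-≡ : ∀ k c₁ c₃ M x u s → (k + (c₁ + + 2 * c₃ + + 2 + M + x)) * u - s ≡
              (c₁ * u - (s - k * u)) + (+ 2 * c₃ + + 2 + M + x) * u
            final-≡ = solve-∀
            final : ∀ k c₁ c₃ M x u s → 0ℤ ≤ u → 0ℤ ≤ + 2 * c₃ + + 2 + M + x → s - k * u ≤ c₁ * u → s ≤ (k + (c₁ + + 2 * c₃ + + 2 + M + x)) * u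
            final k c₁ c₃ M x u s u0 r0 h = by≤ (gap h ⊹ r0 ⊛ u0) (final-≡ k c₁ c₃ M x u s)

        -- Sparsity of c and c′ up to 2^(2 m) bounds h only up to 2^m: the halving comes from
        -- `conclusion`. The new bound depends on `K` and M alone.
        quotient-sparse : P (cl h) m ≤ bound K * u
        quotient-sparse = subst (_≤ bound K * u) (trans (∑-cong m λ i → trans (cong (λ z → z * B (cl h) i) (χ-yes (coprime? h M) coph)) (*-identityˡ (B (cl h) i))) (∑-B₁ (cl h) m))
          (conclusion mertens V-bound Z-lower Z-upper m refl)

    open SparseClasses public

    -- A class with finitely many primes is bounded

    module FewPrimes where

      private
        tail : ℕ → ℕ → ℤ
        tail k p = ∑ X λ i → χ (p ^ suc (suc i) ℕ.<? 2 ^ k) * w (p ^ suc (suc i))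

        tail≥0 : ∀ k p → 0ℤ ≤ tail k p
        tail≥0 k p = ∑-≥0 X λ i → χ≥0 (p ^ suc (suc i) ℕ.<? 2 ^ k) ⊛ w≥0 (p ^ suc (suc i))

        tail-bound : ∀ k → k ℕ.≤ T → ∀ {p} → Prime p → + (p ℕ.* p) * tail k p ≤ + 2 * Y
        tail-bound k k≤T {p} pp = ≤-trans (≤-reflexive (sym (∑-*ˡ X (+ (p ℕ.* p)) λ i → χ (p ^ suc (suc i) ℕ.<? 2 ^ k) * w (p ^ suc (suc i)))))
          (∑-halving X (λ i → + (p ℕ.* p) * (χ (p ^ suc (suc i) ℕ.<? 2 ^ k) * w (p ^ suc (suc i)))) (+ 2 * Y) (0≤+ 2 ⊛ 0≤Y) term)
          where
          lem : ∀ t q c w → + 2 * t * (q * (c * w)) ≡ + 2 * (c * (t * q * w))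
          lem = solve-∀
          term : ∀ i → + (2 ^ suc i) * (+ (p ℕ.* p) * (χ (p ^ suc (suc i) ℕ.<? 2 ^ k) * w (p ^ suc (suc i)))) ≤ + 2 * Y
          term i = ≤-trans (≤-reflexive (trans (cong (λ z → z * (+ (p ℕ.* p) * (χ (m ℕ.<? 2 ^ k) * w m))) (pos-2^suc i)) (lem (+ (2 ^ i)) (+ (p ℕ.* p)) (χ (m ℕ.<? 2 ^ k)) (w m))))
            (*-monoˡ (0≤+ 2) (χ-*-≤ (m ℕ.<? 2 ^ k) 0≤Y λ lt → ≤-trans (*-monoʳ (w≥0 m) (≤-trans (≤-reflexive (sym (pos-* (2 ^ i) (p ℕ.* p)))) (+≤+ size)))
              (≤-reflexive (w-spec m (0<^ (suc (suc i)) (0<p pp)) (ℕₚ.<-≤-trans lt (2^k≤X k≤T))))))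
            where
            m : ℕ
            m = p ^ suc (suc i)
            size : 2 ^ i ℕ.* (p ℕ.* p) ℕ.≤ m
            size = ℕₚ.≤-trans (ℕₚ.*-monoˡ-≤ (p ℕ.* p) (ℕₚ.^-monoˡ-≤ i (1<p pp))) (ℕₚ.≤-reflexive (trans (ℕₚ.*-comm (p ^ i) (p ℕ.* p)) (ℕₚ.*-assoc p p (p ^ i))))

        blocks : ∀ k (g : ℕ → ℤ) → ∑ (2 ^ k) g ≡ g 0 + ∑ k λ j → ∑ (2 ^ j) λ i → g (2 ^ j ℕ.+ i)
        blocks zero g = trans (+-identityˡ (g 0)) (sym (+-identityʳ (g 0)))
        blocks (suc k) g = trans (cong (λ z → ∑ z g) (2^suc k)) (trans (∑-split (2 ^ k) (2 ^ k) g)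
          (trans (cong (λ z → z + ∑ (2 ^ k) λ i → g (2 ^ k ℕ.+ i)) (blocks k g)) (+-assoc (g 0) (∑ k λ j → ∑ (2 ^ j) λ i → g (2 ^ j ℕ.+ i)) _)))

        -- For p in block j the squares and higher powers weigh at most 2 Y / p², hence at most 2 Y
        -- / 2^j over the whole block. Weighting by j + 1 and summing over j gives 4 · 2 Y.
        higher-powers : ∀ k → k ℕ.≤ T → ∑ X (λ p → + suc (L p) * (χ (prime? p) * tail k p)) ≤ + 8 * Y
        higher-powers k k≤T = ≤-trans (≤-reflexive (trans (cong (λ z → ∑ z λ p → + suc (L p) * f p) X≡2^T) (trans (blocks T λ p → + suc (L p) * f p)
            (trans (cong (λ z → z + ∑ T λ j → ∑ (2 ^ j) λ i → + suc (L (2 ^ j ℕ.+ i)) * f (2 ^ j ℕ.+ i)) (trans (cong (λ z → + suc (L 0) * z) (trans (cong (λ z → z * tail k 0) (χ-no (prime? 0) λ p → contradiction (0<p p) λ ())) (*-zeroˡ (tail k 0)))) (*-zeroʳ (+ suc (L 0)))))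
            (trans (+-identityˡ _) (∑-cong T λ j → trans (∑-cong< (2 ^ j) λ i i<2^j → cong (λ z → + suc z * f (2 ^ j ℕ.+ i)) (L-block {j} i<2^j)) (∑-*ˡ (2 ^ j) (+ suc j) λ i → f (2 ^ j ℕ.+ i))))))))
          (≤-trans (∑-weighted-halving T (λ j → ∑ (2 ^ j) λ i → f (2 ^ j ℕ.+ i)) (+ 2 * Y) (0≤+ 2 ⊛ 0≤Y) block) (≤-reflexive (lem Y)))
          where
          lem : ∀ Y → + 4 * (+ 2 * Y) ≡ + 8 * Y
          lem = solve-∀
          f : ℕ → ℤ
          f p = χ (prime? p) * tail k p
          lem′ : ∀ x c t → x * x * (c * t) ≡ c * (x * x * t)
          lem′ = solve-∀
          block : ∀ j → + (2 ^ j) * ∑ (2 ^ j) (λ i → f (2 ^ j ℕ.+ i)) ≤ + 2 * Y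
          block j = *-cancelˡ-≤-pos _ (+ 2 * Y) x ⦃ positive (+<+ (0<2^ j)) ⦄ (≤-trans (≤-reflexive (trans (sym (*-assoc x x _)) (sym (∑-*ˡ (2 ^ j) (x * x) λ i → f (2 ^ j ℕ.+ i)))))
            (≤-trans (∑-mono (2 ^ j) λ i → ≤-trans (≤-reflexive (lem′ x (χ (prime? (2 ^ j ℕ.+ i))) (tail k (2 ^ j ℕ.+ i)))) (χ-*-≤ (prime? (2 ^ j ℕ.+ i)) (0≤+ 2 ⊛ 0≤Y) λ pp →
                ≤-trans (*-monoʳ (tail≥0 k (2 ^ j ℕ.+ i)) (≤-trans (≤-reflexive (sym (pos-* (2 ^ j) (2 ^ j)))) (+≤+ (ℕₚ.*-mono-≤ (ℕₚ.m≤m+n (2 ^ j) i) (ℕₚ.m≤m+n (2 ^ j) i))))) (tail-bound k k≤T pp)))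
              (≤-reflexive (∑-const (2 ^ j) (+ 2 * Y)))))
            where
            x : ℤ
            x = + (2 ^ j)

      -- The primes of the class lie below N, each with logarithm at most κ N and weight at most Y,
      -- which accounts for N². Higher powers of primes are bounded whatever their class, which
      -- accounts for 8.
      few-primes : ∀ c N → (∀ p → Prime p → p % M ≡ c % M → p ℕ.< N) → ∀ k → k ℕ.≤ T → P (cl c) k ≤ (+ N * + N + + 8) * u
      few-primes c N few k k≤T = ≤-trans (∑-mono X row) (≤-trans (≤-reflexive (trans (∑-+ X (λ p → χ (p ℕ.<? N) * (+ κ * + N * Y)) λ p → + κ * (+ suc (L p) * (χ (prime? p) * tail k p)))
          (cong₂ _+_ (∑-*ʳ X (+ κ * + N * Y) λ p → χ (p ℕ.<? N)) (∑-*ˡ X (+ κ) λ p → + suc (L p) * (χ (prime? p) * tail k p)))))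
        (≤-trans (+-mono-≤ (*-monoʳ ((0≤+ κ ⊛ 0≤+ N) ⊛ 0≤Y) (∑-χ<-≤ N X)) (*-monoˡ (0≤+ κ) (higher-powers k k≤T))) (≤-reflexive (lem (+ N) (+ κ) Y))))
        where
        lem : ∀ N κ Y → N * (κ * N * Y) + κ * (+ 8 * Y) ≡ (N * N + + 8) * (κ * Y)
        lem = solve-∀
        x X′ : ℕ
        x = 2 ^ k
        X′ = X ℕ.∸ 1
        X≡ : X ≡ suc X′
        X≡ = sym (ℕₚ.m+[n∸m]≡n 0<X)
        row : ∀ p → ∑ X (λ i → χ (prime? p) * (lam p * (χ (p ^ suc i ℕ.<? x) * (cl c (p ^ suc i) * w (p ^ suc i))))) ≤ χ (p ℕ.<? N) * (+ κ * + N * Y) + + κ * (+ suc (L p) * (χ (prime? p) * tail k p))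
        row p = cases (prime? p)
          where
          Θ : ℕ → ℤ
          Θ i = χ (p ^ suc i ℕ.<? x) * (cl c (p ^ suc i) * w (p ^ suc i))
          swap : ∀ a b c w → a * (b * (c * w)) ≡ b * (c * (a * w))
          swap = solve-∀
          0≤z : 0ℤ ≤ χ (p ℕ.<? N) * (+ κ * + N * Y)
          0≤z = χ≥0 (p ℕ.<? N) ⊛ ((0≤+ κ ⊛ 0≤+ N) ⊛ 0≤Y)
          first : Prime p → lam p * Θ 0 ≤ χ (p ℕ.<? N) * (+ κ * + N * Y)
          first pp = ≤-trans (≤-reflexive (trans (cong (λ m → lam p * (χ (m ℕ.<? x) * (cl c m * w m))) (ℕₚ.*-identityʳ p)) (swap (lam p) (χ (p ℕ.<? x)) (cl c p) (w p))))
            (χ-*-≤ (p ℕ.<? x) 0≤z λ p<x → χ-*-≤ (p % M ℕ.≟ c % M) 0≤z λ p≡c → ≤-trans (*-mono (lam≥0 p) 0≤Y (lam≤ pp (ℕₚ.<⇒≤ (few p pp p≡c))) (w≤Y p (0<p pp) (ℕₚ.<-≤-trans p<x (2^k≤X k≤T))))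
              (≤-reflexive (sym (trans (cong (λ z → z * (+ κ * + N * Y)) (χ-yes (p ℕ.<? N) (few p pp p≡c))) (*-identityˡ (+ κ * + N * Y))))))
          rest : Prime p → lam p * ∑ X′ (λ i → Θ (suc i)) ≤ + κ * (+ suc (L p) * (1ℤ * tail k p))
          rest pp = ≤-trans (*-mono (lam≥0 p) (tail≥0 k p) (≤-trans (+≤+ (lg-≤ κ (0<p pp) (ℕₚ.<⇒≤ (proj₂ (L-spec p (0<p pp)))))) (≤-reflexive (pos-* κ (suc (L p)))))
              (≤-trans (∑-mono X′ λ i → *-monoˡ (χ≥0 (p ^ suc (suc i) ℕ.<? x)) (≤-trans (*-monoʳ (w≥0 (p ^ suc (suc i))) (cl≤1 c (p ^ suc (suc i)))) (≤-reflexive (*-identityˡ (w (p ^ suc (suc i)))))))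
                (∑-monoⁿ {X′} {X} (λ i → χ (p ^ suc (suc i) ℕ.<? x) * w (p ^ suc (suc i))) (λ i → χ≥0 (p ^ suc (suc i) ℕ.<? x) ⊛ w≥0 (p ^ suc (suc i))) (ℕₚ.m∸n≤m X 1))))
            (≤-reflexive (trans (*-assoc (+ κ) (+ suc (L p)) (tail k p)) (cong (λ z → + κ * (+ suc (L p) * z)) (sym (*-identityˡ (tail k p))))))
          cases : (d : Dec (Prime p)) → ∑ X (λ i → χ d * (lam p * (χ (p ^ suc i ℕ.<? x) * (cl c (p ^ suc i) * w (p ^ suc i))))) ≤ χ (p ℕ.<? N) * (+ κ * + N * Y) + + κ * (+ suc (L p) * (χ d * tail k p))
          cases (no _) = ≤-trans (≤-reflexive (∑-zero< X λ i _ → *-zeroˡ (lam p * (χ (p ^ suc i ℕ.<? x) * (cl c (p ^ suc i) * w (p ^ suc i))))))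
              (χ≥0 (p ℕ.<? N) ⊛ ((0≤+ κ ⊛ 0≤+ N) ⊛ 0≤Y) ⊹ 0≤+ κ ⊛ (0≤+ (suc (L p)) ⊛ ≤-reflexive (sym (*-zeroˡ (tail k p)))))
          cases (yes pp) = ≤-trans (≤-reflexive (trans (∑-cong X λ i → *-identityˡ (lam p * Θ i)) (trans (cong (λ z → ∑ z λ i → lam p * Θ i) X≡) (trans (∑-head X′ λ i → lam p * Θ i) (+-congʳ (lam p * Θ 0) (∑-*ˡ X′ (lam p) λ i → Θ (suc i)))))))
            (+-mono-≤ (first pp) (rest pp))

    open FewPrimes public

-- Bounded classes, with constants uniform in the cutoff

module Classes where

  open import Data.Integer hiding (suc; _^_; _/_; _%_; NonZero)
  open import Data.Integer.Properties
  open import Data.Integer.Tactic.RingSolver using (solve-∀; solve)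
  open import Data.List using ([]; _∷_)
  open import Data.Nat as ℕ using (ℕ; zero; suc; z≤n; s≤s; _^_; NonZero)
  import Data.Nat.Properties as ℕₚ
  open import Data.Nat.Coprimality using (Coprime; coprime?)
  open import Data.Nat.DivMod using (_%_; _/_; m*[n/m]≡n; n/1≡n; m%n<n; m%n%n≡m%n)
  open import Data.Nat.Primality using (Prime)
  open import Data.Product using (proj₁)
  open import Relation.Binary.PropositionalEquality hiding (J)
  open import Data.Nat using (_!)
  open import Data.Nat.Properties using (1≤n!)
  open import Data.Empty using (⊥)
  open import Relation.Nullary using (yes; no; ¬_; contradiction)
  open Sums
  open Arith
  open Mertens
  open Modular
  open Selberg

  weight : ℕ → ℕ → ℤ
  weight X zero = + (X !)
  weight X (suc n) = + (X ! / suc n)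

  scale-κ : ℕ → ℕ
  scale-κ T = 4 ℕ.* ((T ℕ.+ 8) ℕ.* (T ℕ.+ 8)) ℕ.* 2 ^ T

  module Scale (M : ℕ) ⦃ _ : NonZero M ⦄ (1<M : 1 ℕ.< M) (T : ℕ) (1≤T : 1 ℕ.≤ T) where

    weight≥0 : ∀ n → 0ℤ ≤ weight (2 ^ T) n
    weight≥0 zero = 0≤+ _
    weight≥0 (suc n) = 0≤+ _

    weight-spec : ∀ n → 0 ℕ.< n → n ℕ.< 2 ^ T → + n * weight (2 ^ T) n ≡ + ((2 ^ T) !)
    weight-spec (suc n) 0<n n<X = trans (sym (pos-* (suc n) ((2 ^ T) ! / suc n))) (cong +_ (m*[n/m]≡n (∣! (2 ^ T) 0<n (ℕₚ.<⇒≤ n<X))))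

    scaling : Scaling
    scaling = record
      { T = T ; X = 2 ^ T ; κ = scale-κ T ; Y = + ((2 ^ T) !) ; w = weight (2 ^ T) ; X≡2^T = refl ; κ-big = ℕₚ.≤-refl ; 1≤T = 1≤T
      ; 0<Y = +<+ (1≤n! (2 ^ T)) ; w≥0 = weight≥0 ; w-spec = weight-spec ; w-0 = cong +_ (sym (n/1≡n ((2 ^ T) !))) }

    open Sieve M 1<M scaling public

  module _ (M : ℕ) ⦃ _ : NonZero M ⦄ (1<M : 1 ℕ.< M) where

    -- Each cutoff T has its own scaling and its own unit `u`. One `K` must serve for all k and T,
    -- while `T₀` only says how large T has to be before the sum up to 2^k is considered; it grows
    -- when quotients are taken, as these look up to 2^(2 k).
    record Bounded (c : ℕ) : Set where
      field
        K : ℤ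
        0≤K : 0ℤ ≤ K
        T₀ : ℕ → ℕ
        at : ∀ k T (1≤T : 1 ℕ.≤ T) → T₀ k ℕ.≤ T → Scale.P M 1<M T 1≤T (Scale.cl M 1<M T 1≤T c) k ≤ K * Scale.u M 1<M T 1≤T

    open Bounded

    bounded-thin : ∀ c N → (∀ p → Prime p → p % M ≡ c % M → p ℕ.< N) → Bounded c
    bounded-thin c N few = record
      { K = + N * + N + + 8 ; 0≤K = 0≤+ N ⊛ 0≤+ N ⊹ 0≤+ 8 ; T₀ = λ k → k
      ; at = λ k T 1≤T k≤T → Scale.few-primes M 1<M T 1≤T c N few k k≤T }

    bounded-cong : ∀ {c c′} → c % M ≡ c′ % M → Bounded c → Bounded c′
    bounded-cong {c} {c′} eq b = record { K = K b ; 0≤K = 0≤K b ; T₀ = T₀ b ; at = λ k T 1≤T h →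
      subst (λ z → Scale.Λ M 1<M T 1≤T (λ n → χ (n ℕ.<? 2 ^ k) * (χ (n % M ℕ.≟ z) * weight (2 ^ T) n)) ≤ K b * Scale.u M 1<M T 1≤T) eq (at b k T 1≤T h) }

    bounded-quotient : ∀ {c c′ h} → Coprime c M → Coprime h M → (h ℕ.* c′) % M ≡ c % M → Bounded c → Bounded c′ → Bounded h
    bounded-quotient {c} {c′} {h} cop coph hc′≡c b b′ = bounded-cong {h % M} {h} (m%n%n≡m%n h M) record
      { K = + 4 * (1ℤ + + 4 * C + + 2 * (C * C)) ; 0≤K = 0≤+ 4 ⊛ (0≤1 ⊹ 0≤+ 4 ⊛ 0≤C ⊹ 0≤+ 2 ⊛ (0≤C ⊛ 0≤C))
      ; T₀ = λ k → (k ℕ.+ k) ℕ.+ (T₀ b (k ℕ.+ k) ℕ.+ T₀ b′ (k ℕ.+ k))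
      ; at = λ k T 1≤T h≤ → Scale.quotient-sparse M 1<M T 1≤T {c} {c′} {h % M} cop (≈-coprime M {h} {h % M} (sym (m%n%n≡m%n h M)) coph) (m%n<n h M)
          (trans (≈-* M {h % M} {h} {c′} {c′} (m%n%n≡m%n h M) refl) hc′≡c) K′ 0≤K′ k (ℕₚ.≤-trans (ℕₚ.m≤m+n _ _) h≤)
          (≤-trans (at b (k ℕ.+ k) T 1≤T (ℕₚ.≤-trans (ℕₚ.≤-trans (ℕₚ.m≤m+n _ _) (ℕₚ.m≤n+m _ (k ℕ.+ k))) h≤)) (*-monoʳ {K b} {K′} (Scale.0≤u M 1<M T 1≤T) K≤K′))
          (≤-trans (at b′ (k ℕ.+ k) T 1≤T (ℕₚ.≤-trans (ℕₚ.≤-trans (ℕₚ.m≤n+m _ _) (ℕₚ.m≤n+m _ (k ℕ.+ k))) h≤)) (*-monoʳ {K b′} {K′} (Scale.0≤u M 1<M T 1≤T) K≤K″)) }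
      where
      K′ : ℤ
      K′ = K b + K b′
      0≤K′ : 0ℤ ≤ K′
      0≤K′ = 0≤K b ⊹ 0≤K b′
      lem : ∀ a b → a + b - a ≡ b
      lem = solve-∀
      lem′ : ∀ a b → a + b - b ≡ a
      lem′ = solve-∀
      K≤K′ : K b ≤ K′
      K≤K′ = by≤ (0≤K b′) (lem (K b) (K b′))
      K≤K″ : K b′ ≤ K′
      K≤K″ = by≤ (0≤K b) (lem′ (K b) (K b′))
      C : ℤ
      -- The constants involve M and `K′` but not T, so their value at T = 1 is their value at every
      -- T.
      C = Scale.C₄ M 1<M 1 ℕₚ.≤-refl K′
      0≤C : 0ℤ ≤ C
      0≤C = Scale.0≤C₁ M 1<M 1 ℕₚ.≤-refl ⊹ 0≤+ 2 ⊛ Scale.0≤C₃ M 1<M 1 ℕₚ.≤-refl ⊹ 0≤+ 2 ⊹ 0≤+ M ⊹ 0≤+ M ⊛ 0≤K′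

    not-all-bounded : ¬ (∀ c → Coprime c M → Bounded c)
    not-all-bounded all = contradiction-at (total M)
      where
      record Total (n : ℕ) : Set where
        field
          Kₙ : ℕ
          Tₙ : ℕ → ℕ
          atₙ : ∀ k T (1≤T : 1 ℕ.≤ T) → Tₙ k ℕ.≤ T → ∑ n (λ a → Scale.e M 1<M T 1≤T a * Scale.P M 1<M T 1≤T (Scale.cl M 1<M T 1≤T a) k) ≤ + Kₙ * Scale.u M 1<M T 1≤T
      open Total
      total : ∀ n → Total n
      total zero = record { Kₙ = 0 ; Tₙ = λ _ → 0 ; atₙ = λ k T 1≤T _ → ≤-reflexive (sym (*-zeroˡ (Scale.u M 1<M T 1≤T))) }
      total (suc n) with coprime? n M | total n
      ... | no ¬c | r = record { Kₙ = Kₙ r ; Tₙ = Tₙ r ; atₙ = λ k T 1≤T h → ≤-trans (≤-reflexive (trans (+-congʳ (∑ n λ a → Scale.e M 1<M T 1≤T a * Scale.P M 1<M T 1≤T (Scale.cl M 1<M T 1≤T a) k)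
            (trans (cong (λ z → z * Scale.P M 1<M T 1≤T (Scale.cl M 1<M T 1≤T n) k) (χ-no (coprime? n M) ¬c)) (*-zeroˡ (Scale.P M 1<M T 1≤T (Scale.cl M 1<M T 1≤T n) k)))) (+-identityʳ _))) (atₙ r k T 1≤T h) }
      ... | yes c | r = record { Kₙ = Kₙ r ℕ.+ ∣ K b ∣ ; Tₙ = λ k → Tₙ r k ℕ.+ T₀ b k
            ; atₙ = λ k T 1≤T h → ≤-trans (+-mono-≤ (atₙ r k T 1≤T (ℕₚ.≤-trans (ℕₚ.m≤m+n _ _) h))
                (≤-trans (≤-reflexive (trans (cong (λ z → z * Scale.P M 1<M T 1≤T (Scale.cl M 1<M T 1≤T n) k) (χ-yes (coprime? n M) c)) (*-identityˡ (Scale.P M 1<M T 1≤T (Scale.cl M 1<M T 1≤T n) k)))) (at b k T 1≤T (ℕₚ.≤-trans (ℕₚ.m≤n+m _ (Tₙ r k)) h))))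
              (≤-reflexive (trans (cong (λ z → + Kₙ r * Scale.u M 1<M T 1≤T + z * Scale.u M 1<M T 1≤T) (sym (0≤i⇒+∣i∣≡i (0≤K b)))) (sym (*-distribʳ-+ (Scale.u M 1<M T 1≤T) (+ Kₙ r) (+ ∣ K b ∣))))) }
        where
        b : Bounded n
        b = all n c
      contradiction-at : Total M → ⊥
      contradiction-at r = contradiction (*-cancelʳ-≤-pos _ _ u′ ⦃ positive (Scale.0<u M 1<M T 1≤T) ⦄ chain) too-big
        where
        C : ℤ
        C = Scale.C₁ M 1<M 1 ℕₚ.≤-refl
        k T : ℕ
        -- One more than Mertens' error and the total bound together, so that k - C ≤ K fails.
        k = suc (∣ C ∣ ℕ.+ Kₙ r)
        T = k ℕ.+ Tₙ r k
        1≤T : 1 ℕ.≤ T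
        1≤T = s≤s z≤n
        u′ : ℤ
        u′ = Scale.u M 1<M T 1≤T
        e′ : ℕ → ℤ
        e′ = Scale.e M 1<M T 1≤T
        final : ∀ k C u s K → - (C * u) ≤ s - k * u → s ≤ K * u → (k - C) * u ≤ K * u
        final k C u s K h₁ h₂ = by≤ (gap h₁ ⊹ gap h₂) (solve (k ∷ C ∷ u ∷ s ∷ K ∷ []))
        s : ℤ
        s = ∑ k (Scale.B M 1<M T 1≤T e′)
        s≤ : s ≤ + Kₙ r * u′
        s≤ = ≤-trans (≤-reflexive (trans (∑-cong k λ i → sym (Scale.B-units M 1<M T 1≤T i)) (trans (∑-swap k M λ i a → e′ a * Scale.B M 1<M T 1≤T (Scale.cl M 1<M T 1≤T a) i)
          (∑-cong M λ a → trans (∑-*ˡ k (e′ a) (Scale.B M 1<M T 1≤T (Scale.cl M 1<M T 1≤T a))) (cong (λ z → e′ a * z) (Scale.∑-B₁ M 1<M T 1≤T (Scale.cl M 1<M T 1≤T a) k))))))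
          (atₙ r k T 1≤T (ℕₚ.m≤n+m (Tₙ r k) k))
        chain : (+ k - C) * u′ ≤ + Kₙ r * u′
        chain = final (+ k) C u′ s (+ Kₙ r) (proj₁ (Scale.mertens-units M 1<M T 1≤T k (ℕₚ.m≤m+n k (Tₙ r k)))) s≤
        too-big : ¬ (+ k - C ≤ + Kₙ r)
        too-big h = contradiction (by≤ {1ℤ} {0ℤ} (gap h) (trans (sym (lem (+ ∣ C ∣) (+ Kₙ r))) (cong (λ z → + Kₙ r - (1ℤ + (+ ∣ C ∣ + + Kₙ r) - z)) (0≤i⇒+∣i∣≡i (Scale.0≤C₁ M 1<M 1 ℕₚ.≤-refl))))) λ { (+≤+ ()) }
          where
          lem : ∀ c K → K - (1ℤ + (c + K) - c) ≡ 0ℤ - 1ℤ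
          lem = solve-∀

-- From thin classes for two primes q to all units

module Group where

  open import Data.Empty using (⊥)
  open import Data.Nat
  open import Data.Nat.Coprimality using (Coprime) renaming (sym to coprime-sym)
  open import Data.Nat.Divisibility
  open import Data.Nat.DivMod
  open import Data.Nat.Primality
  open import Data.Nat.Properties
  open import Data.Product using (Σ; _×_; _,_)
  open import Relation.Binary.PropositionalEquality
  open import Relation.Nullary using (¬_)
  open Arith using (1<p; 0<p; 0<*; prime∣prime; no-common-prime⇒coprime)
  open Modular
  open Classes

  -- What the polynomial side hands to the analytic side. `Thin u` says that the class (a, u) modulo
  -- q j has no prime from N on, and `thin` provides enough such classes: every unit v modulo j is a
  -- ratio of two of them.
  record SparseUnits (N : ℕ) : Set where
    field
      q j a : ℕ
      prime-q : Prime q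
      0<j : 0 < j
      q⊥j : Coprime q j
      a⊥q : Coprime a q

    instance
      q≢0 : NonZero q
      q≢0 = >-nonZero (0<p prime-q)
      j≢0 : NonZero j
      j≢0 = >-nonZero 0<j

    Thin : ℕ → Set
    Thin u = ∀ p → Prime p → p % q ≡ a % q → p % j ≡ u % j → p < N

    field
      thin : ∀ v → Coprime v j → Σ ℕ λ u → Coprime u j × Thin u × Thin (u * v)

  module _ {N : ℕ} (M : ℕ) ⦃ M≢0 : NonZero M ⦄ (1<M : 1 < M) (S : SparseUnits N) (qj∣M : SparseUnits.q S * SparseUnits.j S ∣ M) where

    open SparseUnits S

    private
      q∣M : q ∣ M
      q∣M = ∣-trans (m∣m*n j) qj∣M

      j∣M : j ∣ M
      j∣M = ∣-trans (n∣m*n q) qj∣M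

      instance
        qj≢0 : NonZero (q * j)
        qj≢0 = m*n≢0 q j

      thin⇒bounded : ∀ {c u} → c % q ≡ a % q → c % j ≡ u % j → Thin u → Bounded M 1<M c
      thin⇒bounded {c} {u} c≡a c≡u t = bounded-thin M 1<M c N λ p pp p≡c →
        t p pp (trans (≈-reduce M {q} {p} {c} q∣M p≡c) c≡a) (trans (≈-reduce M {j} {p} {c} j∣M p≡c) c≡u)

    -- Take u with u and u h thin, and a unit c′ in the class (a, u). Since h ≡ 1 mod q, the product
    -- h c′ lies in (a, u h), so h is a ratio of two bounded units.
    one-mod-q-bounded : ∀ {h} → Coprime h M → h % q ≡ 1 % q → Bounded M 1<M h
    one-mod-q-bounded {h} h⊥M h≡1 with thin h (coprime-∣ʳ j∣M h⊥M)
    ... | u , u⊥j , tu , tuh with crt {q} {j} q⊥j a u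
    ...   | x , x≡a , x≡u with coprime-lift {x} (q * j) M (>-nonZero⁻¹ M) x⊥qj
      where
      x⊥qj : Coprime x (q * j)
      x⊥qj = coprime-sym (coprime-* (coprime-sym (≈-coprime q {a} {x} (sym x≡a) a⊥q)) (coprime-sym (≈-coprime j {u} {x} (sym x≡u) u⊥j)) 0<x)
        where
        0<x : 0 < x
        0<x = n≢0⇒n>0 λ { refl → ¬prime[1] (subst Prime (≈-coprime q {a} {0} (sym x≡a) a⊥q {q} (q ∣0 , ∣-refl)) prime-q) }
    ...     | c′ , c′≡x , c′⊥M = bounded-quotient M 1<M {h * c′} {c′} {h} (coprime-* h⊥M c′⊥M (>-nonZero⁻¹ M)) h⊥M refl
        (thin⇒bounded (trans (≈-* q {h} {1} {c′} {c′} h≡1 refl) (trans (cong (_% q) (*-identityˡ c′)) c′≡a)) (trans (≈-* j {h} {h} {c′} {u} refl c′≡u) (cong (_% j) (*-comm h u))) tuh)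
        (thin⇒bounded c′≡a c′≡u tu)
      where
      c′≡a : c′ % q ≡ a % q
      c′≡a = trans (≈-reduce (q * j) {q} {c′} {x} (m∣m*n j) c′≡x) x≡a
      c′≡u : c′ % j ≡ u % j
      c′≡u = trans (≈-reduce (q * j) {j} {c′} {x} (n∣m*n q) c′≡x) x≡u

  -- A unit h is a quotient of units that are 1 modulo q₁ or modulo q₂.
  two-moduli : ∀ {N} (S₁ S₂ : SparseUnits N) → ¬ SparseUnits.q S₁ ≡ SparseUnits.q S₂ → ⊥
  two-moduli S₁ S₂ q₁≢q₂ = not-all-bounded M 1<M λ h h⊥M → all h h⊥M
    where
    open SparseUnits S₁ renaming (q to q₁; j to j₁; prime-q to pq₁; 0<j to 0<j₁)
    open SparseUnits S₂ using () renaming (q to q₂; j to j₂; prime-q to pq₂; 0<j to 0<j₂; q≢0 to q₂≢0)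
    instance
      _ = q₂≢0
    M : ℕ
    M = q₁ * j₁ * (q₂ * j₂)
    0<M : 0 < M
    0<M = 0<* (0<* (0<p pq₁) 0<j₁) (0<* (0<p pq₂) 0<j₂)
    instance
      M≢0 : NonZero M
      M≢0 = >-nonZero 0<M
    d₁ : q₁ * j₁ ∣ M
    d₁ = m∣m*n (q₂ * j₂)
    d₂ : q₂ * j₂ ∣ M
    d₂ = n∣m*n (q₁ * j₁)
    q₁∣M : q₁ ∣ M
    q₁∣M = ∣-trans (m∣m*n j₁) d₁
    q₂∣M : q₂ ∣ M
    q₂∣M = ∣-trans (m∣m*n j₂) d₂
    1<M : 1 < M
    1<M = <-≤-trans (1<p pq₁) (∣⇒≤ q₁∣M)
    q₁⊥q₂ : Coprime q₁ q₂
    q₁⊥q₂ = no-common-prime⇒coprime (0<p pq₂) λ pr r∣q₁ r∣q₂ → q₁≢q₂ (trans (sym (prime∣prime pr pq₁ r∣q₁)) (prime∣prime pr pq₂ r∣q₂))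
    instance
      q₁q₂≢0 : NonZero (q₁ * q₂)
      q₁q₂≢0 = m*n≢0 q₁ q₂
    all : ∀ h → Coprime h M → Bounded M 1<M h
    all h h⊥M with crt {q₁} {q₂} q₁⊥q₂ 1 h
    ... | x , x≡1 , x≡h with coprime-lift {x} (q₁ * q₂) M 0<M x⊥
      where
      x⊥ : Coprime x (q₁ * q₂)
      x⊥ = coprime-sym (coprime-* (coprime-sym (≈-coprime q₁ {1} {x} (sym x≡1) λ (d∣1 , _) → ∣1⇒≡1 d∣1)) (coprime-sym (≈-coprime q₂ {h} {x} (sym x≡h) (coprime-∣ʳ q₂∣M h⊥M)))
        (n≢0⇒n>0 λ { refl → ¬prime[1] (subst Prime (≈-coprime q₁ {1} {0} (sym x≡1) (λ (d∣1 , _) → ∣1⇒≡1 d∣1) {q₁} (q₁ ∣0 , ∣-refl)) pq₁) }))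
    ...   | h₁ , h₁≡x , h₁⊥M with inverse M {h₁} h₁⊥M
    -- h is the ratio of h i and i. As h₁ is 1 modulo q₁ and h modulo q₂, its inverse i is 1 modulo
    -- q₁, and h i is 1 modulo q₂.
    ...     | i , h₁i≡1 = bounded-quotient M 1<M {h * i} {i} {h} (coprime-* h⊥M i⊥M 0<M) h⊥M refl
        (one-mod-q-bounded M 1<M S₂ d₂ (coprime-* h⊥M i⊥M 0<M) hi≡1) (one-mod-q-bounded M 1<M S₁ d₁ i⊥M i≡1)
      where
      h₁≡1 : h₁ % q₁ ≡ 1 % q₁
      h₁≡1 = trans (≈-reduce (q₁ * q₂) {q₁} {h₁} {x} (m∣m*n q₂) h₁≡x) x≡1
      h₁≡h : h₁ % q₂ ≡ h % q₂
      h₁≡h = trans (≈-reduce (q₁ * q₂) {q₂} {h₁} {x} (n∣m*n q₁) h₁≡x) x≡h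
      i⊥M : Coprime i M
      i⊥M = coprime-*ˡ {i} {h₁} (≈-coprime M {1} {i * h₁} (trans (sym h₁i≡1) (cong (_% M) (*-comm h₁ i))) λ (d∣1 , _) → ∣1⇒≡1 d∣1)
      i≡1 : i % q₁ ≡ 1 % q₁
      i≡1 = trans (cong (_% q₁) (sym (*-identityˡ i))) (trans (≈-* q₁ {1} {h₁} {i} {i} (sym h₁≡1) refl) (≈-reduce M {q₁} {h₁ * i} {1} q₁∣M h₁i≡1))
      hi≡1 : (h * i) % q₂ ≡ 1 % q₂
      hi≡1 = trans (≈-* q₂ {h} {h₁} {i} {i} (sym h₁≡h) refl) (≈-reduce M {q₂} {h₁ * i} {1} q₂∣M h₁i≡1)

-- Integer polynomials up to trailing zeros: ring structure, division, composition, evaluation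

module Poly where

  open import Defs
  open import Algebra.Bundles using (CommutativeRing)
  open import Data.Integer hiding (suc; _^_; _/_; _%_; NonZero)
  open import Data.Integer.Properties
  open import Data.Integer.Tactic.RingSolver using () renaming (solve-∀ to ℤ-solve-∀)
  open import Data.List using ([]; _∷_; _++_; [_]; length)
  open import Data.Maybe using (Maybe; just; nothing)
  open import Data.Nat as ℕ using (ℕ; zero; suc; z≤n; s≤s)
  import Data.Nat.Properties as ℕₚ
  open import Data.Product using (Σ; _,_)
  open import Level using (0ℓ)
  open import Relation.Binary.PropositionalEquality hiding ([_])
  open import Relation.Nullary using (yes; no; ¬_; contradiction)
  open import Tactic.RingSolver using (solve-∀)
  open import Tactic.RingSolver.Core.AlmostCommutativeRing using (AlmostCommutativeRing; fromCommutativeRing)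

  coef : Poly → ℕ → ℤ
  coef [] _ = 0ℤ
  coef (a ∷ p) zero = a
  coef (a ∷ p) (suc n) = coef p n

  infix 4 _≋_
  -- Coefficientwise equality ignores trailing zeros and is a congruence for all operations; `≈ₚ⇒≋`
  -- and `≋⇒≈ₚ` connect it with equality of stripped lists. The record lets p and q be inferred from
  -- a proof.
  record _≋_ (p q : Poly) : Set where
    constructor coefs
    field at : ∀ n → coef p n ≡ coef q n
  open _≋_ public

  ≋-refl : ∀ {p} → p ≋ p
  ≋-refl = coefs λ _ → refl

  ≋-sym : ∀ {p q} → p ≋ q → q ≋ p
  ≋-sym e = coefs λ n → sym (at e n)

  ≋-trans : ∀ {p q r} → p ≋ q → q ≋ r → p ≋ r
  ≋-trans e f = coefs λ n → trans (at e n) (at f n)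

  ≋-reflexive : ∀ {p q} → p ≡ q → p ≋ q
  ≋-reflexive refl = ≋-refl

  ∷-cong : ∀ {a b p q} → a ≡ b → p ≋ q → a ∷ p ≋ b ∷ q
  ∷-cong e f = coefs λ { zero → e ; (suc n) → at f n }

  ∷-zero : ∀ {a p} → a ≡ 0ℤ → p ≋ [] → a ∷ p ≋ []
  ∷-zero e f = coefs λ { zero → e ; (suc n) → at f n }

  tail-≋ : ∀ {a b p q} → a ∷ p ≋ b ∷ q → p ≋ q
  tail-≋ e = coefs λ n → at e (suc n)

  tail-zero : ∀ {a p} → a ∷ p ≋ [] → p ≋ []
  tail-zero e = coefs λ n → at e (suc n)

  coef-⊕ : ∀ p q n → coef (p ⊕ q) n ≡ coef p n + coef q n
  coef-⊕ [] q n = sym (+-identityˡ (coef q n))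
  coef-⊕ (a ∷ p) [] n = sym (+-identityʳ (coef (a ∷ p) n))
  coef-⊕ (a ∷ p) (b ∷ q) zero = refl
  coef-⊕ (a ∷ p) (b ∷ q) (suc n) = coef-⊕ p q n

  coef-scale : ∀ a p n → coef (scale a p) n ≡ a * coef p n
  coef-scale a [] n = sym (*-zeroʳ a)
  coef-scale a (b ∷ p) zero = refl
  coef-scale a (b ∷ p) (suc n) = coef-scale a p n

  coef-neg : ∀ p n → coef (negₚ p) n ≡ - coef p n
  coef-neg p n = trans (coef-scale -1ℤ p n) (-1*i≡-i (coef p n))

  ⊕-cong : ∀ {p p′ q q′} → p ≋ p′ → q ≋ q′ → p ⊕ q ≋ p′ ⊕ q′
  ⊕-cong {p} {p′} {q} {q′} e f = coefs λ n → trans (coef-⊕ p q n) (trans (cong₂ _+_ (at e n) (at f n)) (sym (coef-⊕ p′ q′ n)))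

  scale-cong : ∀ {a b p q} → a ≡ b → p ≋ q → scale a p ≋ scale b q
  scale-cong {a} {b} {p} {q} e f = coefs λ n → trans (coef-scale a p n) (trans (cong₂ _*_ e (at f n)) (sym (coef-scale b q n)))

  ⊕-comm : ∀ p q → p ⊕ q ≋ q ⊕ p
  ⊕-comm p q = coefs λ n → trans (coef-⊕ p q n) (trans (+-comm (coef p n) (coef q n)) (sym (coef-⊕ q p n)))

  ⊕-assoc : ∀ p q r → (p ⊕ q) ⊕ r ≋ p ⊕ (q ⊕ r)
  ⊕-assoc p q r = coefs λ n → trans (coef-⊕ (p ⊕ q) r n) (trans (cong (λ z → z + coef r n) (coef-⊕ p q n)) (trans (+-assoc (coef p n) (coef q n) (coef r n))
    (trans (cong (λ z → coef p n + z) (sym (coef-⊕ q r n))) (sym (coef-⊕ p (q ⊕ r) n)))))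

  ⊕-identityʳ : ∀ p → p ⊕ [] ≋ p
  ⊕-identityʳ p = coefs λ n → trans (coef-⊕ p [] n) (+-identityʳ (coef p n))

  neg-cong : ∀ {p q} → p ≋ q → negₚ p ≋ negₚ q
  neg-cong {p} {q} = scale-cong {a = -1ℤ} {b = -1ℤ} {p} {q} refl

  ⊕-inverseʳ : ∀ p → p ⊕ negₚ p ≋ []
  ⊕-inverseʳ p = coefs λ n → trans (coef-⊕ p (negₚ p) n) (trans (cong (λ z → coef p n + z) (coef-neg p n)) (+-inverseʳ (coef p n)))

  scale-⊕ : ∀ a p q → scale a (p ⊕ q) ≋ scale a p ⊕ scale a q
  scale-⊕ a p q = coefs λ n → trans (coef-scale a (p ⊕ q) n) (trans (cong (λ z → a * z) (coef-⊕ p q n)) (trans (*-distribˡ-+ a (coef p n) (coef q n))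
    (trans (sym (cong₂ _+_ (coef-scale a p n) (coef-scale a q n))) (sym (coef-⊕ (scale a p) (scale a q) n)))))

  scale-+ : ∀ a b p → scale (a + b) p ≋ scale a p ⊕ scale b p
  scale-+ a b p = coefs λ n → trans (coef-scale (a + b) p n) (trans (*-distribʳ-+ (coef p n) a b)
    (trans (sym (cong₂ _+_ (coef-scale a p n) (coef-scale b p n))) (sym (coef-⊕ (scale a p) (scale b p) n))))

  scale-* : ∀ a b p → scale (a * b) p ≋ scale a (scale b p)
  scale-* a b p = coefs λ n → trans (coef-scale (a * b) p n) (trans (*-assoc a b (coef p n)) (trans (cong (λ z → a * z) (sym (coef-scale b p n))) (sym (coef-scale a (scale b p) n))))

  scale-0 : ∀ p → scale 0ℤ p ≋ []
  scale-0 p = coefs λ n → trans (coef-scale 0ℤ p n) (*-zeroˡ (coef p n))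

  scale-1 : ∀ p → scale 1ℤ p ≋ p
  scale-1 p = coefs λ n → trans (coef-scale 1ℤ p n) (*-identityˡ (coef p n))

  interchange : ∀ p q r s → (p ⊕ q) ⊕ (r ⊕ s) ≋ (p ⊕ r) ⊕ (q ⊕ s)
  interchange p q r s = coefs λ n → trans (expand p q r s n) (trans (lem (coef p n) (coef q n) (coef r n) (coef s n)) (sym (expand p r q s n)))
    where
    expand : ∀ p q r s n → coef ((p ⊕ q) ⊕ (r ⊕ s)) n ≡ (coef p n + coef q n) + (coef r n + coef s n)
    expand p q r s n = trans (coef-⊕ (p ⊕ q) (r ⊕ s) n) (cong₂ _+_ (coef-⊕ p q n) (coef-⊕ r s n))
    lem : ∀ a b c d → (a + b) + (c + d) ≡ (a + c) + (b + d)
    lem = ℤ-solve-∀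

  0∷-scale : ∀ a p → scale a (0ℤ ∷ p) ≋ 0ℤ ∷ scale a p
  0∷-scale a p = ∷-cong (*-zeroʳ a) ≋-refl

  ⊗-congʳ : ∀ p {q q′} → q ≋ q′ → p ⊗ q ≋ p ⊗ q′
  ⊗-congʳ [] e = ≋-refl
  ⊗-congʳ (a ∷ p) {q} {q′} e = ⊕-cong (scale-cong {a} {a} {q} {q′} refl e) (∷-cong refl (⊗-congʳ p e))

  ⊗-zeroˡ : ∀ p q → p ≋ [] → p ⊗ q ≋ []
  ⊗-zeroˡ [] q e = ≋-refl
  ⊗-zeroˡ (a ∷ p) q e = ≋-trans (⊕-cong (≋-trans (scale-cong (at e 0) ≋-refl) (scale-0 q)) ≋-refl) (∷-zero refl (⊗-zeroˡ p q (tail-zero e)))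

  ⊗-congˡ : ∀ {p p′} q → p ≋ p′ → p ⊗ q ≋ p′ ⊗ q
  ⊗-congˡ {[]} {p′} q e = ≋-sym (⊗-zeroˡ p′ q (≋-sym e))
  ⊗-congˡ {a ∷ p} {[]} q e = ⊗-zeroˡ (a ∷ p) q e
  ⊗-congˡ {a ∷ p} {b ∷ p′} q e = ⊕-cong (scale-cong (at e 0) ≋-refl) (∷-cong refl (⊗-congˡ q (tail-≋ e)))

  ⊗-cong : ∀ {p p′ q q′} → p ≋ p′ → q ≋ q′ → p ⊗ q ≋ p′ ⊗ q′
  ⊗-cong {p} {p′} {q} {q′} e f = ≋-trans (⊗-congˡ q e) (⊗-congʳ p′ f)

  ⊗-distribʳ : ∀ r p q → (p ⊕ q) ⊗ r ≋ p ⊗ r ⊕ q ⊗ r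
  ⊗-distribʳ r [] q = ≋-refl
  ⊗-distribʳ r (a ∷ p) [] = ≋-sym (⊕-identityʳ _)
  ⊗-distribʳ r (a ∷ p) (b ∷ q) = ≋-trans (⊕-cong (scale-+ a b r) (∷-cong refl (⊗-distribʳ r p q)))
    (interchange (scale a r) (scale b r) (0ℤ ∷ p ⊗ r) (0ℤ ∷ q ⊗ r))

  ⊗-zeroʳ : ∀ p → p ⊗ [] ≋ []
  ⊗-zeroʳ [] = ≋-refl
  ⊗-zeroʳ (a ∷ p) = ∷-zero refl (⊗-zeroʳ p)

  ⊗-∷ : ∀ p b q → p ⊗ (b ∷ q) ≋ scale b p ⊕ (0ℤ ∷ p ⊗ q)
  ⊗-∷ [] b q = ≋-sym (∷-zero refl ≋-refl)
  ⊗-∷ (a ∷ p) b q = ∷-cong (cong (λ z → z + 0ℤ) (*-comm a b)) (≋-trans (⊕-cong (≋-refl {scale a q}) (⊗-∷ p b q))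
    (≋-trans (≋-sym (⊕-assoc (scale a q) (scale b p) (0ℤ ∷ p ⊗ q))) (≋-trans (⊕-cong (⊕-comm (scale a q) (scale b p)) ≋-refl) (⊕-assoc (scale b p) (scale a q) (0ℤ ∷ p ⊗ q)))))

  ⊗-comm : ∀ p q → p ⊗ q ≋ q ⊗ p
  ⊗-comm [] q = ≋-sym (⊗-zeroʳ q)
  ⊗-comm (a ∷ p) q = ≋-trans (⊕-cong ≋-refl (∷-cong refl (⊗-comm p q))) (≋-sym (⊗-∷ q a p))

  scale-⊗ : ∀ a p q → scale a p ⊗ q ≋ scale a (p ⊗ q)
  scale-⊗ a [] q = ≋-refl
  scale-⊗ a (b ∷ p) q = ≋-trans (⊕-cong (scale-* a b q) (≋-trans (∷-cong refl (scale-⊗ a p q)) (≋-sym (0∷-scale a (p ⊗ q))))) (≋-sym (scale-⊕ a (scale b q) (0ℤ ∷ p ⊗ q)))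

  0∷-⊗ : ∀ p q → (0ℤ ∷ p) ⊗ q ≋ 0ℤ ∷ p ⊗ q
  0∷-⊗ p q = ⊕-cong (scale-0 q) ≋-refl

  ⊗-assoc : ∀ p q r → (p ⊗ q) ⊗ r ≋ p ⊗ (q ⊗ r)
  ⊗-assoc [] q r = ≋-refl
  ⊗-assoc (a ∷ p) q r = ≋-trans (⊗-distribʳ r (scale a q) (0ℤ ∷ p ⊗ q)) (⊕-cong (scale-⊗ a q r) (≋-trans (0∷-⊗ (p ⊗ q) r) (∷-cong refl (⊗-assoc p q r))))

  ⊗-identityˡ : ∀ p → oneₚ ⊗ p ≋ p
  ⊗-identityˡ p = ≋-trans (⊕-cong (scale-1 p) (∷-zero refl ≋-refl)) (⊕-identityʳ p)

  ⊗-distribˡ : ∀ p q r → p ⊗ (q ⊕ r) ≋ p ⊗ q ⊕ p ⊗ r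
  ⊗-distribˡ p q r = ≋-trans (⊗-comm p (q ⊕ r)) (≋-trans (⊗-distribʳ p q r) (⊕-cong (⊗-comm q p) (⊗-comm r p)))

  polyRing : CommutativeRing 0ℓ 0ℓ
  polyRing = record
    { Carrier = Poly ; _≈_ = _≋_ ; _+_ = _⊕_ ; _*_ = _⊗_ ; -_ = negₚ ; 0# = [] ; 1# = oneₚ
    ; isCommutativeRing = record
      { isRing = record
        { +-isAbelianGroup = record
          { isGroup = record
            { isMonoid = record
              { isSemigroup = record
                { isMagma = record { isEquivalence = record { refl = ≋-refl ; sym = ≋-sym ; trans = ≋-trans } ; ∙-cong = ⊕-cong }
                ; assoc = ⊕-assoc }
              ; identity = (λ p → ≋-refl) , ⊕-identityʳ }
            ; inverse = (λ p → ≋-trans (⊕-comm (negₚ p) p) (⊕-inverseʳ p)) , ⊕-inverseʳ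
            ; ⁻¹-cong = neg-cong }
          ; comm = ⊕-comm }
        ; *-cong = ⊗-cong
        ; *-assoc = ⊗-assoc
        ; *-identity = ⊗-identityˡ , λ p → ≋-trans (⊗-comm p oneₚ) (⊗-identityˡ p)
        ; distrib = ⊗-distribˡ , ⊗-distribʳ }
      ; *-comm = ⊗-comm } }

  zero? : ∀ p → Maybe ([] ≋ p)
  zero? [] = just ≋-refl
  zero? (a ∷ p) with a ≟ 0ℤ | zero? p
  ... | yes e | just f = just (≋-sym (∷-zero e (≋-sym f)))
  ... | _ | _ = nothing

  poly : AlmostCommutativeRing 0ℓ 0ℓ
  poly = fromCommutativeRing polyRing zero?

  open import Relation.Binary.Reasoning.Setoid (CommutativeRing.setoid polyRing)

  const : ℤ → Poly
  const c = c ∷ []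

  scale-const : ∀ c p → scale c p ≋ const c ⊗ p
  scale-const c p = ≋-sym (≋-trans (⊕-cong ≋-refl (∷-zero refl ≋-refl)) (⊕-identityʳ (scale c p)))

  const-⊗ : ∀ a b → const a ⊗ const b ≋ const (a * b)
  const-⊗ a b = ≋-sym (scale-const a (const b))

  ∷-const : ∀ c p → c ∷ p ≋ const c ⊕ X ⊗ p
  ∷-const c p = ≋-sym (≋-trans (⊕-cong (≋-refl {const c}) (0∷-⊗ (1ℤ ∷ []) p)) (∷-cong (+-identityʳ c) (⊗-identityˡ p)))

  cons : ℤ → Poly → Poly
  cons a [] with a ≟ 0ℤ
  ... | yes _ = []
  ... | no _ = a ∷ []
  cons a (b ∷ q) = a ∷ b ∷ q

  strip-∷ : ∀ a p → strip (a ∷ p) ≡ cons a (strip p)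
  strip-∷ a p with strip p
  ... | [] with a ≟ 0ℤ
  ...   | yes _ = refl
  ...   | no _ = refl
  strip-∷ a p | b ∷ q = refl

  cons-≋ : ∀ a p → cons a p ≋ a ∷ p
  cons-≋ a [] with a ≟ 0ℤ
  ... | yes refl = ≋-sym (∷-zero refl ≋-refl)
  ... | no _ = ≋-refl
  cons-≋ a (b ∷ q) = ≋-refl

  strip-≋ : ∀ p → strip p ≋ p
  strip-≋ [] = ≋-refl
  strip-≋ (a ∷ p) = ≋-trans (≋-reflexive (strip-∷ a p)) (≋-trans (cons-≋ a (strip p)) (∷-cong refl (strip-≋ p)))

  ≈ₚ⇒≋ : ∀ {p q} → p ≈ₚ q → p ≋ q
  ≈ₚ⇒≋ {p} {q} e = ≋-trans (≋-sym (strip-≋ p)) (≋-trans (≋-reflexive e) (strip-≋ q))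

  strip-zero : ∀ p → p ≋ [] → strip p ≡ []
  strip-zero [] e = refl
  strip-zero (a ∷ p) e = trans (strip-∷ a p) (trans (cong₂ cons (at e 0) (strip-zero p (tail-zero e))) refl)

  ≋⇒≈ₚ : ∀ {p q} → p ≋ q → p ≈ₚ q
  ≋⇒≈ₚ {[]} {q} e = sym (strip-zero q (≋-sym e))
  ≋⇒≈ₚ {a ∷ p} {[]} e = strip-zero (a ∷ p) e
  ≋⇒≈ₚ {a ∷ p} {b ∷ q} e = trans (strip-∷ a p) (trans (cong₂ cons (at e 0) (≋⇒≈ₚ (tail-≋ e))) (sym (strip-∷ b q)))

  infix 4 _∣ᵖ_
  record _∣ᵖ_ (g p : Poly) : Set where
    constructor divᵖ
    field
      quo : Poly
      eqn : p ≋ g ⊗ quo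

  ∣ᵖ-refl : ∀ {p} → p ∣ᵖ p
  ∣ᵖ-refl {p} = divᵖ oneₚ (≋-sym (≋-trans (⊗-comm p oneₚ) (⊗-identityˡ p)))

  ∣ᵖ-trans : ∀ {p q r} → p ∣ᵖ q → q ∣ᵖ r → p ∣ᵖ r
  ∣ᵖ-trans {p} {q} {r} (divᵖ a e) (divᵖ b f) = divᵖ (a ⊗ b) (≋-trans f (≋-trans (⊗-congˡ b e) (⊗-assoc p a b)))

  ∣ᵖ-cong : ∀ {p q q′} → q ≋ q′ → p ∣ᵖ q → p ∣ᵖ q′
  ∣ᵖ-cong e (divᵖ a f) = divᵖ a (≋-trans (≋-sym e) f)

  ∣ᵖ-congˡ : ∀ {p p′ q} → p ≋ p′ → p ∣ᵖ q → p′ ∣ᵖ q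
  ∣ᵖ-congˡ e (divᵖ a f) = divᵖ a (≋-trans f (⊗-congˡ a e))

  ∣ᵖ-zero : ∀ {p q} → q ≋ [] → p ∣ᵖ q
  ∣ᵖ-zero {p} e = divᵖ [] (≋-trans e (≋-sym (⊗-zeroʳ p)))

  ∣ᵖ-⊗ʳ : ∀ {p q} r → p ∣ᵖ q → p ∣ᵖ q ⊗ r
  ∣ᵖ-⊗ʳ {p} {q} r (divᵖ a e) = divᵖ (a ⊗ r) (≋-trans (⊗-congˡ r e) (⊗-assoc p a r))

  ∣ᵖ-⊗ˡ : ∀ {p q} r → p ∣ᵖ q → p ∣ᵖ r ⊗ q
  ∣ᵖ-⊗ˡ {p} {q} r d = ∣ᵖ-cong (⊗-comm q r) (∣ᵖ-⊗ʳ r d)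

  ∣ᵖ-⊕ : ∀ {p q r} → p ∣ᵖ q → p ∣ᵖ r → p ∣ᵖ q ⊕ r
  ∣ᵖ-⊕ {p} (divᵖ a e) (divᵖ b f) = divᵖ (a ⊕ b) (≋-trans (⊕-cong e f) (≋-sym (⊗-distribˡ p a b)))

  ∣ᵖ-neg : ∀ {p q} → p ∣ᵖ q → p ∣ᵖ negₚ q
  ∣ᵖ-neg {p} {q} d = ∣ᵖ-cong (≋-sym (scale-const -1ℤ q)) (∣ᵖ-⊗ˡ (const -1ℤ) d)

  ∣ᵖ-scale : ∀ {p q} c → p ∣ᵖ q → p ∣ᵖ scale c q
  ∣ᵖ-scale {p} {q} c d = ∣ᵖ-cong (≋-sym (scale-const c q)) (∣ᵖ-⊗ˡ (const c) d)

  ⊗-mono-∣ᵖ : ∀ {p q r s} → p ∣ᵖ q → r ∣ᵖ s → p ⊗ r ∣ᵖ q ⊗ s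
  ⊗-mono-∣ᵖ {p} {q} {r} {s} (divᵖ a e) (divᵖ b f) = divᵖ (a ⊗ b) (≋-trans (⊗-cong e f) (lem p a r b))
    where
    lem : ∀ p a r b → (p ⊗ a) ⊗ (r ⊗ b) ≋ (p ⊗ r) ⊗ (a ⊗ b)
    lem = solve-∀ poly

  record Below (n : ℕ) (p : Poly) : Set where
    constructor below
    field out : ∀ i → n ℕ.≤ i → coef p i ≡ 0ℤ
  open Below public

  Below-≋ : ∀ {n p q} → p ≋ q → Below n p → Below n q
  Below-≋ e b = below λ i n≤i → trans (sym (at e i)) (out b i n≤i)

  Below-length : ∀ p → Below (length p) p
  Below-length [] = below λ _ _ → refl
  Below-length (a ∷ p) = below λ { (suc i) (s≤s h) → out (Below-length p) i h }

  Below-mono : ∀ {m n p} → m ℕ.≤ n → Below m p → Below n p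
  Below-mono m≤n b = below λ i n≤i → out b i (ℕₚ.≤-trans m≤n n≤i)

  Below-0 : ∀ {p} → Below 0 p → p ≋ []
  Below-0 b = coefs λ i → out b i z≤n

  Below-tail : ∀ {n a p} → Below (suc n) (a ∷ p) → Below n p
  Below-tail b = below λ i n≤i → out b (suc i) (s≤s n≤i)

  Below-⊕ : ∀ {n} p q → Below n p → Below n q → Below n (p ⊕ q)
  Below-⊕ p q b c = below λ i n≤i → trans (coef-⊕ p q i) (cong₂ _+_ (out b i n≤i) (out c i n≤i))

  Below-scale : ∀ {n} a p → Below n p → Below n (scale a p)
  Below-scale a p b = below λ i n≤i → trans (coef-scale a p i) (trans (cong (λ z → a * z) (out b i n≤i)) (*-zeroʳ a))

  ⊗-const : ∀ a p q → p ≋ [] → (a ∷ p) ⊗ q ≋ scale a q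
  ⊗-const a p q e = ≋-trans (⊕-cong (≋-refl {scale a q}) (∷-zero refl (⊗-zeroˡ p q e))) (⊕-identityʳ (scale a q))

  coef-⊗-top : ∀ p q m n → Below (suc m) p → Below (suc n) q → coef (p ⊗ q) (m ℕ.+ n) ≡ coef p m * coef q n
  coef-⊗-top [] q m n _ _ = sym (*-zeroˡ (coef q n))
  coef-⊗-top (a ∷ p) q zero n b _ = trans (at (⊗-const a p q (Below-0 (Below-tail b))) n) (coef-scale a q n)
  coef-⊗-top (a ∷ p) q (suc m) n b c = trans (coef-⊕ (scale a q) (0ℤ ∷ p ⊗ q) (suc (m ℕ.+ n)))
    (trans (cong₂ _+_ (out (Below-scale a q c) (suc (m ℕ.+ n)) (s≤s (ℕₚ.m≤n+m n m))) (coef-⊗-top p q m n (Below-tail b) c)) (+-identityˡ _))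

  Below-⊗ : ∀ p q m n → Below (suc m) p → Below (suc n) q → Below (suc (m ℕ.+ n)) (p ⊗ q)
  Below-⊗ [] q m n _ _ = below λ _ _ → refl
  Below-⊗ (a ∷ p) q zero n b c = Below-≋ (≋-sym (⊗-const a p q (Below-0 (Below-tail b)))) (Below-scale a q c)
  Below-⊗ (a ∷ p) q (suc m) n b c = Below-⊕ (scale a q) (0ℤ ∷ p ⊗ q) (Below-mono (s≤s (ℕₚ.m≤n+m n (suc m))) (Below-scale a q c))
    (below λ { (suc i) (s≤s h) → out (Below-⊗ p q m n (Below-tail b) c) i h })

  record MonicAt (n : ℕ) (p : Poly) : Set where
    constructor monicAt
    field
      top : coef p n ≡ 1ℤ
      bounded : Below (suc n) p
  open MonicAt public

  monic-≋ : ∀ {n p q} → p ≋ q → MonicAt n p → MonicAt n q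
  monic-≋ {n} e (monicAt t b) = monicAt (trans (sym (at e n)) t) (Below-≋ e b)

  monic-⊗ : ∀ {m n p q} → MonicAt m p → MonicAt n q → MonicAt (m ℕ.+ n) (p ⊗ q)
  monic-⊗ {m} {n} {p} {q} (monicAt t b) (monicAt t′ b′) = monicAt (trans (coef-⊗-top p q m n b b′) (cong₂ _*_ t t′)) (Below-⊗ p q m n b b′)

  monic-one : MonicAt 0 oneₚ
  monic-one = monicAt refl (below λ { (suc i) _ → refl })

  monic-X : MonicAt 1 X
  monic-X = monicAt refl (below λ { (suc zero) (s≤s ()) ; (suc (suc i)) _ → refl })

  Monic⇒MonicAt : ∀ {f} → Monic f → Σ ℕ λ n → MonicAt n f
  Monic⇒MonicAt {f} (cs , e) = length cs , monic-≋ (≋-trans (≋-reflexive (sym e)) (strip-≋ f)) (go cs)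
    where
    go : ∀ cs → MonicAt (length cs) (cs ++ [ 1ℤ ])
    go [] = monic-one
    go (c ∷ cs) = monicAt (top (go cs)) (below λ { (suc i) (s≤s h) → out (bounded (go cs)) i h })

  Below-pred : ∀ {k q} → Below (suc k) q → coef q k ≡ 0ℤ → Below k q
  Below-pred {k} {q} b e = below λ i k≤i → case i (ℕₚ.m≤n⇒m<n∨m≡n k≤i)
    where
    open import Data.Sum using (_⊎_; inj₁; inj₂)
    case : ∀ i → k ℕ.< i ⊎ k ≡ i → coef q i ≡ 0ℤ
    case i (inj₁ k<i) = out b i k<i
    case i (inj₂ refl) = e

  -- The top coefficient of g q is that of q because g is monic, so every candidate degree of q is
  -- excluded in turn, starting from the length of its list.
  monic-zero : ∀ {n g} q → MonicAt n g → Below n (g ⊗ q) → q ≋ []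
  monic-zero {n} {g} q (monicAt t b) h = Below-0 (descend (length q) (Below-length q))
    where
    descend : ∀ k → Below k q → Below 0 q
    descend zero c = c
    descend (suc k) c = descend k (Below-pred c (trans (sym (trans (coef-⊗-top g q n k b c) (trans (cong (λ z → z * coef q k) t) (*-identityˡ (coef q k))))) (out h (n ℕ.+ k) (ℕₚ.m≤m+n n k))))

  record Division (n : ℕ) (g p : Poly) : Set where
    field
      quotient remainder : Poly
      division : p ≋ g ⊗ quotient ⊕ remainder
      small : Below n remainder

  -- Recursion in the style of Horner: from p = g q + r follows a + x p = g (c + x q) + (a + x r - c
  -- g), where c is the coefficient of a + x r that has to be cancelled.
  divide : ∀ {n g} → MonicAt n g → ∀ p → Division n g p
  divide {n} {g} m [] = record { quotient = [] ; remainder = [] ; division = ≋-sym (≋-trans (⊕-identityʳ (g ⊗ [])) (⊗-zeroʳ g)) ; small = below λ _ _ → refl }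
  divide {n} {g} m (a ∷ p) = record { quotient = c ∷ quotient ; remainder = s ; division = eq ; small = Below-pred s-below s-top }
    where
    open Division (divide m p)
    c : ℤ
    c = coef (a ∷ remainder) n
    s : Poly
    s = (a ∷ remainder) ⊕ negₚ (scale c g)
    s-below : Below (suc n) s
    s-below = Below-⊕ (a ∷ remainder) (negₚ (scale c g)) (below λ { (suc i) (s≤s h) → out small i h }) (Below-scale -1ℤ (scale c g) (Below-scale c g (bounded m)))
    s-top : coef s n ≡ 0ℤ
    s-top = trans (coef-⊕ (a ∷ remainder) (negₚ (scale c g)) n) (trans (cong (λ z → c + z) (trans (coef-neg (scale c g) n) (cong -_ (trans (coef-scale c g n) (trans (cong (λ z → c * z) (top m)) (*-identityʳ c)))))) (+-inverseʳ c))
    eq : a ∷ p ≋ g ⊗ (c ∷ quotient) ⊕ s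
    eq = begin
      a ∷ p                                                    ≈⟨ ∷-cong refl division ⟩
      a ∷ (g ⊗ quotient ⊕ remainder)                            ≈⟨ ∷-const a _ ⟩
      const a ⊕ X ⊗ (g ⊗ quotient ⊕ remainder)                  ≈⟨ lem (const a) X g quotient remainder (const c) ⟩
      g ⊗ (const c ⊕ X ⊗ quotient) ⊕ ((const a ⊕ X ⊗ remainder) ⊕ negₚ (const c ⊗ g))
        ≈⟨ ⊕-cong (⊗-congʳ g (≋-sym (∷-const c quotient))) (⊕-cong (≋-sym (∷-const a remainder)) (neg-cong (≋-sym (scale-const c g)))) ⟩
      g ⊗ (c ∷ quotient) ⊕ s ∎
      where
      lem : ∀ a x g q r c → a ⊕ x ⊗ (g ⊗ q ⊕ r) ≋ g ⊗ (c ⊕ x ⊗ q) ⊕ ((a ⊕ x ⊗ r) ⊕ negₚ (c ⊗ g))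
      lem = solve-∀ poly

  ∣ᵖ-small : ∀ {n g r} → MonicAt n g → g ∣ᵖ r → Below n r → r ≋ []
  ∣ᵖ-small {n} {g} {r} m (divᵖ q e) b = ≋-trans e (≋-trans (⊗-congʳ g (monic-zero q m (Below-≋ e b))) (⊗-zeroʳ g))

  zero-remainder : ∀ {n g p} (d : Division n g p) → Division.remainder d ≋ [] → g ∣ᵖ p
  zero-remainder {g = g} d e = divᵖ quotient (≋-trans division (≋-trans (⊕-cong ≋-refl e) (⊕-identityʳ (g ⊗ quotient))))
    where open Division d

  scale-zero : ∀ {c p} → ¬ c ≡ 0ℤ → scale c p ≋ [] → p ≋ []
  scale-zero {c} {p} c≢0 e = coefs λ n → case (i*j≡0⇒i≡0∨j≡0 c {coef p n} (trans (sym (coef-scale c p n)) (at e n)))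
    where
    open import Data.Sum using (_⊎_; inj₁; inj₂)
    case : ∀ {x} → c ≡ 0ℤ ⊎ x ≡ 0ℤ → x ≡ 0ℤ
    case (inj₁ z) = contradiction z c≢0
    case (inj₂ z) = z

  -- c times the remainder of p is divisible by g and of smaller degree, so the remainder is zero.
  monic-torsion : ∀ {n g c p} → MonicAt n g → ¬ c ≡ 0ℤ → g ∣ᵖ scale c p → g ∣ᵖ p
  monic-torsion {n} {g} {c} {p} m c≢0 h = zero-remainder d (scale-zero c≢0 (∣ᵖ-small m
      (∣ᵖ-cong (≋-trans (⊕-cong (≋-trans (scale-cong {c} {c} refl division) (scale-const c _)) (neg-cong (scale-const c _))) (≋-trans (lem (const c) (g ⊗ quotient) remainder) (≋-sym (scale-const c remainder))))
        (∣ᵖ-⊕ h (∣ᵖ-neg (∣ᵖ-scale c (∣ᵖ-⊗ʳ quotient ∣ᵖ-refl)))))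
      (Below-scale c remainder small)))
    where
    d : Division n g p
    d = divide m p
    open Division d
    lem : ∀ c a r → c ⊗ (a ⊕ r) ⊕ negₚ (c ⊗ a) ≋ c ⊗ r
    lem = solve-∀ poly

  comp : Poly → Poly → Poly
  comp [] g = []
  comp (c ∷ p) g = const c ⊕ g ⊗ comp p g

  comp-zero : ∀ p g → p ≋ [] → comp p g ≋ []
  comp-zero [] g e = ≋-refl
  comp-zero (c ∷ p) g e = ≋-trans (⊕-cong (∷-zero (at e 0) ≋-refl) (⊗-congʳ g (comp-zero p g (tail-zero e)))) (⊗-zeroʳ g)

  comp-congˡ : ∀ {p q} g → p ≋ q → comp p g ≋ comp q g
  comp-congˡ {[]} {q} g e = ≋-sym (comp-zero q g (≋-sym e))
  comp-congˡ {a ∷ p} {[]} g e = comp-zero (a ∷ p) g e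
  comp-congˡ {a ∷ p} {b ∷ q} g e = ⊕-cong (∷-cong (at e 0) ≋-refl) (⊗-congʳ g (comp-congˡ g (tail-≋ e)))

  comp-congʳ : ∀ p {g h} → g ≋ h → comp p g ≋ comp p h
  comp-congʳ [] e = ≋-refl
  comp-congʳ (c ∷ p) e = ⊕-cong ≋-refl (⊗-cong e (comp-congʳ p e))

  comp-⊕ : ∀ p q g → comp (p ⊕ q) g ≋ comp p g ⊕ comp q g
  comp-⊕ [] q g = ≋-refl
  comp-⊕ (a ∷ p) [] g = ≋-sym (⊕-identityʳ _)
  comp-⊕ (a ∷ p) (b ∷ q) g = ≋-trans (⊕-cong (≋-refl {const a ⊕ const b}) (⊗-congʳ g (comp-⊕ p q g))) (lem (const a) (const b) g (comp p g) (comp q g))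
    where
    lem : ∀ a b g p q → (a ⊕ b) ⊕ g ⊗ (p ⊕ q) ≋ (a ⊕ g ⊗ p) ⊕ (b ⊕ g ⊗ q)
    lem = solve-∀ poly

  comp-scale : ∀ c p g → comp (scale c p) g ≋ const c ⊗ comp p g
  comp-scale c [] g = ≋-sym (⊗-zeroʳ (const c))
  comp-scale c (a ∷ p) g = ≋-trans (⊕-cong (≋-sym (const-⊗ c a)) (⊗-congʳ g (comp-scale c p g))) (lem (const c) (const a) g (comp p g))
    where
    lem : ∀ c a g p → c ⊗ a ⊕ g ⊗ (c ⊗ p) ≋ c ⊗ (a ⊕ g ⊗ p)
    lem = solve-∀ poly

  comp-⊗ : ∀ p q g → comp (p ⊗ q) g ≋ comp p g ⊗ comp q g
  comp-⊗ [] q g = ≋-refl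
  comp-⊗ (a ∷ p) q g = ≋-trans (comp-⊕ (scale a q) (0ℤ ∷ p ⊗ q) g) (≋-trans (⊕-cong (comp-scale a q g) (⊕-cong (∷-zero refl ≋-refl) (⊗-congʳ g (comp-⊗ p q g)))) (lem (const a) (comp q g) g (comp p g)))
    where
    lem : ∀ a q g p → a ⊗ q ⊕ g ⊗ (p ⊗ q) ≋ (a ⊕ g ⊗ p) ⊗ q
    lem = solve-∀ poly

  comp-neg : ∀ p g → comp (negₚ p) g ≋ negₚ (comp p g)
  comp-neg p g = ≋-trans (comp-scale -1ℤ p g) (≋-sym (scale-const -1ℤ (comp p g)))

  comp-const : ∀ c g → comp (const c) g ≋ const c
  comp-const c g = ≋-trans (⊕-cong ≋-refl (⊗-zeroʳ g)) (⊕-identityʳ (const c))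

  comp-X : ∀ g → comp X g ≋ g
  comp-X g = ≋-trans (⊕-cong (∷-zero refl ≋-refl) (⊗-congʳ g (comp-const 1ℤ g))) (≋-trans (⊗-comm g oneₚ) (⊗-identityˡ g))

  comp-id : ∀ p → comp p X ≋ p
  comp-id [] = ≋-refl
  comp-id (c ∷ p) = ≋-trans (⊕-cong (≋-refl {const c}) (⊗-congʳ X (comp-id p))) (≋-sym (∷-const c p))

  comp-^ : ∀ p n g → comp (p ^ₚ n) g ≋ comp p g ^ₚ n
  comp-^ p zero g = comp-const 1ℤ g
  comp-^ p (suc n) g = ≋-trans (comp-⊗ p (p ^ₚ n) g) (⊗-congʳ (comp p g) (comp-^ p n g))

  comp-comp : ∀ p g h → comp (comp p g) h ≋ comp p (comp g h)
  comp-comp [] g h = ≋-refl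
  comp-comp (c ∷ p) g h = ≋-trans (comp-⊕ (const c) (g ⊗ comp p g) h) (⊕-cong (comp-const c h) (≋-trans (comp-⊗ g (comp p g) h) (⊗-congʳ (comp g h) (comp-comp p g h))))

  comp-∣ᵖ : ∀ {p q} g → p ∣ᵖ q → comp p g ∣ᵖ comp q g
  comp-∣ᵖ {p} g (divᵖ a e) = divᵖ (comp a g) (≋-trans (comp-congˡ g e) (comp-⊗ p a g))

  comp-diff : ∀ p g h → g ⊕ negₚ h ∣ᵖ comp p g ⊕ negₚ (comp p h)
  comp-diff [] g h = ∣ᵖ-zero ≋-refl
  comp-diff (c ∷ p) g h = ∣ᵖ-cong (lem (const c) g h (comp p g) (comp p h)) (∣ᵖ-⊕ (∣ᵖ-⊗ʳ (comp p g) ∣ᵖ-refl) (∣ᵖ-⊗ˡ h (comp-diff p g h)))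
    where
    lem : ∀ c g h p q → (g ⊕ negₚ h) ⊗ p ⊕ h ⊗ (p ⊕ negₚ q) ≋ (c ⊕ g ⊗ p) ⊕ negₚ (c ⊕ h ⊗ q)
    lem = solve-∀ poly

  ^ₚ-cong : ∀ {p q} n → p ≋ q → p ^ₚ n ≋ q ^ₚ n
  ^ₚ-cong zero e = ≋-refl
  ^ₚ-cong (suc n) e = ⊗-cong e (^ₚ-cong n e)

  ^ₚ-+ : ∀ p m n → p ^ₚ (m ℕ.+ n) ≋ p ^ₚ m ⊗ p ^ₚ n
  ^ₚ-+ p zero n = ≋-sym (⊗-identityˡ (p ^ₚ n))
  ^ₚ-+ p (suc m) n = ≋-trans (⊗-congʳ p (^ₚ-+ p m n)) (≋-sym (⊗-assoc p (p ^ₚ m) (p ^ₚ n)))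

  ^ₚ-* : ∀ p m n → p ^ₚ (m ℕ.* n) ≋ (p ^ₚ n) ^ₚ m
  ^ₚ-* p zero n = ≋-refl
  ^ₚ-* p (suc m) n = ≋-trans (^ₚ-+ p n (m ℕ.* n)) (⊗-congʳ (p ^ₚ n) (^ₚ-* p m n))

  monic-X^ : ∀ n → MonicAt n (X ^ₚ n)
  monic-X^ zero = monic-one
  monic-X^ (suc n) = monic-⊗ monic-X (monic-X^ n)

  eval-⊕ : ∀ p q a → eval (p ⊕ q) a ≡ eval p a + eval q a
  eval-⊕ [] q a = sym (+-identityˡ (eval q a))
  eval-⊕ (b ∷ p) [] a = sym (+-identityʳ (eval (b ∷ p) a))
  eval-⊕ (b ∷ p) (c ∷ q) a = trans (cong (λ z → b + c + a * z) (eval-⊕ p q a)) (lem b c a (eval p a) (eval q a))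
    where
    lem : ∀ b c a p q → b + c + a * (p + q) ≡ b + a * p + (c + a * q)
    lem = ℤ-solve-∀

  eval-scale : ∀ c p a → eval (scale c p) a ≡ c * eval p a
  eval-scale c [] a = sym (*-zeroʳ c)
  eval-scale c (b ∷ p) a = trans (cong (λ z → c * b + a * z) (eval-scale c p a)) (lem c b a (eval p a))
    where
    lem : ∀ c b a p → c * b + a * (c * p) ≡ c * (b + a * p)
    lem = ℤ-solve-∀

  eval-⊗ : ∀ p q a → eval (p ⊗ q) a ≡ eval p a * eval q a
  eval-⊗ [] q a = sym (*-zeroˡ (eval q a))
  eval-⊗ (b ∷ p) q a = trans (eval-⊕ (scale b q) (0ℤ ∷ p ⊗ q) a) (trans (cong₂ (λ x y → x + (0ℤ + a * y)) (eval-scale b q a) (eval-⊗ p q a)) (lem b (eval q a) a (eval p a)))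
    where
    lem : ∀ b q a p → b * q + (0ℤ + a * (p * q)) ≡ (b + a * p) * q
    lem = ℤ-solve-∀

  eval-zero : ∀ p a → p ≋ [] → eval p a ≡ 0ℤ
  eval-zero [] a e = refl
  eval-zero (b ∷ p) a e = trans (cong₂ (λ x y → x + a * y) (at e 0) (eval-zero p a (tail-zero e))) (trans (+-identityˡ (a * 0ℤ)) (*-zeroʳ a))

  eval-cong : ∀ {p q} a → p ≋ q → eval p a ≡ eval q a
  eval-cong {[]} {q} a e = sym (eval-zero q a (≋-sym e))
  eval-cong {b ∷ p} {[]} a e = eval-zero (b ∷ p) a e
  eval-cong {b ∷ p} {c ∷ q} a e = cong₂ (λ x y → x + a * y) (at e 0) (eval-cong a (tail-≋ e))

  eval-const : ∀ c a → eval (const c) a ≡ c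
  eval-const c a = trans (cong (λ z → c + z) (*-zeroʳ a)) (+-identityʳ c)

  eval-comp : ∀ p g a → eval (comp p g) a ≡ eval p (eval g a)
  eval-comp [] g a = refl
  eval-comp (c ∷ p) g a = trans (eval-⊕ (const c) (g ⊗ comp p g) a) (cong₂ _+_ (eval-const c a) (trans (eval-⊗ g (comp p g) a) (cong (λ z → eval g a * z) (eval-comp p g a))))

  eval-X : ∀ a → eval X a ≡ a
  eval-X a = lem a
    where
    lem : ∀ a → 0ℤ + a * (1ℤ + a * 0ℤ) ≡ a
    lem = ℤ-solve-∀

  eval-X^ : ∀ n a → eval (X ^ₚ n) (+ a) ≡ + (a ℕ.^ n)
  eval-X^ zero a = eval-const 1ℤ (+ a)
  eval-X^ (suc n) a = trans (eval-⊗ X (X ^ₚ n) (+ a)) (trans (cong₂ _*_ (eval-X (+ a)) (eval-X^ n a)) (sym (pos-* a (a ℕ.^ n))))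

-- Cyclotomic polynomials: the recursive definition is exact, monic, pairwise comaximal

module Cyclo where

  open import Defs
  open import Data.Integer hiding (suc; _^_; _/_; _%_; NonZero)
  open import Data.Integer.Properties
  open import Data.Integer.Tactic.RingSolver using () renaming (solve-∀ to ℤ-solve-∀)
  open import Data.List using (List; []; _∷_; _++_; [_]; length; map; filter; zip; upTo; replicate)
  open import Data.List.Properties using (filter-++; map-++; length-++; length-map; length-upTo; upTo-∷ʳ)
  open import Data.Nat as ℕ using (ℕ; zero; suc; z≤n; s≤s)
  import Data.Nat.Properties as ℕₚ
  open import Data.Nat.Divisibility using (_∣_; _∣?_; divides; ∣-refl; ∣-trans; ∣⇒≤)
  open import Data.Nat.GCD using (gcd; gcd-GCD; gcd[m,n]∣m; gcd[m,n]∣n; module Bézout)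
  open import Data.Nat.Induction using (<-rec)
  open import Data.Product using (Σ; _×_; _,_; proj₁; proj₂)
  open import Data.Sum using (inj₁; inj₂)
  open import Relation.Binary.PropositionalEquality hiding ([_])
  open import Relation.Nullary using (Dec; yes; no; ¬_; contradiction)
  open import Tactic.RingSolver using (solve-∀)
  open Poly

  -- Coprimality over ℚ with denominators cleared: a nonzero integer in the ideal (a, b). The
  -- integer itself matters in the end, since every prime that divides a value of a and the
  -- corresponding value of b divides it.
  record Comaximal (a b : Poly) : Set where
    constructor comax
    field
      c : ℤ
      c≢0 : ¬ c ≡ 0ℤ
      U V : Poly
      bezout : const c ≋ a ⊗ U ⊕ b ⊗ V

  comax-sym : ∀ {a b} → Comaximal a b → Comaximal b a
  comax-sym {a} {b} (comax c c≢0 U V e) = comax c c≢0 V U (≋-trans e (⊕-comm (a ⊗ U) (b ⊗ V)))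

  comax-combination : ∀ {a b b′} s t → Comaximal a b → b ≋ a ⊗ s ⊕ b′ ⊗ t → Comaximal a b′
  comax-combination {a} {b} {b′} s t (comax c c≢0 U V e) f = comax c c≢0 (U ⊕ s ⊗ V) (t ⊗ V)
    (≋-trans e (≋-trans (⊕-cong ≋-refl (⊗-congˡ V f)) (lem a U s b′ t V)))
    where
    lem : ∀ a U s b t V → a ⊗ U ⊕ (a ⊗ s ⊕ b ⊗ t) ⊗ V ≋ a ⊗ (U ⊕ s ⊗ V) ⊕ b ⊗ (t ⊗ V)
    lem = solve-∀ poly

  comax-∣ : ∀ {a b b′} → b′ ∣ᵖ b → Comaximal a b → Comaximal a b′
  comax-∣ {a} {b} {b′} (divᵖ q e) h = comax-combination [] q h (≋-trans e (≋-sym (⊕-cong (⊗-zeroʳ a) (≋-refl {b′ ⊗ q}))))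

  comax-≡ : ∀ {a b b′} → a ∣ᵖ b ⊕ negₚ b′ → Comaximal a b → Comaximal a b′
  comax-≡ {a} {b} {b′} (divᵖ q e) h = comax-combination q oneₚ h (≋-trans (lem b b′) (⊕-cong e ≋-refl))
    where
    lem : ∀ b b′ → b ≋ (b ⊕ negₚ b′) ⊕ b′ ⊗ oneₚ
    lem = solve-∀ poly

  comax-⊗ : ∀ {a b b′} → Comaximal a b → Comaximal a b′ → Comaximal a (b ⊗ b′)
  comax-⊗ {a} {b} {b′} (comax c c≢0 U V e) (comax c′ c′≢0 U′ V′ e′) = comax (c * c′) cc′≢0 (U ⊗ (a ⊗ U′ ⊕ b′ ⊗ V′) ⊕ b ⊗ V ⊗ U′) (V ⊗ V′)
    (≋-trans (≋-sym (const-⊗ c c′)) (≋-trans (⊗-cong e e′) (lem a U b V U′ b′ V′)))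
    where
    cc′≢0 : ¬ c * c′ ≡ 0ℤ
    cc′≢0 z with i*j≡0⇒i≡0∨j≡0 c z
    ... | inj₁ h = c≢0 h
    ... | inj₂ h = c′≢0 h
    lem : ∀ a U b V U′ b′ V′ → (a ⊗ U ⊕ b ⊗ V) ⊗ (a ⊗ U′ ⊕ b′ ⊗ V′) ≋ a ⊗ (U ⊗ (a ⊗ U′ ⊕ b′ ⊗ V′) ⊕ b ⊗ V ⊗ U′) ⊕ (b ⊗ b′) ⊗ (V ⊗ V′)
    lem = solve-∀ poly

  comax-one : ∀ a → Comaximal a oneₚ
  comax-one a = comax 1ℤ (λ ()) [] oneₚ (≋-sym (⊕-cong (⊗-zeroʳ a) (≋-refl {oneₚ ⊗ oneₚ})))

  -- The Bézout identity times r shows that a divides c r; the integer c is cancelled because a is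
  -- monic.
  comax-cancel : ∀ {n a b r} → MonicAt n a → Comaximal a b → a ∣ᵖ b ⊗ r → a ∣ᵖ r
  comax-cancel {n} {a} {b} {r} m (comax c c≢0 U V e) h = monic-torsion m c≢0
    (∣ᵖ-cong (≋-sym (≋-trans (scale-const c r) (≋-trans (⊗-congˡ r e) (lem a U b V r)))) (∣ᵖ-⊕ (∣ᵖ-⊗ʳ (U ⊗ r) ∣ᵖ-refl) (∣ᵖ-⊗ˡ V h)))
    where
    lem : ∀ a U b V r → (a ⊗ U ⊕ b ⊗ V) ⊗ r ≋ a ⊗ (U ⊗ r) ⊕ V ⊗ (b ⊗ r)
    lem = solve-∀ poly

  comax-product : ∀ {n a b h} → MonicAt n a → Comaximal a b → a ∣ᵖ h → b ∣ᵖ h → b ⊗ a ∣ᵖ h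
  comax-product {n} {a} {b} {h} m ab a∣h (divᵖ k e) = combine (comax-cancel {r = k} m ab (∣ᵖ-cong e a∣h))
    where
    combine : a ∣ᵖ k → b ⊗ a ∣ᵖ h
    combine (divᵖ l f) = divᵖ l (≋-trans e (≋-trans (⊗-congʳ b f) (≋-sym (⊗-assoc b a l))))

  monic-cofactor : ∀ {n k g q} → MonicAt n g → MonicAt k (g ⊗ q) → MonicAt (k ℕ.∸ n) q
  monic-cofactor {n} {k} {g} {q} m mk = go (length q) (Below-length q)
    where
    go : ∀ l → Below l q → MonicAt (k ℕ.∸ n) q
    go zero b = contradiction (trans (sym (top mk)) (at (≋-trans (⊗-congʳ g (Below-0 b)) (⊗-zeroʳ g)) k)) λ ()
    go (suc l) b with n ℕ.+ l ℕ.≟ k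
    ... | yes refl = subst (λ z → MonicAt z q) (sym (ℕₚ.m+n∸m≡n n l)) (monicAt (trans (sym (top-q l b)) (top mk)) b)
      where
      top-q : ∀ l → Below (suc l) q → coef (g ⊗ q) (n ℕ.+ l) ≡ coef q l
      top-q l b = trans (coef-⊗-top g q n l (bounded m) b) (trans (cong (λ z → z * coef q l) (top m)) (*-identityˡ (coef q l)))
    ... | no n+l≢k with n ℕ.+ l ℕ.<? k
    ...   | yes lt = contradiction (trans (sym (top mk)) (out (Below-⊗ g q n l (bounded m) b) k lt)) λ ()
    ...   | no ¬lt = go l (Below-pred b (trans (sym (trans (coef-⊗-top g q n l (bounded m) b) (trans (cong (λ z → z * coef q l) (top m)) (*-identityˡ (coef q l)))))
              (out (bounded mk) (n ℕ.+ l) (ℕₚ.≤∧≢⇒< (ℕₚ.≮⇒≥ ¬lt) λ eq → n+l≢k (sym eq)))))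

  -- The derivation x d/dx
  θ : Poly → Poly
  θ [] = []
  θ (c ∷ p) = 0ℤ ∷ (p ⊕ θ p)

  coef-θ : ∀ p n → coef (θ p) n ≡ + n * coef p n
  coef-θ [] n = sym (*-zeroʳ (+ n))
  coef-θ (c ∷ p) zero = sym (*-zeroˡ c)
  coef-θ (c ∷ p) (suc n) = trans (coef-⊕ p (θ p) n) (trans (cong (λ z → coef p n + z) (coef-θ p n)) (lem (+ n) (coef p n)))
    where
    lem : ∀ n a → a + n * a ≡ (1ℤ + n) * a
    lem = ℤ-solve-∀

  θ-cong : ∀ {p q} → p ≋ q → θ p ≋ θ q
  θ-cong {p} {q} e = coefs λ n → trans (coef-θ p n) (trans (cong (λ z → + n * z) (at e n)) (sym (coef-θ q n)))

  θ-⊕ : ∀ p q → θ (p ⊕ q) ≋ θ p ⊕ θ q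
  θ-⊕ p q = coefs λ n → trans (coef-θ (p ⊕ q) n) (trans (cong (λ z → + n * z) (coef-⊕ p q n)) (trans (*-distribˡ-+ (+ n) (coef p n) (coef q n))
    (trans (sym (cong₂ _+_ (coef-θ p n) (coef-θ q n))) (sym (coef-⊕ (θ p) (θ q) n)))))

  θ-scale : ∀ c p → θ (scale c p) ≋ scale c (θ p)
  θ-scale c p = coefs λ n → trans (coef-θ (scale c p) n) (trans (cong (λ z → + n * z) (coef-scale c p n)) (trans (lem (+ n) c (coef p n)) (trans (cong (λ z → c * z) (sym (coef-θ p n))) (sym (coef-scale c (θ p) n)))))
    where
    lem : ∀ n c a → n * (c * a) ≡ c * (n * a)
    lem = ℤ-solve-∀

  0∷-X : ∀ p → 0ℤ ∷ p ≋ X ⊗ p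
  0∷-X p = ≋-trans (∷-const 0ℤ p) (⊕-cong (∷-zero refl ≋-refl) (≋-refl {X ⊗ p}))

  θ-⊗ : ∀ p q → θ (p ⊗ q) ≋ θ p ⊗ q ⊕ p ⊗ θ q
  θ-⊗ [] q = ≋-refl
  θ-⊗ (c ∷ p) q = ≋-trans (θ-⊕ (scale c q) (0ℤ ∷ p ⊗ q)) (≋-trans (⊕-cong (≋-trans (θ-scale c q) (scale-const c (θ q)))
      (≋-trans (0∷-X (p ⊗ q ⊕ θ (p ⊗ q))) (⊗-congʳ X (⊕-cong (≋-refl {p ⊗ q}) (θ-⊗ p q)))))
    (≋-trans (lem (const c) (θ q) X p q (θ p)) (≋-sym (⊕-cong (⊗-congˡ q (0∷-X (p ⊕ θ p))) (⊗-congˡ (θ q) (∷-const c p))))))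
    where
    lem : ∀ c tq x p q tp → c ⊗ tq ⊕ x ⊗ (p ⊗ q ⊕ (tp ⊗ q ⊕ p ⊗ tq)) ≋ (x ⊗ (p ⊕ tp)) ⊗ q ⊕ (c ⊕ x ⊗ p) ⊗ tq
    lem = solve-∀ poly

  θ-X^ : ∀ n → θ (X ^ₚ n) ≋ const (+ n) ⊗ X ^ₚ n
  θ-X^ zero = ≋-trans (∷-zero refl ≋-refl) (≋-sym (⊗-zeroˡ (const 0ℤ) oneₚ (∷-zero refl ≋-refl)))
  θ-X^ (suc n) = ≋-trans (θ-⊗ X (X ^ₚ n)) (≋-trans (⊕-cong (⊗-congˡ (X ^ₚ n) θX) (⊗-congʳ X (θ-X^ n))) (≋-trans (lem X (X ^ₚ n) (const (+ n)))
    (⊗-congˡ (X ⊗ X ^ₚ n) (≋-refl {oneₚ ⊕ const (+ n)}))))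
    where
    θX : θ X ≋ X
    θX = coefs λ { zero → refl ; (suc zero) → refl ; (suc (suc n)) → refl }
    lem : ∀ x y n → x ⊗ y ⊕ x ⊗ (n ⊗ y) ≋ (oneₚ ⊕ n) ⊗ (x ⊗ y)
    lem = solve-∀ poly

  -- Separability of x^d - 1. Since θ multiplies x^d by d, the integer d equals θ(A B) - d A B, and
  -- the product rule makes this a combination of A and B.
  xⁿ-1-bezout : ∀ {A B} d → 0 ℕ.< d → xⁿ-1 d ≋ A ⊗ B → Comaximal A B
  xⁿ-1-bezout {A} {B} d@(suc _) 0<d e = comax (+ d) (λ ()) (θ B ⊕ negₚ (const (+ d) ⊗ B)) (θ A)
    (≋-trans (lem (const (+ d)) (X ^ₚ d)) (≋-trans (⊕-cong (≋-trans (≋-sym (≋-trans (θ-⊕ (X ^ₚ d) (negₚ oneₚ)) (≋-trans (⊕-cong (θ-X^ d) (∷-zero refl ≋-refl)) (⊕-identityʳ _)))) (≋-trans (θ-cong e) (θ-⊗ A B)))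
      (neg-cong (⊗-congʳ (const (+ d)) e))) (lem′ A (θ A) B (θ B) (const (+ d)))))
    where
    lem : ∀ d x → d ≋ d ⊗ x ⊕ negₚ (d ⊗ (x ⊕ negₚ oneₚ))
    lem = solve-∀ poly
    lem′ : ∀ a ta b tb d → (ta ⊗ b ⊕ a ⊗ tb) ⊕ negₚ (d ⊗ (a ⊗ b)) ≋ a ⊗ (tb ⊕ negₚ (d ⊗ b)) ⊕ b ⊗ ta
    lem′ = solve-∀ poly

  pow-1 : ∀ y k → y ⊕ negₚ oneₚ ∣ᵖ y ^ₚ k ⊕ negₚ oneₚ
  pow-1 y zero = ∣ᵖ-zero (⊕-inverseʳ oneₚ)
  pow-1 y (suc k) = ∣ᵖ-cong (lem y (y ^ₚ k)) (∣ᵖ-⊕ (∣ᵖ-⊗ˡ y (pow-1 y k)) ∣ᵖ-refl)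
    where
    lem : ∀ y z → y ⊗ (z ⊕ negₚ oneₚ) ⊕ (y ⊕ negₚ oneₚ) ≋ y ⊗ z ⊕ negₚ oneₚ
    lem = solve-∀ poly

  xⁿ-1-* : ∀ d k → xⁿ-1 d ∣ᵖ xⁿ-1 (k ℕ.* d)
  xⁿ-1-* d k = ∣ᵖ-cong (⊕-cong (≋-sym (^ₚ-* X k d)) (≋-refl {negₚ oneₚ})) (pow-1 (X ^ₚ d) k)

  xⁿ-1-∣ : ∀ {d n} → d ∣ n → xⁿ-1 d ∣ᵖ xⁿ-1 n
  xⁿ-1-∣ {d} (divides k refl) = xⁿ-1-* d k

  xⁿ-1-+ : ∀ m n → xⁿ-1 (m ℕ.+ n) ≋ X ^ₚ m ⊗ xⁿ-1 n ⊕ xⁿ-1 m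
  xⁿ-1-+ m n = ≋-trans (⊕-cong (^ₚ-+ X m n) (≋-refl {negₚ oneₚ})) (lem (X ^ₚ m) (X ^ₚ n))
    where
    lem : ∀ x y → x ⊗ y ⊕ negₚ oneₚ ≋ x ⊗ (y ⊕ negₚ oneₚ) ⊕ (x ⊕ negₚ oneₚ)
    lem = solve-∀ poly

  monic-xⁿ-1 : ∀ n → 0 ℕ.< n → MonicAt n (xⁿ-1 n)
  monic-xⁿ-1 n@(suc m) _ = monicAt (trans (coef-⊕ (X ^ₚ n) (negₚ oneₚ) n) (cong₂ _+_ (top (monic-X^ n)) refl))
    (Below-⊕ (X ^ₚ n) (negₚ oneₚ) (bounded (monic-X^ n)) (below λ { (suc i) _ → refl }))

  -- d x = g + e y (or the symmetric equation) gives x^g - 1 ∈ (x^d - 1, x^e - 1).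
  xⁿ-1-gcd : ∀ {a b} d e → a ∣ᵖ xⁿ-1 d → b ∣ᵖ xⁿ-1 e → Σ Poly λ s → Σ Poly λ t → xⁿ-1 (gcd d e) ≋ a ⊗ s ⊕ b ⊗ t
  xⁿ-1-gcd {a} {b} d e a∣ b∣ with Bézout.identity (gcd-GCD d e)
  ... | Bézout.+- x y eq = combine (∣ᵖ-trans a∣ (xⁿ-1-* d x)) (∣ᵖ-trans b∣ (xⁿ-1-* e y))
        (≋-trans (≋-reflexive (cong xⁿ-1 (sym eq))) (xⁿ-1-+ (gcd d e) (y ℕ.* e)))
    where
    combine : ∀ {p q} → a ∣ᵖ p → b ∣ᵖ q → p ≋ X ^ₚ gcd d e ⊗ q ⊕ xⁿ-1 (gcd d e) → _
    combine {p} {q} (divᵖ s f) (divᵖ t g) h = s , negₚ (X ^ₚ gcd d e ⊗ t) , ≋-trans (lem (X ^ₚ gcd d e ⊗ q) (xⁿ-1 (gcd d e))) (≋-trans (⊕-cong (≋-trans (≋-sym h) f) (neg-cong (⊗-congʳ (X ^ₚ gcd d e) g))) (lem′ (a ⊗ s) (X ^ₚ gcd d e) b t))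
      where
      lem : ∀ u v → v ≋ (u ⊕ v) ⊕ negₚ u
      lem = solve-∀ poly
      lem′ : ∀ u x b t → u ⊕ negₚ (x ⊗ (b ⊗ t)) ≋ u ⊕ b ⊗ negₚ (x ⊗ t)
      lem′ = solve-∀ poly
  ... | Bézout.-+ x y eq = combine (∣ᵖ-trans a∣ (xⁿ-1-* d x)) (∣ᵖ-trans b∣ (xⁿ-1-* e y))
        (≋-trans (≋-reflexive (cong xⁿ-1 (sym eq))) (xⁿ-1-+ (gcd d e) (x ℕ.* d)))
    where
    combine : ∀ {p q} → a ∣ᵖ p → b ∣ᵖ q → q ≋ X ^ₚ gcd d e ⊗ p ⊕ xⁿ-1 (gcd d e) → _
    combine {p} {q} (divᵖ s f) (divᵖ t g) h = negₚ (X ^ₚ gcd d e ⊗ s) , t , ≋-trans (lem (X ^ₚ gcd d e ⊗ p) (xⁿ-1 (gcd d e))) (≋-trans (⊕-cong (≋-trans (≋-sym h) g) (neg-cong (⊗-congʳ (X ^ₚ gcd d e) f))) (lem′ (b ⊗ t) (X ^ₚ gcd d e) a s))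
      where
      lem : ∀ u v → v ≋ (u ⊕ v) ⊕ negₚ u
      lem = solve-∀ poly
      lem′ : ∀ u x b t → u ⊕ negₚ (x ⊗ (b ⊗ t)) ≋ b ⊗ negₚ (x ⊗ t) ⊕ u
      lem′ = solve-∀ poly

  length-strip : ∀ k p → Below k p → length (strip p) ℕ.≤ k
  length-strip k [] b = z≤n
  length-strip zero (a ∷ p) b = subst (λ z → length z ℕ.≤ 0) (sym (strip-zero (a ∷ p) (Below-0 b))) z≤n
  length-strip (suc k) (a ∷ p) b = subst (λ z → length z ℕ.≤ suc k) (sym (strip-∷ a p)) (ℕₚ.≤-trans (length-cons a (strip p)) (s≤s (length-strip k p (Below-tail b))))
    where
    length-cons : ∀ a p → length (cons a p) ℕ.≤ suc (length p)
    length-cons a [] with a ≟ 0ℤ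
    ... | yes _ = z≤n
    ... | no _ = s≤s z≤n
    length-cons a (b ∷ p) = ℕₚ.≤-refl

  length-strip-monic : ∀ {n p} → MonicAt n p → length (strip p) ≡ suc n
  length-strip-monic {n} {p} m = ℕₚ.≤-antisym (length-strip (suc n) p (bounded m)) (ℕₚ.≰⇒> λ h →
    contradiction (trans (sym (top (monic-≋ (≋-sym (strip-≋ p)) m))) (out (Below-length (strip p)) n h)) λ ())

  lastCoeff-coef : ∀ p l → length p ≡ suc l → lastCoeff p ≡ coef p l
  lastCoeff-coef (a ∷ []) zero e = refl
  lastCoeff-coef (a ∷ b ∷ p) (suc l) e = lastCoeff-coef (b ∷ p) l (ℕₚ.suc-injective e)

  monomial : ℕ → ℤ → Poly
  monomial j c = replicate j 0ℤ ++ [ c ]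

  monomial-top : ∀ j c → coef (monomial j c) j ≡ c
  monomial-top zero c = refl
  monomial-top (suc j) c = monomial-top j c

  monomial-below : ∀ j c → Below (suc j) (monomial j c)
  monomial-below zero c = below λ { (suc i) _ → refl }
  monomial-below (suc j) c = below λ { (suc i) (s≤s h) → out (monomial-below j c) i h }

  -- On a multiple of g the division is exact. Each step cancels the top coefficient and shortens r,
  -- so fuel at least the length of r suffices.
  quot-correct : ∀ {n} g k r Q → MonicAt n g → length g ≡ suc n → length r ℕ.≤ k → r ≋ g ⊗ Q → quot k r g ≋ Q
  quot-correct g zero [] Q m _ _ e = ≋-sym (monic-zero Q m (Below-≋ e (below λ _ _ → refl)))
  quot-correct {n} g (suc k) r Q m lg lr e with length r ℕ.<? length g
  ... | yes lt = ≋-sym (monic-zero Q m (Below-≋ e (Below-mono (ℕₚ.≤-pred (subst (length r ℕ.<_) lg lt)) (Below-length r))))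
  ... | no ¬lt = ≋-trans (⊕-cong (≋-refl {t}) (quot-correct g k (strip r′) (Q ⊕ negₚ t) m lg (length-strip k r′ (Below-mono l≤k r′-below)) (≋-trans (strip-≋ r′) r′≋))) (lem t Q)
    where
    l : ℕ
    l = ℕ.pred (length r)
    n<r : suc n ℕ.≤ length r
    n<r = subst (ℕ._≤ length r) lg (ℕₚ.≮⇒≥ ¬lt)
    r≡ : length r ≡ suc l
    r≡ = sym (ℕₚ.suc-pred (length r) ⦃ ℕ.>-nonZero (ℕₚ.≤-trans (s≤s z≤n) n<r) ⦄)
    l≤k : l ℕ.≤ k
    l≤k = ℕₚ.≤-pred (subst (ℕ._≤ suc k) r≡ lr)
    t : Poly
    t = monomial (length r ℕ.∸ length g) (lastCoeff r)
    r′ : Poly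
    r′ = r ⊕ negₚ (t ⊗ g)
    lem : ∀ t Q → t ⊕ (Q ⊕ negₚ t) ≋ Q
    lem = solve-∀ poly
    lem′ : ∀ g Q t → g ⊗ Q ⊕ negₚ (t ⊗ g) ≋ g ⊗ (Q ⊕ negₚ t)
    lem′ = solve-∀ poly
    r′≋ : r′ ≋ g ⊗ (Q ⊕ negₚ t)
    r′≋ = ≋-trans (⊕-cong e (≋-refl {negₚ (t ⊗ g)})) (lem′ g Q t)
    j : ℕ
    j = length r ℕ.∸ length g
    j+n : j ℕ.+ n ≡ l
    j+n = trans (cong (ℕ._+ n) (cong₂ ℕ._∸_ r≡ lg)) (ℕₚ.m∸n+n≡m (ℕₚ.≤-pred (subst (suc n ℕ.≤_) r≡ n<r)))
    tg-top : coef (t ⊗ g) l ≡ coef r l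
    tg-top = trans (cong (coef (t ⊗ g)) (sym j+n)) (trans (coef-⊗-top t g j n (monomial-below j (lastCoeff r)) (bounded m)) (trans (cong₂ _*_ (monomial-top j (lastCoeff r)) (top m)) (trans (*-identityʳ (lastCoeff r)) (lastCoeff-coef r l r≡))))
    r′-below : Below l r′
    r′-below = Below-pred (Below-⊕ r (negₚ (t ⊗ g)) (subst (λ z → Below z r) r≡ (Below-length r)) (Below-scale -1ℤ (t ⊗ g) (subst (λ z → Below (suc z) (t ⊗ g)) j+n (Below-⊗ t g j n (monomial-below j (lastCoeff r)) (bounded m)))))
      (trans (coef-⊕ r (negₚ (t ⊗ g)) l) (trans (cong (λ z → coef r l + z) (trans (coef-neg (t ⊗ g) l) (cong -_ tg-top))) (+-inverseʳ (coef r l))))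

  opaque
    -- A sealed copy of `Φ`, which keeps its recursion from being unfolded; from here on `Φ°` is
    -- known through the properties in `Cyclotomic`.
    Φ° : ℕ → Poly
    Φ° = Φ

    Φ°≡Φ : ∀ n → Φ° n ≡ Φ n
    Φ°≡Φ n = refl

  pick : ∀ {d n} → Dec (d ∣ n) → Poly → Poly
  pick (yes _) p = p
  pick (no _) p = oneₚ

  -- The product of the Φ_d over the divisors d ≤ k of n
  PP : ℕ → ℕ → Poly
  PP n zero = oneₚ
  PP n (suc k) = PP n k ⊗ pick (suc k ∣? n) (Φ° (suc k))

  prodₚ-++ : ∀ ps qs → prodₚ (ps ++ qs) ≋ prodₚ ps ⊗ prodₚ qs
  prodₚ-++ [] qs = ≋-sym (⊗-identityˡ (prodₚ qs))
  prodₚ-++ (p ∷ ps) qs = ≋-trans (⊗-congʳ p (prodₚ-++ ps qs)) (≋-sym (⊗-assoc p (prodₚ ps) (prodₚ qs)))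

  properProd : ℕ → List Poly → Poly
  properProd n prev = prodₚ (map proj₂ (filter (λ kp → proj₁ kp ∣? n) (zip (map suc (upTo (length prev))) prev)))

  length-cycs : ∀ m → length (cycs m) ≡ m
  length-cycs zero = refl
  length-cycs (suc m) = trans (length-++ (cycs m)) (trans (cong (ℕ._+ 1) (length-cycs m)) (ℕₚ.+-comm m 1))

  zip-∷ʳ : ∀ {A B : Set} (xs : List A) (ys : List B) x y → length xs ≡ length ys → zip (xs ++ [ x ]) (ys ++ [ y ]) ≡ zip xs ys ++ [ (x , y) ]
  zip-∷ʳ [] [] x y e = refl
  zip-∷ʳ (a ∷ xs) (b ∷ ys) x y e = cong ((a , b) ∷_) (zip-∷ʳ xs ys x y (ℕₚ.suc-injective e))

  filter-pick : ∀ {n} (P? : (kp : ℕ × Poly) → Dec (proj₁ kp ∣ n)) k p → prodₚ (map proj₂ (filter P? [ (k , p) ])) ≋ pick (P? (k , p)) p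
  filter-pick P? k p with P? (k , p)
  ... | yes _ = ≋-trans (⊗-comm p oneₚ) (⊗-identityˡ p)
  ... | no _ = ≋-refl

  properProd-PP : ∀ n m → properProd n (cycs m) ≋ PP n m
  properProd-PP n zero = ≋-refl
  properProd-PP n (suc m) = ≋-trans (≋-reflexive (trans (cong (λ z → prodₚ (map proj₂ (filter P? z))) zip≡) (cong prodₚ (trans (cong (map proj₂) (filter-++ P? (zip (map suc (upTo (length (cycs m)))) (cycs m)) [ (suc m , Φ (suc m)) ])) (map-++ proj₂ (filter P? (zip (map suc (upTo (length (cycs m)))) (cycs m))) _)))))
    (≋-trans (prodₚ-++ (map proj₂ (filter P? (zip (map suc (upTo (length (cycs m)))) (cycs m)))) _) (⊗-cong (properProd-PP n m) last))
    where
    P? : (kp : ℕ × Poly) → Dec (proj₁ kp ∣ n)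
    P? kp = proj₁ kp ∣? n
    zip≡ : zip (map suc (upTo (length (cycs (suc m))))) (cycs (suc m)) ≡ zip (map suc (upTo (length (cycs m)))) (cycs m) ++ [ (suc m , Φ (suc m)) ]
    zip≡ = trans (cong (λ z → zip (map suc (upTo z)) (cycs (suc m))) (length-cycs (suc m)))
      (trans (cong (λ z → zip (map suc z) (cycs (suc m))) (sym (upTo-∷ʳ m)))
      (trans (cong (λ z → zip z (cycs (suc m))) (map-++ suc (upTo m) [ m ]))
      (trans (zip-∷ʳ (map suc (upTo m)) (cycs m) (suc m) (Φ (suc m)) (trans (length-map suc (upTo m)) (trans (length-upTo m) (sym (length-cycs m)))))
        (cong (λ z → zip (map suc (upTo z)) (cycs m) ++ [ (suc m , Φ (suc m)) ]) (sym (length-cycs m))))))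
    last : prodₚ (map proj₂ (filter P? [ (suc m , Φ (suc m)) ])) ≋ pick (suc m ∣? n) (Φ° (suc m))
    last = ≋-trans (filter-pick P? (suc m) (Φ (suc m))) (≋-reflexive (cong (pick (suc m ∣? n)) (sym (Φ°≡Φ (suc m)))))

  Φ-quot : ∀ m → Φ (suc m) ≡ quot (suc (suc m)) (strip (xⁿ-1 (suc m))) (strip (properProd (suc m) (cycs m)))
  Φ-quot m = refl

  -- For index m + 1. The identity `product` has to be proved, as `quot` returns a result whether or
  -- not the division is exact.
  record Cyclotomic (m : ℕ) : Set where
    field
      degree : ℕ
      monic-Φ : MonicAt degree (Φ° (suc m))
      product : xⁿ-1 (suc m) ≋ PP (suc m) m ⊗ Φ° (suc m)
  open Cyclotomic

  PP-∣-step : ∀ {g d} → g ∣ d → ∀ k → PP g k ∣ᵖ PP d k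
  PP-∣-step g∣d zero = ∣ᵖ-refl
  PP-∣-step {g} {d} g∣d (suc k) = ⊗-mono-∣ᵖ (PP-∣-step g∣d k) (go (suc k ∣? g) (suc k ∣? d))
    where
    go : (a : Dec (suc k ∣ g)) (b : Dec (suc k ∣ d)) → pick a (Φ° (suc k)) ∣ᵖ pick b (Φ° (suc k))
    go (yes _) (yes _) = ∣ᵖ-refl
    go (yes h) (no ¬h) = contradiction (∣-trans h g∣d) ¬h
    go (no _) b = divᵖ (pick b (Φ° (suc k))) (≋-sym (⊗-identityˡ (pick b (Φ° (suc k)))))

  PP-mono : ∀ d {k l} → k ℕ.≤′ l → PP d k ∣ᵖ PP d l
  PP-mono d ℕ.≤′-refl = ∣ᵖ-refl
  PP-mono d {l = suc l} (ℕ.≤′-step h) = ∣ᵖ-⊗ʳ (pick (suc l ∣? d) (Φ° (suc l))) (PP-mono d h)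

  PP-self : ∀ m → PP (suc m) (suc m) ≋ PP (suc m) m ⊗ Φ° (suc m)
  PP-self m with suc m ∣? suc m
  ... | yes _ = ≋-refl
  ... | no h = contradiction ∣-refl h

  Φ-∣ : ∀ {m} → Cyclotomic m → Φ° (suc m) ∣ᵖ xⁿ-1 (suc m)
  Φ-∣ {m} C = ∣ᵖ-cong (≋-sym (product C)) (∣ᵖ-⊗ˡ (PP (suc m) m) ∣ᵖ-refl)

  -- For a proper divisor e of d, x^e - 1 is a product of Φ's with index dividing d and less than d,
  -- hence divides the cofactor of Φ_d in x^d - 1. By separability that cofactor is comaximal to
  -- Φ_d.
  Φ-comax-proper : ∀ {m g} → Cyclotomic m → Cyclotomic g → suc g ∣ suc m → g ℕ.< m → Comaximal (Φ° (suc m)) (xⁿ-1 (suc g))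
  Φ-comax-proper {m} {g} C D g∣m g<m = comax-∣ (∣ᵖ-trans (∣ᵖ-congˡ (≋-sym (≋-trans (product D) (≋-sym (PP-self g)))) (PP-∣-step g∣m (suc g))) (PP-mono (suc m) (ℕₚ.≤⇒≤′ g<m)))
    (comax-sym (xⁿ-1-bezout (suc m) (s≤s z≤n) (product C)))

  -- With g the gcd of the two indices, x^g - 1 lies in the ideal generated by the two polynomials,
  -- and it is comaximal to the one of larger index because g is a proper divisor of that index.
  Φ-comax : ∀ {d e} → (∀ g → g ℕ.≤ e → Cyclotomic g) → Cyclotomic d → e ℕ.< d → Comaximal (Φ° (suc d)) (Φ° (suc e))
  Φ-comax {d} {e} all D e<d = go (gcd (suc d) (suc e)) refl
    where
    go : ∀ g → gcd (suc d) (suc e) ≡ g → Comaximal (Φ° (suc d)) (Φ° (suc e))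
    go zero eq = contradiction (subst (_∣ suc e) eq (gcd[m,n]∣n (suc d) (suc e))) λ { (divides q h) → contradiction (trans h (ℕₚ.*-zeroʳ q)) λ () }
    go (suc g) eq = comax-combination (proj₁ st) (proj₁ (proj₂ st)) (Φ-comax-proper D (all g g≤e) (subst (_∣ suc d) eq (gcd[m,n]∣m (suc d) (suc e))) (ℕₚ.≤-<-trans g≤e e<d))
        (≋-trans (≋-reflexive (cong xⁿ-1 (sym eq))) (proj₂ (proj₂ st)))
      where
      g≤e : g ℕ.≤ e
      g≤e = ℕₚ.≤-pred (∣⇒≤ (subst (_∣ suc e) eq (gcd[m,n]∣n (suc d) (suc e))))
      st : Σ Poly λ s → Σ Poly λ t → xⁿ-1 (gcd (suc d) (suc e)) ≋ Φ° (suc d) ⊗ s ⊕ Φ° (suc e) ⊗ t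
      st = xⁿ-1-gcd (suc d) (suc e) (Φ-∣ D) (Φ-∣ (all e ℕₚ.≤-refl))

  -- One factor at a time: each Φ divides x^n - 1 and is comaximal to the product so far, so it can
  -- be multiplied in.
  PP-divides : ∀ m → (∀ {d} → d ℕ.< m → Cyclotomic d) → ∀ k → k ℕ.≤ m → Σ ℕ λ n → MonicAt n (PP (suc m) k) × PP (suc m) k ∣ᵖ xⁿ-1 (suc m)
  PP-divides m rec zero _ = 0 , monic-one , divᵖ (xⁿ-1 (suc m)) (≋-sym (⊗-identityˡ (xⁿ-1 (suc m))))
  PP-divides m rec (suc k) k<m with suc k ∣? suc m | PP-divides m rec k (ℕₚ.<⇒≤ k<m)
  ... | no _ | n , mon , div = n , monic-≋ one mon , ∣ᵖ-congˡ one div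
    where
    one : PP (suc m) k ≋ PP (suc m) k ⊗ oneₚ
    one = ≋-sym (≋-trans (⊗-comm (PP (suc m) k) oneₚ) (⊗-identityˡ (PP (suc m) k)))
  ... | yes k∣m | n , mon , div = n ℕ.+ degree (rec k<m) , monic-⊗ mon (monic-Φ (rec k<m)) , comax-product (monic-Φ (rec k<m)) (comax-PP k ℕₚ.≤-refl) (∣ᵖ-trans (Φ-∣ (rec k<m)) (xⁿ-1-∣ k∣m)) div
    where
    comax-PP : ∀ l → l ℕ.≤ k → Comaximal (Φ° (suc k)) (PP (suc m) l)
    comax-PP zero _ = comax-one (Φ° (suc k))
    comax-PP (suc l) l<k = comax-⊗ (comax-PP l (ℕₚ.<⇒≤ l<k)) (go (suc l ∣? suc m))
      where
      go : (a : Dec (suc l ∣ suc m)) → Comaximal (Φ° (suc k)) (pick a (Φ° (suc l)))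
      go (yes _) = Φ-comax (λ g g≤l → rec (ℕₚ.≤-<-trans g≤l (ℕₚ.<-trans l<k k<m))) (rec k<m) l<k
      go (no _) = comax-one (Φ° (suc k))

  cyclotomic : ∀ m → Cyclotomic m
  cyclotomic = <-rec _ step
    where
    step : ∀ m → (∀ {d} → d ℕ.< m → Cyclotomic d) → Cyclotomic m
    step m rec with PP-divides m rec m ℕₚ.≤-refl
    ... | n , mon , divᵖ Q e = record { degree = suc m ℕ.∸ n ; monic-Φ = monic-≋ (≋-sym Φ≋Q) monic-Q ; product = ≋-trans e (⊗-congʳ (PP (suc m) m) (≋-sym Φ≋Q)) }
      where
      g : Poly
      g = strip (properProd (suc m) (cycs m))
      g≋ : g ≋ PP (suc m) m
      g≋ = ≋-trans (strip-≋ (properProd (suc m) (cycs m))) (properProd-PP (suc m) m)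
      Φ≋Q : Φ° (suc m) ≋ Q
      Φ≋Q = ≋-trans (≋-reflexive (trans (Φ°≡Φ (suc m)) (Φ-quot m))) (quot-correct g (suc (suc m)) (strip (xⁿ-1 (suc m))) Q (monic-≋ (≋-sym g≋) mon)
        (length-strip-monic (monic-≋ (≋-sym (properProd-PP (suc m) m)) mon)) (length-strip (suc (suc m)) (xⁿ-1 (suc m)) (bounded (monic-xⁿ-1 (suc m) (s≤s z≤n))))
        (≋-trans (strip-≋ (xⁿ-1 (suc m))) (≋-trans e (⊗-congˡ Q (≋-sym g≋)))))
      monic-Q : MonicAt (suc m ℕ.∸ n) Q
      monic-Q = monic-cofactor mon (monic-≋ e (monic-xⁿ-1 (suc m) (s≤s z≤n)))

-- Products of powers of x and of cyclotomic polynomials satisfy the divisibility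

module Back where

  open import Defs
  open import Data.Fin using (Fin; zero; suc)
  open import Data.Integer using (+_)
  open import Data.Integer.Divisibility using () renaming (_∣_ to _∣ℤ_)
  import Data.Integer.Divisibility.Signed as Signed
  open import Data.Nat
  open import Data.Nat.Coprimality using (Coprime; prime⇒coprime)
  open import Data.Nat.Divisibility using (_∣_; _∣?_; divides)
  open import Data.Nat.DivMod using (_/_; m≡m%n+[m/n]*n; m<n⇒m%n≡m)
  open import Data.Nat.Primality using (Prime)
  open import Data.Nat.Properties
  open import Data.Nat.Tactic.RingSolver using () renaming (solve-∀ to ℕ-solve-∀)
  open import Data.Product using (Σ; _×_; _,_; proj₁; proj₂)
  open import Relation.Binary.PropositionalEquality
  open import Relation.Nullary using (Dec; yes; no)
  open Modular using (inverse)
  open Poly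
  open Cyclo
  open Cyclotomic
  import Data.Integer.Properties as ℤₚ

  comp-xⁿ-1 : ∀ n k → comp (xⁿ-1 n) (X ^ₚ k) ≋ xⁿ-1 (n * k)
  comp-xⁿ-1 n k = ≋-trans (comp-⊕ (X ^ₚ n) (negₚ oneₚ) (X ^ₚ k)) (⊕-cong (≋-trans (comp-^ X n (X ^ₚ k)) (≋-trans (^ₚ-cong n (comp-X (X ^ₚ k))) (≋-sym (^ₚ-* X n k))))
    (≋-trans (comp-neg oneₚ (X ^ₚ k)) (neg-cong (comp-const (+ 1) (X ^ₚ k)))))

  X^-periodic : ∀ {e d} → e ∣ᵖ xⁿ-1 d → ∀ r q → e ∣ᵖ X ^ₚ (r + q * d) ⊕ negₚ (X ^ₚ r)
  X^-periodic {e} {d} h r q = ∣ᵖ-cong (≋-trans (lem (X ^ₚ r) (X ^ₚ (q * d))) (⊕-cong (≋-sym (^ₚ-+ X r (q * d))) ≋-refl)) (∣ᵖ-⊗ˡ (X ^ₚ r) (∣ᵖ-trans h (xⁿ-1-* d q)))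
    where
    open import Tactic.RingSolver using (solve-∀)
    lem : ∀ x y → x ⊗ (y ⊕ negₚ oneₚ) ≋ x ⊗ y ⊕ negₚ x
    lem = solve-∀ poly

  Φ-power-∣ : ∀ m k → Coprime k (suc m) → Φ° (suc m) ∣ᵖ comp (Φ° (suc m)) (X ^ₚ k)
  Φ-power-∣ m k k⊥d = comax-cancel (monic-Φ C) (comax-PP m ≤-refl) (∣ᵖ-cong (comp-⊗ (PP d m) (Φ° d) y)
      (∣ᵖ-cong (comp-congˡ y (product C)) (∣ᵖ-cong (≋-sym (≋-trans (comp-xⁿ-1 d k) (≋-reflexive (cong xⁿ-1 (*-comm d k))))) (∣ᵖ-trans (Φ-∣ C) (xⁿ-1-* d k)))))
    where
    d : ℕ
    d = suc m
    C : Cyclotomic m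
    C = cyclotomic m
    y : Poly
    y = X ^ₚ k
    k′ t : ℕ
    k′ = proj₁ (inverse d {k} k⊥d)
    t = (k * k′) / d
    -- With k′ inverse to k modulo d, and g the divisor of d in question, Φ_g(x^k) divides x^(g k
    -- k′) - 1, which agrees with x^g - 1 modulo Φ_d; the latter is comaximal to Φ_d.
    proper : ∀ g → suc g ∣ d → g < m → Comaximal (Φ° d) (comp (Φ° (suc g)) y)
    proper g g∣d g<m = comax-∣ (∣ᵖ-trans (comp-∣ᵖ y (Φ-∣ (cyclotomic g))) (∣ᵖ-congˡ (≋-sym (comp-xⁿ-1 (suc g) k)) (xⁿ-1-* (suc g * k) k′)))
      (comax-≡ (∣ᵖ-cong (lem (X ^ₚ suc g) (X ^ₚ (k′ * (suc g * k)))) (∣ᵖ-neg (subst (λ z → Φ° d ∣ᵖ X ^ₚ z ⊕ negₚ (X ^ₚ suc g)) (sym exponent) (X^-periodic (Φ-∣ C) (suc g) (suc g * t)))))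
        (Φ-comax-proper C (cyclotomic g) g∣d g<m))
      where
      open import Tactic.RingSolver using (solve-∀)
      lem : ∀ x y → negₚ (y ⊕ negₚ x) ≋ (x ⊕ negₚ oneₚ) ⊕ negₚ (y ⊕ negₚ oneₚ)
      lem = solve-∀ poly
      kk′ : k * k′ ≡ 1 + t * d
      kk′ = trans (m≡m%n+[m/n]*n (k * k′) d) (cong (_+ t * d) (trans (proj₂ (inverse d {k} k⊥d)) (m<n⇒m%n≡m (s≤s (≤-trans (s≤s z≤n) g<m)))))
      lem₁ : ∀ k′ g k → k′ * (g * k) ≡ g * (k * k′)
      lem₁ = ℕ-solve-∀
      lem₂ : ∀ g t d → g * (1 + t * d) ≡ g + g * t * d
      lem₂ = ℕ-solve-∀
      exponent : k′ * (suc g * k) ≡ suc g + suc g * t * d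
      exponent = trans (lem₁ k′ (suc g) k) (trans (cong (suc g *_) kk′) (lem₂ (suc g) t d))
    comax-PP : ∀ l → l ≤ m → Comaximal (Φ° d) (comp (PP d l) y)
    comax-PP zero _ = comax-∣ (divᵖ oneₚ (≋-sym (≋-trans (⊗-congˡ oneₚ (comp-const (+ 1) y)) (⊗-identityˡ oneₚ)))) (comax-one (Φ° d))
    comax-PP (suc l) l<m = comax-∣ (divᵖ oneₚ (≋-trans (≋-sym (comp-⊗ (PP d l) (pick (suc l ∣? d) (Φ° (suc l))) y)) (≋-sym (≋-trans (⊗-comm (comp (PP d (suc l)) y) oneₚ) (⊗-identityˡ (comp (PP d (suc l)) y))))))
        (comax-⊗ (comax-PP l (<⇒≤ l<m)) (go (suc l ∣? d)))
      where
      go : (a : Dec (suc l ∣ d)) → Comaximal (Φ° d) (comp (pick a (Φ° (suc l))) y)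
      go (yes h) = proper l h l<m
      go (no _) = comax-∣ (divᵖ oneₚ (≋-sym (≋-trans (⊗-congˡ oneₚ (comp-const (+ 1) y)) (⊗-identityˡ oneₚ)))) (comax-one (Φ° d))

  eval-∣ : ∀ {p q} a → p ∣ᵖ q → eval p a ∣ℤ eval q a
  eval-∣ {p} a (divᵖ s e) = Signed.∣⇒∣ᵤ (Signed.divides (eval s a) (trans (eval-cong a e) (trans (eval-⊗ p s a) (ℤₚ.*-comm (eval p a) (eval s a)))))

  -- The condition at the level of polynomials, where it is multiplicative in f. For k = p,
  -- evaluation at p gives f(p) ∣ f(p^p).
  Stable : ℕ → Poly → Set
  Stable k f = f ∣ᵖ comp f (X ^ₚ k)

  stable-⊗ : ∀ {k f g} → Stable k f → Stable k g → Stable k (f ⊗ g)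
  stable-⊗ {k} {f} {g} s t = ∣ᵖ-cong (≋-sym (comp-⊗ f g (X ^ₚ k))) (⊗-mono-∣ᵖ s t)

  stable-one : ∀ {k} → Stable k oneₚ
  stable-one {k} = ∣ᵖ-cong (≋-sym (comp-const (+ 1) (X ^ₚ k))) ∣ᵖ-refl

  stable-^ : ∀ {k f} n → Stable k f → Stable k (f ^ₚ n)
  stable-^ {k} zero s = stable-one {k}
  stable-^ {k} {f} (suc n) s = stable-⊗ {k} {f} {f ^ₚ n} s (stable-^ {k} {f} n s)

  stable-X : ∀ {k} → 0 < k → Stable k X
  stable-X {suc k} _ = ∣ᵖ-cong (≋-sym (comp-X (X ^ₚ suc k))) (∣ᵖ-⊗ʳ (X ^ₚ k) ∣ᵖ-refl)

  stable-≋ : ∀ {k f g} → f ≋ g → Stable k g → Stable k f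
  stable-≋ {k} {f} {g} e s = ∣ᵖ-congˡ (≋-sym e) (∣ᵖ-cong (comp-congˡ (X ^ₚ k) (≋-sym e)) s)

  stable-∏ : ∀ {k} m (f : Fin m → Poly) → (∀ i → Stable k (f i)) → Stable k (∏ₚ m f)
  stable-∏ {k} zero f s = stable-one {k}
  stable-∏ {k} (suc m) f s = stable-⊗ {k} {f zero} {∏ₚ m λ i → f (suc i)} (s zero) (stable-∏ {k} m (λ i → f (suc i)) λ i → s (suc i))

  stable⇒∣ : ∀ {p f} → Stable p f → eval f (+ p) ∣ℤ eval f (+ (p ^ p))
  stable⇒∣ {p} {f} s = subst (eval f (+ p) ∣ℤ_) (trans (eval-comp f (X ^ₚ p) (+ p)) (cong (eval f) (eval-X^ p p))) (eval-∣ (+ p) s)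

  total : ∀ m → (Fin m → ℕ) → ℕ
  total zero d = 0
  total (suc m) d = d zero + total m λ i → d (suc i)

  term≤total : ∀ m (d : Fin m → ℕ) i → d i ≤ total m d
  term≤total (suc m) d zero = m≤m+n _ _
  term≤total (suc m) d (suc i) = ≤-trans (term≤total m (λ i → d (suc i)) i) (m≤n+m _ (d zero))

  cyclotomic-product⇒divides : ∀ f m (d : Fin m → ℕ) → (∀ i → 1 ≤ d i) → ∀ e₀ (e : Fin m → ℕ) → f ≈ₚ (X ^ₚ e₀) ⊗ ∏ₚ m (λ i → Φ (d i) ^ₚ e i) →
    Σ ℕ λ N → (1 ≤ N) × ((p : ℕ) → Prime p → N ≤ p → eval f (+ p) ∣ℤ eval f (+ (p ^ p)))
  -- The sum of the d i plus one exceeds each of them, so a prime p ≥ N is coprime to every d i.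
  cyclotomic-product⇒divides f m d 1≤d e₀ e f≈ = suc (total m d) , s≤s z≤n , λ p pp N≤p → stable⇒∣ {p} {f}
      (stable-≋ {p} {f} {(X ^ₚ e₀) ⊗ ∏ₚ m (λ i → Φ (d i) ^ₚ e i)} (≈ₚ⇒≋ f≈) (stable-⊗ {p} {X ^ₚ e₀} {∏ₚ m λ i → Φ (d i) ^ₚ e i} (stable-^ {p} {X} e₀ (stable-X (≤-trans (s≤s z≤n) N≤p)))
        (stable-∏ {p} m (λ i → Φ (d i) ^ₚ e i) λ i → stable-^ {p} {Φ (d i)} (e i) (stable-Φ (d i) (1≤d i) pp (<-≤-trans (s≤s (term≤total m d i)) N≤p)))))
    where
    stable-Φ : ∀ {p} d → 1 ≤ d → Prime p → d < p → Stable p (Φ d)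
    stable-Φ {p} (suc d) _ pp d<p = subst (Stable p) (Φ°≡Φ (suc d)) (Φ-power-∣ d p (prime⇒coprime pp d<p))

-- Landau's argument for divisors of x^d - 1; counting roots in quotient rings

module Landau where

  open import Defs
  open import Algebra.Bundles using (CommutativeRing; CommutativeSemiring)
  open import Data.Fin using (Fin; zero; suc; toℕ; fromℕ; inject₁)
  import Data.Fin.Properties as Finₚ
  open import Data.Integer using (ℤ; +_; -[1+_]; 0ℤ; ∣_∣)
  import Data.Integer as ℤ
  import Data.Integer.Properties as ℤₚ
  open import Data.List using (List; []; _∷_; length)
  open import Data.List.Relation.Unary.All using (All; []; _∷_)
  open import Data.Nat
  open import Data.Nat.Combinatorics using (_C_; nCn≡1; nCk≡n!/k![n-k]!; k![n∸k]!∣n!)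
  open import Data.Nat.Coprimality using (Coprime)
  open import Data.Nat.Divisibility hiding (quotient)
  open import Data.Nat.DivMod using (m/n*n≡m; m≡m%n+[m/n]*n; m%n<n)
  open import Data.Nat.Induction using (<-rec)
  open import Data.Nat.Primality
  open import Data.Nat.Properties
  open import Data.Product using (_,_)
  open import Data.Sum using (inj₁; inj₂)
  open import Relation.Binary.PropositionalEquality
  open import Relation.Nullary using (contradiction)
  open import Tactic.RingSolver using (solve-∀)
  open Arith using (0<p; 1<p; prime-divisor; ∣!)
  open Modular using (coprime-lift)
  open Poly
  open Cyclo
  open Back using (X^-periodic)

  private
    commSemiring : CommutativeSemiring _ _
    commSemiring = CommutativeRing.commutativeSemiring polyRing

  open import Algebra.Properties.CommutativeSemiring.Binomial commSemiring using (binomialTerm; theorem)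
  open import Algebra.Properties.Semiring.Exp (CommutativeSemiring.semiring commSemiring) using () renaming (_^_ to _^′_)
  open import Algebra.Properties.Semiring.Mult (CommutativeSemiring.semiring commSemiring) using () renaming (_×_ to _×′_)
  open import Algebra.Properties.Semiring.Sum (CommutativeSemiring.semiring commSemiring) using (sum; sum-init-last)

  infix 4 _≈[_]_
  record _≈[_]_ (a e b : Poly) : Set where
    constructor by-diff
    field diff : e ∣ᵖ a ⊕ negₚ b
  open _≈[_]_

  module _ {e : Poly} where

    ≈-≋ : ∀ {a b} → a ≋ b → a ≈[ e ] b
    ≈-≋ {a} {b} h = by-diff (∣ᵖ-zero (≋-trans (⊕-cong h (≋-refl {negₚ b})) (⊕-inverseʳ b)))

    ≈-trans : ∀ {a b c} → a ≈[ e ] b → b ≈[ e ] c → a ≈[ e ] c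
    ≈-trans {a} {b} {c} (by-diff h) (by-diff h′) = by-diff (∣ᵖ-cong (lem a b c) (∣ᵖ-⊕ h h′))
      where
      lem : ∀ a b c → (a ⊕ negₚ b) ⊕ (b ⊕ negₚ c) ≋ a ⊕ negₚ c
      lem = solve-∀ poly

    ≈-sym : ∀ {a b} → a ≈[ e ] b → b ≈[ e ] a
    ≈-sym {a} {b} (by-diff h) = by-diff (∣ᵖ-cong (lem a b) (∣ᵖ-neg h))
      where
      lem : ∀ a b → negₚ (a ⊕ negₚ b) ≋ b ⊕ negₚ a
      lem = solve-∀ poly

    ≈-⊕ : ∀ {a b c d} → a ≈[ e ] b → c ≈[ e ] d → a ⊕ c ≈[ e ] b ⊕ d
    ≈-⊕ {a} {b} {c} {d} (by-diff h) (by-diff h′) = by-diff (∣ᵖ-cong (lem a b c d) (∣ᵖ-⊕ h h′))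
      where
      lem : ∀ a b c d → (a ⊕ negₚ b) ⊕ (c ⊕ negₚ d) ≋ (a ⊕ c) ⊕ negₚ (b ⊕ d)
      lem = solve-∀ poly

    ≈-⊗ : ∀ {b c} a → b ≈[ e ] c → a ⊗ b ≈[ e ] a ⊗ c
    ≈-⊗ {b} {c} a (by-diff h) = by-diff (∣ᵖ-cong (lem a b c) (∣ᵖ-⊗ˡ a h))
      where
      lem : ∀ a b c → a ⊗ (b ⊕ negₚ c) ≋ a ⊗ b ⊕ negₚ (a ⊗ c)
      lem = solve-∀ poly

    ≈-comp : ∀ {a b} f → a ≈[ e ] b → comp f a ≈[ e ] comp f b
    ≈-comp {a} {b} f (by-diff h) = by-diff (∣ᵖ-trans h (comp-diff f a b))

    ≈-^ : ∀ {a b} n → a ≈[ e ] b → a ^ₚ n ≈[ e ] b ^ₚ n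
    ≈-^ {a} {b} n h = ≈-trans (≈-≋ (≋-sym (pow a))) (≈-trans (≈-comp (X ^ₚ n) h) (≈-≋ (pow b)))
      where
      pow : ∀ a → comp (X ^ₚ n) a ≋ a ^ₚ n
      pow a = ≋-trans (comp-^ X n a) (^ₚ-cong n (comp-X a))

    ≈-∣ : ∀ {a b} → a ≈[ e ] b → e ∣ᵖ b → e ∣ᵖ a
    ≈-∣ {a} {b} (by-diff h) h′ = ∣ᵖ-cong (lem a b) (∣ᵖ-⊕ h h′)
      where
      lem : ∀ a b → (a ⊕ negₚ b) ⊕ b ≋ a
      lem = solve-∀ poly

  prime∣!⇒≤ : ∀ {p} k → Prime p → p ∣ k ! → p ≤ k
  prime∣!⇒≤ zero pp h = contradiction (subst Prime (∣1⇒≡1 h) pp) ¬prime[1]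
  prime∣!⇒≤ (suc k) pp h with euclidsLemma (suc k) (k !) pp h
  ... | inj₁ d = ∣⇒≤ d
  ... | inj₂ d = m≤n⇒m≤1+n (prime∣!⇒≤ k pp d)

  prime∣binomial : ∀ {p k} → Prime p → 0 < k → k < p → p ∣ p C k
  prime∣binomial {p} {k} pp 0<k k<p with euclidsLemma (p C k) (k ! * (p ∸ k) !) pp (subst (p ∣_) (sym factor) (∣! p (0<p pp) ≤-refl))
    where
    instance
      nz : NonZero (k ! * (p ∸ k) !)
      nz = k !* (p ∸ k) !≢0
    factor : (p C k) * (k ! * (p ∸ k) !) ≡ p !
    factor = trans (cong (_* (k ! * (p ∸ k) !)) (nCk≡n!/k![n-k]! (<⇒≤ k<p))) (m/n*n≡m ⦃ k !* (p ∸ k) !≢0 ⦄ (k![n∸k]!∣n! (<⇒≤ k<p)))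
  ... | inj₁ d = d
  ... | inj₂ d with euclidsLemma (k !) ((p ∸ k) !) pp d
  ...   | inj₁ d′ = contradiction (prime∣!⇒≤ k pp d′) (<⇒≱ k<p)
  ...   | inj₂ d′ = contradiction (prime∣!⇒≤ (p ∸ k) pp d′) (<⇒≱ (∸-monoʳ-< {p} {k} {0} 0<k (<⇒≤ k<p)))

  ^′-^ₚ : ∀ a n → a ^′ n ≋ a ^ₚ n
  ^′-^ₚ a zero = ≋-refl
  ^′-^ₚ a (suc n) = ⊗-congʳ a (^′-^ₚ a n)

  ×′-const : ∀ n a → n ×′ a ≋ const (+ n) ⊗ a
  ×′-const zero a = ≋-sym (⊗-zeroˡ (const 0ℤ) a (∷-zero refl ≋-refl))
  ×′-const (suc n) a = ≋-trans (⊕-cong (≋-refl {a}) (×′-const n a)) (≋-trans (lem a (const (+ n))) (⊗-congˡ a (≋-refl {oneₚ ⊕ const (+ n)})))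
    where
    lem : ∀ a n → a ⊕ n ⊗ a ≋ (oneₚ ⊕ n) ⊗ a
    lem = solve-∀ poly

  const-∣ : ∀ {m n} → m ∣ n → const (+ m) ∣ᵖ const (+ n)
  const-∣ {m} (divides q refl) = divᵖ (const (+ q)) (≋-sym (≋-trans (const-⊗ (+ m) (+ q)) (≋-reflexive (cong const (trans (sym (ℤₚ.pos-* m q)) (cong +_ (*-comm m q)))))))

  sum-∣ : ∀ {e} n (v : Fin n → Poly) → (∀ i → e ∣ᵖ v i) → e ∣ᵖ sum v
  sum-∣ zero v h = ∣ᵖ-zero ≋-refl
  sum-∣ (suc n) v h = ∣ᵖ-⊕ (h zero) (sum-∣ n (λ i → v (suc i)) λ i → h (suc i))

  frobenius : ∀ {p} → Prime p → ∀ a b → (a ⊕ b) ^ₚ p ≈[ const (+ p) ] a ^ₚ p ⊕ b ^ₚ p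
  frobenius {zero} pp a b = contradiction (0<p pp) λ ()
  frobenius {p@(suc m)} pp a b = ≈-trans (≈-≋ (≋-trans (≋-sym (^′-^ₚ (a ⊕ b) p)) (≋-trans (theorem p a b) (⊕-cong (≋-refl {t zero}) (sum-init-last (λ i → t (suc i)))))))
      (by-diff (∣ᵖ-cong (≋-trans (lem inner (t zero) (t (suc (fromℕ m)))) (⊕-cong (≋-refl {t zero ⊕ (inner ⊕ t (suc (fromℕ m)))}) (neg-cong ends))) (sum-∣ m (λ i → t (suc (inject₁ i))) middle)))
    where
    t : Fin (suc p) → Poly
    t = binomialTerm a b p
    inner : Poly
    inner = sum (λ i → t (suc (inject₁ i)))
    lem : ∀ s x y → s ≋ (x ⊕ (s ⊕ y)) ⊕ negₚ (y ⊕ x)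
    lem = solve-∀ poly
    one× : ∀ {n} c → n ≡ 1 → n ×′ c ≋ c
    one× c refl = ⊕-identityʳ c
    ends : t (suc (fromℕ m)) ⊕ t zero ≋ a ^ₚ p ⊕ b ^ₚ p
    ends = ⊕-cong (≋-trans (≋-reflexive (cong (λ k → (p C k) ×′ (a ^′ k ⊗ b ^′ (p ∸ k))) (cong suc (Finₚ.toℕ-fromℕ m))))
        (≋-trans (one× (a ^′ p ⊗ b ^′ (p ∸ p)) (nCn≡1 p)) (≋-trans (≋-reflexive (cong (λ k → a ^′ p ⊗ b ^′ k) (n∸n≡0 p))) (≋-trans (⊗-comm (a ^′ p) oneₚ) (≋-trans (⊗-identityˡ (a ^′ p)) (^′-^ₚ a p))))))
      (≋-trans (one× (oneₚ ⊗ b ^′ p) refl) (≋-trans (⊗-identityˡ (b ^′ p)) (^′-^ₚ b p)))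
    middle : ∀ i → const (+ p) ∣ᵖ t (suc (inject₁ i))
    middle i = ∣ᵖ-cong (≋-sym (×′-const (p C suc (toℕ (inject₁ i))) _)) (∣ᵖ-⊗ʳ (a ^′ suc (toℕ (inject₁ i)) ⊗ b ^′ (p ∸ suc (toℕ (inject₁ i))))
      (const-∣ (prime∣binomial pp (s≤s z≤n) (s≤s (subst (_< m) (sym (Finₚ.toℕ-inject₁ i)) (Finₚ.toℕ<n i))))))

  one-^ : ∀ n → oneₚ ^ₚ n ≋ oneₚ
  one-^ zero = ≋-refl
  one-^ (suc n) = ≋-trans (⊗-identityˡ (oneₚ ^ₚ n)) (one-^ n)

  zero-^ : ∀ {n p} → 0 < n → p ≋ [] → p ^ₚ n ≋ []
  zero-^ {suc n} {p} _ e = ⊗-zeroˡ p (p ^ₚ n) e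

  ^ₚ-⊗ : ∀ p q n → (p ⊗ q) ^ₚ n ≋ p ^ₚ n ⊗ q ^ₚ n
  ^ₚ-⊗ p q zero = ≋-sym (⊗-identityˡ oneₚ)
  ^ₚ-⊗ p q (suc n) = ≋-trans (⊗-congʳ (p ⊗ q) (^ₚ-⊗ p q n)) (lem p q (p ^ₚ n) (q ^ₚ n))
    where
    lem : ∀ p q a b → (p ⊗ q) ⊗ (a ⊗ b) ≋ (p ⊗ a) ⊗ (q ⊗ b)
    lem = solve-∀ poly

  fermat-ℕ : ∀ {p} → Prime p → ∀ n → const (+ n) ^ₚ p ≈[ const (+ p) ] const (+ n)
  fermat-ℕ {p} pp zero = ≈-≋ (≋-trans (zero-^ (0<p pp) (∷-zero refl ≋-refl)) (≋-sym (∷-zero refl ≋-refl)))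
  fermat-ℕ {p} pp (suc n) = ≈-trans (frobenius pp oneₚ (const (+ n))) (≈-⊕ (≈-≋ (one-^ p)) (fermat-ℕ pp n))

  fermat : ∀ {p} → Prime p → ∀ c → const c ^ₚ p ≈[ const (+ p) ] const c
  fermat {p} pp c = ≈-trans (≈-^ p c≈n) (≈-trans (fermat-ℕ pp ∣ n ∣) (≈-sym c≈n))
    where
    n : ℤ
    -- Adding p times the absolute value makes the integer nonnegative without changing it modulo p.
    n = c ℤ.+ + p ℤ.* + ∣ c ∣
    0≤n : 0ℤ ℤ.≤ n
    0≤n = ℤₚ.≤-trans (nonneg c) (ℤₚ.+-monoʳ-≤ c (ℤₚ.≤-trans (ℤ.+≤+ (m≤n*m ∣ c ∣ p ⦃ >-nonZero (0<p pp) ⦄)) (ℤₚ.≤-reflexive (ℤₚ.pos-* p ∣ c ∣))))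
      where
      nonneg : ∀ c → 0ℤ ℤ.≤ c ℤ.+ + ∣ c ∣
      nonneg (+ n) = ℤ.+≤+ z≤n
      nonneg -[1+ n ] = ℤₚ.≤-reflexive (sym (ℤₚ.+-inverseˡ (+ suc n)))
    c≈n : const c ≈[ const (+ p) ] const (+ ∣ n ∣)
    c≈n = by-diff (∣ᵖ-cong (⊕-cong (≋-refl {const c}) (neg-cong (≋-trans (≋-sym split) (≋-reflexive (cong const (sym (ℤₚ.0≤i⇒+∣i∣≡i 0≤n)))))))
        (∣ᵖ-cong (lem (const c) (const (+ p ℤ.* + ∣ c ∣))) (∣ᵖ-neg (divᵖ (const (+ ∣ c ∣)) (≋-sym (const-⊗ (+ p) (+ ∣ c ∣)))))))
      where
      split : const n ≋ const c ⊕ const (+ p ℤ.* + ∣ c ∣)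
      split = ≋-refl
      lem : ∀ c d → negₚ d ≋ c ⊕ negₚ (c ⊕ d)
      lem = solve-∀ poly

  frobenius-comp : ∀ {p} → Prime p → ∀ f → f ^ₚ p ≈[ const (+ p) ] comp f (X ^ₚ p)
  frobenius-comp {p} pp [] = ≈-≋ (zero-^ (0<p pp) ≋-refl)
  frobenius-comp {p} pp (c ∷ f) = ≈-trans (≈-≋ (^ₚ-cong p (∷-const c f))) (≈-trans (frobenius pp (const c) (X ⊗ f))
    (≈-⊕ (fermat pp c) (≈-trans (≈-≋ (^ₚ-⊗ X f p)) (≈-⊗ (X ^ₚ p) (frobenius-comp pp f)))))

  norm : Poly → ℕ
  norm [] = 0
  norm (c ∷ p) = ∣ c ∣ + norm p

  coef≤norm : ∀ p n → ∣ coef p n ∣ ≤ norm p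
  coef≤norm [] n = z≤n
  coef≤norm (c ∷ p) zero = m≤m+n _ _
  coef≤norm (c ∷ p) (suc n) = ≤-trans (coef≤norm p n) (m≤n+m _ _)

  small-multiple : ∀ {q r b} → norm r < q → r ≋ const (+ q) ⊗ b → r ≋ []
  small-multiple {q} {r} {b} lt e = coefs λ n → trans (trans (at e n) (trans (at (≋-sym (scale-const (+ q) b)) n) (coef-scale (+ q) b n))) (vanish n (coef b n) refl)
    where
    vanish : ∀ n x → coef b n ≡ x → + q ℤ.* x ≡ 0ℤ
    vanish n x eq = go ∣ x ∣ refl
      where
      coef≡ : coef r n ≡ + q ℤ.* x
      coef≡ = trans (at e n) (trans (at (≋-sym (scale-const (+ q) b)) n) (trans (coef-scale (+ q) b n) (cong (λ z → + q ℤ.* z) eq)))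
      go : ∀ k → ∣ x ∣ ≡ k → + q ℤ.* x ≡ 0ℤ
      go zero h = trans (cong (λ z → + q ℤ.* z) (ℤₚ.∣i∣≡0⇒i≡0 h)) (ℤₚ.*-zeroʳ (+ q))
      go (suc k) h = contradiction (≤-trans (≤-trans (m≤m*n q (suc k)) (≤-reflexive (trans (cong (q *_) (sym h)) (trans (sym (ℤₚ.abs-* (+ q) x)) (cong ∣_∣ (sym coef≡)))))) (coef≤norm r n)) (<⇒≱ lt)

  -- e(x^q) ≡ e(x)^q mod q, and modulo e the left side takes only finitely many values, all small compared to q.
  module _ {n d e} (0<d : 0 < d) (m : MonicAt n e) (e∣ : e ∣ᵖ xⁿ-1 d) where

    private
      R : ℕ → Poly
      R r = Division.remainder (divide m (comp e (X ^ₚ r)))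

      -- `A d` dominates the norms of all d possible remainders at once, independently of q.
      A : ℕ → ℕ
      A zero = 0
      A (suc r) = norm (R r) + A r

      norm≤A : ∀ {r k} → r < k → norm (R r) ≤ A k
      norm≤A {r} {suc k} (s≤s r≤k) with m≤n⇒m<n∨m≡n r≤k
      ... | inj₁ r<k = ≤-trans (norm≤A r<k) (m≤n+m _ _)
      ... | inj₂ refl = m≤m+n _ _

      instance
        d≢0 : NonZero d
        d≢0 = >-nonZero 0<d

      reduce : ∀ k → X ^ₚ k ≈[ e ] X ^ₚ (k % d)
      reduce k = by-diff (subst (λ z → e ∣ᵖ X ^ₚ z ⊕ negₚ (X ^ₚ (k % d))) (sym (m≡m%n+[m/n]*n k d)) (X^-periodic e∣ (k % d) (k / d)))

      -- Modulo e, e(x^q) is the remainder R belonging to q mod d. It is also -q times some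
      -- remainder, because e^q vanishes modulo e. Both have degree below that of e and are
      -- therefore equal, so R is a multiple of q with norm less than q, that is, zero.
      prime-power : ∀ {q} → Prime q → A d < q → e ∣ᵖ comp e (X ^ₚ q)
      prime-power {q} pq A<q = ≈-∣ comp≈ (zero-remainder D (small-multiple {q} {R r} {negₚ remainder′} (≤-<-trans (norm≤A (m%n<n q d)) A<q) R≡))
        where
        r : ℕ
        r = q % d
        D : Division n e (comp e (X ^ₚ r))
        D = divide m (comp e (X ^ₚ r))
        comp≈ : comp e (X ^ₚ q) ≈[ e ] comp e (X ^ₚ r)
        comp≈ = ≈-comp e (reduce q)
        b : Poly
        b = _∣ᵖ_.quo (diff (frobenius-comp pq e))
        open Division (divide m b) renaming (quotient to quotient′; remainder to remainder′; division to division′; small to small′)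
        open Division D
        e^q : e ∣ᵖ e ^ₚ q
        e^q = go (0<p pq)
          where
          go : ∀ {q} → 0 < q → e ∣ᵖ e ^ₚ q
          go {suc q} _ = ∣ᵖ-⊗ʳ (e ^ₚ q) ∣ᵖ-refl
        lem : ∀ eq cq cr e Q R p b Q′ R′ → cr ≋ e ⊗ Q ⊕ R → b ≋ e ⊗ Q′ ⊕ R′ → eq ⊕ negₚ cq ≋ p ⊗ b → R ⊕ p ⊗ R′ ≋ (eq ⊕ negₚ (cq ⊕ negₚ cr)) ⊕ negₚ (e ⊗ (Q ⊕ p ⊗ Q′))
        lem eq cq cr e Q R p b Q′ R′ h₁ h₂ h₃ = ≋-trans (lem₁ R p R′ e Q Q′) (≋-trans (⊕-cong (≋-trans (⊕-cong (≋-sym h₃′) (≋-sym h₁)) (lem₂ eq cq cr)) (≋-refl {negₚ (e ⊗ (Q ⊕ p ⊗ Q′))}))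
            (≋-refl {(eq ⊕ negₚ (cq ⊕ negₚ cr)) ⊕ negₚ (e ⊗ (Q ⊕ p ⊗ Q′))}))
          where
          h₃′ : eq ⊕ negₚ cq ≋ p ⊗ (e ⊗ Q′ ⊕ R′)
          h₃′ = ≋-trans h₃ (⊗-congʳ p h₂)
          lem₁ : ∀ R p R′ e Q Q′ → R ⊕ p ⊗ R′ ≋ (p ⊗ (e ⊗ Q′ ⊕ R′) ⊕ (e ⊗ Q ⊕ R)) ⊕ negₚ (e ⊗ (Q ⊕ p ⊗ Q′))
          lem₁ = solve-∀ poly
          lem₂ : ∀ eq cq cr → (eq ⊕ negₚ cq) ⊕ cr ≋ eq ⊕ negₚ (cq ⊕ negₚ cr)
          lem₂ = solve-∀ poly
        sum-∣e : e ∣ᵖ R r ⊕ const (+ q) ⊗ remainder′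
        sum-∣e = ∣ᵖ-cong (≋-sym (lem (e ^ₚ q) (comp e (X ^ₚ q)) (comp e (X ^ₚ r)) e quotient (R r) (const (+ q)) b quotient′ remainder′ division division′ (_∣ᵖ_.eqn (diff (frobenius-comp pq e)))))
          (∣ᵖ-⊕ (∣ᵖ-⊕ e^q (∣ᵖ-neg (diff comp≈))) (∣ᵖ-neg (∣ᵖ-⊗ʳ (quotient ⊕ const (+ q) ⊗ quotient′) ∣ᵖ-refl)))
        sum≋0 : R r ⊕ const (+ q) ⊗ remainder′ ≋ []
        sum≋0 = ∣ᵖ-small m sum-∣e (Below-⊕ (R r) (const (+ q) ⊗ remainder′) small (Below-≋ (scale-const (+ q) remainder′) (Below-scale (+ q) remainder′ small′)))
        lem₃ : ∀ R p R′ → R ≋ (R ⊕ p ⊗ R′) ⊕ p ⊗ negₚ R′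
        lem₃ = solve-∀ poly
        R≡ : R r ≋ const (+ q) ⊗ negₚ remainder′
        R≡ = ≋-trans (lem₃ (R r) (const (+ q)) remainder′) (⊕-cong sum≋0 (≋-refl {const (+ q) ⊗ negₚ remainder′}))

      -- The prime case is iterated: the relation e(x) ∣ e(x^q) survives the substitution of x^k for
      -- x.
      large-primes : ∀ k → 0 < k → (∀ {q} → Prime q → q ∣ k → A d < q) → e ∣ᵖ comp e (X ^ₚ k)
      large-primes = <-rec _ step
        where
        Goal : ℕ → Set
        Goal k = 0 < k → (∀ {q} → Prime q → q ∣ k → A d < q) → e ∣ᵖ comp e (X ^ₚ k)
        factor : ∀ {q} k → Prime q → A d < q → e ∣ᵖ comp e (X ^ₚ k) → e ∣ᵖ comp e (X ^ₚ (k * q))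
        factor {q} k pq A<q h = ∣ᵖ-trans h (∣ᵖ-cong (≋-trans (comp-comp e (X ^ₚ q) (X ^ₚ k)) (comp-congʳ e (≋-trans (comp-^ X q (X ^ₚ k)) (≋-trans (^ₚ-cong q (comp-X (X ^ₚ k))) (≋-trans (≋-sym (^ₚ-* X q k)) (≋-reflexive (cong (X ^ₚ_) (*-comm q k))))))))
          (comp-∣ᵖ (X ^ₚ k) (prime-power pq A<q)))
        step : ∀ k → (∀ {k′} → k′ < k → Goal k′) → Goal k
        step (suc zero) rec _ _ = ∣ᵖ-cong (≋-sym (≋-trans (comp-congʳ e (≋-trans (⊗-comm X oneₚ) (⊗-identityˡ X))) (comp-id e))) ∣ᵖ-refl
        step k@(suc (suc _)) rec 0<k large with prime-divisor {k} (s≤s (s≤s z≤n))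
        ... | q , pq , divides k′ eq = subst (λ z → e ∣ᵖ comp e (X ^ₚ z)) (sym eq) (factor k′ pq (large pq (divides k′ eq)) (rec k′<k 0<k′ λ pr r∣k′ → large pr (∣-trans r∣k′ (divides q (trans eq (*-comm k′ q))))))
          where
          0<k′ : 0 < k′
          0<k′ = n≢0⇒n>0 λ { refl → contradiction eq λ () }
          k′<k : k′ < k
          k′<k = subst (k′ <_) (sym eq) (m<m*n k′ q ⦃ >-nonZero 0<k′ ⦄ (1<p pq))

    -- k may be replaced by any k′ ≡ k mod d, as x^k and x^k′ agree modulo e. Choosing k′ prime to
    -- (A d)! forces all its prime factors beyond `A d`.
    landau : ∀ k → 0 < k → Coprime k d → e ∣ᵖ comp e (X ^ₚ k)
    landau k 0<k k⊥d with coprime-lift {k} d (A d !) (1≤n! (A d)) k⊥d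
    ... | k′ , k′≡k , k′⊥A = ≈-∣ (≈-comp e (class k k′ k′≡k)) (lifted k′ k′≡k k′⊥A)
      where
      class : ∀ k k′ → k′ % d ≡ k % d → X ^ₚ k ≈[ e ] X ^ₚ k′
      class k k′ eq = ≈-trans (reduce k) (≈-sym (subst (λ z → X ^ₚ k′ ≈[ e ] X ^ₚ z) eq (reduce k′)))
      lifted : ∀ k′ → k′ % d ≡ k % d → Coprime k′ (A d !) → e ∣ᵖ comp e (X ^ₚ k′)
      -- A lift equal to 0 means that d divides k, so d = 1, and then 1 is as good a lift.
      lifted zero eq c = ∣ᵖ-cong (comp-congʳ e (≋-refl {oneₚ})) one-case
        where
        d≡1 : d ≡ 1
        d≡1 = k⊥d (m%n≡0⇒n∣m k d (trans (sym eq) (n∣m⇒m%n≡0 0 d (d ∣0))) , ∣-refl)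
        one-case : e ∣ᵖ comp e (X ^ₚ 0)
        one-case = ≈-∣ (≈-comp e (class 0 1 (trans (n∣m⇒m%n≡0 1 d (subst (_∣ 1) (sym d≡1) ∣-refl)) (sym (n∣m⇒m%n≡0 0 d (d ∣0)))))) (large-primes 1 (s≤s z≤n) λ pq q∣1 → contradiction (subst Prime (∣1⇒≡1 q∣1) pq) ¬prime[1])
      lifted (suc k′) _ c = large-primes (suc k′) (s≤s z≤n) λ {q} pq q∣k′ → ≰⇒> λ q≤A → ¬prime[1] (subst Prime (c (q∣k′ , ∣! (A d) (0<p pq) q≤A)) pq)

  -- The list holds coefficients in ℤ[x] of a polynomial in a second variable; read modulo e, it is
  -- a polynomial over the quotient ring by e.
  evalᵖ : List Poly → Poly → Poly
  evalᵖ [] y = []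
  evalᵖ (f ∷ fs) y = f ⊕ y ⊗ evalᵖ fs y

  synth : List Poly → Poly → List Poly
  synth [] y = []
  synth (f ∷ []) y = []
  synth (f ∷ g ∷ fs) y = evalᵖ (g ∷ fs) y ∷ synth (g ∷ fs) y

  length-synth : ∀ f fs y → length (synth (f ∷ fs) y) ≡ length fs
  length-synth f [] y = refl
  length-synth f (g ∷ fs) y = cong suc (length-synth g fs y)

  synth-eval : ∀ fs y z → evalᵖ fs z ⊕ negₚ (evalᵖ fs y) ≋ (z ⊕ negₚ y) ⊗ evalᵖ (synth fs y) z
  synth-eval [] y z = ≋-sym (⊗-zeroʳ (z ⊕ negₚ y))
  synth-eval (f ∷ []) y z = ≋-trans (⊕-cong (⊕-cong (≋-refl {f}) (⊗-zeroʳ z)) (neg-cong (⊕-cong (≋-refl {f}) (⊗-zeroʳ y)))) (≋-trans (⊕-inverseʳ (f ⊕ [])) (≋-sym (⊗-zeroʳ (z ⊕ negₚ y))))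
  synth-eval (f ∷ g ∷ fs) y z = ≋-trans (lem f z y (evalᵖ (g ∷ fs) z) (evalᵖ (g ∷ fs) y)) (≋-trans (⊕-cong (≋-refl {(z ⊕ negₚ y) ⊗ evalᵖ (g ∷ fs) y}) (⊗-congʳ z (synth-eval (g ∷ fs) y z))) (lem′ z y (evalᵖ (g ∷ fs) y) (evalᵖ (synth (g ∷ fs) y) z)))
    where
    lem : ∀ f z y gz gy → (f ⊕ z ⊗ gz) ⊕ negₚ (f ⊕ y ⊗ gy) ≋ (z ⊕ negₚ y) ⊗ gy ⊕ z ⊗ (gz ⊕ negₚ gy)
    lem = solve-∀ poly
    lem′ : ∀ z y gy s → (z ⊕ negₚ y) ⊗ gy ⊕ z ⊗ ((z ⊕ negₚ y) ⊗ s) ≋ (z ⊕ negₚ y) ⊗ (gy ⊕ z ⊗ s)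
    lem′ = solve-∀ poly

  synth-zero : ∀ {e} fs y → e ∣ᵖ evalᵖ fs y → All (e ∣ᵖ_) (synth fs y) → All (e ∣ᵖ_) fs
  synth-zero [] y h _ = []
  synth-zero (f ∷ []) y h _ = ∣ᵖ-cong (≋-trans (⊕-cong (≋-refl {f}) (⊗-zeroʳ y)) (⊕-identityʳ f)) h ∷ []
  synth-zero {e} (f ∷ g ∷ fs) y h (h′ ∷ hs) = ∣ᵖ-cong (lem f (y ⊗ evalᵖ (g ∷ fs) y)) (∣ᵖ-⊕ h (∣ᵖ-neg (∣ᵖ-⊗ˡ y h′))) ∷ synth-zero (g ∷ fs) y h′ hs
    where
    lem : ∀ f y → (f ⊕ y) ⊕ negₚ y ≋ f
    lem = solve-∀ poly

  -- Lagrange's bound on roots, in a quotient ring that may have zero divisors: it is enough that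
  -- differences of the roots are none. A list of n coefficients with n such roots vanishes. This
  -- serves modulo a factor of Φ_d and again modulo a prime number.
  roots-vanish : ∀ {e} n fs → length fs ≡ n → (r : ℕ → Poly) → (∀ i j → i < j → j < n → ∀ x → e ∣ᵖ (r i ⊕ negₚ (r j)) ⊗ x → e ∣ᵖ x) →
    (∀ i → i < n → e ∣ᵖ evalᵖ fs (r i)) → All (e ∣ᵖ_) fs
  roots-vanish zero [] eq r reg root = []
  roots-vanish {e} (suc l) (f ∷ fs) eq r reg root = synth-zero (f ∷ fs) (r l) (root l ≤-refl)
    (roots-vanish l (synth (f ∷ fs) (r l)) (trans (length-synth f fs (r l)) (suc-injective eq)) r (λ i j i<j j<l → reg i j i<j (m<n⇒m<1+n j<l))
      λ i i<l → reg i l i<l ≤-refl (evalᵖ (synth (f ∷ fs) (r l)) (r i)) (∣ᵖ-cong (synth-eval (f ∷ fs) (r l) (r i)) (∣ᵖ-⊕ (root i (m<n⇒m<1+n i<l)) (∣ᵖ-neg (root l ≤-refl)))))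

-- Irreducibility of cyclotomic polynomials and the dichotomy it yields

module Irr where

  open import Defs
  open import Data.Integer using (ℤ; +_; -[1+_]; 0ℤ; 1ℤ; -1ℤ; ∣_∣)
  import Data.Integer as ℤ
  import Data.Integer.Properties as ℤₚ
  open import Data.List using ([]; _∷_; length; map)
  open import Data.List.Properties using (length-map)
  open import Data.List.Relation.Unary.All using (All; []; _∷_)
  open import Data.Nat
  open import Data.Nat.Coprimality using (Coprime; coprime?)
  open import Data.Nat.Divisibility
  open import Data.Nat.GCD using (gcd; gcd[m,n]∣m; gcd[m,n]∣n)
  open import Data.Nat.Coprimality using (gcd≡1⇒coprime)
  open import Data.Nat.Induction using (<-rec)
  open import Data.Nat.Primality
  open import Data.Nat.Properties
  open import Data.Nat.Tactic.RingSolver using () renaming (solve-∀ to ℕ-solve-∀)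
  open import Data.Product using (Σ; _×_; _,_; proj₁; proj₂)
  import Data.Sum
  open import Data.Sum using (_⊎_; inj₁; inj₂)
  open import Relation.Binary.PropositionalEquality hiding ([_])
  open import Relation.Nullary using (Dec; yes; no; ¬_; contradiction)
  open import Tactic.RingSolver using (solve-∀)
  open Arith using (0<p; 1<p; prime-divisor)
  open Poly
  open Cyclo
  open Back using (comp-xⁿ-1; X^-periodic)
  open Landau
  open Cyclotomic

  comax-comp : ∀ {a b} y → Comaximal a b → Comaximal (comp a y) (comp b y)
  comax-comp {a} {b} y (comax c c≢0 U V e) = comax c c≢0 (comp U y) (comp V y)
    (≋-trans (≋-sym (comp-const c y)) (≋-trans (comp-congˡ y e) (≋-trans (comp-⊕ (a ⊗ U) (b ⊗ V) y) (⊕-cong (comp-⊗ a U y) (comp-⊗ b V y)))))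

  comax-∣ˡ : ∀ {a a′ b} → a′ ∣ᵖ a → Comaximal a b → Comaximal a′ b
  comax-∣ˡ h c = comax-sym (comax-∣ h (comax-sym c))

  -- k + d is positive even for k = 0, and x^(k+d) agrees with x^k modulo e.
  landau-all : ∀ {n d e} → 0 < d → MonicAt n e → e ∣ᵖ xⁿ-1 d → ∀ k → Coprime k d → e ∣ᵖ comp e (X ^ₚ k)
  landau-all {n} {d} {e} 0<d m e∣ k k⊥d = ≈-∣ (≈-comp e (≈-sym (by-diff (subst (λ z → e ∣ᵖ X ^ₚ (k + z) ⊕ negₚ (X ^ₚ k)) (*-identityˡ d) (X^-periodic e∣ k 1)))))
    (landau 0<d m e∣ (k + d) (≤-trans 0<d (m≤n+m d k)) λ {i} (i∣k+d , i∣d) → k⊥d (∣m+n∣m⇒∣n (subst (i ∣_) (+-comm k d) i∣k+d) i∣d , i∣d))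

  comp-evalᵖ : ∀ p y → evalᵖ (map const p) y ≡ comp p y
  comp-evalᵖ [] y = refl
  comp-evalᵖ (c ∷ p) y = cong (λ z → const c ⊕ y ⊗ z) (comp-evalᵖ p y)

  all-coefs : ∀ {e} p → All (e ∣ᵖ_) (map const p) → ∀ t → e ∣ᵖ const (coef p t)
  all-coefs [] [] t = ∣ᵖ-zero (∷-zero refl ≋-refl)
  all-coefs (c ∷ p) (h ∷ hs) zero = h
  all-coefs (c ∷ p) (h ∷ hs) (suc t) = all-coefs p hs t

  monic-∣one : ∀ {n e} → MonicAt (suc n) e → ¬ e ∣ᵖ oneₚ
  monic-∣one m h = contradiction (at (∣ᵖ-small m h (Below-mono (s≤s z≤n) (bounded monic-one))) 0) λ ()

  monic-0 : ∀ {p} → MonicAt 0 p → p ≋ oneₚ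
  monic-0 (monicAt t b) = coefs λ { zero → t ; (suc i) → out b (suc i) (s≤s z≤n) }

  module _ (m : ℕ) where

    private
      d : ℕ
      d = suc m
      C : Cyclotomic m
      C = cyclotomic m
      Φd : Poly
      Φd = Φ° d

    Φ-comax-xⁿ-1 : ∀ s → 0 < s → s < d → Comaximal Φd (xⁿ-1 s)
    Φ-comax-xⁿ-1 s 0<s s<d = go (gcd d s) refl
      where
      go : ∀ g → gcd d s ≡ g → Comaximal Φd (xⁿ-1 s)
      go zero eq = contradiction (0∣⇒≡0 (subst (_∣ s) eq (gcd[m,n]∣n d s))) (>⇒≢ 0<s)
      go (suc g) eq = comax-combination (proj₁ st) (proj₁ (proj₂ st)) (Φ-comax-proper C (cyclotomic g) (subst (_∣ d) eq (gcd[m,n]∣m d s)) (≤-pred (≤-<-trans (∣⇒≤ ⦃ >-nonZero 0<s ⦄ (subst (_∣ s) eq (gcd[m,n]∣n d s))) s<d)))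
          (≋-trans (≋-reflexive (cong xⁿ-1 (sym eq))) (proj₂ (proj₂ st)))
        where
        st : Σ Poly λ a → Σ Poly λ b → xⁿ-1 (gcd d s) ≋ Φd ⊗ a ⊕ xⁿ-1 s ⊗ b
        st = xⁿ-1-gcd d s (Φ-∣ C) ∣ᵖ-refl

    -- If c had positive degree, all d powers of x would be roots of w = (x^d - 1) / c modulo e.
    irreducible : ∀ {n e c} → MonicAt (suc n) e → Φd ≋ e ⊗ c → Φd ∣ᵖ e
    irreducible {n} {e} {c} me eq = by-degree (degree C ∸ suc n) (monic-cofactor me (monic-≋ eq (monic-Φ C)))
      where
      e∣Φ : e ∣ᵖ Φd
      e∣Φ = divᵖ c eq
      e∣xᵈ-1 : e ∣ᵖ xⁿ-1 d
      e∣xᵈ-1 = ∣ᵖ-trans e∣Φ (Φ-∣ C)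
      by-degree : ∀ k → MonicAt k c → Φd ∣ᵖ e
      by-degree zero mc = divᵖ oneₚ (≋-sym (≋-trans (⊗-congˡ oneₚ (≋-trans eq (≋-trans (⊗-congʳ e (monic-0 mc)) (≋-trans (⊗-comm e oneₚ) (⊗-identityˡ e))))) (≋-trans (⊗-comm e oneₚ) (⊗-identityˡ e))))
      -- All coefficients of w would be divisible by e, among them its leading coefficient 1,
      -- although e has positive degree.
      by-degree (suc k) mc = contradiction (subst (λ z → e ∣ᵖ const z) (top mw′) (all-coefs (strip w) all-zero (d ∸ suc k))) (monic-∣one me)
        where
        w : Poly
        w = PP d m ⊗ e
        lem : ∀ p e c → p ⊗ (e ⊗ c) ≋ c ⊗ (p ⊗ e)
        lem = solve-∀ poly
        cw : xⁿ-1 d ≋ c ⊗ w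
        cw = ≋-trans (product C) (≋-trans (⊗-congʳ (PP d m) eq) (lem (PP d m) e c))
        mw : MonicAt (d ∸ suc k) w
        mw = monic-cofactor mc (monic-≋ cw (monic-xⁿ-1 d (s≤s z≤n)))
        mw′ : MonicAt (d ∸ suc k) (strip w)
        mw′ = monic-≋ (≋-sym (strip-≋ w)) mw
        length-w : length (map const (strip w)) ≡ suc (d ∸ suc k)
        length-w = trans (length-map const (strip w)) (length-strip-monic mw)
        few : suc (d ∸ suc k) ≤ d
        few = s≤s (m∸n≤m m k)
        e-c : Comaximal e c
        e-c = comax-∣ (divᵖ (PP d m) ≋-refl) (xⁿ-1-bezout d (s≤s z≤n) (≋-trans (product C) (≋-trans (⊗-congʳ (PP d m) eq) (lem′ (PP d m) e c))))
          where
          lem′ : ∀ p e c → p ⊗ (e ⊗ c) ≋ e ⊗ (c ⊗ p)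
          lem′ = solve-∀ poly
        -- For i prime to d, e divides e(x^i), and the comaximality of e and c is carried over by
        -- substituting x^i. Otherwise d = s g with g = gcd(i, d) > 1. Then d divides s i, so e
        -- divides x^(s i) - 1, while c(x^i) divides Φ_d(x^i), which is comaximal to x^(s i) - 1
        -- because s < d.
        e-cᵢ : ∀ i → Comaximal e (comp c (X ^ₚ i))
        e-cᵢ i = decide (coprime? i d)
          where
          decide : Dec (Coprime i d) → Comaximal e (comp c (X ^ₚ i))
          decide (yes i⊥d) = comax-∣ˡ (landau-all (s≤s z≤n) me e∣xᵈ-1 i i⊥d) (comax-comp (X ^ₚ i) e-c)
          decide (no ¬i⊥d) = go (gcd[m,n]∣m i d) (gcd[m,n]∣n i d)
            where
            go : gcd i d ∣ i → gcd i d ∣ d → Comaximal e (comp c (X ^ₚ i))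
            go (divides t i≡tg) (divides s d≡sg) = comax-∣ (comp-∣ᵖ {c} (X ^ₚ i) (divᵖ e (≋-trans eq (⊗-comm e c))))
                (comax-sym (comax-∣ (∣ᵖ-trans e∣xᵈ-1 (∣ᵖ-cong (≋-sym (≋-trans (comp-xⁿ-1 s i) (≋-reflexive (cong xⁿ-1 si≡td)))) (xⁿ-1-* d t))) (comax-comp (X ^ₚ i) (Φ-comax-xⁿ-1 s 0<s s<d))))
              where
              g≢1 : ¬ gcd i d ≡ 1
              g≢1 h = ¬i⊥d (gcd≡1⇒coprime h)
              0<s : 0 < s
              0<s = n≢0⇒n>0 λ { refl → contradiction d≡sg λ () }
              1<g : 1 < gcd i d
              1<g = ≤∧≢⇒< (n≢0⇒n>0 λ z → contradiction (trans d≡sg (trans (cong (s *_) z) (*-zeroʳ s))) λ ()) λ h → g≢1 (sym h)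
              s<d : s < d
              s<d = subst (s <_) (sym d≡sg) (m<m*n s (gcd i d) ⦃ >-nonZero 0<s ⦄ 1<g)
              lem″ : ∀ s t g → s * (t * g) ≡ t * (s * g)
              lem″ = ℕ-solve-∀
              si≡td : s * i ≡ t * d
              si≡td = trans (cong (s *_) i≡tg) (trans (lem″ s t (gcd i d)) (cong (t *_) (sym d≡sg)))
        -- e divides x^(d i) - 1 = c(x^i) w(x^i), and c(x^i) can be cancelled.
        root : ∀ i → i < suc (d ∸ suc k) → e ∣ᵖ evalᵖ (map const (strip w)) (X ^ₚ i)
        root i _ = ∣ᵖ-cong (≋-sym (≋-trans (≋-reflexive (comp-evalᵖ (strip w) (X ^ₚ i))) (comp-congˡ (X ^ₚ i) (strip-≋ w)))) (comax-cancel me (e-cᵢ i)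
          (∣ᵖ-cong (≋-trans (≋-sym (comp-xⁿ-1 d i)) (≋-trans (comp-congˡ (X ^ₚ i) cw) (comp-⊗ c w (X ^ₚ i)))) (∣ᵖ-trans e∣xᵈ-1 (∣ᵖ-cong (≋-reflexive (cong xⁿ-1 (*-comm i d))) (xⁿ-1-* d i)))))
        -- Modulo e the power x^d is 1, so x is invertible.
        e-X : Comaximal e X
        e-X = comax-combination {e} {oneₚ} {X} (negₚ (_∣ᵖ_.quo e∣xᵈ-1)) (X ^ₚ m) (comax-one e)
          (≋-trans (lem₁ (X ^ₚ d)) (≋-trans (⊕-cong (neg-cong (_∣ᵖ_.eqn e∣xᵈ-1)) (≋-refl {X ^ₚ d})) (lem₂ e (_∣ᵖ_.quo e∣xᵈ-1) (X ^ₚ d))))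
          where
          lem₁ : ∀ x → oneₚ ≋ negₚ (x ⊕ negₚ oneₚ) ⊕ x
          lem₁ = solve-∀ poly
          lem₂ : ∀ e q x → negₚ (e ⊗ q) ⊕ x ≋ e ⊗ negₚ q ⊕ x
          lem₂ = solve-∀ poly
        e-X^ : ∀ i → Comaximal e (X ^ₚ i)
        e-X^ zero = comax-one e
        e-X^ (suc i) = comax-⊗ e-X (e-X^ i)
        -- x^i - x^j is x^i times 1 - x^(j-i). Both factors are comaximal to e, the second because 0
        -- < j - i < d.
        regular : ∀ i j → i < j → j < suc (d ∸ suc k) → ∀ x → e ∣ᵖ (X ^ₚ i ⊕ negₚ (X ^ₚ j)) ⊗ x → e ∣ᵖ x
        regular i j i<j j<n x = comax-cancel {b = X ^ₚ i ⊕ negₚ (X ^ₚ j)} me (comax-∣ (divᵖ (negₚ oneₚ) (≋-trans (lem₁ (X ^ₚ i) (X ^ₚ s)) (⊗-congˡ (negₚ oneₚ) (⊕-cong (≋-refl {X ^ₚ i}) (neg-cong (≋-trans (≋-sym (^ₚ-+ X i s)) (≋-reflexive (cong (X ^ₚ_) (m+[n∸m]≡n (<⇒≤ i<j))))))))))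
            (comax-⊗ (e-X^ i) (comax-∣ˡ e∣Φ (Φ-comax-xⁿ-1 s (m<n⇒0<n∸m i<j) (≤-<-trans (m∸n≤m j i) (<-≤-trans j<n few))))))
          where
          s : ℕ
          s = j ∸ i
          lem₁ : ∀ x y → x ⊗ (y ⊕ negₚ oneₚ) ≋ (x ⊕ negₚ (x ⊗ y)) ⊗ negₚ oneₚ
          lem₁ = solve-∀ poly
        all-zero : All (e ∣ᵖ_) (map const (strip w))
        all-zero = roots-vanish (suc (d ∸ suc k)) (map const (strip w)) length-w (X ^ₚ_) regular root

  *≢0 : ∀ {a b} → ¬ a ≡ 0ℤ → ¬ b ≡ 0ℤ → ¬ a ℤ.* b ≡ 0ℤ
  *≢0 {a} a≢0 b≢0 z = Data.Sum.[ a≢0 , b≢0 ] (ℤₚ.i*j≡0⇒i≡0∨j≡0 a z)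

  -- Division over ℚ, with the powers of the leading coefficient of q collected in k.
  record PseudoDivision (n : ℕ) (q p : Poly) : Set where
    field
      k : ℤ
      k≢0 : ¬ k ≡ 0ℤ
      a r : Poly
      division : const k ⊗ p ≋ q ⊗ a ⊕ r
      small : Below n r

  pseudo-divide : ∀ {n q} → ¬ coef q n ≡ 0ℤ → Below (suc n) q → ∀ p → PseudoDivision n q p
  pseudo-divide {n} {q} l≢0 b [] = record { k = 1ℤ ; k≢0 = λ () ; a = [] ; r = [] ; division = ≋-trans (⊗-zeroʳ (const 1ℤ)) (≋-sym (≋-trans (⊕-identityʳ (q ⊗ [])) (⊗-zeroʳ q))) ; small = below λ _ _ → refl }
  pseudo-divide {n} {q} l≢0 b (c ∷ p) = record { k = l ℤ.* k ; k≢0 = *≢0 l≢0 k≢0 ; a = const l ⊗ (X ⊗ a) ⊕ const z ; r = t′ ; division = eq ; small = Below-pred t′-below t′-top }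
    where
    open PseudoDivision (pseudo-divide l≢0 b p)
    l : ℤ
    l = coef q n
    t : Poly
    t = (k ℤ.* c) ∷ r
    z : ℤ
    z = coef t n
    t′ : Poly
    t′ = scale l t ⊕ negₚ (scale z q)
    t′-below : Below (suc n) t′
    t′-below = Below-⊕ (scale l t) (negₚ (scale z q)) (Below-scale l t (below λ { (suc i) (s≤s h) → out small i h })) (Below-scale -1ℤ (scale z q) (Below-scale z q b))
    t′-top : coef t′ n ≡ 0ℤ
    t′-top = trans (coef-⊕ (scale l t) (negₚ (scale z q)) n) (trans (cong₂ ℤ._+_ (coef-scale l t n) (trans (coef-neg (scale z q) n) (cong ℤ.-_ (coef-scale z q n))))
      (trans (cong (λ x → l ℤ.* z ℤ.+ ℤ.- x) (ℤₚ.*-comm z l)) (ℤₚ.+-inverseʳ (l ℤ.* z))))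
    lem : ∀ l kc x q a r z → l ⊗ (kc ⊕ x ⊗ (q ⊗ a ⊕ r)) ≋ q ⊗ (l ⊗ (x ⊗ a) ⊕ z) ⊕ (l ⊗ (kc ⊕ x ⊗ r) ⊕ negₚ (z ⊗ q))
    lem = solve-∀ poly
    lem′ : ∀ l k c x p → (l ⊗ k) ⊗ (c ⊕ x ⊗ p) ≋ l ⊗ (k ⊗ c ⊕ x ⊗ (k ⊗ p))
    lem′ = solve-∀ poly
    eq : const (l ℤ.* k) ⊗ (c ∷ p) ≋ q ⊗ (const l ⊗ (X ⊗ a) ⊕ const z) ⊕ t′
    eq = ≋-trans (⊗-cong (≋-sym (const-⊗ l k)) (∷-const c p)) (≋-trans (lem′ (const l) (const k) (const c) X p)
      (≋-trans (⊗-congʳ (const l) (⊕-cong (const-⊗ k c) (⊗-congʳ X division))) (≋-trans (lem (const l) (const (k ℤ.* c)) X q a r (const z))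
        (⊕-cong (≋-refl {q ⊗ (const l ⊗ (X ⊗ a) ⊕ const z)}) (⊕-cong (≋-trans (⊗-congʳ (const l) (≋-sym (∷-const (k ℤ.* c) r))) (≋-sym (scale-const l t))) (neg-cong (≋-sym (scale-const z q))))))))

  -- A gcd over ℚ without fractions: h is an integral combination of p and q and divides nonzero
  -- integer multiples of both.
  record Gcd (p q : Poly) : Set where
    field
      h U V s s′ : Poly
      c c′ : ℤ
      c≢0 : ¬ c ≡ 0ℤ
      c′≢0 : ¬ c′ ≡ 0ℤ
      combination : h ≋ p ⊗ U ⊕ q ⊗ V
      left : h ⊗ s ≋ const c ⊗ p
      right : h ⊗ s′ ≋ const c′ ⊗ q

  euclid : ∀ n p q → Below n q → Gcd p q
  euclid zero p q b = record { h = p ; U = oneₚ ; V = [] ; s = oneₚ ; s′ = [] ; c = 1ℤ ; c′ = 1ℤ ; c≢0 = λ () ; c′≢0 = λ ()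
    ; combination = ≋-sym (≋-trans (⊕-cong (≋-trans (⊗-comm p oneₚ) (⊗-identityˡ p)) (⊗-zeroʳ q)) (⊕-identityʳ p))
    ; left = ⊗-comm p oneₚ ; right = ≋-trans (⊗-zeroʳ p) (≋-sym (≋-trans (⊗-identityˡ q) (Below-0 b))) }
  euclid (suc n) p q b = decide (coef q n ℤ.≟ 0ℤ)
    where
    decide : Dec (coef q n ≡ 0ℤ) → Gcd p q
    decide (yes z) = euclid n p q (Below-pred b z)
    decide (no l≢0) = record { h = h ; U = const k ⊗ V ; V = U ⊕ negₚ (a ⊗ V) ; s = const c′ ⊗ s ⊗ a ⊕ const c ⊗ s′ ; s′ = s ; c = c ℤ.* c′ ℤ.* k ; c′ = c
      ; c≢0 = *≢0 (*≢0 c≢0 c′≢0) k≢0 ; c′≢0 = c≢0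
      ; combination = ≋-trans combination (≋-trans (⊕-cong (≋-refl {q ⊗ U}) (⊗-congˡ V r≋)) (lem₁ q U (const k) p a V))
      ; left = ≋-trans (lem₂ h (const c′) s a (const c) s′) (≋-trans (⊕-cong (⊗-congʳ (const c′ ⊗ a) left) (⊗-congʳ (const c) right)) (≋-trans (lem₃ (const c′) a (const c) q r) (≋-trans (⊗-congʳ (const c ⊗ const c′) (≋-sym division)) (≋-trans (≋-sym (⊗-assoc (const c ⊗ const c′) (const k) p))
          (⊗-congˡ p (≋-trans (⊗-congˡ (const k) (const-⊗ c c′)) (const-⊗ (c ℤ.* c′) k)))))))
      ; right = left }
      where
      open PseudoDivision (pseudo-divide l≢0 b p)
      open Gcd (euclid n q r small)
      lem₀ : ∀ x r → r ≋ (x ⊕ r) ⊕ negₚ x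
      lem₀ = solve-∀ poly
      r≋ : r ≋ const k ⊗ p ⊕ negₚ (q ⊗ a)
      r≋ = ≋-trans (lem₀ (q ⊗ a) r) (⊕-cong (≋-sym division) (≋-refl {negₚ (q ⊗ a)}))
      lem₁ : ∀ q U k p a V → q ⊗ U ⊕ (k ⊗ p ⊕ negₚ (q ⊗ a)) ⊗ V ≋ p ⊗ (k ⊗ V) ⊕ q ⊗ (U ⊕ negₚ (a ⊗ V))
      lem₁ = solve-∀ poly
      lem₂ : ∀ h c′ s a c s′ → h ⊗ (c′ ⊗ s ⊗ a ⊕ c ⊗ s′) ≋ c′ ⊗ a ⊗ (h ⊗ s) ⊕ c ⊗ (h ⊗ s′)
      lem₂ = solve-∀ poly
      lem₃ : ∀ c′ a c q r → c′ ⊗ a ⊗ (c ⊗ q) ⊕ c ⊗ (c′ ⊗ r) ≋ c ⊗ c′ ⊗ (q ⊗ a ⊕ r)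
      lem₃ = solve-∀ poly

  const-∣-coef : ∀ {π p} → const (+ π) ∣ᵖ p → ∀ n → π ∣ ∣ coef p n ∣
  const-∣-coef {π} {p} (divᵖ q e) n = divides ∣ coef q n ∣ (trans (cong ∣_∣ (trans (at e n) (trans (at (≋-sym (scale-const (+ π) q)) n) (coef-scale (+ π) q n)))) (trans (ℤₚ.abs-* (+ π) (coef q n)) (*-comm π ∣ coef q n ∣)))

  const-∣ℤ : ∀ {π a} → π ∣ ∣ a ∣ → Σ ℤ λ x → a ≡ + π ℤ.* x
  const-∣ℤ {π} {+ n} (divides q eq) = + q , trans (cong +_ (trans eq (*-comm q π))) (ℤₚ.pos-* π q)
  const-∣ℤ {π} { -[1+ n ]} (divides q eq) = ℤ.- (+ q) , trans (cong (λ z → ℤ.- (+ z)) (trans eq (*-comm q π))) (trans (cong ℤ.-_ (ℤₚ.pos-* π q)) (ℤₚ.neg-distribʳ-* (+ π) (+ q)))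

  const-∣-∷ : ∀ {π a p} → π ∣ ∣ a ∣ → const (+ π) ∣ᵖ p → const (+ π) ∣ᵖ a ∷ p
  const-∣-∷ {π} {a} {p} h (divᵖ q e) = go (const-∣ℤ {π} {a} h)
    where
    go : (Σ ℤ λ x → a ≡ + π ℤ.* x) → const (+ π) ∣ᵖ a ∷ p
    go (x , refl) = divᵖ (x ∷ q) (≋-trans (∷-cong refl (≋-trans e (≋-sym (scale-const (+ π) q)))) (scale-const (+ π) (x ∷ q)))

  const-∣-tail : ∀ {π a p} → const (+ π) ∣ᵖ a ∷ p → const (+ π) ∣ᵖ p
  const-∣-tail {π} {a} {p} h = go p λ n → const-∣-coef h (suc n)
    where
    go : ∀ p → (∀ n → π ∣ ∣ coef p n ∣) → const (+ π) ∣ᵖ p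
    go [] _ = ∣ᵖ-zero ≋-refl
    go (b ∷ p) h = const-∣-∷ {π} {b} {p} (h 0) (go p λ n → h (suc n))

  gauss : ∀ {π} → Prime π → ∀ a b → const (+ π) ∣ᵖ a ⊗ b → const (+ π) ∣ᵖ a ⊎ const (+ π) ∣ᵖ b
  gauss pπ [] b h = inj₁ (∣ᵖ-zero ≋-refl)
  gauss {π} pπ (a₀ ∷ a) = inner
    where
    drop : ∀ {x y s : Poly} → s ≋ x ⊕ (0ℤ ∷ y) → const (+ π) ∣ᵖ x → const (+ π) ∣ᵖ s → const (+ π) ∣ᵖ y
    drop {x} {y} {s} e hx hs = const-∣-tail {π} {0ℤ} {y} (∣ᵖ-cong (≋-trans (⊕-cong e (≋-refl {negₚ x})) (lem x (0ℤ ∷ y))) (∣ᵖ-⊕ hs (∣ᵖ-neg hx)))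
      where
      lem : ∀ x y → (x ⊕ y) ⊕ negₚ x ≋ y
      lem = solve-∀ poly
    mult : ∀ c p → π ∣ ∣ c ∣ → const (+ π) ∣ᵖ scale c p
    mult c p d = ∣ᵖ-cong (≋-sym (scale-const c p)) (∣ᵖ-⊗ʳ p (const-∣-∷ {π} {c} {[]} d (∣ᵖ-zero ≋-refl)))
    inner : ∀ b → const (+ π) ∣ᵖ (a₀ ∷ a) ⊗ b → const (+ π) ∣ᵖ a₀ ∷ a ⊎ const (+ π) ∣ᵖ b
    inner [] h = inj₂ (∣ᵖ-zero ≋-refl)
    inner (b₀ ∷ b) h = decide (π ∣? ∣ a₀ ∣) (π ∣? ∣ b₀ ∣)
      where
      decide : Dec (π ∣ ∣ a₀ ∣) → Dec (π ∣ ∣ b₀ ∣) → const (+ π) ∣ᵖ a₀ ∷ a ⊎ const (+ π) ∣ᵖ b₀ ∷ b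
      decide (yes d) _ = Data.Sum.map₁ (const-∣-∷ {π} {a₀} {a} d) (gauss pπ a (b₀ ∷ b) (drop {scale a₀ (b₀ ∷ b)} {a ⊗ (b₀ ∷ b)} ≋-refl (mult a₀ (b₀ ∷ b) d) h))
      decide (no _) (yes d) = Data.Sum.map₂ (const-∣-∷ {π} {b₀} {b} d) (inner b (drop {scale b₀ (a₀ ∷ a)} {(a₀ ∷ a) ⊗ b} (⊗-∷ (a₀ ∷ a) b₀ b) (mult b₀ (a₀ ∷ a) d) h))
      decide (no ¬a) (no ¬b) = contradiction (euclidsLemma ∣ a₀ ∣ ∣ b₀ ∣ pπ (subst (π ∣_) (trans (cong ∣_∣ (ℤₚ.+-identityʳ (a₀ ℤ.* b₀))) (ℤₚ.abs-* a₀ b₀)) (const-∣-coef h 0))) Data.Sum.[ ¬a , ¬b ]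

  const-cancel : ∀ {c p q} → ¬ c ≡ 0ℤ → const c ⊗ p ≋ const c ⊗ q → p ≋ q
  const-cancel {c} {p} {q} c≢0 e = ≋-trans (lem₀ p q) (≋-trans (⊕-cong (≋-refl {q}) (scale-zero c≢0 (≋-trans (scale-const c (p ⊕ negₚ q)) (≋-trans (lem (const c) p q) (≋-trans (⊕-cong e ≋-refl) (⊕-inverseʳ (const c ⊗ q))))))) (⊕-identityʳ q))
    where
    lem₀ : ∀ p q → p ≋ q ⊕ (p ⊕ negₚ q)
    lem₀ = solve-∀ poly
    lem : ∀ g p q → g ⊗ (p ⊕ negₚ q) ≋ g ⊗ p ⊕ negₚ (g ⊗ q)
    lem = solve-∀ poly

  record IntegralFactor (h g : Poly) : Set where
    field
      μ : ℤ
      μ≢0 : ¬ μ ≡ 0ℤ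
      h′ s′ : Poly
      h≋ : h ≋ const μ ⊗ h′
      factors : h′ ⊗ s′ ≋ g

  -- Gauss's lemma: the primes dividing c can be moved, one by one, into h or s.
  integral-factor : ∀ n h s c g → ∣ c ∣ ≡ n → ¬ c ≡ 0ℤ → h ⊗ s ≋ const c ⊗ g → IntegralFactor h g
  integral-factor = <-rec _ step
    where
    Goal : ℕ → Set
    Goal n = ∀ h s c g → ∣ c ∣ ≡ n → ¬ c ≡ 0ℤ → h ⊗ s ≋ const c ⊗ g → IntegralFactor h g
    step : ∀ n → (∀ {k} → k < n → Goal k) → Goal n
    step zero rec h s c g eq c≢0 e = contradiction (ℤₚ.∣i∣≡0⇒i≡0 eq) c≢0
    step (suc zero) rec h s c g eq c≢0 e = record { μ = 1ℤ ; μ≢0 = λ () ; h′ = h ; s′ = const c ⊗ s ; h≋ = ≋-sym (⊗-identityˡ h)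
        ; factors = ≋-trans (lem h (const c) s) (≋-trans (⊗-congʳ (const c) e) (≋-trans (≋-sym (⊗-assoc (const c) (const c) g)) (≋-trans (⊗-congˡ g (≋-trans (const-⊗ c c) (≋-reflexive (cong const (unit c eq))))) (⊗-identityˡ g)))) }
      where
      lem : ∀ h c s → h ⊗ (c ⊗ s) ≋ c ⊗ (h ⊗ s)
      lem = solve-∀ poly
      unit : ∀ c → ∣ c ∣ ≡ 1 → c ℤ.* c ≡ 1ℤ
      unit (+ 1) refl = refl
      unit -[1+ 0 ] refl = refl
    step n@(suc (suc _)) rec h s c g eq c≢0 e = at-prime (prime-divisor {n} (s≤s (s≤s z≤n)))
      where
      at-prime : (Σ ℕ λ π → Prime π × π ∣ n) → IntegralFactor h g
      at-prime (π , pπ , π∣n) = with-quotient (const-∣ℤ {π} {c} (subst (π ∣_) (sym eq) π∣n))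
        where
        π≢0 : ¬ + π ≡ 0ℤ
        π≢0 z = >⇒≢ (0<p pπ) (ℤₚ.+-injective z)
        with-quotient : (Σ ℤ λ x → c ≡ + π ℤ.* x) → IntegralFactor h g
        with-quotient (x , refl) = split (gauss pπ h s (∣ᵖ-cong (≋-sym e′) (∣ᵖ-⊗ʳ (const x ⊗ g) ∣ᵖ-refl)))
          where
          e′ : h ⊗ s ≋ const (+ π) ⊗ (const x ⊗ g)
          e′ = ≋-trans e (≋-trans (⊗-congˡ g (≋-sym (const-⊗ (+ π) x))) (⊗-assoc (const (+ π)) (const x) g))
          x≢0 : ¬ x ≡ 0ℤ
          x≢0 refl = c≢0 (ℤₚ.*-zeroʳ (+ π))
          x<n : ∣ x ∣ < n
          x<n = subst (∣ x ∣ <_) (trans (*-comm ∣ x ∣ π) (trans (sym (ℤₚ.abs-* (+ π) x)) eq)) (m<m*n ∣ x ∣ π ⦃ >-nonZero (n≢0⇒n>0 λ z → x≢0 (ℤₚ.∣i∣≡0⇒i≡0 z)) ⦄ (1<p pπ))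
          lemʳ : ∀ h π s → h ⊗ (π ⊗ s) ≋ π ⊗ (h ⊗ s)
          lemʳ = solve-∀ poly
          split : const (+ π) ∣ᵖ h ⊎ const (+ π) ∣ᵖ s → IntegralFactor h g
          split (inj₂ (divᵖ s₁ f)) = rec x<n h s₁ x g refl x≢0 (const-cancel π≢0 (≋-trans (≋-sym (≋-trans (⊗-congʳ h f) (lemʳ h (const (+ π)) s₁))) e′))
          split (inj₁ (divᵖ h₁ f)) = record { μ = + π ℤ.* μ ; μ≢0 = *≢0 π≢0 μ≢0 ; h′ = h′ ; s′ = s′ ; factors = factors
              ; h≋ = ≋-trans f (≋-trans (⊗-congʳ (const (+ π)) h≋) (≋-trans (≋-sym (⊗-assoc (const (+ π)) (const μ) h′)) (⊗-congˡ h′ (const-⊗ (+ π) μ)))) }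
            where
            open IntegralFactor (rec x<n h₁ s x g refl x≢0 (const-cancel π≢0 (≋-trans (≋-sym (≋-trans (⊗-congˡ s f) (⊗-assoc (const (+ π)) h₁ s))) e′)))

  record Leading (p : Poly) : Set where
    field
      deg : ℕ
      lead≢0 : ¬ coef p deg ≡ 0ℤ
      upto : Below (suc deg) p

  leading : ∀ p → p ≋ [] ⊎ Leading p
  leading p = go (length p) (Below-length p)
    where
    go : ∀ n → Below n p → p ≋ [] ⊎ Leading p
    go zero b = inj₁ (Below-0 b)
    go (suc n) b = decide (coef p n ℤ.≟ 0ℤ)
      where
      decide : Dec (coef p n ≡ 0ℤ) → p ≋ [] ⊎ Leading p
      decide (yes z) = go n (Below-pred b z)
      decide (no l≢0) = inj₂ (record { deg = n ; lead≢0 = l≢0 ; upto = b })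

  record UnitLeading (p : Poly) : Set where
    field
      ε : ℤ
      ε² : ε ℤ.* ε ≡ 1ℤ
      deg : ℕ
      monic : MonicAt deg (const ε ⊗ p)

  -- The leading coefficients of p and q multiply to 1, so that of p is a sign, its own inverse ε.
  factor-of-monic : ∀ {n g p q} → MonicAt n g → p ⊗ q ≋ g → UnitLeading p
  factor-of-monic {n} {g} {p} {q} m e = go (leading p) (leading q)
    where
    unit : ∀ a b → a ℤ.* b ≡ 1ℤ → a ℤ.* a ≡ 1ℤ
    unit a b h = square a (m*n≡1⇒m≡1 ∣ a ∣ ∣ b ∣ (trans (sym (ℤₚ.abs-* a b)) (cong ∣_∣ h)))
      where
      square : ∀ a → ∣ a ∣ ≡ 1 → a ℤ.* a ≡ 1ℤ
      square (+ 1) refl = refl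
      square -[1+ 0 ] refl = refl
    absurd : g ≋ [] → UnitLeading p
    absurd z = contradiction (trans (sym (top m)) (at z n)) λ ()
    go : p ≋ [] ⊎ Leading p → q ≋ [] ⊎ Leading q → UnitLeading p
    go (inj₁ z) _ = absurd (≋-trans (≋-sym e) (⊗-zeroˡ p q z))
    go (inj₂ _) (inj₁ z) = absurd (≋-trans (≋-sym e) (≋-trans (⊗-congʳ p z) (⊗-zeroʳ p)))
    go (inj₂ P) (inj₂ Q) = by-size (<-cmp (P.deg + Q.deg) n)
      where
      module P = Leading P
      module Q = Leading Q
      open import Relation.Binary.Definitions using (Tri; tri<; tri≈; tri>)
      top-coef : coef g (P.deg + Q.deg) ≡ coef p P.deg ℤ.* coef q Q.deg
      top-coef = trans (sym (at e (P.deg + Q.deg))) (coef-⊗-top p q P.deg Q.deg P.upto Q.upto)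
      by-size : Tri (P.deg + Q.deg < n) (P.deg + Q.deg ≡ n) (n < P.deg + Q.deg) → UnitLeading p
      by-size (tri< lt _ _) = contradiction (trans (sym (top m)) (trans (sym (at e n)) (out (Below-⊗ p q P.deg Q.deg P.upto Q.upto) n lt))) λ ()
      by-size (tri> _ _ gt) = contradiction (trans (sym top-coef) (out (bounded m) (P.deg + Q.deg) gt)) (*≢0 P.lead≢0 Q.lead≢0)
      by-size (tri≈ _ eq _) = record { ε = coef p P.deg ; ε² = ε² ; deg = P.deg
          ; monic = monicAt (trans (at (≋-sym (scale-const (coef p P.deg) p)) P.deg) (trans (coef-scale (coef p P.deg) p P.deg) ε²)) (Below-≋ (scale-const (coef p P.deg) p) (Below-scale (coef p P.deg) p P.upto)) }
        where
        ε² : coef p P.deg ℤ.* coef p P.deg ≡ 1ℤ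
        ε² = unit (coef p P.deg) (coef q Q.deg) (trans (sym top-coef) (trans (cong (coef g) eq) (top m)))

  -- The gcd h of Φ and f over ℚ is an integer times an integral factor h′ of Φ with leading
  -- coefficient ε. If h′ is constant, h is a nonzero integer in the ideal. Otherwise Φ divides h′
  -- by irreducibility, hence a nonzero multiple of f, hence f.
  cyclotomic-dichotomy : ∀ m f → Φ° (suc m) ∣ᵖ f ⊎ Comaximal (Φ° (suc m)) f
  cyclotomic-dichotomy m f = from-gcd (euclid (length f) (Φ° (suc m)) f (Below-length f))
    where
    C : Cyclotomic m
    C = cyclotomic m
    lem : ∀ e h t → (e ⊗ h) ⊗ (e ⊗ t) ≋ e ⊗ (e ⊗ (h ⊗ t))
    lem = solve-∀ poly
    from-gcd : Gcd (Φ° (suc m)) f → Φ° (suc m) ∣ᵖ f ⊎ Comaximal (Φ° (suc m)) f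
    from-gcd G = from-factor (integral-factor ∣ c ∣ h s c (Φ° (suc m)) refl c≢0 left)
      where
      open Gcd G
      from-factor : IntegralFactor h (Φ° (suc m)) → Φ° (suc m) ∣ᵖ f ⊎ Comaximal (Φ° (suc m)) f
      from-factor F = from-lead (factor-of-monic {p = h′} {q = t} (monic-Φ C) factors)
        where
        open IntegralFactor F renaming (s′ to t)
        from-lead : UnitLeading h′ → Φ° (suc m) ∣ᵖ f ⊎ Comaximal (Φ° (suc m)) f
        from-lead L = by-degree deg monic
          where
          open UnitLeading L
          ε≢0 : ¬ ε ≡ 0ℤ
          ε≢0 z = contradiction (trans (sym ε²) (trans (cong (λ x → x ℤ.* ε) z) (ℤₚ.*-zeroˡ ε))) λ ()
          εε : ∀ p → const ε ⊗ (const ε ⊗ p) ≋ p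
          εε p = ≋-trans (≋-sym (⊗-assoc (const ε) (const ε) p)) (≋-trans (⊗-congˡ p (≋-trans (const-⊗ ε ε) (≋-reflexive (cong const ε²)))) (⊗-identityˡ p))
          by-degree : ∀ k → MonicAt k (const ε ⊗ h′) → Φ° (suc m) ∣ᵖ f ⊎ Comaximal (Φ° (suc m)) f
          by-degree zero mon = inj₂ (comax (μ ℤ.* ε) (*≢0 μ≢0 ε≢0) U V (≋-trans (≋-trans (≋-sym (const-⊗ μ ε)) (≋-sym (≋-trans h≋ (⊗-congʳ (const μ) (≋-trans (≋-sym (εε h′)) (≋-trans (⊗-congʳ (const ε) (monic-0 mon)) (≋-trans (⊗-comm (const ε) oneₚ) (⊗-identityˡ (const ε))))))))) combination))
          by-degree (suc k) mon = inj₁ (monic-torsion (monic-Φ C) c′≢0 (∣ᵖ-cong (≋-trans right (≋-sym (scale-const c′ f))) (∣ᵖ-⊗ʳ s′ (∣ᵖ-cong (≋-sym (≋-trans h≋ (⊗-congʳ (const μ) (≋-sym (εε h′))))) (∣ᵖ-⊗ˡ (const μ) (∣ᵖ-⊗ˡ (const ε)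
            (irreducible m {c = const ε ⊗ t} mon (≋-sym (≋-trans (lem (const ε) h′ t) (≋-trans (εε (h′ ⊗ t)) factors))))))))))

  -- The positive degree is recorded so that removing Φ from f lowers the degree of f. A Φ of degree
  -- 0 would equal 1, which is comaximal to everything, and is put on the other side.
  xⁿ-1-dichotomy : ∀ m f → (Σ ℕ λ d → 0 < degree (cyclotomic d) × Φ° (suc d) ∣ᵖ f) ⊎ Comaximal f (xⁿ-1 (suc m))
  xⁿ-1-dichotomy m f = Data.Sum.map₂ (λ c → comax-∣ (divᵖ oneₚ (≋-trans (≋-trans (PP-self m) (≋-sym (product (cyclotomic m)))) (≋-sym (≋-trans (⊗-comm (xⁿ-1 (suc m)) oneₚ) (⊗-identityˡ (xⁿ-1 (suc m))))))) c) (go (suc m))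
    where
    go : ∀ k → (Σ ℕ λ d → 0 < degree (cyclotomic d) × Φ° (suc d) ∣ᵖ f) ⊎ Comaximal f (PP (suc m) k)
    go zero = inj₂ (comax-one f)
    go (suc k) = combine (go k) (factor (suc k ∣? suc m))
      where
      factor : (a : Dec (suc k ∣ suc m)) → (Σ ℕ λ d → 0 < degree (cyclotomic d) × Φ° (suc d) ∣ᵖ f) ⊎ Comaximal f (pick a (Φ° (suc k)))
      factor (yes _) = by-degree (degree (cyclotomic k)) refl
        where
        by-degree : ∀ n → degree (cyclotomic k) ≡ n → (Σ ℕ λ d → 0 < degree (cyclotomic d) × Φ° (suc d) ∣ᵖ f) ⊎ Comaximal f (Φ° (suc k))
        by-degree zero eq = inj₂ (comax-∣ (divᵖ oneₚ (≋-sym (≋-trans (⊗-congˡ oneₚ (monic-0 (subst (λ n → MonicAt n (Φ° (suc k))) eq (monic-Φ (cyclotomic k))))) (⊗-identityˡ oneₚ)))) (comax-one f))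
        by-degree (suc n) eq = Data.Sum.map (λ h → k , subst (0 <_) (sym eq) (s≤s z≤n) , h) comax-sym (cyclotomic-dichotomy k f)
      factor (no _) = inj₂ (comax-one f)
      combine : (Σ ℕ λ d → 0 < degree (cyclotomic d) × Φ° (suc d) ∣ᵖ f) ⊎ Comaximal f (PP (suc m) k) → (Σ ℕ λ d → 0 < degree (cyclotomic d) × Φ° (suc d) ∣ᵖ f) ⊎ Comaximal f (pick (suc k ∣? suc m) (Φ° (suc k))) → (Σ ℕ λ d → 0 < degree (cyclotomic d) × Φ° (suc d) ∣ᵖ f) ⊎ Comaximal f (PP (suc m) (suc k))
      combine (inj₁ x) _ = inj₁ x
      combine (inj₂ _) (inj₁ x) = inj₁ x
      combine (inj₂ c) (inj₂ c′) = inj₂ (comax-⊗ c c′)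

-- A factor comaximal to x^W - 1 produces too many thin classes

module Contra where

  open import Defs
  open import Data.Empty using (⊥)
  open import Data.Integer using (ℤ; +_; -[1+_]; 0ℤ; 1ℤ; -1ℤ; ∣_∣)
  import Data.Integer as ℤ
  import Data.Integer.Properties as ℤₚ
  open import Data.Integer.Divisibility using () renaming (_∣_ to _∣ℤ_)
  open import Data.Integer.Tactic.RingSolver using () renaming (solve-∀ to ℤ-solve-∀)
  open import Data.List using (List; []; _∷_; length; map; filter; upTo)
  open import Data.List.Properties using (length-map; length-upTo)
  open import Data.List.Relation.Unary.All as All using (All; []; _∷_)
  import Data.List.Relation.Unary.All.Properties as All
  open import Data.List.Relation.Unary.AllPairs as AllPairs using (AllPairs; []; _∷_)
  import Data.List.Relation.Unary.AllPairs.Properties as AllPairs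
  open import Data.List.Relation.Unary.Any as Any using (Any; here; there)
  open import Data.Nat
  open import Data.Nat.Coprimality using (Coprime; coprime-divisor; prime⇒coprime) renaming (sym to coprime-sym)
  open import Data.Nat.Divisibility
  open import Data.Nat.DivMod
  open import Data.Nat.Induction using (<-rec)
  open import Data.Nat.Primality
  open import Data.Nat.Properties
  open import Data.Nat.Tactic.RingSolver using () renaming (solve-∀ to ℕ-solve-∀)
  open import Data.Product using (Σ; _×_; _,_; proj₁; proj₂)
  open import Data.Sum using (_⊎_; inj₁; inj₂; [_,_]′)
  open import Relation.Binary.PropositionalEquality hiding ([_])
  open import Relation.Nullary using (Dec; yes; no; ¬_; contradiction)
  open import Relation.Nullary.Decidable using (¬?)
  open Arith using (0<p; 1<p; prime-divisor; no-common-prime⇒coprime; prime∣prime; prime∣^; ∣!)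
  open Modular
  open Group
  open Poly
  open Cyclo
  open Landau
  open Irr

  eval-diff : ∀ p a b → Σ ℤ λ k → eval p a ≡ eval p b ℤ.+ (a ℤ.- b) ℤ.* k
  eval-diff [] a b = 0ℤ , sym (trans (ℤₚ.+-identityˡ _) (ℤₚ.*-zeroʳ (a ℤ.- b)))
  eval-diff (c ∷ p) a b = step (eval-diff p a b)
    where
    lem : ∀ c a b q k → c ℤ.+ a ℤ.* (q ℤ.+ (a ℤ.- b) ℤ.* k) ≡ c ℤ.+ b ℤ.* q ℤ.+ (a ℤ.- b) ℤ.* (q ℤ.+ a ℤ.* k)
    lem = ℤ-solve-∀
    step : (Σ ℤ λ k → eval p a ≡ eval p b ℤ.+ (a ℤ.- b) ℤ.* k) → Σ ℤ λ k → c ℤ.+ a ℤ.* eval p a ≡ c ℤ.+ b ℤ.* eval p b ℤ.+ (a ℤ.- b) ℤ.* k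
    step (k , e) = eval p b ℤ.+ a ℤ.* k , trans (cong (λ z → c ℤ.+ a ℤ.* z) e) (lem c a b (eval p b) k)

  ∣∣-+ : ∀ {q} a b → q ∣ ∣ a ∣ → q ∣ ∣ b ∣ → q ∣ ∣ a ℤ.+ b ∣
  ∣∣-+ {q} a b h h′ = combine (const-∣ℤ {q} {a} h) (const-∣ℤ {q} {b} h′)
    where
    combine : (Σ ℤ λ x → a ≡ + q ℤ.* x) → (Σ ℤ λ x → b ≡ + q ℤ.* x) → q ∣ ∣ a ℤ.+ b ∣
    combine (x , e) (y , f) = divides ∣ x ℤ.+ y ∣ (trans (cong ∣_∣ (trans (cong₂ ℤ._+_ e f) (sym (ℤₚ.*-distribˡ-+ (+ q) x y)))) (trans (ℤₚ.abs-* (+ q) (x ℤ.+ y)) (*-comm q ∣ x ℤ.+ y ∣)))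

  ∣∣-*ˡ : ∀ {q} a b → q ∣ ∣ a ∣ → q ∣ ∣ a ℤ.* b ∣
  ∣∣-*ˡ {q} a b h = subst (q ∣_) (sym (ℤₚ.abs-* a b)) (∣m⇒∣m*n ∣ b ∣ h)

  ≡-diff : ∀ {q} .⦃ _ : NonZero q ⦄ x y → x % q ≡ y % q → q ∣ ∣ + x ℤ.- + y ∣
  ≡-diff {q} x y e = divides ∣ + (x / q) ℤ.- + (y / q) ∣ (trans (cong ∣_∣ (trans (cong₂ ℤ._-_ (split x) (split y)) (trans (cong (λ r → + (x % q) ℤ.+ + (x / q) ℤ.* + q ℤ.- (+ r ℤ.+ + (y / q) ℤ.* + q)) (sym e)) (lem (+ (x % q)) (+ (x / q)) (+ (y / q)) (+ q)))))
      (ℤₚ.abs-* (+ (x / q) ℤ.- + (y / q)) (+ q)))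
    where
    split : ∀ x → + x ≡ + (x % q) ℤ.+ + (x / q) ℤ.* + q
    split x = trans (cong +_ (m≡m%n+[m/n]*n x q)) (trans (ℤₚ.pos-+ (x % q) (x / q * q)) (cong (λ z → + (x % q) ℤ.+ z) (ℤₚ.pos-* (x / q) q)))
    lem : ∀ r s t q → r ℤ.+ s ℤ.* q ℤ.- (r ℤ.+ t ℤ.* q) ≡ (s ℤ.- t) ℤ.* q
    lem = ℤ-solve-∀

  diff-≡ : ∀ {q} .⦃ _ : NonZero q ⦄ x y → q ∣ ∣ + x ℤ.- + y ∣ → x % q ≡ y % q
  diff-≡ {q} x y h = [ (λ x≤y → sym (go x y x≤y (subst (q ∣_) (trans (ℤₚ.∣i-j∣≡∣j-i∣ (+ x) (+ y)) refl) h))) , (λ y≤x → go y x y≤x h) ]′ (≤-total x y)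
    where
    go : ∀ y x → y ≤ x → q ∣ ∣ + x ℤ.- + y ∣ → x % q ≡ y % q
    go y x y≤x h = trans (cong (_% q) (trans (sym (m+[n∸m]≡n y≤x)) (cong (λ z → y + z) (_∣_.equality q∣)))) ([m+kn]%n≡m%n y (quotient q∣) q)
      where
      q∣ : q ∣ x ∸ y
      q∣ = subst (q ∣_) (cong ∣_∣ (trans (ℤₚ.m-n≡m⊖n x y) (ℤₚ.⊖-≥ y≤x))) h

  eval-≡ : ∀ {q} .⦃ _ : NonZero q ⦄ p x y → x % q ≡ y % q → q ∣ ∣ eval p (+ y) ∣ → q ∣ ∣ eval p (+ x) ∣
  eval-≡ {q} p x y e h = go (eval-diff p (+ x) (+ y))
    where
    go : (Σ ℤ λ k → eval p (+ x) ≡ eval p (+ y) ℤ.+ (+ x ℤ.- + y) ℤ.* k) → q ∣ ∣ eval p (+ x) ∣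
    go (k , f) = subst (λ z → q ∣ ∣ z ∣) (sym f) (∣∣-+ (eval p (+ y)) ((+ x ℤ.- + y) ℤ.* k) h (∣∣-*ˡ (+ x ℤ.- + y) k (≡-diff x y e)))

  ^-% : ∀ {q} .⦃ _ : NonZero q ⦄ {x y} n → x % q ≡ y % q → (x ^ n) % q ≡ (y ^ n) % q
  ^-% zero e = refl
  ^-% {q} {x} {y} (suc n) e = ≈-* q {x} {y} {x ^ n} {y ^ n} e (^-% n e)

  nonzero-eval : ∀ p → ¬ p ≋ [] → Σ ℕ λ B → ∀ a → B < ∣ a ∣ → ¬ eval p a ≡ 0ℤ
  nonzero-eval [] h = contradiction ≋-refl h
  nonzero-eval (c ∷ p) h = decide (c ℤ.≟ 0ℤ)
    where
    decide : Dec (c ≡ 0ℤ) → Σ ℕ λ B → ∀ a → B < ∣ a ∣ → ¬ eval (c ∷ p) a ≡ 0ℤ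
    decide (yes refl) = go (nonzero-eval p λ z → h (∷-zero refl z))
      where
      go : (Σ ℕ λ B → ∀ a → B < ∣ a ∣ → ¬ eval p a ≡ 0ℤ) → Σ ℕ λ B → ∀ a → B < ∣ a ∣ → ¬ eval (0ℤ ∷ p) a ≡ 0ℤ
      go (B , f) = B , λ a B<a z → [ (λ { refl → contradiction B<a λ () }) , f a B<a ]′ (ℤₚ.i*j≡0⇒i≡0∨j≡0 a (trans (sym (ℤₚ.+-identityˡ (a ℤ.* eval p a))) z))
    decide (no c≢0) = ∣ c ∣ , λ a c<a z → <⇒≱ c<a (∣⇒≤ ⦃ >-nonZero (n≢0⇒n>0 λ e → c≢0 (ℤₚ.∣i∣≡0⇒i≡0 e)) ⦄
      (divides ∣ eval p a ∣ (trans (trans (cong ∣_∣ (trans (lem c (a ℤ.* eval p a)) (trans (cong (λ y → y ℤ.- a ℤ.* eval p a) z) (ℤₚ.+-identityˡ (ℤ.- (a ℤ.* eval p a)))))) (ℤₚ.∣-i∣≡∣i∣ (a ℤ.* eval p a))) (trans (ℤₚ.abs-* a (eval p a)) (*-comm ∣ a ∣ ∣ eval p a ∣)))))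
      where
      lem : ∀ c x → c ≡ (c ℤ.+ x) ℤ.- x
      lem = ℤ-solve-∀

  -- Euclid's argument: f(a) = c₀ (1 + c₀ V g(a)) for a = c₀² V, where f = c₀ + x g.
  prime-factor-of-value : ∀ {n c₀ g} → ¬ c₀ ≡ 0ℤ → MonicAt n g → ∀ V → 0 < V →
    Σ ℕ λ q → Σ ℕ λ a → Prime q × (¬ q ∣ V) × Coprime a q × q ∣ ∣ eval (c₀ ∷ g) (+ a) ∣
  prime-factor-of-value {n} {c₀} {g} c₀≢0 mg V 0<V = go (nonzero-eval g λ z → contradiction (trans (sym (top mg)) (at z n)) λ ())
    where
    0<c₀ : 0 < ∣ c₀ ∣
    0<c₀ = n≢0⇒n>0 λ e → c₀≢0 (ℤₚ.∣i∣≡0⇒i≡0 e)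
    go : (Σ ℕ λ B → ∀ a → B < ∣ a ∣ → ¬ eval g a ≡ 0ℤ) → Σ ℕ λ q → Σ ℕ λ a → Prime q × (¬ q ∣ V) × Coprime a q × q ∣ ∣ eval (c₀ ∷ g) (+ a) ∣
    go (B , nz) = found (prime-divisor 1<z)
      where
      V′ a : ℕ
      -- The factor B + 1 makes a exceed B, so g(a) ≠ 0. The factor 3 makes the absolute value of y
      -- at least 3, so that 1 + y has a prime divisor.
      V′ = 3 * (V * suc B)
      a = ∣ c₀ ∣ * ∣ c₀ ∣ * V′
      +a : + a ≡ c₀ ℤ.* (c₀ ℤ.* + V′)
      +a = trans (ℤₚ.pos-* (∣ c₀ ∣ * ∣ c₀ ∣) V′) (trans (cong (ℤ._* + V′) (trans (cong +_ (sym (ℤₚ.abs-* c₀ c₀))) (ℤₚ.0≤i⇒+∣i∣≡i (square c₀)))) (ℤₚ.*-assoc c₀ c₀ (+ V′)))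
        where
        square : ∀ c → 0ℤ ℤ.≤ c ℤ.* c
        square (+ n) = subst (0ℤ ℤ.≤_) (ℤₚ.pos-* n n) (ℤ.+≤+ z≤n)
        square -[1+ n ] = ℤ.+≤+ z≤n
      B<a : B < a
      B<a = ≤-trans (≤-trans (≤-trans (m≤n*m (suc B) V ⦃ >-nonZero 0<V ⦄) (m≤n*m (V * suc B) 3)) (m≤n*m V′ (∣ c₀ ∣ * ∣ c₀ ∣) ⦃ >-nonZero (*-mono-≤ 0<c₀ 0<c₀) ⦄)) ≤-refl
      y z : ℤ
      y = c₀ ℤ.* + V′ ℤ.* eval g (+ a)
      z = 1ℤ ℤ.+ y
      3≤y : 3 ≤ ∣ y ∣
      3≤y = subst (3 ≤_) (sym (trans (ℤₚ.abs-* (c₀ ℤ.* + V′) (eval g (+ a))) (cong (_* ∣ eval g (+ a) ∣) (ℤₚ.abs-* c₀ (+ V′)))))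
        (≤-trans (m≤m*n 3 (V * suc B) ⦃ >-nonZero (*-mono-≤ 0<V (s≤s (z≤n {B}))) ⦄) (≤-trans (m≤n*m V′ ∣ c₀ ∣ ⦃ >-nonZero 0<c₀ ⦄) (m≤m*n (∣ c₀ ∣ * V′) ∣ eval g (+ a) ∣ ⦃ >-nonZero (n≢0⇒n>0 λ e → nz (+ a) B<a (ℤₚ.∣i∣≡0⇒i≡0 e)) ⦄)))
      1<z : 1 < ∣ z ∣
      1<z = big y 3≤y
        where
        big : ∀ y → 3 ≤ ∣ y ∣ → 1 < ∣ 1ℤ ℤ.+ y ∣
        big (+ n) h = s≤s (≤-trans (s≤s z≤n) h)
        big -[1+ suc n ] (s≤s h) = h
      f≡ : eval (c₀ ∷ g) (+ a) ≡ c₀ ℤ.* z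
      f≡ = trans (cong (λ x → c₀ ℤ.+ x ℤ.* eval g (+ a)) +a) (lem c₀ (+ V′) (eval g (+ a)))
        where
        lem : ∀ c v e → c ℤ.+ c ℤ.* (c ℤ.* v) ℤ.* e ≡ c ℤ.* (1ℤ ℤ.+ c ℤ.* v ℤ.* e)
        lem = ℤ-solve-∀
      found : (Σ ℕ λ q → Prime q × q ∣ ∣ z ∣) → Σ ℕ λ q → Σ ℕ λ a → Prime q × (¬ q ∣ V) × Coprime a q × q ∣ ∣ eval (c₀ ∷ g) (+ a) ∣
      found (q , pq , q∣z) = q , a , pq , (λ q∣V → not-y (∣∣-*ˡ (c₀ ℤ.* + V′) (eval g (+ a)) (subst (q ∣_) (sym (ℤₚ.abs-* c₀ (+ V′))) (∣n⇒∣m*n ∣ c₀ ∣ (∣n⇒∣m*n 3 (∣m⇒∣m*n (suc B) q∣V)))))) ,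
          no-common-prime⇒coprime (0<p pq) (λ {r} pr r∣a r∣q → a-bad (subst (_∣ a) (prime∣prime pr pq r∣q) r∣a)) ,
          subst (λ x → q ∣ ∣ x ∣) (trans (ℤₚ.*-comm z c₀) (sym f≡)) (∣∣-*ˡ z c₀ q∣z)
        where
        not-y : ¬ q ∣ ∣ y ∣
        not-y q∣y = ¬prime[1] (subst Prime (∣1⇒≡1 (subst (q ∣_) (cong ∣_∣ (lem y)) (∣∣-+ z (ℤ.- y) q∣z (subst (q ∣_) (sym (ℤₚ.∣-i∣≡∣i∣ y)) q∣y)))) pq)
          where
          lem : ∀ y → 1ℤ ℤ.+ y ℤ.+ ℤ.- y ≡ 1ℤ
          lem = ℤ-solve-∀
        a-bad : ¬ q ∣ a
        a-bad q∣a = [ (λ h → not-y (∣∣-*ˡ (c₀ ℤ.* + V′) (eval g (+ a)) (subst (q ∣_) (sym (ℤₚ.abs-* c₀ (+ V′))) (∣m⇒∣m*n {m = ∣ c₀ ∣} V′ ([ (λ x → x) , (λ x → x) ]′ (euclidsLemma ∣ c₀ ∣ ∣ c₀ ∣ pq h)))))) ,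
            (λ h → not-y (∣∣-*ˡ (c₀ ℤ.* + V′) (eval g (+ a)) (subst (q ∣_) (sym (ℤₚ.abs-* c₀ (+ V′))) (∣n⇒∣m*n ∣ c₀ ∣ h)))) ]′ (euclidsLemma (∣ c₀ ∣ * ∣ c₀ ∣) V′ pq q∣a)

  prime-part : ∀ {p} → Prime p → ∀ j → 0 < j → Σ ℕ λ e → Σ ℕ λ m → j ≡ p ^ e * m × ¬ p ∣ m
  prime-part {p} pp = <-rec _ step
    where
    Goal : ℕ → Set
    Goal j = 0 < j → Σ ℕ λ e → Σ ℕ λ m → j ≡ p ^ e * m × ¬ p ∣ m
    step : ∀ j → (∀ {k} → k < j → Goal k) → Goal j
    step j rec 0<j with p ∣? j
    ... | no ¬d = 0 , j , sym (*-identityˡ j) , ¬d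
    ... | yes (divides k eq) with rec {k} (subst (k <_) (sym eq) (m<m*n k p ⦃ >-nonZero 0<k ⦄ (1<p pp))) 0<k
      where
      0<k : 0 < k
      0<k = n≢0⇒n>0 λ { refl → contradiction eq (>⇒≢ 0<j) }
    ...   | e , m , k≡ , ¬d = suc e , m , trans eq (trans (*-comm k p) (trans (cong (p *_) k≡) (sym (*-assoc p (p ^ e) m)))) , ¬d

  -- If all maximal prime powers in j are at most B, each divides B!, and being pairwise coprime so
  -- does their product j.
  large-prime-power : ∀ B j → 0 < j → j ∣ B ! ⊎ Σ ℕ λ p → Σ ℕ λ e → Prime p × p ^ e ∣ j × B < p ^ e
  large-prime-power B = <-rec _ step
    where
    Goal : ℕ → Set
    Goal j = 0 < j → j ∣ B ! ⊎ Σ ℕ λ p → Σ ℕ λ e → Prime p × p ^ e ∣ j × B < p ^ e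
    step : ∀ j → (∀ {k} → k < j → Goal k) → Goal j
    step (suc zero) rec _ = inj₁ (1∣ (B !))
    step j@(suc (suc _)) rec 0<j with prime-divisor {j} (s≤s (s≤s z≤n))
    ... | p , pp , p∣j with prime-part pp j 0<j
    ...   | e , m , j≡ , p∤m with p ^ e ≤? B
    ...     | no big = inj₂ (p , e , pp , divides m (trans j≡ (*-comm (p ^ e) m)) , ≰⇒> big)
    ...     | yes small with rec {m} m<j 0<m
      where
      0<m : 0 < m
      0<m = n≢0⇒n>0 λ { refl → contradiction (trans j≡ (*-zeroʳ (p ^ e))) λ () }
      p^e>1 : 1 < p ^ e
      p^e>1 = go e j≡
        where
        go : ∀ e → j ≡ p ^ e * m → 1 < p ^ e
        go zero h = contradiction (subst (p ∣_) (trans h (*-identityˡ m)) p∣j) p∤m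
        go (suc e) _ = <-≤-trans (1<p pp) (m≤m*n p (p ^ e) ⦃ m^n≢0 p e ⦃ >-nonZero (0<p pp) ⦄ ⦄)
      m<j : m < j
      m<j = subst (m <_) (sym (trans j≡ (*-comm (p ^ e) m))) (m<m*n m (p ^ e) ⦃ >-nonZero 0<m ⦄ p^e>1)
    ...       | inj₂ found = inj₂ (proj₁ found , proj₁ (proj₂ found) , proj₁ (proj₂ (proj₂ found)) , ∣-trans (proj₁ (proj₂ (proj₂ (proj₂ found)))) (divides (p ^ e) j≡) , proj₂ (proj₂ (proj₂ (proj₂ found))))
    ...       | inj₁ (divides k B!≡) = inj₁ (subst₂ _∣_ (sym (trans j≡ (*-comm (p ^ e) m))) (trans (*-comm m k) (sym B!≡)) (*-monoʳ-∣ m p^e∣k))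
      where
      p^e∣k : p ^ e ∣ k
      p^e∣k = coprime-divisor {p ^ e} {m} {k} (no-common-prime⇒coprime (n≢0⇒n>0 λ { refl → p∤m (p ∣0) }) λ pr r∣pᵉ r∣m → p∤m (subst (_∣ m) (prime∣prime pr pp (prime∣^ p e pr r∣pᵉ)) r∣m))
        (subst (p ^ e ∣_) (trans B!≡ (*-comm k m)) (∣! B (n≢0⇒n>0 λ z → contradiction (trans j≡ (cong (_* m) z)) λ ()) small))

  fermat-little : ∀ {q a} .⦃ _ : NonZero q ⦄ → Prime q → (a ^ q) % q ≡ a % q
  fermat-little {q} {a} pq = diff-≡ (a ^ q) a (go (diff (fermat-ℕ pq a)))
    where
    open _≈[_]_
    eval-const^ : ∀ n → eval (const (+ a) ^ₚ n) 0ℤ ≡ + (a ^ n)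
    eval-const^ zero = refl
    eval-const^ (suc n) = trans (eval-⊗ (const (+ a)) (const (+ a) ^ₚ n) 0ℤ) (trans (cong₂ ℤ._*_ (eval-const (+ a) 0ℤ) (eval-const^ n)) (sym (ℤₚ.pos-* a (a ^ n))))
    go : const (+ q) ∣ᵖ const (+ a) ^ₚ q ⊕ negₚ (const (+ a)) → q ∣ ∣ + (a ^ q) ℤ.- + a ∣
    go (divᵖ b e) = subst (λ z → q ∣ ∣ z ∣) value (∣∣-*ˡ (+ q) (eval b 0ℤ) ∣-refl)
      where
      value : + q ℤ.* eval b 0ℤ ≡ + (a ^ q) ℤ.- + a
      value = trans (cong (ℤ._* eval b 0ℤ) (sym (eval-const (+ q) 0ℤ))) (trans (sym (eval-⊗ (const (+ q)) b 0ℤ)) (trans (sym (eval-cong 0ℤ e))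
        (trans (eval-⊕ (const (+ a) ^ₚ q) (negₚ (const (+ a))) 0ℤ) (cong₂ ℤ._+_ (eval-const^ q) (trans (eval-scale -1ℤ (const (+ a)) 0ℤ) (trans (cong (-1ℤ ℤ.*_) (eval-const (+ a) 0ℤ)) (ℤₚ.-1*i≡-i (+ a))))))))

  record Order (q a : ℕ) ⦃ _ : NonZero q ⦄ : Set where
    field
      j : ℕ
      0<j : 0 < j
      j<q : j < q
      power : (a ^ j) % q ≡ 1 % q
      minimal : ∀ k → 0 < k → k < j → ¬ (a ^ k) % q ≡ 1 % q

  order : ∀ {q a} ⦃ _ : NonZero q ⦄ → Prime q → Coprime a q → Order q a
  order {q} {a} pq a⊥q = search (q ∸ 1) 1 ≤-refl (m+[n∸m]≡n (0<p pq)) λ k 0<k k<1 → contradiction k<1 (≤⇒≯ 0<k)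
    where
    q-1 : (a ^ (q ∸ 1)) % q ≡ 1 % q
    q-1 = ≈-cancel q {a} {a ^ (q ∸ 1)} {1} a⊥q (trans (cong (_% q) (cong (a ^_) (m+[n∸m]≡n (0<p pq)))) (trans (fermat-little {q} {a} pq) (cong (_% q) (sym (*-identityʳ a)))))
    search : ∀ fuel j → 0 < j → j + fuel ≡ q → (∀ k → 0 < k → k < j → ¬ (a ^ k) % q ≡ 1 % q) → Order q a
    search zero j 0<j eq none = contradiction q-1 (none (q ∸ 1) (m<n⇒0<n∸m (1<p pq)) (subst (q ∸ 1 <_) (trans (sym eq) (+-identityʳ j)) (∸-monoʳ-< {q} {1} {0} (s≤s z≤n) (0<p pq))))
    search (suc fuel) j 0<j eq none with (a ^ j) % q ≟ 1 % q
    ... | yes h = record { j = j ; 0<j = 0<j ; j<q = subst (j <_) eq (m<m+n j (s≤s z≤n)) ; power = h ; minimal = none }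
    ... | no ¬h = search fuel (suc j) (s≤s z≤n) (trans (sym (+-suc j fuel)) eq) λ k 0<k k<1+j → [ none k 0<k , (λ { refl → ¬h }) ]′ (m≤n⇒m<n∨m≡n (≤-pred k<1+j))

  module _ {q a : ℕ} ⦃ q≢0 : NonZero q ⦄ (a⊥q : Coprime a q) (0<q : 0 < q) (O : Order q a) where
    open Order O

    private
      instance
        j≢0 : NonZero j
        j≢0 = >-nonZero 0<j

    ^-reduce : ∀ t → (a ^ t) % q ≡ (a ^ (t % j)) % q
    ^-reduce t = trans (cong (λ z → (a ^ z) % q) (m≡m%n+[m/n]*n t j)) (trans (cong (_% q) (^-distribˡ-+-* a (t % j) (t / j * j)))
      (trans (≈-* q {a ^ (t % j)} {a ^ (t % j)} {a ^ (t / j * j)} {1} refl (trans (cong (_% q) (trans (cong (a ^_) (*-comm (t / j) j)) (sym (^-*-assoc a j (t / j))))) (trans (^-% (t / j) power) (cong (_% q) (^-zeroˡ (t / j)))))) (cong (_% q) (*-identityʳ (a ^ (t % j))))))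

    coprime-^ : ∀ s → Coprime (a ^ s) q
    coprime-^ zero (d∣1 , _) = ∣1⇒≡1 d∣1
    coprime-^ (suc s) = coprime-* a⊥q (coprime-^ s) 0<q

    ^-injective : ∀ s t → (a ^ s) % q ≡ (a ^ t) % q → s % j ≡ t % j
    ^-injective s t e = [ (λ s≤t → sym (go s t s≤t e)) , (λ t≤s → go t s t≤s (sym e)) ]′ (≤-total s t)
      where
      go : ∀ s t → s ≤ t → (a ^ s) % q ≡ (a ^ t) % q → t % j ≡ s % j
      go s t s≤t e = trans (cong (_% j) (trans (sym (m+[n∸m]≡n s≤t)) (cong (λ z → s + z) (_∣_.equality j∣)))) ([m+kn]%n≡m%n s (quotient j∣) j)
        where
        one : (a ^ (t ∸ s)) % q ≡ 1 % q
        one = ≈-cancel q {a ^ s} {a ^ (t ∸ s)} {1} (coprime-^ s) (trans (cong (_% q) (trans (sym (^-distribˡ-+-* a s (t ∸ s))) (cong (a ^_) (m+[n∸m]≡n s≤t)))) (trans (sym e) (cong (_% q) (sym (*-identityʳ (a ^ s))))))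
        j∣ : j ∣ t ∸ s
        j∣ = m%n≡0⇒n∣m (t ∸ s) j (zero-case ((t ∸ s) % j) refl)
          where
          zero-case : ∀ r → (t ∸ s) % j ≡ r → (t ∸ s) % j ≡ 0
          zero-case zero h = h
          zero-case (suc r) h = contradiction (trans (sym (^-reduce (t ∸ s))) one) (minimal ((t ∸ s) % j) (subst (0 <_) (sym h) (s≤s z≤n)) (m%n<n (t ∸ s) j))

  nth : List ℕ → ℕ → ℕ
  nth [] _ = 0
  nth (i ∷ l) zero = i
  nth (i ∷ l) (suc t) = nth l t

  All-nth : ∀ {P : ℕ → Set} {l} → All P l → ∀ t → t < length l → P (nth l t)
  All-nth (h ∷ hs) zero _ = h
  All-nth (h ∷ hs) (suc t) (s≤s lt) = All-nth hs t lt

  AllPairs-nth : ∀ {R : ℕ → ℕ → Set} {l} → AllPairs R l → ∀ s t → s < t → t < length l → R (nth l s) (nth l t)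
  AllPairs-nth (h ∷ hs) zero (suc t) _ (s≤s lt) = All-nth h t lt
  AllPairs-nth (h ∷ hs) (suc s) (suc t) (s≤s s<t) (s≤s lt) = AllPairs-nth hs s t s<t lt

  -- The root bound over the field with q elements, obtained from `roots-vanish` with the constant
  -- polynomial q as modulus. By `gauss`, a constant prime to q is not a zero divisor there.
  module RootBound {D F} (mF : MonicAt D F) {q} ⦃ q≢0 : NonZero q ⦄ (pq : Prime q) (val : ℕ → ℕ) where

    Root : ℕ → Set
    Root i = q ∣ ∣ eval F (+ val i) ∣

    Distinct : ℕ → ℕ → Set
    Distinct i k = ¬ val i % q ≡ val k % q

    const-∣-eval : ∀ p x → q ∣ ∣ eval p (+ x) ∣ → const (+ q) ∣ᵖ evalᵖ (map const p) (const (+ x))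
    const-∣-eval p x h = ∣ᵖ-cong (≋-sym (eval-constant p)) (const-∣-∷ {q} {eval p (+ x)} {[]} h (∣ᵖ-zero ≋-refl))
      where
      eval-constant : ∀ p → evalᵖ (map const p) (const (+ x)) ≋ const (eval p (+ x))
      eval-constant [] = ≋-sym (∷-zero refl ≋-refl)
      eval-constant (c ∷ p) = ⊕-cong (≋-refl {const c}) (≋-trans (⊗-congʳ (const (+ x)) (eval-constant p)) (const-⊗ (+ x) (eval p (+ x))))

    root-bound : ∀ l → AllPairs Distinct l → All Root l → ¬ suc D ≤ length l
    root-bound l distinct roots D<l = ¬prime[1] (subst Prime (∣1⇒≡1 (subst (λ z → q ∣ ∣ z ∣) (top mF) (subst (q ∣_) refl top-divisible))) pq)
      where
      r : ℕ → Poly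
      r t = const (+ val (nth l t))
      length-F : length (map const (strip F)) ≡ suc D
      length-F = trans (length-map const (strip F)) (length-strip-monic mF)
      regular : ∀ i k → i < k → k < suc D → ∀ x → const (+ q) ∣ᵖ (r i ⊕ negₚ (r k)) ⊗ x → const (+ q) ∣ᵖ x
      regular i k i<k k<D x h = [ (λ d → contradiction (diff-≡ (val (nth l i)) (val (nth l k)) (subst (λ z → q ∣ ∣ + val (nth l i) ℤ.+ z ∣) (ℤₚ.-1*i≡-i (+ val (nth l k))) (const-∣-coef d 0))) (AllPairs-nth distinct i k i<k (<-≤-trans k<D D<l))) , (λ d → d) ]′ (gauss pq (r i ⊕ negₚ (r k)) x h)
      all-divisible : All (const (+ q) ∣ᵖ_) (map const (strip F))
      all-divisible = roots-vanish (suc D) (map const (strip F)) length-F r regular λ i i<D → const-∣-eval (strip F) (val (nth l i)) (subst (λ z → q ∣ ∣ z ∣) (eval-cong (+ val (nth l i)) (≋-sym (strip-≋ F))) (All-nth roots i (<-≤-trans i<D D<l)))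
      top-divisible : q ∣ ∣ coef F D ∣
      top-divisible = subst (λ z → q ∣ ∣ z ∣) (at (strip-≋ F) D) (const-∣-coef (all-coefs (strip F) all-divisible D) 0)

  filter-lengths : ∀ {P : ℕ → Set} (P? : ∀ i → Dec (P i)) l → length (filter P? l) + length (filter (λ i → ¬? (P? i)) l) ≡ length l
  filter-lengths P? [] = refl
  filter-lengths P? (i ∷ l) with P? i
  ... | yes _ = cong suc (filter-lengths P? l)
  ... | no _ = trans (+-suc _ _) (cong suc (filter-lengths P? l))

  -- Of 2 D + 1 candidates at most D give a root x i of F and at most D a root y i, so at least one
  -- gives neither.
  module TwoValues {D F} (mF : MonicAt D F) {q} ⦃ q≢0 : NonZero q ⦄ (pq : Prime q) (x y : ℕ → ℕ)
    (x-distinct : ∀ i k → i < k → k < suc (D + D) → ¬ x i % q ≡ x k % q) (y-distinct : ∀ i k → i < k → k < suc (D + D) → ¬ y i % q ≡ y k % q) where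

    private
      module A = RootBound mF pq x
      module B = RootBound mF pq y
      rootx? : ∀ i → Dec (A.Root i)
      rootx? i = q ∣? ∣ eval F (+ x i) ∣
      rooty? : ∀ i → Dec (B.Root i)
      rooty? i = q ∣? ∣ eval F (+ y i) ∣
      l : List ℕ
      l = upTo (suc (D + D))
      good : List ℕ
      good = filter (λ i → ¬? (rootx? i)) l
      pairs : ∀ {R : ℕ → ℕ → Set} → (∀ i k → i < k → k < suc (D + D) → R i k) → AllPairs R l
      pairs h = AllPairs.applyUpTo⁺₁ (λ i → i) (suc (D + D)) λ {i} {k} → h i k
      few-bad : length (filter rootx? l) ≤ D
      few-bad = ≮⇒≥ (A.root-bound (filter rootx? l) (AllPairs.filter⁺ rootx? (pairs x-distinct)) (All.all-filter rootx? l))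
      many-good : suc D ≤ length good
      many-good = +-cancelˡ-≤ D (suc D) (length good) (≤-trans (≤-reflexive (trans (+-suc D D) (sym (trans (filter-lengths rootx? l) (length-upTo (suc (D + D))))))) (+-monoˡ-≤ (length good) few-bad))

    non-roots : Σ ℕ λ i → i < suc (D + D) × ¬ A.Root i × ¬ B.Root i
    non-roots with Any.any? (λ i → ¬? (rooty? i)) good
    ... | yes found = choose good (All.all-filter (λ i → ¬? (rootx? i)) l) (All.filter⁺ (λ i → ¬? (rootx? i)) (All.applyUpTo⁺₁ (λ i → i) (suc (D + D)) λ h → h)) found
      where
      choose : ∀ g → All (λ i → ¬ A.Root i) g → All (_< suc (D + D)) g → Any (λ i → ¬ B.Root i) g → Σ ℕ λ i → i < suc (D + D) × ¬ A.Root i × ¬ B.Root i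
      choose (i ∷ g) (h ∷ _) (b ∷ _) (here k) = i , b , h , k
      choose (i ∷ g) (_ ∷ hs) (_ ∷ bs) (there k) = choose g hs bs k
    ... | no none = contradiction many-good (B.root-bound good (AllPairs.filter⁺ (λ i → ¬? (rootx? i)) (pairs y-distinct)) (All.map (λ {i} ¬¬r → stable i ¬¬r) (All.¬Any⇒All¬ good none)))
      where
      stable : ∀ i → ¬ ¬ B.Root i → B.Root i
      stable i h with rooty? i
      ... | yes r = r
      ... | no ¬r = contradiction ¬r h

  -- Of the consecutive numbers 2 i + 1 and 2 i + 2 at least one is prime to p; the chosen ones
  -- increase with i.
  unit-residue : ℕ → ℕ → ℕ
  unit-residue p i with p ∣? suc (i + i)
  ... | yes _ = suc (suc (i + i))
  ... | no _ = suc (i + i)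

  unit-residue-∤ : ∀ {p} i → Prime p → ¬ p ∣ unit-residue p i
  unit-residue-∤ {p} i pp with p ∣? suc (i + i)
  ... | no h = h
  ... | yes h = λ h′ → ¬prime[1] (subst Prime (∣1⇒≡1 (∣m+n∣m⇒∣n (subst (p ∣_) (+-comm 1 (suc (i + i))) h′) h)) pp)

  unit-residue-bounds : ∀ p i → suc (i + i) ≤ unit-residue p i × unit-residue p i ≤ suc (suc (i + i))
  unit-residue-bounds p i with p ∣? suc (i + i)
  ... | yes _ = n≤1+n _ , ≤-refl
  ... | no _ = ≤-refl , n≤1+n _

  unit-residue-mono : ∀ p {i k} → i < k → unit-residue p i < unit-residue p k
  unit-residue-mono p {i} {k} i<k = ≤-<-trans (proj₂ (unit-residue-bounds p i)) (<-≤-trans (s≤s (≤-trans (≤-reflexive (cong suc (sym (+-suc i i)))) (+-mono-≤ i<k i<k))) (proj₁ (unit-residue-bounds p k)))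

  -- 4 D + 2 bounds `unit-residue p i` for i ≤ 2 D, so a larger modulus keeps the 2 D + 1 residues
  -- apart. It depends on the degree alone, which lets W = (4 D + 2)! be fixed before any prime is
  -- chosen.
  threshold : ℕ → ℕ
  threshold D = suc (suc (D + D + (D + D)))

  -- The order j of a does not divide (4 D + 2)!, so some prime power P ∣ j exceeds 4 D + 2. The
  -- unit residues modulo P lift to 2 D + 1 units u modulo j, distinct already modulo P. Hence the
  -- powers a^u are distinct modulo q, and so are the a^(u v) for a unit v, as `TwoValues` requires.
  sparse-units : ∀ {D F q a} N → MonicAt D F → ∀ f → Prime q → Coprime a q → q ∣ ∣ eval f (+ a) ∣ →
    (∀ .⦃ _ : NonZero q ⦄ → ¬ (a ^ (threshold D !)) % q ≡ 1 % q) →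
    (∀ p → Prime p → N ≤ p → eval f (+ p) ∣ℤ eval F (+ (p ^ p))) → Σ (SparseUnits N) λ S → SparseUnits.q S ≡ q
  sparse-units {D} {F} {q} {a} N mF f pq a⊥q q∣fa not-W divides-F = build (large-prime-power B j 0<j)
    where
    instance
      q≢0 : NonZero q
      q≢0 = >-nonZero (0<p pq)
    B : ℕ
    B = threshold D
    O : Order q a
    O = order pq a⊥q
    open Order O
    instance
      j≢0 : NonZero j
      j≢0 = >-nonZero 0<j
    reduce : ∀ t → (a ^ t) % q ≡ (a ^ (t % j)) % q
    reduce = ^-reduce a⊥q (0<p pq) O
    W-multiple : j ∣ B ! → (a ^ (B !)) % q ≡ 1 % q
    W-multiple j∣W = trans (reduce (B !)) (cong (λ z → (a ^ z) % q) (n∣m⇒m%n≡0 (B !) j j∣W))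
    build : j ∣ B ! ⊎ (Σ ℕ λ p → Σ ℕ λ e → Prime p × p ^ e ∣ j × B < p ^ e) → Σ (SparseUnits N) λ S → SparseUnits.q S ≡ q
    build (inj₁ j∣W) = contradiction (W-multiple j∣W) not-W
    build (inj₂ (p , e , pp , P∣j , B<P)) = record { q = q ; j = j ; a = a ; prime-q = pq ; 0<j = 0<j ; q⊥j = prime⇒coprime pq ⦃ j≢0 ⦄ j<q ; a⊥q = a⊥q ; thin = thin } , refl
      where
      P : ℕ
      P = p ^ e
      instance
        P≢0 : NonZero P
        P≢0 = >-nonZero (≤-<-trans z≤n B<P)
      r : ℕ → ℕ
      r = unit-residue p
      lift : ∀ i → Σ ℕ λ c → c % P ≡ r i % P × Coprime c j
      lift i = coprime-lift {r i} P j 0<j (no-common-prime⇒coprime (>-nonZero⁻¹ P) λ {ℓ} pℓ ℓ∣r ℓ∣P → unit-residue-∤ i pp (subst (_∣ r i) (prime∣prime pℓ pp (prime∣^ p e pℓ ℓ∣P)) ℓ∣r))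
      u : ℕ → ℕ
      u i = proj₁ (lift i)
      r<P : ∀ i → i < suc (D + D) → r i < P
      r<P i i≤2D = ≤-<-trans (≤-trans (proj₂ (unit-residue-bounds p i)) (s≤s (s≤s (+-mono-≤ (≤-pred i≤2D) (≤-pred i≤2D))))) B<P
      u-distinct : ∀ i k → i < k → k < suc (D + D) → ¬ u i % j ≡ u k % j
      u-distinct i k i<k k≤2D eq = <⇒≢ (unit-residue-mono p i<k) (trans (sym (m<n⇒m%n≡m (r<P i (<-trans i<k k≤2D)))) (trans (trans (sym (proj₁ (proj₂ (lift i)))) (trans (≈-reduce j {P} {u i} {u k} P∣j eq) (proj₁ (proj₂ (lift k))))) (m<n⇒m%n≡m (r<P k k≤2D))))
      Thin : ℕ → Set
      Thin u = ∀ p → Prime p → p % q ≡ a % q → p % j ≡ u % j → p < N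
      -- A prime ℓ ≥ N in the class satisfies q ∣ f(ℓ) ∣ F(ℓ^ℓ). Since j is the order of a, ℓ^ℓ ≡
      -- a^ℓ ≡ a^u modulo q, and a^u would be a root of F.
      non-root⇒thin : ∀ u → ¬ q ∣ ∣ eval F (+ (a ^ u)) ∣ → Thin u
      non-root⇒thin u nr ℓ pℓ ℓ≡a ℓ≡u = ≰⇒> λ N≤ℓ → nr (eval-≡ F (a ^ u) (ℓ ^ ℓ) powers (∣-trans (eval-≡ f ℓ a ℓ≡a q∣fa) (divides-F ℓ pℓ N≤ℓ)))
        where
        powers : (a ^ u) % q ≡ (ℓ ^ ℓ) % q
        powers = trans (reduce u) (trans (cong (λ z → (a ^ z) % q) (sym ℓ≡u)) (trans (sym (reduce ℓ)) (^-% ℓ (sym ℓ≡a))))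
      thin : ∀ v → Coprime v j → Σ ℕ λ u → Coprime u j × Thin u × Thin (u * v)
      thin v v⊥j = found non-roots
        where
        open TwoValues mF pq (λ i → a ^ u i) (λ i → a ^ (u i * v)) (λ i k i<k k≤2D eq → u-distinct i k i<k k≤2D (^-injective a⊥q (0<p pq) O (u i) (u k) eq))
          (λ i k i<k k≤2D eq → u-distinct i k i<k k≤2D (≈-cancel j {v} {u i} {u k} v⊥j (trans (cong (_% j) (*-comm v (u i))) (trans (^-injective a⊥q (0<p pq) O (u i * v) (u k * v) eq) (cong (_% j) (*-comm (u k) v))))))
        found : (Σ ℕ λ i → i < suc (D + D) × (¬ q ∣ ∣ eval F (+ (a ^ u i)) ∣) × (¬ q ∣ ∣ eval F (+ (a ^ (u i * v))) ∣)) → Σ ℕ λ u → Coprime u j × Thin u × Thin (u * v)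
        found (i , _ , nx , ny) = u i , proj₂ (proj₂ (lift i)) , non-root⇒thin (u i) nx , non-root⇒thin (u i * v) ny

  -- Otherwise q would divide f(a) and a^W - 1, and with them the integer in the ideal (f, x^W - 1).
  power-free : ∀ {f} W (c : Comaximal f (xⁿ-1 W)) {q a} → q ∣ ∣ eval f (+ a) ∣ → ¬ q ∣ ∣ Comaximal.c c ∣ → .⦃ _ : NonZero q ⦄ → ¬ (a ^ W) % q ≡ 1 % q
  power-free {f} W (comax R R≢0 U V e) {q} {a} q∣f q∤R h = q∤R (subst (λ z → q ∣ ∣ z ∣) (sym value) (∣∣-+ (eval f (+ a) ℤ.* eval U (+ a)) (eval (xⁿ-1 W) (+ a) ℤ.* eval V (+ a)) (∣∣-*ˡ (eval f (+ a)) (eval U (+ a)) q∣f)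
      (∣∣-*ˡ (eval (xⁿ-1 W) (+ a)) (eval V (+ a)) (subst (λ z → q ∣ ∣ z ∣) (sym value′) (≡-diff (a ^ W) 1 h)))))
    where
    value : R ≡ eval f (+ a) ℤ.* eval U (+ a) ℤ.+ eval (xⁿ-1 W) (+ a) ℤ.* eval V (+ a)
    value = trans (sym (eval-const R (+ a))) (trans (eval-cong (+ a) e) (trans (eval-⊕ (f ⊗ U) (xⁿ-1 W ⊗ V) (+ a)) (cong₂ ℤ._+_ (eval-⊗ f U (+ a)) (eval-⊗ (xⁿ-1 W) V (+ a)))))
    value′ : eval (xⁿ-1 W) (+ a) ≡ + (a ^ W) ℤ.- + 1
    value′ = trans (eval-⊕ (X ^ₚ W) (negₚ oneₚ) (+ a)) (cong₂ ℤ._+_ (eval-X^ W a) (eval-const -1ℤ (+ a)))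

  no-comaximal : ∀ {D F n c₀ g} N → MonicAt D F → ¬ c₀ ≡ 0ℤ → MonicAt n g → Comaximal (c₀ ∷ g) (xⁿ-1 (threshold D !)) →
    (∀ p → Prime p → N ≤ p → eval (c₀ ∷ g) (+ p) ∣ℤ eval F (+ (p ^ p))) → ⊥
  no-comaximal {D} {F} {n} {c₀} {g} N mF c₀≢0 mg cx divides-F = first (prime-factor-of-value c₀≢0 mg R 0<R)
    where
    R : ℕ
    R = ∣ Comaximal.c cx ∣
    0<R : 0 < R
    0<R = n≢0⇒n>0 λ e → Comaximal.c≢0 cx (ℤₚ.∣i∣≡0⇒i≡0 e)
    Prime-factor : ℕ → Set
    Prime-factor V = Σ ℕ λ q → Σ ℕ λ a → Prime q × (¬ q ∣ V) × Coprime a q × q ∣ ∣ eval (c₀ ∷ g) (+ a) ∣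
    units : ∀ {q a} → Prime q → ¬ q ∣ R → Coprime a q → q ∣ ∣ eval (c₀ ∷ g) (+ a) ∣ → Σ (SparseUnits N) λ S → SparseUnits.q S ≡ q
    units {q} {a} pq q∤R a⊥q q∣f = sparse-units N mF (c₀ ∷ g) pq a⊥q q∣f (power-free {c₀ ∷ g} (threshold D !) cx {q} {a} q∣f q∤R) divides-F
    first : Prime-factor R → ⊥
    -- Avoiding R q₁ makes the second prime different from q₁ while it still misses R.
    first (q₁ , a₁ , pq₁ , q₁∤R , a₁⊥q₁ , q₁∣f) = second (prime-factor-of-value c₀≢0 mg (R * q₁) (*-mono-≤ 0<R (0<p pq₁)))
      where
      second : Prime-factor (R * q₁) → ⊥
      second (q₂ , a₂ , pq₂ , q₂∤Rq₁ , a₂⊥q₂ , q₂∣f) = combine (units pq₁ q₁∤R a₁⊥q₁ q₁∣f) (units pq₂ (λ h → q₂∤Rq₁ (∣m⇒∣m*n q₁ h)) a₂⊥q₂ q₂∣f)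
        where
        combine : (Σ (SparseUnits N) λ S → SparseUnits.q S ≡ q₁) → (Σ (SparseUnits N) λ S → SparseUnits.q S ≡ q₂) → ⊥
        combine (S₁ , e₁) (S₂ , e₂) = two-moduli S₁ S₂ λ eq → q₂∤Rq₁ (subst (_∣ R * q₁) (trans (sym e₁) (trans eq e₂)) (n∣m*n R))

-- Removal of the factors x and Φ_d, and the equivalence

module Main where

  open import Defs
  open import Data.Fin using (Fin; zero; suc)
  open import Data.Integer using (ℤ; +_; 0ℤ)
  import Data.Integer as ℤ
  import Data.Integer.Properties as ℤₚ
  import Data.Integer.Divisibility as ℤ
  open import Data.List using ([]; _∷_)
  open import Data.Nat
  open import Data.Nat.Divisibility using (∣-trans)
  open import Data.Nat.Induction using (<-rec)
  open import Data.Nat.Primality using (Prime)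
  open import Data.Nat.Properties
  open import Data.Product using (Σ; _×_; _,_; proj₁; proj₂)
  open import Data.Sum using (_⊎_; inj₁; inj₂)
  open import Relation.Binary.PropositionalEquality
  open import Relation.Nullary using (Dec; yes; no; contradiction)
  open import Tactic.RingSolver using (solve-∀)
  open Poly
  open Cyclo
  open Back
  open Irr
  open Contra
  open Cyclotomic

  record CyclotomicForm (f : Poly) : Set where
    field
      m : ℕ
      d : Fin m → ℕ
      1≤d : ∀ i → 1 ≤ d i
      e₀ : ℕ
      e : Fin m → ℕ
      form : f ≋ (X ^ₚ e₀) ⊗ ∏ₚ m (λ i → Φ (d i) ^ₚ e i)

  form-one : ∀ {f} → f ≋ oneₚ → CyclotomicForm f
  form-one h = record { m = 0 ; d = λ () ; 1≤d = λ () ; e₀ = 0 ; e = λ () ; form = ≋-trans h (≋-sym (⊗-identityˡ oneₚ)) }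

  form-X : ∀ {f g} → f ≋ X ⊗ g → CyclotomicForm g → CyclotomicForm f
  form-X h G = record { m = m ; d = d ; 1≤d = 1≤d ; e₀ = suc e₀ ; e = e ; form = ≋-trans h (≋-trans (⊗-congʳ X form) (≋-sym (⊗-assoc X (X ^ₚ e₀) (∏ₚ m λ i → Φ (d i) ^ₚ e i)))) }
    where open CyclotomicForm G

  -- A repeated factor is listed repeatedly, each time as a new index with exponent 1.
  form-Φ : ∀ {f g} k → f ≋ Φ° (suc k) ⊗ g → CyclotomicForm g → CyclotomicForm f
  form-Φ k h G = record { m = suc m ; d = λ { zero → suc k ; (suc i) → d i } ; 1≤d = λ { zero → s≤s z≤n ; (suc i) → 1≤d i } ; e₀ = e₀ ; e = λ { zero → 1 ; (suc i) → e i }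
      ; form = ≋-trans h (≋-trans (⊗-cong (≋-reflexive (Φ°≡Φ (suc k))) form) (lem (Φ (suc k)) (X ^ₚ e₀) (∏ₚ m λ i → Φ (d i) ^ₚ e i))) }
    where
    open CyclotomicForm G
    lem : ∀ p x q → p ⊗ (x ⊗ q) ≋ x ⊗ ((p ⊗ oneₚ) ⊗ q)
    lem = solve-∀ poly

  module _ {D F} (mF : MonicAt D F) (N : ℕ) where

    -- The right-hand side keeps the original F: in this form the relation passes from f to each of
    -- its factors, which f(p) ∣ f(p^p) does not obviously do.
    Divides : Poly → Set
    Divides f = ∀ p → Prime p → N ≤ p → eval f (+ p) ℤ.∣ eval F (+ (p ^ p))

    divides-factor : ∀ {f g} → g ∣ᵖ f → Divides f → Divides g
    divides-factor g∣f h p pp N≤p = ∣-trans (eval-∣ (+ p) g∣f) (h p pp N≤p)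

    cyclotomic-form : ∀ n f → MonicAt n f → Divides f → CyclotomicForm f
    cyclotomic-form = <-rec _ step
      where
      Goal : ℕ → Set
      Goal n = ∀ f → MonicAt n f → Divides f → CyclotomicForm f
      W : ℕ
      W = threshold D !
      W≡ : suc (W ∸ 1) ≡ W
      W≡ = m+[n∸m]≡n (1≤n! (threshold D))
      ∸-< : ∀ n {k} → 0 < k → suc n ∸ k < suc n
      ∸-< n {suc k} _ = s≤s (m∸n≤m n k)
      step : ∀ n → (∀ {k} → k < n → Goal k) → Goal n
      step zero rec f mf _ = form-one (monic-0 mf)
      step (suc n) rec [] mf _ = contradiction (top mf) λ ()
      step (suc n) rec (c₀ ∷ g) mf h = decide (c₀ ℤ.≟ 0ℤ)
        where
        f : Poly
        f = c₀ ∷ g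
        mg : MonicAt n g
        mg = monicAt (top mf) (Below-tail (bounded mf))
        decide : Dec (c₀ ≡ 0ℤ) → CyclotomicForm f
        decide (yes c₀≡0) = form-X f≋ (rec ≤-refl g mg (divides-factor {f} {g} (divᵖ X (≋-trans f≋ (⊗-comm X g))) h))
          where
          f≋ : f ≋ X ⊗ g
          f≋ = ≋-trans (∷-cong c₀≡0 ≋-refl) (0∷-X g)
        decide (no c₀≢0) = dichotomy (xⁿ-1-dichotomy (W ∸ 1) f)
          where
          dichotomy : (Σ ℕ λ k → 0 < degree (cyclotomic k) × Φ° (suc k) ∣ᵖ f) ⊎ Comaximal f (xⁿ-1 (suc (W ∸ 1))) → CyclotomicForm f
          dichotomy (inj₁ (k , 0<deg , divᵖ q f≋)) = form-Φ k f≋ (rec (∸-< n 0<deg) q (monic-cofactor (monic-Φ (cyclotomic k)) (monic-≋ f≋ mf)) (divides-factor {f} {q} (divᵖ (Φ° (suc k)) (≋-trans f≋ (⊗-comm (Φ° (suc k)) q))) h))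
          dichotomy (inj₂ c) = contradiction h (no-comaximal N mF c₀≢0 mg (subst (λ w → Comaximal f (xⁿ-1 w)) W≡ c))

  divides⇒cyclotomic-form : ∀ {f N} → Monic f → (∀ p → Prime p → N ≤ p → eval f (+ p) ℤ.∣ eval f (+ (p ^ p))) → CyclotomicForm f
  divides⇒cyclotomic-form {f} {N} monic h = cyclotomic-form (proj₂ mf) N (proj₁ mf) f (proj₂ mf) h
    where
    mf : Σ ℕ λ n → MonicAt n f
    mf = Monic⇒MonicAt {f} monic

open import Defs
open import Data.Nat using (ℕ; _≤_; _^_)
open import Data.Nat.Primality using (Prime)
open import Data.Integer using (+_)
open import Data.Integer.Divisibility using (_∣_)
open import Data.Fin using (Fin)
open import Data.Product using (Σ; _×_; _,_)
open import Function.Bundles using (_⇔_; mk⇔)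
open Poly using (≋⇒≈ₚ)
open Back using (cyclotomic-product⇒divides)
open Main using (divides⇒cyclotomic-form; module CyclotomicForm)

theorem2p1 : (f : Poly) → Monic f →
    (Σ ℕ λ N → (1 ≤ N) × ((p : ℕ) → Prime p → N ≤ p → eval f (+ p) ∣ eval f (+ (p ^ p))))
    ⇔
    (Σ ℕ λ m → Σ (Fin m → ℕ) λ d → ((i : Fin m) → 1 ≤ d i) ×
    Σ ℕ λ e₀ → Σ (Fin m → ℕ) λ e →
    f ≈ₚ (X ^ₚ e₀) ⊗ ∏ₚ m (λ i → Φ (d i) ^ₚ e i))
theorem2p1 f monic = mk⇔
  (λ (N , _ , h) → let open CyclotomicForm (divides⇒cyclotomic-form {f} {N} monic h) in m , d , 1≤d , e₀ , e , ≋⇒≈ₚ form)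
  (λ (m , d , 1≤d , e₀ , e , f≈) → cyclotomic-product⇒divides f m d 1≤d e₀ e f≈)
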